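{- Let $\cong$ denote linear isomorphism of MALL formulas, $=_{\mathcal{AC}}$ equality in the theory $\mathcal{AC}$ and $=_{\mathcal{E}}$ equality in the theory $\mathcal{E}$ (all defined in the context). (1) For all distributed MALL formulas $A$ and $B$: if $A\cong B$ then $A=_{\mathcal{AC}}B$. (2) For all MALL formulas $A$ and $B$: if $A\cong B$ then $A=_{\mathcal{E}}B$. (3) For any subset $S$ of $\{\otimes,\mathbin{⅋},1,\bot,\&,\oplus,\top,0\}$, if $A$ and $B$ are MALL formulas using only connectives and units from $S$ and $A\cong B$, then $A=B$ in the equational theory $\mathcal{E}_S$ consisting of those equations of $\mathcal{E}$ that use only connectives and units from $S$.
   Context: MALL formulas: $A,B::=X\mid X^\perp\mid A\otimes B\mid A⅋ B\mid 1\mid\bot\mid A\& B\mid A\oplus B\mid\top\mid 0$ ($X$ ranging over atoms). Negation is extended to all formulas by $X^{\perp\perp}=X$, $1^\perp=\bot$, $\bot^\perp=1$, $\top^\perp=0$, $0^\perp=\top$, $(A\otimes B)^\perp=B^\perp⅋A^\perp$, $(A⅋B)^\perp=B^\perp\otimes A^\perp$, $(A\&B)^\perp=B^\perp\oplus A^\perp$, $(A\oplus B)^\perp=B^\perp\& A^\perp$. Proofs are derivations in the one-sided MALL sequent calculus (sequents $\vdash\Gamma$ are lists of formulas; rules: $ax$ $\vdash A^\perp,A$ for any formula $A$; exchange; $cut$ from $\vdash A,\Gamma$ and $\vdash A^\perp,\Delta$ to $\vdash\Gamma,\Delta$; $\otimes$ from $\vdash A,\Gamma$ and $\vdash B,\Delta$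 to $\vdash A\otimes B,\Gamma,\Delta$; $⅋$ from $\vdash A,B,\Gamma$ to $\vdash A⅋B,\Gamma$; $1$: $\vdash 1$; $\bot$ from $\vdash\Gamma$ to $\vdash\bot,\Gamma$; $\&$ from $\vdash A,\Gamma$ and $\vdash B,\Gamma$ to $\vdash A\&B,\Gamma$; $\oplus_1$/$\oplus_2$ from $\vdash A,\Gamma$ / $\vdash B,\Gamma$ to $\vdash A\oplus B,\Gamma$; $\top$: $\vdash\top,\Gamma$; no rule for $0$). Proofs are compared up to $=_{\beta\eta}$: the equivalence generated by standard cut-elimination steps (key cases $ax$, $⅋/\otimes$, $\&/\oplus_i$, $\bot/1$, and commutations of a cut with the rule above it, including the $\top$ case where the cut and the other premise are absorbed into a $\top$-rule, and cut/cut commutation) and axiom-expansion (replacing an $ax$-rule on a compound formula or unit by the corresponding $\eta$-expanded derivation using axioms on its immediate subformulas). $A\cong B$ means: there exist proofs $\pi$ of $\vdash A^\perp,B$ and $\pi'$ of $\vdash B^\perp,A$ such that the cut of $\pi$ and $\pi'$ on $B$ is $=_{\beta\eta}$ to the single axiom proof of $\vdash A^\perp,A$, and the cut of $\pi'$ and $\pi$ on $A$ is $=_{\beta\eta}$ to the single axiom proof of $\vdash B^\perp,B$. The theory $\mathcal{E}$ consists of: associativity and commutativity of each of $\otimes,⅋,\oplus,\&$; distributivity $A\otimes(B\oplus C)=(A\otimes B)\oplus(A\otimes C)$ and $A⅋(B\&C)=(A⅋B)\&(A⅋C)$; unit laws $A\otimes1=A$, $A⅋\bot=A$, $A\oplus0=A$,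 $A\&\top=A$; cancellation $A\otimes0=0$ and $A⅋\top=\top$ (closed under congruence). $\mathcal{AC}$ is the subtheory consisting only of the associativity and commutativity equations. A formula is distributed if it has no subformula of any of the forms $A\otimes(B\oplus C)$, $(A\oplus B)\otimes C$, $A\otimes1$, $1\otimes A$, $A\oplus0$, $0\oplus A$, $A\otimes0$, $0\otimes A$, $(C\&B)⅋A$, $C⅋(B\&A)$, $\bot⅋A$, $A⅋\bot$, $\top\&A$, $A\&\top$, $\top⅋A$, $A⅋\top$. -}

module Defs where

open import Data.Nat using (ℕ)
open import Data.Fin using (Fin; zero; suc)
open import Data.Bool using (Bool; true; false; not; _∨_; T)
open import Data.Unit using (tt) renaming (⊤ to Unit)
open import Data.Empty renaming (⊥ to Empty)
open import Data.Product using (Σ; _×_; _,_)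
open import Data.List using (List; []; _∷_; _++_; [_]; length; _∷ʳ_)
open import Data.List.Properties using (++-assoc; ++-identityʳ)
open import Data.List.Relation.Unary.All using (All)
open import Data.List.Relation.Binary.Permutation.Propositional
  using (_↭_; prep; swap; ↭-sym; ↭-reflexive)
  renaming (refl to ↭-refl; trans to ↭-trans)
open import Data.List.Relation.Binary.Permutation.Propositional.Properties
  using (shift; ++⁺ˡ; ++⁺ʳ; ∷↭∷ʳ)
  renaming (++-comm to ↭-++-comm)
open import Relation.Binary.PropositionalEquality
  using (_≡_; refl; cong; cong₂; sym; trans; subst)

infixr 7 _⊗_ _⅋_
infixr 6 _⊕_ _&_
infix 10 _⁻

data Fm : Set where
  var  : ℕ → Fm
  nvar : ℕ → Fm
  _⊗_ _⅋_ _&_ _⊕_ : Fm → Fm → Fm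
  𝟏 ⊥ₘ ⊤ₘ 𝟎 : Fm

_⁻ : Fm → Fm
var x ⁻  = nvar x
nvar x ⁻ = var x
(A ⊗ B) ⁻ = B ⁻ ⅋ A ⁻
(A ⅋ B) ⁻ = B ⁻ ⊗ A ⁻
(A & B) ⁻ = B ⁻ ⊕ A ⁻
(A ⊕ B) ⁻ = B ⁻ & A ⁻
𝟏 ⁻  = ⊥ₘ
⊥ₘ ⁻ = 𝟏
⊤ₘ ⁻ = 𝟎
𝟎 ⁻  = ⊤ₘ

⁻⁻ : ∀ A → A ⁻ ⁻ ≡ A
⁻⁻ (var x)  = refl
⁻⁻ (nvar x) = refl
⁻⁻ (A ⊗ B) = cong₂ _⊗_ (⁻⁻ A) (⁻⁻ B)
⁻⁻ (A ⅋ B) = cong₂ _⅋_ (⁻⁻ A) (⁻⁻ B)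
⁻⁻ (A & B) = cong₂ _&_ (⁻⁻ A) (⁻⁻ B)
⁻⁻ (A ⊕ B) = cong₂ _⊕_ (⁻⁻ A) (⁻⁻ B)
⁻⁻ 𝟏  = refl
⁻⁻ ⊥ₘ = refl
⁻⁻ ⊤ₘ = refl
⁻⁻ 𝟎  = refl

infix 4 ⊢_

data ⊢_ : List Fm → Set where
  ax  : ∀ A → ⊢ (A ⁻ ∷ A ∷ [])
  ex  : ∀ {Γ Δ} → Γ ↭ Δ → ⊢ Γ → ⊢ Δ
  cut : ∀ {A Γ Δ} → ⊢ (A ∷ Γ) → ⊢ (A ⁻ ∷ Δ) → ⊢ (Γ ++ Δ)
  ⊗r  : ∀ {A B Γ Δ} → ⊢ (A ∷ Γ) → ⊢ (B ∷ Δ) → ⊢ (A ⊗ B ∷ Γ ++ Δ)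
  ⅋r  : ∀ {A B Γ} → ⊢ (A ∷ B ∷ Γ) → ⊢ (A ⅋ B ∷ Γ)
  𝟏r  : ⊢ (𝟏 ∷ [])
  ⊥r  : ∀ {Γ} → ⊢ Γ → ⊢ (⊥ₘ ∷ Γ)
  &r  : ∀ {A B Γ} → ⊢ (A ∷ Γ) → ⊢ (B ∷ Γ) → ⊢ (A & B ∷ Γ)
  ⊕₁r : ∀ {A B Γ} → ⊢ (A ∷ Γ) → ⊢ (A ⊕ B ∷ Γ)
  ⊕₂r : ∀ {A B Γ} → ⊢ (B ∷ Γ) → ⊢ (A ⊕ B ∷ Γ)
  ⊤r  : ∀ Γ → ⊢ (⊤ₘ ∷ Γ)

-- Permutations: the bijection on positions induced by a permutation
-- proof (pos σ i = position in the target of the i-th formula of the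
-- source).  Exchanges inducing the same bijection are identified.

pos : ∀ {Γ Δ : List Fm} → Γ ↭ Δ → Fin (length Γ) → Fin (length Δ)
pos ↭-refl i = i
pos (prep x σ) zero = zero
pos (prep x σ) (suc i) = suc (pos σ i)
pos (swap x y σ) zero = suc zero
pos (swap x y σ) (suc zero) = zero
pos (swap x y σ) (suc (suc i)) = suc (suc (pos σ i))
pos (↭-trans σ τ) i = pos τ (pos σ i)

toFront : ∀ (A : Fm) (Θ₁ Θ₂ : List Fm) → Θ₁ ++ A ∷ Θ₂ ↭ A ∷ Θ₁ ++ Θ₂
toFront A Θ₁ Θ₂ = shift A Θ₁ Θ₂

fromFront : ∀ (A : Fm) (Θ₁ Θ₂ : List Fm) → A ∷ Θ₁ ++ Θ₂ ↭ Θ₁ ++ A ∷ Θ₂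
fromFront A Θ₁ Θ₂ = ↭-sym (shift A Θ₁ Θ₂)

toFront2 : ∀ (A B : Fm) (Γ Θ : List Fm) → Γ ++ A ∷ B ∷ Θ ↭ A ∷ B ∷ Γ ++ Θ
toFront2 A B Γ Θ = ↭-trans (shift A Γ (B ∷ Θ)) (prep A (shift B Γ Θ))

swap2 : ∀ (A B : Fm) → A ∷ B ∷ [] ↭ B ∷ A ∷ []
swap2 A B = swap A B ↭-refl

rev3 : ∀ (A B C : Fm) → A ∷ B ∷ C ∷ [] ↭ C ∷ B ∷ A ∷ []
rev3 A B C = ↭-trans (swap A B ↭-refl)
               (↭-trans (prep B (swap A C ↭-refl)) (swap B C ↭-refl))

perm1 : ∀ (Θ₁ Θ₂ Δ Γ₂ : List Fm) →
        ((Θ₁ ++ Θ₂) ++ Δ) ++ Γ₂ ↭ (Θ₁ ++ (Θ₂ ++ Γ₂)) ++ Δ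
perm1 Θ₁ Θ₂ Δ Γ₂ =
  ↭-trans (↭-reflexive (++-assoc (Θ₁ ++ Θ₂) Δ Γ₂))
  (↭-trans (++⁺ˡ (Θ₁ ++ Θ₂) (↭-++-comm Δ Γ₂))
  (↭-trans (↭-reflexive (sym (++-assoc (Θ₁ ++ Θ₂) Γ₂ Δ)))
           (++⁺ʳ Δ (↭-reflexive (++-assoc Θ₁ Θ₂ Γ₂)))))

eq2 : ∀ (Γ₁ Θ₁ Θ₂ Δ : List Fm) →
      Γ₁ ++ ((Θ₁ ++ Θ₂) ++ Δ) ≡ ((Γ₁ ++ Θ₁) ++ Θ₂) ++ Δ
eq2 Γ₁ Θ₁ Θ₂ Δ = trans (sym (++-assoc Γ₁ (Θ₁ ++ Θ₂) Δ))
                       (cong (_++ Δ) (sym (++-assoc Γ₁ Θ₁ Θ₂)))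

eq3 : ∀ (Γ Θ₁ Θ₂ Γ₂ : List Fm) →
      (Γ ++ (Θ₁ ++ Θ₂)) ++ Γ₂ ≡ Γ ++ (Θ₁ ++ (Θ₂ ++ Γ₂))
eq3 Γ Θ₁ Θ₂ Γ₂ = trans (++-assoc Γ (Θ₁ ++ Θ₂) Γ₂)
                       (cong (Γ ++_) (++-assoc Θ₁ Θ₂ Γ₂))

perm4 : ∀ (Γ₁ Γ Θ₁ Θ₂ : List Fm) →
        Γ₁ ++ (Γ ++ (Θ₁ ++ Θ₂)) ↭ Γ ++ ((Γ₁ ++ Θ₁) ++ Θ₂)
perm4 Γ₁ Γ Θ₁ Θ₂ =
  ↭-trans (↭-reflexive (sym (++-assoc Γ₁ Γ (Θ₁ ++ Θ₂))))
  (↭-trans (++⁺ʳ (Θ₁ ++ Θ₂) (↭-++-comm Γ₁ Γ))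
  (↭-trans (↭-reflexive (++-assoc Γ Γ₁ (Θ₁ ++ Θ₂)))
           (↭-reflexive (cong (Γ ++_) (sym (++-assoc Γ₁ Θ₁ Θ₂))))))

-- =βη : equivalence on proofs generated by cut-elimination steps
-- (key cases, commutations, cut/cut), axiom expansion, and the
-- bookkeeping laws of exchange, closed under congruence.

variable
  A B C : Fm
  Γ Δ Σ' Γ₁ Γ₂ Θ₁ Θ₂ Γ' Δ' : List Fm

infix 3 _≈_

data _≈_ : ∀ {Γ} → ⊢ Γ → ⊢ Γ → Set where
  ≈-refl  : {π : ⊢ Γ} → π ≈ π
  ≈-sym   : {π π' : ⊢ Γ} → π ≈ π' → π' ≈ π
  ≈-trans : {π π' π'' : ⊢ Γ} → π ≈ π' → π' ≈ π'' → π ≈ π''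
  ex-cong  : (σ : Γ ↭ Δ) {π π' : ⊢ Γ} → π ≈ π' → ex σ π ≈ ex σ π'
  cut-cong : {π π' : ⊢ (A ∷ Γ)} {ρ ρ' : ⊢ (A ⁻ ∷ Δ)} →
             π ≈ π' → ρ ≈ ρ' → cut π ρ ≈ cut π' ρ'
  ⊗-cong   : {π π' : ⊢ (A ∷ Γ)} {ρ ρ' : ⊢ (B ∷ Δ)} →
             π ≈ π' → ρ ≈ ρ' → ⊗r π ρ ≈ ⊗r π' ρ'
  ⅋-cong   : {π π' : ⊢ (A ∷ B ∷ Γ)} → π ≈ π' → ⅋r π ≈ ⅋r π'
  ⊥-cong   : {π π' : ⊢ Γ} → π ≈ π' → ⊥r π ≈ ⊥r π'
  &-cong   : {π π' : ⊢ (A ∷ Γ)} {ρ ρ' : ⊢ (B ∷ Γ)} →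
             π ≈ π' → ρ ≈ ρ' → &r π ρ ≈ &r π' ρ'
  ⊕₁-cong  : {π π' : ⊢ (A ∷ Γ)} → π ≈ π' → ⊕₁r {A} {B} π ≈ ⊕₁r π'
  ⊕₂-cong  : {π π' : ⊢ (B ∷ Γ)} → π ≈ π' → ⊕₂r {A} {B} π ≈ ⊕₂r π'
  ex-id    : (π : ⊢ Γ) → ex ↭-refl π ≈ π
  ex-comp  : (σ : Γ ↭ Δ) (τ : Δ ↭ Γ') (π : ⊢ Γ) →
             ex τ (ex σ π) ≈ ex (↭-trans σ τ) π
  ex-ext   : (σ τ : Γ ↭ Δ) → (∀ i → pos σ i ≡ pos τ i) → (π : ⊢ Γ) →
             ex σ π ≈ ex τ π
  cut-exˡ  : (σ : Γ ↭ Γ') (π : ⊢ (A ∷ Γ)) (ρ : ⊢ (A ⁻ ∷ Δ)) →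
             cut (ex (prep A σ) π) ρ ≈ ex (++⁺ʳ Δ σ) (cut π ρ)
  cut-exʳ  : (σ : Δ ↭ Δ') (ρ : ⊢ (A ∷ Γ)) (π : ⊢ (A ⁻ ∷ Δ)) →
             cut ρ (ex (prep (A ⁻) σ) π) ≈ ex (++⁺ˡ Γ σ) (cut ρ π)
  β-axˡ  : (π : ⊢ (A ⁻ ⁻ ∷ Δ)) →
           cut (ax A) π ≈ subst (λ X → ⊢ (X ∷ Δ)) (⁻⁻ A) π
  β-axˡ' : (π : ⊢ (A ⁻ ∷ Δ)) → cut (ex (swap2 (A ⁻) A) (ax A)) π ≈ π
  β-axʳ  : (π : ⊢ (A ∷ Γ)) → cut π (ax A) ≈ ex (∷↭∷ʳ A Γ) π
  β-axʳ' : (π : ⊢ (A ∷ Γ)) →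
           cut π (ex (swap2 (A ⁻ ⁻) (A ⁻)) (ax (A ⁻))) ≈
           ex (∷↭∷ʳ (A ⁻ ⁻) Γ) (subst (λ X → ⊢ (X ∷ Γ)) (sym (⁻⁻ A)) π)
  β-⊗⅋ : (π₁ : ⊢ (A ∷ Γ)) (π₂ : ⊢ (B ∷ Δ)) (π₃ : ⊢ (B ⁻ ∷ A ⁻ ∷ Σ')) →
         cut (⊗r π₁ π₂) (⅋r π₃) ≈
         ex (↭-reflexive (sym (++-assoc Γ Δ Σ')))
            (cut π₁ (ex (toFront (A ⁻) Δ Σ') (cut π₂ π₃)))
  β-⅋⊗ : (π₃ : ⊢ (A ∷ B ∷ Σ')) (π₁ : ⊢ (B ⁻ ∷ Γ)) (π₂ : ⊢ (A ⁻ ∷ Δ)) →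
         cut (⅋r π₃) (⊗r π₁ π₂) ≈
         ex (↭-trans (↭-reflexive (++-assoc Σ' Δ Γ)) (++⁺ˡ Σ' (↭-++-comm Δ Γ)))
            (cut (cut π₃ π₂) π₁)
  β-&⊕₁ : (π₁ : ⊢ (A ∷ Γ)) (π₂ : ⊢ (B ∷ Γ)) (π₃ : ⊢ (B ⁻ ∷ Δ)) →
          cut (&r π₁ π₂) (⊕₁r {B ⁻} {A ⁻} π₃) ≈ cut π₂ π₃
  β-&⊕₂ : (π₁ : ⊢ (A ∷ Γ)) (π₂ : ⊢ (B ∷ Γ)) (π₃ : ⊢ (A ⁻ ∷ Δ)) →
          cut (&r π₁ π₂) (⊕₂r {B ⁻} {A ⁻} π₃) ≈ cut π₁ π₃
  β-⊕₁& : (π₃ : ⊢ (A ∷ Γ)) (π₁ : ⊢ (B ⁻ ∷ Δ)) (π₂ : ⊢ (A ⁻ ∷ Δ)) →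
          cut (⊕₁r {A} {B} π₃) (&r π₁ π₂) ≈ cut π₃ π₂
  β-⊕₂& : (π₃ : ⊢ (B ∷ Γ)) (π₁ : ⊢ (B ⁻ ∷ Δ)) (π₂ : ⊢ (A ⁻ ∷ Δ)) →
          cut (⊕₂r {A} {B} π₃) (&r π₁ π₂) ≈ cut π₃ π₁
  β-𝟏⊥ : (π : ⊢ Δ) → cut 𝟏r (⊥r π) ≈ π
  β-⊥𝟏 : (π : ⊢ Γ) → cut (⊥r π) 𝟏r ≈ ex (↭-reflexive (sym (++-identityʳ Γ))) π
  -- commutations: the cut formula A is in the context of the last
  -- rule of the left premise (brought to the front by an exchange)
  c-⅋ˡ : (π : ⊢ (B ∷ C ∷ Θ₁ ++ A ∷ Θ₂)) (ρ : ⊢ (A ⁻ ∷ Δ)) →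
         cut (ex (toFront A (B ⅋ C ∷ Θ₁) Θ₂) (⅋r π)) ρ ≈
         ⅋r (cut (ex (toFront A (B ∷ C ∷ Θ₁) Θ₂) π) ρ)
  c-⊥ˡ : (π : ⊢ (Θ₁ ++ A ∷ Θ₂)) (ρ : ⊢ (A ⁻ ∷ Δ)) →
         cut (ex (toFront A (⊥ₘ ∷ Θ₁) Θ₂) (⊥r π)) ρ ≈
         ⊥r (cut (ex (toFront A Θ₁ Θ₂) π) ρ)
  c-⊕₁ˡ : (π : ⊢ (B ∷ Θ₁ ++ A ∷ Θ₂)) (ρ : ⊢ (A ⁻ ∷ Δ)) →
          cut (ex (toFront A (B ⊕ C ∷ Θ₁) Θ₂) (⊕₁r π)) ρ ≈
          ⊕₁r (cut (ex (toFront A (B ∷ Θ₁) Θ₂) π) ρ)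
  c-⊕₂ˡ : (π : ⊢ (C ∷ Θ₁ ++ A ∷ Θ₂)) (ρ : ⊢ (A ⁻ ∷ Δ)) →
          cut (ex (toFront A (B ⊕ C ∷ Θ₁) Θ₂) (⊕₂r π)) ρ ≈
          ⊕₂r (cut (ex (toFront A (C ∷ Θ₁) Θ₂) π) ρ)
  c-&ˡ : (π₁ : ⊢ (B ∷ Θ₁ ++ A ∷ Θ₂)) (π₂ : ⊢ (C ∷ Θ₁ ++ A ∷ Θ₂))
         (ρ : ⊢ (A ⁻ ∷ Δ)) →
         cut (ex (toFront A (B & C ∷ Θ₁) Θ₂) (&r π₁ π₂)) ρ ≈
         &r (cut (ex (toFront A (B ∷ Θ₁) Θ₂) π₁) ρ)
            (cut (ex (toFront A (C ∷ Θ₁) Θ₂) π₂) ρ)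
  c-⊤ˡ : (ρ : ⊢ (A ⁻ ∷ Δ)) →
         cut (ex (toFront A (⊤ₘ ∷ Θ₁) Θ₂) (⊤r (Θ₁ ++ A ∷ Θ₂))) ρ ≈
         ⊤r ((Θ₁ ++ Θ₂) ++ Δ)
  c-⊗ˡ₁ : (π₁ : ⊢ (B ∷ Θ₁ ++ A ∷ Θ₂)) (π₂ : ⊢ (C ∷ Γ₂)) (ρ : ⊢ (A ⁻ ∷ Δ)) →
          cut (ex (↭-trans (prep (B ⊗ C) (↭-reflexive (++-assoc Θ₁ (A ∷ Θ₂) Γ₂)))
                           (toFront A (B ⊗ C ∷ Θ₁) (Θ₂ ++ Γ₂)))
                  (⊗r π₁ π₂)) ρ ≈
          ex (prep (B ⊗ C) (perm1 Θ₁ Θ₂ Δ Γ₂))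
             (⊗r (cut (ex (toFront A (B ∷ Θ₁) Θ₂) π₁) ρ) π₂)
  c-⊗ˡ₂ : (π₁ : ⊢ (B ∷ Γ₁)) (π₂ : ⊢ (C ∷ Θ₁ ++ A ∷ Θ₂)) (ρ : ⊢ (A ⁻ ∷ Δ)) →
          cut (ex (↭-trans (prep (B ⊗ C) (↭-reflexive (sym (++-assoc Γ₁ Θ₁ (A ∷ Θ₂)))))
                           (toFront A (B ⊗ C ∷ Γ₁ ++ Θ₁) Θ₂))
                  (⊗r π₁ π₂)) ρ ≈
          ex (prep (B ⊗ C) (↭-reflexive (eq2 Γ₁ Θ₁ Θ₂ Δ)))
             (⊗r π₁ (cut (ex (toFront A (C ∷ Θ₁) Θ₂) π₂) ρ))
  c-cutˡ₁ : (π₁ : ⊢ (B ∷ Θ₁ ++ A ∷ Θ₂)) (π₂ : ⊢ (B ⁻ ∷ Γ₂)) (ρ : ⊢ (A ⁻ ∷ Δ)) →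
            cut (ex (↭-trans (↭-reflexive (++-assoc Θ₁ (A ∷ Θ₂) Γ₂))
                             (toFront A Θ₁ (Θ₂ ++ Γ₂)))
                    (cut π₁ π₂)) ρ ≈
            ex (perm1 Θ₁ Θ₂ Δ Γ₂)
               (cut (cut (ex (toFront A (B ∷ Θ₁) Θ₂) π₁) ρ) π₂)
  c-cutˡ₂ : (π₁ : ⊢ (B ∷ Γ₁)) (π₂ : ⊢ (B ⁻ ∷ Θ₁ ++ A ∷ Θ₂)) (ρ : ⊢ (A ⁻ ∷ Δ)) →
            cut (ex (↭-trans (↭-reflexive (sym (++-assoc Γ₁ Θ₁ (A ∷ Θ₂))))
                             (toFront A (Γ₁ ++ Θ₁) Θ₂))
                    (cut π₁ π₂)) ρ ≈
            ex (↭-reflexive (eq2 Γ₁ Θ₁ Θ₂ Δ))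
               (cut π₁ (cut (ex (toFront A (B ⁻ ∷ Θ₁) Θ₂) π₂) ρ))
  -- commutations: the cut formula A ⁻ is in the context of the last
  -- rule of the right premise
  c-⅋ʳ : (ρ : ⊢ (A ∷ Γ)) (π : ⊢ (B ∷ C ∷ Θ₁ ++ A ⁻ ∷ Θ₂)) →
         cut ρ (ex (toFront (A ⁻) (B ⅋ C ∷ Θ₁) Θ₂) (⅋r π)) ≈
         ex (fromFront (B ⅋ C) Γ (Θ₁ ++ Θ₂))
            (⅋r (ex (toFront2 B C Γ (Θ₁ ++ Θ₂))
                    (cut ρ (ex (toFront (A ⁻) (B ∷ C ∷ Θ₁) Θ₂) π))))
  c-⊥ʳ : (ρ : ⊢ (A ∷ Γ)) (π : ⊢ (Θ₁ ++ A ⁻ ∷ Θ₂)) →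
         cut ρ (ex (toFront (A ⁻) (⊥ₘ ∷ Θ₁) Θ₂) (⊥r π)) ≈
         ex (fromFront ⊥ₘ Γ (Θ₁ ++ Θ₂))
            (⊥r (cut ρ (ex (toFront (A ⁻) Θ₁ Θ₂) π)))
  c-⊕₁ʳ : (ρ : ⊢ (A ∷ Γ)) (π : ⊢ (B ∷ Θ₁ ++ A ⁻ ∷ Θ₂)) →
          cut ρ (ex (toFront (A ⁻) (B ⊕ C ∷ Θ₁) Θ₂) (⊕₁r π)) ≈
          ex (fromFront (B ⊕ C) Γ (Θ₁ ++ Θ₂))
             (⊕₁r (ex (toFront B Γ (Θ₁ ++ Θ₂))
                      (cut ρ (ex (toFront (A ⁻) (B ∷ Θ₁) Θ₂) π))))
  c-⊕₂ʳ : (ρ : ⊢ (A ∷ Γ)) (π : ⊢ (C ∷ Θ₁ ++ A ⁻ ∷ Θ₂)) →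
          cut ρ (ex (toFront (A ⁻) (B ⊕ C ∷ Θ₁) Θ₂) (⊕₂r π)) ≈
          ex (fromFront (B ⊕ C) Γ (Θ₁ ++ Θ₂))
             (⊕₂r (ex (toFront C Γ (Θ₁ ++ Θ₂))
                      (cut ρ (ex (toFront (A ⁻) (C ∷ Θ₁) Θ₂) π))))
  c-&ʳ : (ρ : ⊢ (A ∷ Γ)) (π₁ : ⊢ (B ∷ Θ₁ ++ A ⁻ ∷ Θ₂))
         (π₂ : ⊢ (C ∷ Θ₁ ++ A ⁻ ∷ Θ₂)) →
         cut ρ (ex (toFront (A ⁻) (B & C ∷ Θ₁) Θ₂) (&r π₁ π₂)) ≈
         ex (fromFront (B & C) Γ (Θ₁ ++ Θ₂))
            (&r (ex (toFront B Γ (Θ₁ ++ Θ₂))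
                    (cut ρ (ex (toFront (A ⁻) (B ∷ Θ₁) Θ₂) π₁)))
                (ex (toFront C Γ (Θ₁ ++ Θ₂))
                    (cut ρ (ex (toFront (A ⁻) (C ∷ Θ₁) Θ₂) π₂))))
  c-⊤ʳ : (ρ : ⊢ (A ∷ Γ)) →
         cut ρ (ex (toFront (A ⁻) (⊤ₘ ∷ Θ₁) Θ₂) (⊤r (Θ₁ ++ A ⁻ ∷ Θ₂))) ≈
         ex (fromFront ⊤ₘ Γ (Θ₁ ++ Θ₂)) (⊤r (Γ ++ Θ₁ ++ Θ₂))
  c-⊗ʳ₁ : (ρ : ⊢ (A ∷ Γ)) (π₁ : ⊢ (B ∷ Θ₁ ++ A ⁻ ∷ Θ₂)) (π₂ : ⊢ (C ∷ Γ₂)) →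
          cut ρ (ex (↭-trans (prep (B ⊗ C) (↭-reflexive (++-assoc Θ₁ (A ⁻ ∷ Θ₂) Γ₂)))
                             (toFront (A ⁻) (B ⊗ C ∷ Θ₁) (Θ₂ ++ Γ₂)))
                    (⊗r π₁ π₂)) ≈
          ex (↭-trans (prep (B ⊗ C) (↭-reflexive (eq3 Γ Θ₁ Θ₂ Γ₂)))
                      (fromFront (B ⊗ C) Γ (Θ₁ ++ (Θ₂ ++ Γ₂))))
             (⊗r (ex (toFront B Γ (Θ₁ ++ Θ₂))
                     (cut ρ (ex (toFront (A ⁻) (B ∷ Θ₁) Θ₂) π₁))) π₂)
  c-⊗ʳ₂ : (ρ : ⊢ (A ∷ Γ)) (π₁ : ⊢ (B ∷ Γ₁)) (π₂ : ⊢ (C ∷ Θ₁ ++ A ⁻ ∷ Θ₂)) →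
          cut ρ (ex (↭-trans (prep (B ⊗ C) (↭-reflexive (sym (++-assoc Γ₁ Θ₁ (A ⁻ ∷ Θ₂)))))
                             (toFront (A ⁻) (B ⊗ C ∷ Γ₁ ++ Θ₁) Θ₂))
                    (⊗r π₁ π₂)) ≈
          ex (↭-trans (prep (B ⊗ C) (perm4 Γ₁ Γ Θ₁ Θ₂))
                      (fromFront (B ⊗ C) Γ ((Γ₁ ++ Θ₁) ++ Θ₂)))
             (⊗r π₁ (ex (toFront C Γ (Θ₁ ++ Θ₂))
                        (cut ρ (ex (toFront (A ⁻) (C ∷ Θ₁) Θ₂) π₂))))
  c-cutʳ₁ : (ρ : ⊢ (A ∷ Γ)) (π₁ : ⊢ (B ∷ Θ₁ ++ A ⁻ ∷ Θ₂)) (π₂ : ⊢ (B ⁻ ∷ Γ₂)) →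
            cut ρ (ex (↭-trans (↭-reflexive (++-assoc Θ₁ (A ⁻ ∷ Θ₂) Γ₂))
                               (toFront (A ⁻) Θ₁ (Θ₂ ++ Γ₂)))
                      (cut π₁ π₂)) ≈
            ex (↭-reflexive (eq3 Γ Θ₁ Θ₂ Γ₂))
               (cut (ex (toFront B Γ (Θ₁ ++ Θ₂))
                        (cut ρ (ex (toFront (A ⁻) (B ∷ Θ₁) Θ₂) π₁))) π₂)
  c-cutʳ₂ : (ρ : ⊢ (A ∷ Γ)) (π₁ : ⊢ (B ∷ Γ₁)) (π₂ : ⊢ (B ⁻ ∷ Θ₁ ++ A ⁻ ∷ Θ₂)) →
            cut ρ (ex (↭-trans (↭-reflexive (sym (++-assoc Γ₁ Θ₁ (A ⁻ ∷ Θ₂))))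
                               (toFront (A ⁻) (Γ₁ ++ Θ₁) Θ₂))
                      (cut π₁ π₂)) ≈
            ex (perm4 Γ₁ Γ Θ₁ Θ₂)
               (cut π₁ (ex (toFront (B ⁻) Γ (Θ₁ ++ Θ₂))
                           (cut ρ (ex (toFront (A ⁻) (B ⁻ ∷ Θ₁) Θ₂) π₂))))
  η-⊗ : ax (A ⊗ B) ≈
        ⅋r (ex (rev3 (A ⊗ B) (A ⁻) (B ⁻))
               (⊗r (ex (swap2 (A ⁻) A) (ax A)) (ex (swap2 (B ⁻) B) (ax B))))
  η-⅋ : ax (A ⅋ B) ≈
        ex (swap2 (A ⅋ B) (B ⁻ ⊗ A ⁻))
           (⅋r (ex (rev3 (B ⁻ ⊗ A ⁻) B A) (⊗r (ax B) (ax A))))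
  η-𝟏 : ax 𝟏 ≈ ⊥r 𝟏r
  η-⊥ : ax ⊥ₘ ≈ ex (swap2 ⊥ₘ 𝟏) (⊥r 𝟏r)
  η-& : ax (A & B) ≈
        ex (swap2 (A & B) (B ⁻ ⊕ A ⁻))
           (&r (ex (swap2 (B ⁻ ⊕ A ⁻) A) (⊕₂r {B ⁻} {A ⁻} (ax A)))
               (ex (swap2 (B ⁻ ⊕ A ⁻) B) (⊕₁r {B ⁻} {A ⁻} (ax B))))
  η-⊕ : ax (A ⊕ B) ≈
        &r {B ⁻} {A ⁻}
           (ex (swap2 (A ⊕ B) (B ⁻)) (⊕₂r {A} {B} (ex (swap2 (B ⁻) B) (ax B))))
           (ex (swap2 (A ⊕ B) (A ⁻)) (⊕₁r {A} {B} (ex (swap2 (A ⁻) A) (ax A))))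
  η-⊤ : ax ⊤ₘ ≈ ex (swap2 ⊤ₘ 𝟎) (⊤r (𝟎 ∷ []))
  η-𝟎 : ax 𝟎 ≈ ⊤r (𝟎 ∷ [])

infix 2 _≅_

_≅_ : Fm → Fm → Set
A ≅ B = Σ (⊢ (A ⁻ ∷ B ∷ [])) λ π → Σ (⊢ (B ⁻ ∷ A ∷ [])) λ π' →
        (cut (ex (swap2 (A ⁻) B) π) π' ≈ ax A) ×
        (cut (ex (swap2 (B ⁻) A) π') π ≈ ax B)

data Conn : Set where
  c⊗ c⅋ c𝟏 c⊥ c& c⊕ c⊤ c𝟎 : Conn

data Ax : Set where
  ⊗-assoc ⊗-comm ⅋-assoc ⅋-comm ⊕-assoc ⊕-comm &-assoc &-comm : Ax
  ⊗⊕-distr ⅋&-distr : Ax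
  ⊗-unit ⅋-unit ⊕-unit &-unit : Ax
  ⊗-𝟎 ⅋-⊤ : Ax

conns : Ax → List Conn
conns ⊗-assoc  = c⊗ ∷ []
conns ⊗-comm   = c⊗ ∷ []
conns ⅋-assoc  = c⅋ ∷ []
conns ⅋-comm   = c⅋ ∷ []
conns ⊕-assoc  = c⊕ ∷ []
conns ⊕-comm   = c⊕ ∷ []
conns &-assoc  = c& ∷ []
conns &-comm   = c& ∷ []
conns ⊗⊕-distr = c⊗ ∷ c⊕ ∷ []
conns ⅋&-distr = c⅋ ∷ c& ∷ []
conns ⊗-unit   = c⊗ ∷ c𝟏 ∷ []
conns ⅋-unit   = c⅋ ∷ c⊥ ∷ []
conns ⊕-unit   = c⊕ ∷ c𝟎 ∷ []
conns &-unit   = c& ∷ c⊤ ∷ []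
conns ⊗-𝟎      = c⊗ ∷ c𝟎 ∷ []
conns ⅋-⊤      = c⅋ ∷ c⊤ ∷ []

data Th (P : Ax → Set) : Fm → Fm → Set where
  th-refl  : ∀ {A} → Th P A A
  th-sym   : ∀ {A B} → Th P A B → Th P B A
  th-trans : ∀ {A B C} → Th P A B → Th P B C → Th P A C
  th-⊗ : ∀ {A A' B B'} → Th P A A' → Th P B B' → Th P (A ⊗ B) (A' ⊗ B')
  th-⅋ : ∀ {A A' B B'} → Th P A A' → Th P B B' → Th P (A ⅋ B) (A' ⅋ B')
  th-& : ∀ {A A' B B'} → Th P A A' → Th P B B' → Th P (A & B) (A' & B')
  th-⊕ : ∀ {A A' B B'} → Th P A A' → Th P B B' → Th P (A ⊕ B) (A' ⊕ B')
  ax-⊗-assoc  : P ⊗-assoc → ∀ A B C → Th P (A ⊗ (B ⊗ C)) ((A ⊗ B) ⊗ C)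
  ax-⊗-comm   : P ⊗-comm → ∀ A B → Th P (A ⊗ B) (B ⊗ A)
  ax-⅋-assoc  : P ⅋-assoc → ∀ A B C → Th P (A ⅋ (B ⅋ C)) ((A ⅋ B) ⅋ C)
  ax-⅋-comm   : P ⅋-comm → ∀ A B → Th P (A ⅋ B) (B ⅋ A)
  ax-⊕-assoc  : P ⊕-assoc → ∀ A B C → Th P (A ⊕ (B ⊕ C)) ((A ⊕ B) ⊕ C)
  ax-⊕-comm   : P ⊕-comm → ∀ A B → Th P (A ⊕ B) (B ⊕ A)
  ax-&-assoc  : P &-assoc → ∀ A B C → Th P (A & (B & C)) ((A & B) & C)
  ax-&-comm   : P &-comm → ∀ A B → Th P (A & B) (B & A)
  ax-⊗⊕-distr : P ⊗⊕-distr → ∀ A B C → Th P (A ⊗ (B ⊕ C)) ((A ⊗ B) ⊕ (A ⊗ C))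
  ax-⅋&-distr : P ⅋&-distr → ∀ A B C → Th P (A ⅋ (B & C)) ((A ⅋ B) & (A ⅋ C))
  ax-⊗-unit   : P ⊗-unit → ∀ A → Th P (A ⊗ 𝟏) A
  ax-⅋-unit   : P ⅋-unit → ∀ A → Th P (A ⅋ ⊥ₘ) A
  ax-⊕-unit   : P ⊕-unit → ∀ A → Th P (A ⊕ 𝟎) A
  ax-&-unit   : P &-unit → ∀ A → Th P (A & ⊤ₘ) A
  ax-⊗-𝟎      : P ⊗-𝟎 → ∀ A → Th P (A ⊗ 𝟎) 𝟎
  ax-⅋-⊤      : P ⅋-⊤ → ∀ A → Th P (A ⅋ ⊤ₘ) ⊤ₘ

inE : Ax → Set
inE _ = Unit

inAC : Ax → Set
inAC ⊗-assoc = Unit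
inAC ⊗-comm  = Unit
inAC ⅋-assoc = Unit
inAC ⅋-comm  = Unit
inAC ⊕-assoc = Unit
inAC ⊕-comm  = Unit
inAC &-assoc = Unit
inAC &-comm  = Unit
inAC _       = Empty


Sub : Set
Sub = Conn → Bool

inE[_] : Sub → Ax → Set
inE[ S ] a = All (λ c → T (S c)) (conns a)

infix 4 _=E_ _=AC_ _=E[_]_

_=E_ : Fm → Fm → Set
A =E B = Th inE A B

_=AC_ : Fm → Fm → Set
A =AC B = Th inAC A B

_=E[_]_ : Fm → Sub → Fm → Set
A =E[ S ] B = Th inE[ S ] A B

Uses : Sub → Fm → Set
Uses S (var x)  = Unit
Uses S (nvar x) = Unit
Uses S (A ⊗ B) = T (S c⊗) × Uses S A × Uses S B
Uses S (A ⅋ B) = T (S c⅋) × Uses S A × Uses S B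
Uses S (A & B) = T (S c&) × Uses S A × Uses S B
Uses S (A ⊕ B) = T (S c⊕) × Uses S A × Uses S B
Uses S 𝟏  = T (S c𝟏)
Uses S ⊥ₘ = T (S c⊥)
Uses S ⊤ₘ = T (S c⊤)
Uses S 𝟎  = T (S c𝟎)

isPlus isWith is𝟏 is⊥ is⊤ is𝟎 : Fm → Bool
isPlus (_ ⊕ _) = true
isPlus _ = false
isWith (_ & _) = true
isWith _ = false
is𝟏 𝟏 = true
is𝟏 _ = false
is⊥ ⊥ₘ = true
is⊥ _ = false
is⊤ ⊤ₘ = true
is⊤ _ = false
is𝟎 𝟎 = true
is𝟎 _ = false

okTensor : Fm → Fm → Bool
okTensor A B = not (isPlus A ∨ isPlus B ∨ is𝟏 A ∨ is𝟏 B ∨ is𝟎 A ∨ is𝟎 B)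
okPlus : Fm → Fm → Bool
okPlus A B = not (is𝟎 A ∨ is𝟎 B)
okPar : Fm → Fm → Bool
okPar A B = not (isWith A ∨ isWith B ∨ is⊥ A ∨ is⊥ B ∨ is⊤ A ∨ is⊤ B)
okWith : Fm → Fm → Bool
okWith A B = not (is⊤ A ∨ is⊤ B)

Distributed : Fm → Set
Distributed (var x)  = Unit
Distributed (nvar x) = Unit
Distributed (A ⊗ B) = T (okTensor A B) × Distributed A × Distributed B
Distributed (A ⅋ B) = T (okPar A B) × Distributed A × Distributed B
Distributed (A & B) = T (okWith A B) × Distributed A × Distributed B
Distributed (A ⊕ B) = T (okPlus A B) × Distributed A × Distributed B
Distributed 𝟏  = Unit
Distributed ⊥ₘ = Unit
Distributed ⊤ₘ = Unit
Distributed 𝟎  = Unit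

{-# OPTIONS --safe #-}
module Submission where

-- Polarise the formulas and interpret a proof of ⊢ Γ as a functional sending one counter-proof ("value")
-- of every formula of Γ to a cut-free focused proof; such proofs are trees with named variables, taken up
-- to the exchange of independent foci (~).  A negative value is an answer to all choices, a positive one a
-- continuation, so cuts, units and the additives are interpreted by plumbing, and two proofs equal up to
-- =βη get ~-related interpretations.  The only delicate point is the commutation of cuts: it holds because
-- interpretations of proofs are linear in every argument (Lin), so that they commute with each other.
--
-- An isomorphism A ≅ B thus yields two normal forms whose composites are ~-equal to identities.  In a
-- distributed formula no positive subformula has a unique skeleton made of a single positive slot, which
-- makes identities rigid: a tree ~-equal to one is literally one.  Reading the composites off, the two
-- normal forms are bijections between the skeletons (the choices at the &'s) of A and B and, skeleton by
-- skeleton, between their slots (the positive subformulas and atoms below the ⅋'s), matched slots being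
-- isomorphic again.  Up to associativity and commutativity a distributed formula is the & of the ⅋'s of its
-- slots, whence (1).  For (2) and (3), every formula is equal to a distributed one in the theory 𝓔
-- restricted to its own connectives, and the equations of 𝓔 are isomorphisms of the semantics.

-- Why `Central` comes before linearity. When both cut types are negative, exchanging two cuts means
-- `r (λ x → k (λ y → t x y)) ~ k (λ y → r (λ x → t x y))`, which arbitrary functionals do not
-- satisfy, while `~` only exchanges single foci. That exchange makes a focus central. A linear
-- functional commutes with all central ones, so with foci, so it is central itself; hence two
-- linear functionals commute.
--
-- Why rigidity needs distributed formulas. If the unique skeleton of `P` is one positive slot, as
-- for a `⅋` with `⊥`, the focus on a variable of type `pst P` has the same shape for every input,
-- and nothing ties it below the focus that precedes it: `~comm` may swap the two inside an
-- identity.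
--
-- Why resources are recorded. A leaf of type `pst top` has no branch from which the absorbed
-- variables could be read, yet slots are matched one to one by counting resources.
--
-- Why isomorphisms are composed in the semantics. There the equations of the theory hold almost by
-- computation, so that none of them has to be derived in `≈`, which enters through soundness alone.

open import Defs hiding (A; B; C; Γ; Δ; Σ'; Γ₁; Γ₂; Θ₁; Θ₂; Γ'; Δ')
open import Data.Bool using (Bool; true; false; not; _∨_; T)
open import Data.Empty using (⊥; ⊥-elim)
open import Data.Fin using (Fin; zero; suc)
open import Data.List using (List; []; _∷_; _++_; [_]; map; length; lookup; cartesianProduct; allFin; tabulate)
open import Data.List.Membership.Propositional using (_∈_)
import Data.List.Membership.Propositional.Properties as ∈
open import Data.List.Membership.Propositional.Properties.WithK using (unique∧set⇒bag)
open import Data.List.Properties using (++-assoc; ++-identityʳ; ++-conicalˡ; ∷-injective; length-++; map-++; map-∘; map-tabulate)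
open import Data.List.Relation.Binary.BagAndSetEquality using (∼bag⇒↭)
import Data.List.Relation.Binary.Permutation.Propositional as ↭
open import Data.List.Relation.Binary.Permutation.Propositional
  using (_↭_; prep; swap; ↭-sym; ↭-reflexive)
  renaming (refl to ↭-refl; trans to ↭-trans)
open import Data.List.Relation.Binary.Permutation.Propositional.Properties
  using (++⁺; ++⁺ˡ; ++⁺ʳ; shift; ∷↭∷ʳ; map⁺; ++-commutativeMonoid; ↭-empty-inv; ↭-singleton-inv; ↭-length)
  renaming (++-comm to ↭-++-comm)
open import Data.List.Relation.Unary.All using (All; []; _∷_)
import Data.List.Relation.Unary.All.Properties as All
open import Data.List.Relation.Unary.Any using (here)
open import Data.List.Relation.Unary.Unique.Propositional using (Unique; []; _∷_)
import Data.List.Relation.Unary.Unique.Propositional.Properties as Unique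
open import Data.Nat using (ℕ; zero; suc; _+_; _≤_; z≤n; s≤s)
open import Data.Nat.Properties using (≤-refl; ≤-trans; ≤-reflexive; m≤m+n; +-mono-≤; suc-injective)
open import Data.Product using (Σ; ∃; _×_; _,_; proj₁; proj₂)
open import Data.Sum using (_⊎_; inj₁; inj₂) renaming ([_,_]′ to either)
open import Data.Sum.Properties using (inj₁-injective; inj₂-injective)
open import Data.Unit using (⊤; tt)
open import Function.Bundles using (mk⇔)
open import Relation.Binary.PropositionalEquality using (_≡_; refl; cong; cong₂; sym; trans; subst)
open import Relation.Nullary using (¬_)

-- Trees and values

-- Negative formulas are ⅋, &, ⊥, ⊤ and the negated atoms; pst N is the dual of neg N.
data Arg : Set
data Ng : Set where
  par wit : Arg → Arg → Ng
  bot top : Ng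
  nv : ℕ → Ng
data Arg where
  neg pst : Ng → Arg

dual : Arg → Arg
dual (neg N) = pst N
dual (pst N) = neg N

-- Any infinite type would do: what matters is that `[]` differs from `true ∷ []` and that `unary`
-- is injective.
Nm : Set
Nm = List Bool

Res : Set
Res = Arg × Nm

M : Set
M = List Res

-- Generic inputs of an argument: one choice for every &, and a name for every leaf.
Gn : Arg → Set
Gn (neg (par a b)) = Gn a × Gn b
Gn (neg (wit a b)) = Gn a ⊎ Gn b
Gn (neg bot) = ⊤
Gn (neg top) = ⊥
Gn (neg (nv x)) = Nm
Gn (pst N) = Nm

grG : ∀ a → Gn a → M
grG (neg (par a b)) (g , h) = grG a g ++ grG b h
grG (neg (wit a b)) (inj₁ g) = grG a g
grG (neg (wit a b)) (inj₂ g) = grG b g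
grG (neg bot) _ = []
grG (neg (nv x)) n = [ neg (nv x) , n ]
grG (pst N) n = [ pst N , n ]

-- Normal proofs up to the choice of names: a node focuses on the variable n of type pst N;
-- a leaf records the resources it uses, which matters when it has no branch at all (⊤).
data Tm : Set
data Bd : Arg → Set
data Tm where
  node : ∀ N → Nm → Bd (neg N) → Tm
data Bd where
  b-par : ∀ {a b} → Bd a → Bd b → Bd (neg (par a b))
  b-inl : ∀ {a b} → Bd a → Bd (neg (wit a b))
  b-inr : ∀ {a b} → Bd b → Bd (neg (wit a b))
  b-bot : Bd (neg bot)
  b-nv  : ∀ {x} → Nm → Bd (neg (nv x))
  b-leaf : ∀ {N} → M → (Gn (neg N) → Tm) → Bd (pst N)

-- A leaf contributes its annotation and its branches are not inspected, so that a leaf without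
-- branches still accounts for what it absorbs.
grB : ∀ {a} → Bd a → M
grB (b-par b c) = grB b ++ grB c
grB (b-inl b) = grB b
grB (b-inr b) = grB b
grB b-bot = []
grB (b-nv {x} n) = [ neg (nv x) , n ]
grB (b-leaf S T) = S

-- One-hole contexts: a body with one positive leaf removed. They single out the leaf under which
-- the second focus of `~comm` sits.
data Hl (N : Ng) : Arg → Set where
  h-leaf : Hl N (pst N)
  h-parˡ : ∀ {a b} → Hl N a → Bd b → Hl N (neg (par a b))
  h-parʳ : ∀ {a b} → Bd a → Hl N b → Hl N (neg (par a b))
  h-inl : ∀ {a b} → Hl N a → Hl N (neg (wit a b))
  h-inr : ∀ {a b} → Hl N b → Hl N (neg (wit a b))

plug : ∀ {N a} → Hl N a → M → (Gn (neg N) → Tm) → Bd a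
plug h-leaf S T = b-leaf S T
plug (h-parˡ H b) S T = b-par (plug H S T) b
plug (h-parʳ b H) S T = b-par b (plug H S T)
plug (h-inl H) S T = b-inl (plug H S T)
plug (h-inr H) S T = b-inr (plug H S T)

grH : ∀ {N a} → Hl N a → M
grH h-leaf = []
grH (h-parˡ H b) = grH H ++ grB b
grH (h-parʳ b H) = grB b ++ grH H
grH (h-inl H) = grH H
grH (h-inr H) = grH H

infix 4 _~_ _~B_
data _~_ : Tm → Tm → Set
data _~B_ : ∀ {a} → Bd a → Bd a → Set
data _~_ where
  ~refl : ∀ {t} → t ~ t
  ~sym : ∀ {t u} → t ~ u → u ~ t
  ~trans : ∀ {t u v} → t ~ u → u ~ v → t ~ v
  ~node : ∀ {N n b b'} → b ~B b' → node N n b ~ node N n b'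
  -- Independence is enforced by scoping: `N'`, `n'` and `H'` are fixed before the input `g` bound
  -- at the outer leaf. `U` stands for what the common continuation uses besides the two bound
  -- inputs.
  ~comm : ∀ {N N' P P'} n n' (H : Hl P (neg N)) (H' : Hl P' (neg N')) (U : M)
          (T : Gn (neg P) → Gn (neg P') → Tm) →
          node N n (plug H (((pst N' , n') ∷ grH H') ++ U) λ g →
            node N' n' (plug H' (U ++ grG _ g) λ g' → T g g'))
          ~ node N' n' (plug H' (((pst N , n) ∷ grH H) ++ U) λ g' →
            node N n (plug H (U ++ grG _ g') λ g → T g g'))
data _~B_ where
  ~par : ∀ {a b} {x x' : Bd a} {y y' : Bd b} → x ~B x' → y ~B y' → b-par x y ~B b-par x' y'
  ~inl : ∀ {a b} {x x' : Bd a} → x ~B x' → b-inl {a} {b} x ~B b-inl x'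
  ~inr : ∀ {a b} {x x' : Bd b} → x ~B x' → b-inr {a} {b} x ~B b-inr x'
  ~bot : b-bot ~B b-bot
  ~nv : ∀ {x n} → b-nv {x} n ~B b-nv n
  ~leaf : ∀ {N S S'} {T T' : Gn (neg N) → Tm} → S ↭ S' → (∀ g → T g ~ T' g) →
          b-leaf S T ~B b-leaf S' T'

~B-refl : ∀ {a} {b : Bd a} → b ~B b
~B-refl {b = b-par b c} = ~par ~B-refl ~B-refl
~B-refl {b = b-inl b} = ~inl ~B-refl
~B-refl {b = b-inr b} = ~inr ~B-refl
~B-refl {b = b-bot} = ~bot
~B-refl {b = b-nv n} = ~nv
~B-refl {b = b-leaf S T} = ~leaf ↭-refl λ _ → ~refl

~plug : ∀ {N a} (H : Hl N a) {S S' T T'} → S ↭ S' → (∀ g → T g ~ T' g) →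
        plug H S T ~B plug H S' T'
~plug h-leaf p q = ~leaf p q
~plug (h-parˡ H b) p q = ~par (~plug H p q) ~B-refl
~plug (h-parʳ b H) p q = ~par ~B-refl (~plug H p q)
~plug (h-inl H) p q = ~inl (~plug H p q)
~plug (h-inr H) p q = ~inr (~plug H p q)

-- A value of neg N answers every choice of the opponent; a value of pst N is a continuation,
-- together with the resources it uses.
Val : Arg → Set
ValN : Ng → Set
Val (neg N) = ValN N
Val (pst N) = M × (ValN N → Tm)
ValN (par a b) = Val a × Val b
ValN (wit a b) = Val a ⊎ Val b
ValN bot = ⊤
ValN top = ⊥
ValN (nv x) = Nm

gr : ∀ a → Val a → M
gr (neg (par a b)) (x , y) = gr a x ++ gr b y
gr (neg (wit a b)) (inj₁ x) = gr a x
gr (neg (wit a b)) (inj₂ x) = gr b x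
gr (neg bot) _ = []
gr (neg (nv x)) n = [ neg (nv x) , n ]
gr (pst N) k = proj₁ k

-- `gen` and `reify` are the reflection and reification of normalisation by evaluation: a name
-- becomes the continuation that focuses on it, and a continuation is read off at generic inputs.
gen : ∀ a → Gn a → Val a
genN : ∀ N → Gn (neg N) → ValN N
reify : ∀ a → Val a → Bd a
reifyN : ∀ N → ValN N → Bd (neg N)
focus : ∀ N → Nm → ValN N → Tm
gen (neg N) g = genN N g
gen (pst N) n = [ pst N , n ] , focus N n
genN (par a b) (g , h) = gen a g , gen b h
genN (wit a b) (inj₁ g) = inj₁ (gen a g)
genN (wit a b) (inj₂ g) = inj₂ (gen b g)
genN bot _ = tt
genN (nv x) n = n
reify (neg N) x = reifyN N x
reify (pst N) (S , h) = b-leaf S λ g → h (genN N g)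
reifyN (par a b) (x , y) = b-par (reify a x) (reify b y)
reifyN (wit a b) (inj₁ x) = b-inl (reify a x)
reifyN (wit a b) (inj₂ x) = b-inr (reify b x)
reifyN bot _ = b-bot
reifyN (nv x) n = b-nv n
focus N n x = node N n (reifyN N x)

gr-gen : ∀ a g → gr a (gen a g) ≡ grG a g
gr-gen (neg (par a b)) (g , h) = cong₂ _++_ (gr-gen a g) (gr-gen b h)
gr-gen (neg (wit a b)) (inj₁ g) = gr-gen a g
gr-gen (neg (wit a b)) (inj₂ g) = gr-gen b g
gr-gen (neg bot) g = refl
gr-gen (neg (nv x)) g = refl
gr-gen (pst N) g = refl

-- Extensional equality, a partial equivalence relation.
E : ∀ a → Val a → Val a → Set
EN : ∀ N → ValN N → ValN N → Set
E (neg N) x y = EN N x y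
E (pst N) (S , h) (S' , h') = S ↭ S' × (∀ x x' → EN N x x' → h x ~ h' x')
EN (par a b) (x , y) (x' , y') = E a x x' × E b y y'
EN (wit a b) (inj₁ x) (inj₁ y) = E a x y
EN (wit a b) (inj₁ x) (inj₂ y) = ⊥
EN (wit a b) (inj₂ x) (inj₁ y) = ⊥
EN (wit a b) (inj₂ x) (inj₂ y) = E b x y
EN bot _ _ = ⊤
EN top _ _ = ⊥
EN (nv x) n m = n ≡ m

E-gr : ∀ a {x x'} → E a x x' → gr a x ↭ gr a x'
E-gr (neg (par a b)) (p , q) = ++⁺ (E-gr a p) (E-gr b q)
E-gr (neg (wit a b)) {inj₁ x} {inj₁ y} p = E-gr a p
E-gr (neg (wit a b)) {inj₂ x} {inj₂ y} p = E-gr b p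
E-gr (neg bot) p = ↭-refl
E-gr (neg (nv x)) refl = ↭-refl
E-gr (pst N) p = proj₁ p

reify-E : ∀ a {x x'} → E a x x' → reify a x ~B reify a x'
reifyN-E : ∀ N {x x'} → EN N x x' → reifyN N x ~B reifyN N x'
gen-E : ∀ a g → E a (gen a g) (gen a g)
genN-E : ∀ N g → EN N (genN N g) (genN N g)
reify-E (neg N) p = reifyN-E N p
reify-E (pst N) (p , q) = ~leaf p λ g → q _ _ (genN-E N g)
reifyN-E (par a b) (p , q) = ~par (reify-E a p) (reify-E b q)
reifyN-E (wit a b) {inj₁ x} {inj₁ y} p = ~inl (reify-E a p)
reifyN-E (wit a b) {inj₂ x} {inj₂ y} p = ~inr (reify-E b p)
reifyN-E bot p = ~bot
reifyN-E (nv x) refl = ~nv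
gen-E (neg N) g = genN-E N g
gen-E (pst N) g = ↭-refl , λ x x' p → ~node (reifyN-E N p)
genN-E (par a b) (g , h) = gen-E a g , gen-E b h
genN-E (wit a b) (inj₁ g) = gen-E a g
genN-E (wit a b) (inj₂ g) = gen-E b g
genN-E bot g = tt
genN-E (nv x) g = refl

E-sym : ∀ a {x y} → E a x y → E a y x
EN-sym : ∀ N {x y} → EN N x y → EN N y x
E-trans : ∀ a {x y z} → E a x y → E a y z → E a x z
EN-trans : ∀ N {x y z} → EN N x y → EN N y z → EN N x z
E-sym (neg N) p = EN-sym N p
E-sym (pst N) (p , q) = ↭-sym p , λ x y r → ~sym (q _ _ (EN-sym N r))
EN-sym (par a b) (p , q) = E-sym a p , E-sym b q
EN-sym (wit a b) {inj₁ x} {inj₁ y} p = E-sym a p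
EN-sym (wit a b) {inj₂ x} {inj₂ y} p = E-sym b p
EN-sym bot p = tt
EN-sym (nv x) p = sym p
E-trans (neg N) p q = EN-trans N p q
E-trans (pst N) (p , q) (r , s) = ↭-trans p r , λ x y e →
  ~trans (q _ _ e) (s _ _ (EN-trans N (EN-sym N e) e))
EN-trans (par a b) (p , q) (r , s) = E-trans a p r , E-trans b q s
EN-trans (wit a b) {inj₁ x} {inj₁ y} {inj₁ z} p q = E-trans a p q
EN-trans (wit a b) {inj₂ x} {inj₂ y} {inj₂ z} p q = E-trans b p q
EN-trans bot p q = tt
EN-trans (nv x) p q = trans p q

E-left : ∀ a {x y} → E a x y → E a x x
E-left a p = E-trans a p (E-sym a p)
E-right : ∀ a {x y} → E a x y → E a y y
E-right a p = E-trans a (E-sym a p) p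

open import Algebra.Solver.CommutativeMonoid (++-commutativeMonoid {A = Res})
  using (solve; _⊜_) renaming (_⊕_ to _:+_)

-- Linearity

-- `op` is a single focus seen as a functional of the continuation at its hole, and `wop` is what
-- that focus consumes. These are the elementary central functionals.
wop : ∀ {P} N → Nm → Hl P (neg N) → M
wop N n H = (pst N , n) ∷ grH H

op : ∀ {P} N → Nm → Hl P (neg N) → Val (pst P) → Tm
op {P} N n H (S , h) = node N n (plug H S λ g → h (genN P g))

op-E : ∀ {P} N n (H : Hl P (neg N)) {k k'} → E (pst P) k k' → op N n H k ~ op N n H k'
op-E {P} N n H (p , q) = ~node (~plug H p λ g → q _ _ (genN-E P g))

-- Functionals commuting with every node; composition with a proof is one of them, see Fn-central.
record Central (N : Ng) (w : M) (Φ : Val (pst N) → Tm) : Set where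
  field
    resp : ∀ {k k'} → E (pst N) k k' → Φ k ~ Φ k'
    comm : ∀ {P} N' n (H : Hl P (neg N')) U (T : ValN N → ValN P → Tm) →
           (∀ {x x' y y'} → EN N x x' → EN P y y' → T x y ~ T x' y') →
           Φ (wop N' n H ++ U , λ x → op N' n H (U ++ gr (neg N) x , λ y → T x y))
           ~ op N' n H (w ++ U , λ y → Φ (U ++ gr (neg P) y , λ x → T x y))
open Central

-- A logical predicate strengthening self-relatedness under `E` by linearity. `GE` accompanies it
-- because soundness yields agreement on good values only: it relates good continuations that agree
-- on `GE`-related arguments.
Good : ∀ a → Val a → Set
GoodN : ∀ N → ValN N → Set
GE : ∀ a → Val a → Val a → Set
GEN : ∀ N → ValN N → ValN N → Set
Lin : ∀ a → (Val a → Tm) → M → Set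
LinN : ∀ N → (ValN N → Tm) → M → Set
GoodP : ∀ N → M → (ValN N → Tm) → Set

GoodP N S h = (∀ {x x'} → EN N x x' → h x ~ h x') × (∀ {x x'} → GEN N x x' → h x ~ h x') × LinN N h S
Good (neg N) x = GoodN N x
Good (pst N) (S , h) = GoodP N S h
GoodN (par a b) (x , y) = Good a x × Good b y
GoodN (wit a b) (inj₁ x) = Good a x
GoodN (wit a b) (inj₂ x) = Good b x
GoodN bot _ = ⊤
GoodN top _ = ⊥
GoodN (nv x) _ = ⊤
GE (neg N) x y = GEN N x y
GE (pst N) (S , h) (S' , h') =
  S ↭ S' × (∀ {x x'} → GEN N x x' → h x ~ h' x') × GoodP N S h × GoodP N S' h'
GEN (par a b) (x , y) (x' , y') = GE a x x' × GE b y y'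
GEN (wit a b) (inj₁ x) (inj₁ y) = GE a x y
GEN (wit a b) (inj₁ x) (inj₂ y) = ⊥
GEN (wit a b) (inj₂ x) (inj₁ y) = ⊥
GEN (wit a b) (inj₂ x) (inj₂ y) = GE b x y
GEN bot _ _ = ⊤
GEN top _ _ = ⊥
GEN (nv x) n m = n ≡ m
-- Linearity in every leaf: f commutes with central functionals acting on that leaf alone.
Lin (neg N) f w = LinN N f w
Lin (pst P) f w₀ = ∀ {N w Φ} → Central N w Φ → ∀ U (fam : ValN N → Val (pst P)) base →
  E (pst P) base base →
  (∀ {x x'} → EN N x x' → E (pst P) (fam x) (fam x')) →
  proj₁ base ↭ w ++ U → (∀ x → proj₁ (fam x) ↭ U ++ gr (neg N) x) →
  (∀ y → GoodN P y → proj₂ base y ~ Φ (U ++ gr (neg P) y , λ x → proj₂ (fam x) y)) →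
  ∀ W → W ↭ U ++ w₀ → f base ~ Φ (W , λ x → f (fam x))
LinN (par a b) f w =
  (∀ y → Good b y → Lin a (λ x → f (x , y)) (w ++ gr b y)) ×
  (∀ x → Good a x → Lin b (λ y → f (x , y)) (w ++ gr a x))
LinN (wit a b) f w = Lin a (λ x → f (inj₁ x)) w × Lin b (λ x → f (inj₂ x)) w
LinN bot f w = ⊤
LinN top f w = ⊤
LinN (nv x) f w = ⊤

Lin-↭ : ∀ a {f w w'} → w ↭ w' → Lin a f w → Lin a f w'
Lin-↭ (neg (par a b)) p (l , r) =
  (λ y gy → Lin-↭ a (++⁺ʳ _ p) (l y gy)) , (λ x gx → Lin-↭ b (++⁺ʳ _ p) (r x gx))
Lin-↭ (neg (wit a b)) p (l , r) = Lin-↭ a p l , Lin-↭ b p r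
Lin-↭ (neg bot) p l = tt
Lin-↭ (neg top) p l = tt
Lin-↭ (neg (nv x)) p l = tt
Lin-↭ (pst N) p l c U fam base e₁ e₂ e₃ e₄ e₅ W q =
  l c U fam base e₁ e₂ e₃ e₄ e₅ W (↭-trans q (++⁺ˡ U (↭-sym p)))

Good-E : ∀ a {x} → Good a x → E a x x
Good-E (neg (par a b)) (p , q) = Good-E a p , Good-E b q
Good-E (neg (wit a b)) {inj₁ x} p = Good-E a p
Good-E (neg (wit a b)) {inj₂ x} p = Good-E b p
Good-E (neg bot) p = tt
Good-E (neg (nv x)) p = refl
Good-E (pst N) (p , _) = ↭-refl , λ _ _ → p

Good-GE : ∀ a {x} → Good a x → GE a x x
Good-GE (neg (par a b)) (p , q) = Good-GE a p , Good-GE b q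
Good-GE (neg (wit a b)) {inj₁ x} p = Good-GE a p
Good-GE (neg (wit a b)) {inj₂ x} p = Good-GE b p
Good-GE (neg bot) p = tt
Good-GE (neg (nv x)) p = refl
Good-GE (pst N) p@(_ , q , _) = ↭-refl , q , p , p

GE-left : ∀ a {x y} → GE a x y → Good a x
GE-left (neg (par a b)) (p , q) = GE-left a p , GE-left b q
GE-left (neg (wit a b)) {inj₁ x} {inj₁ y} p = GE-left a p
GE-left (neg (wit a b)) {inj₂ x} {inj₂ y} p = GE-left b p
GE-left (neg bot) p = tt
GE-left (neg (nv x)) p = tt
GE-left (pst N) (_ , _ , p , _) = p

GE-right : ∀ a {x y} → GE a x y → Good a y
GE-right (neg (par a b)) (p , q) = GE-right a p , GE-right b q
GE-right (neg (wit a b)) {inj₁ x} {inj₁ y} p = GE-right a p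
GE-right (neg (wit a b)) {inj₂ x} {inj₂ y} p = GE-right b p
GE-right (neg bot) p = tt
GE-right (neg (nv x)) p = tt
GE-right (pst N) (_ , _ , _ , p) = p

GE-gr : ∀ a {x x'} → GE a x x' → gr a x ↭ gr a x'
GE-gr (neg (par a b)) (p , q) = ++⁺ (GE-gr a p) (GE-gr b q)
GE-gr (neg (wit a b)) {inj₁ x} {inj₁ y} p = GE-gr a p
GE-gr (neg (wit a b)) {inj₂ x} {inj₂ y} p = GE-gr b p
GE-gr (neg bot) p = ↭-refl
GE-gr (neg (nv x)) refl = ↭-refl
GE-gr (pst N) p = proj₁ p

record Fn (a : Arg) (f : Val a → Tm) (w : M) : Set where
  constructor fn
  field
    fE : ∀ {x x'} → E a x x' → f x ~ f x'
    fG : ∀ {x x'} → GE a x x' → f x ~ f x'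
    fL : Lin a f w
open Fn

Fn-↭ : ∀ {a f w w'} → w ↭ w' → Fn a f w → Fn a f w'
Fn-↭ {a} p (fn e g l) = fn e g (Lin-↭ a p l)

good⁺ : ∀ {N h S} → Fn (neg N) h S → GoodP N S h
good⁺ (fn e g l) = e , g , l

good⁻ : ∀ {N h S} → GoodP N S h → Fn (neg N) h S
good⁻ (e , g , l) = fn e g l

-- This is `~comm` itself, with annotations rewritten by `gr-gen`; every commutation of cuts rests
-- on it.
op-central : ∀ {P} N n (H : Hl P (neg N)) → Central P (wop N n H) (op N n H)
op-central {P} N n H = record { resp = op-E N n H ; comm = c }
  where
  c : ∀ {P'} N' n' (H' : Hl P' (neg N')) U (T : ValN P → ValN P' → Tm) →
      (∀ {x x' y y'} → EN P x x' → EN P' y y' → T x y ~ T x' y') →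
      op N n H (wop N' n' H' ++ U , λ x → op N' n' H' (U ++ gr (neg P) x , λ y → T x y))
      ~ op N' n' H' (wop N n H ++ U , λ y → op N n H (U ++ gr (neg P') y , λ x → T x y))
  c {P'} N' n' H' U T e = ~trans
    (~node (~plug H ↭-refl λ g → ~node (~plug H'
      (↭-reflexive (cong (U ++_) (gr-gen (neg P) g))) λ _ → ~refl)))
    (~trans (~comm n n' H H' U λ g g' → T (genN P g) (genN P' g'))
    (~node (~plug H' ↭-refl λ g → ~node (~plug H
      (↭-reflexive (cong (U ++_) (sym (gr-gen (neg P') g)))) λ _ → ~refl))))

-- Linearity of `r` in its leaf, applied to the central functional `op`, says that `r` commutes with
-- every focus. This is the step from foci to all linear functionals.
Fn-central : ∀ {N r w} → Fn (pst N) r w → Central N w r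
Fn-central {N} {r} {w} F = record { resp = fE F ; comm = c }
  where
  c : ∀ {P} N' n (H : Hl P (neg N')) U (T : ValN N → ValN P → Tm) →
      (∀ {x x' y y'} → EN N x x' → EN P y y' → T x y ~ T x' y') →
      r (wop N' n H ++ U , λ x → op N' n H (U ++ gr (neg N) x , λ y → T x y))
      ~ op N' n H (w ++ U , λ y → r (U ++ gr (neg P) y , λ x → T x y))
  c {P} N' n H U T e = ~trans
    (fL F (op-central N' n H) U (λ y → U ++ gr (neg P) y , λ x → T x y) _
      (↭-refl , λ x x' q → op-E N' n H (++⁺ˡ U (E-gr (neg N) q) , λ y y' q' → e q q'))
      (λ q → ++⁺ˡ U (E-gr (neg P) q) , λ x x' q' → e q' q)
      ↭-refl (λ _ → ↭-refl) (λ _ _ → ~refl) (w ++ U) (↭-++-comm w U))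
    ~refl

-- The meaning of a cut: the functional on the negative side is the continuation passed to the other one.
Fun : Arg → Set
Fun a = M × (Val a → Tm)

br : ∀ a → Fun a → Fun (dual a) → Tm
br (neg N) f (T , g) = g f
br (pst N) (S , f) g = f g

EF GEF : ∀ a → Fun a → Fun a → Set
EF a (S , f) (S' , f') = S ↭ S' × (∀ x x' → E a x x' → f x ~ f' x')
GEF a (S , f) (S' , f') = S ↭ S' × (∀ {x x'} → GE a x x' → f x ~ f' x') × Fn a f S × Fn a f' S'

br-E : ∀ a {F F' G G'} → EF a F F' → EF (dual a) G G' → br a F G ~ br a F' G'
br-E (neg N) p (_ , q) = q _ _ p
br-E (pst N) (_ , p) q = p _ _ q

br-GE : ∀ a {F F' G G'} → GEF a F F' → GEF (dual a) G G' → br a F G ~ br a F' G'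
br-GE (neg N) (p , q , f , f') (_ , r , _) = r (p , q , good⁺ f , good⁺ f')
br-GE (pst N) (_ , r , _) (p , q , f , f') = r (p , q , good⁺ f , good⁺ f')

-- For positive `a` the cut is the substitution of `r` into `p`. For negative `a`, a central
-- functional acting at a leaf of `c` first passes through `p`, by the linearity assumed at good
-- `x`, and then through `r`. The first passage is why `Lin` tests `base` on good arguments only.
br-Lin : ∀ a c (p : Val a → Val c → Tm) (σ : Val c → M) {wp} {r : Fun (dual a)} →
  (∀ y → σ y ↭ wp ++ gr c y) →
  (∀ {x x' y y'} → E a x x' → E c y y' → p x y ~ p x' y') →
  (∀ x → Good a x → Lin c (p x) (wp ++ gr a x)) →
  Fn (dual a) (proj₂ r) (proj₁ r) →
  Lin c (λ y → br a (σ y , λ x → p x y) r) (wp ++ proj₁ r)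
br-Lin (pst N) c p σ {r = r} s e l g = l r (good⁺ g)
br-Lin (neg N) (neg (par c d)) p σ {wp} {r} s e l g =
  (λ y gy → Lin-↭ c (lem wp (gr d y) (proj₁ r)) (br-Lin (neg N) c (λ x z → p x (z , y)) (λ z → σ (z , y))
     (λ z → ↭-trans (s (z , y)) (lem' wp (gr c z) (gr d y)))
     (λ q q' → e q (q' , Good-E d gy))
     (λ x gx → Lin-↭ c (lem wp (gr (neg N) x) (gr d y)) (proj₁ (l x gx) y gy)) g)) ,
  (λ y gy → Lin-↭ d (lem wp (gr c y) (proj₁ r)) (br-Lin (neg N) d (λ x z → p x (y , z)) (λ z → σ (y , z))
     (λ z → ↭-trans (s (y , z)) (↭-reflexive (sym (++-assoc wp (gr c y) (gr d z)))))
     (λ q q' → e q (Good-E c gy , q'))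
     (λ x gx → Lin-↭ d (lem wp (gr (neg N) x) (gr c y)) (proj₂ (l x gx) y gy)) g))
  where
  lem : ∀ a b c → (a ++ b) ++ c ↭ (a ++ c) ++ b
  lem = solve 3 (λ a b c → (a :+ b) :+ c ⊜ (a :+ c) :+ b) ↭-refl
  lem' : ∀ a b c → a ++ (b ++ c) ↭ (a ++ c) ++ b
  lem' = solve 3 (λ a b c → a :+ (b :+ c) ⊜ (a :+ c) :+ b) ↭-refl
br-Lin (neg N) (neg (wit c d)) p σ s e l g =
  br-Lin (neg N) c (λ x z → p x (inj₁ z)) (λ z → σ (inj₁ z)) (λ z → s (inj₁ z)) e
    (λ x gx → proj₁ (l x gx)) g ,
  br-Lin (neg N) d (λ x z → p x (inj₂ z)) (λ z → σ (inj₂ z)) (λ z → s (inj₂ z)) e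
    (λ x gx → proj₂ (l x gx)) g
br-Lin (neg N) (neg bot) p σ s e l g = tt
br-Lin (neg N) (neg top) p σ s e l g = tt
br-Lin (neg N) (neg (nv x)) p σ s e l g = tt
br-Lin (neg N) (pst P) p σ {wp} {r} s e l g {N'} {w} c U fam base e₁ e₂ e₃ e₄ e₅ W q =
  -- Here the central functional acts on the continuation `λ x → p x y` handed to `r`; besides `U`,
  -- that continuation uses the fixed part `wp`.
  fL g c (U ++ wp) (λ d → σ (fam d) , λ x → p x (fam d)) (σ base , λ x → p x base)
    (↭-refl , λ x x' q → e q e₁)
    (λ q → ↭-trans (s _) (↭-trans (++⁺ˡ wp (proj₁ (e₂ q))) (↭-sym (s _))) , λ x x' q' → e q' (e₂ q))
    (↭-trans (s base) (↭-trans (++⁺ˡ wp e₃) (lem wp w U)))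
    (λ d → ↭-trans (s (fam d)) (↭-trans (++⁺ˡ wp (e₄ d)) (lem2 wp U (gr (neg N') d))))
    (λ x gx → l x gx c U fam base e₁ e₂ e₃ e₄ e₅ _ (lem3 U wp (gr (neg N) x)))
    W (↭-trans q (↭-reflexive (sym (++-assoc U wp (proj₁ r)))))
  where
  lem : ∀ a b c → a ++ (b ++ c) ↭ b ++ (c ++ a)
  lem = solve 3 (λ a b c → a :+ (b :+ c) ⊜ b :+ (c :+ a)) ↭-refl
  lem2 : ∀ a b c → a ++ (b ++ c) ↭ (b ++ a) ++ c
  lem2 = solve 3 (λ a b c → a :+ (b :+ c) ⊜ (b :+ a) :+ c) ↭-refl
  lem3 : ∀ a b c → (a ++ b) ++ c ↭ a ++ (b ++ c)
  lem3 a b c = ↭-reflexive (++-assoc a b c)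

dual-dual : ∀ a → dual (dual a) ≡ a
dual-dual (neg N) = refl
dual-dual (pst N) = refl

pair : ∀ a → Val a → Val (dual a) → Tm
pair (neg N) x k = proj₂ k x
pair (pst N) k x = proj₂ k x

cast : ∀ {a b} → a ≡ b → Val a → Val b
cast refl x = x

pair-E : ∀ a {x x' y y'} → E a x x' → E (dual a) y y' → pair a x y ~ pair a x' y'
pair-E (neg N) p (_ , q) = q _ _ p
pair-E (pst N) (_ , q) p = q _ _ p

pair-GE : ∀ a {x x' y y'} → GE a x x' → GE (dual a) y y' → pair a x y ~ pair a x' y'
pair-GE (neg N) p (_ , q , _) = q p
pair-GE (pst N) (_ , q , _) p = q p

leaf-Lin : ∀ N {x} → GoodN N x → Lin (pst N) (λ k → proj₂ k x) (gr (neg N) x)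
leaf-Lin N {x} g c U fam base e₁ e₂ e₃ e₄ e₅ W q =
  ~trans (e₅ x g) (resp c (↭-sym q , λ _ _ p → proj₂ (e₂ p) _ _ (Good-E (neg N) g)))

pair-Linˡ : ∀ a {y} → Good (dual a) y → Lin a (λ x → pair a x y) (gr (dual a) y)
pair-Linˡ (neg N) (_ , _ , l) = l
pair-Linˡ (pst N) g = leaf-Lin N g

pair-Linʳ : ∀ a {x} → Good a x → Lin (dual a) (λ y → pair a x y) (gr a x)
pair-Linʳ (neg N) g = leaf-Lin N g
pair-Linʳ (pst N) (_ , _ , l) = l

GE-Fn : ∀ a {f w} → Fn a f w → GEF a (w , f) (w , f)
GE-Fn a F = ↭-refl , fG F , F , F

-- A calculus of polarised labels, its interpretation, and linearity of the interpretation

module Calculus (L : Set) (τ : L → Arg) where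

  infix 4 ⊩_
  -- The positive rules are axioms to be composed by cuts, so that commuting a cut past a positive
  -- rule becomes commuting two cuts. Types are constrained by equations because labels may be
  -- formulas, for which `τ` commutes with negation only propositionally.
  data ⊩_ : List L → Set where
    axiom : ∀ {X Y} → τ X ≡ dual (τ Y) → ⊩ X ∷ Y ∷ []
    exch : ∀ {Γ Δ} → Γ ↭ Δ → ⊩ Γ → ⊩ Δ
    cutr : ∀ {X Y Γ Δ} → τ Y ≡ dual (τ X) → ⊩ X ∷ Γ → ⊩ Y ∷ Δ → ⊩ Γ ++ Δ
    parr : ∀ {X Y Z Γ} → τ Z ≡ neg (par (τ X) (τ Y)) → ⊩ X ∷ Y ∷ Γ → ⊩ Z ∷ Γ
    witr : ∀ {X Y Z Γ} → τ Z ≡ neg (wit (τ X) (τ Y)) → ⊩ X ∷ Γ → ⊩ Y ∷ Γ → ⊩ Z ∷ Γ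
    botr : ∀ {Z Γ} → τ Z ≡ neg bot → ⊩ Γ → ⊩ Z ∷ Γ
    topr : ∀ {Z Γ} → τ Z ≡ neg top → ⊩ Z ∷ Γ
    tens : ∀ {X Y Z} → τ Z ≡ pst (par (τ X) (τ Y)) → ⊩ Z ∷ X ∷ Y ∷ []
    injl : ∀ {X Y Z} → τ Z ≡ pst (wit (τ X) (τ Y)) → ⊩ Z ∷ X ∷ []
    injr : ∀ {X Y Z} → τ Z ≡ pst (wit (τ X) (τ Y)) → ⊩ Z ∷ Y ∷ []
    oner : ∀ {Z} → τ Z ≡ pst bot → ⊩ Z ∷ []

  ⌈_⌉ : List L → Arg
  ⌈ [] ⌉ = neg bot
  ⌈ X ∷ Γ ⌉ = neg (par (τ X) ⌈ Γ ⌉)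

  Env : List L → Set
  Env Γ = Val ⌈ Γ ⌉

  left : ∀ Γ {Δ} → Env (Γ ++ Δ) → Env Γ
  left [] _ = tt
  left (X ∷ Γ) (x , γ) = x , left Γ γ

  right : ∀ Γ {Δ} → Env (Γ ++ Δ) → Env Δ
  right [] γ = γ
  right (X ∷ Γ) (x , γ) = right Γ γ

  perm : ∀ {Γ Δ} → Γ ↭ Δ → Env Δ → Env Γ
  perm ↭-refl γ = γ
  perm (prep X σ) (x , γ) = x , perm σ γ
  perm (swap X Y σ) (y , (x , γ)) = x , (y , perm σ γ)
  perm (↭-trans σ ρ) γ = perm σ (perm ρ γ)

  ⟦_⟧ : ∀ {Γ} → ⊩ Γ → Env Γ → Tm
  ⟦ axiom {X} {Y} e ⟧ (x , (y , _)) = pair (τ Y) y (cast e x)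
  ⟦ exch σ π ⟧ γ = ⟦ π ⟧ (perm σ γ)
  ⟦ cutr {X} {Y} {Γ} {Δ} e π ρ ⟧ γ =
    br (τ X) (gr ⌈ Γ ⌉ (left Γ γ) , λ x → ⟦ π ⟧ (x , left Γ γ))
             (gr ⌈ Δ ⌉ (right Γ γ) , λ y → ⟦ ρ ⟧ (cast (sym e) y , right Γ γ))
  ⟦ parr e π ⟧ (z , γ) = let (x , y) = cast e z in ⟦ π ⟧ (x , (y , γ))
  ⟦ witr e π ρ ⟧ (z , γ) = either (λ x → ⟦ π ⟧ (x , γ)) (λ y → ⟦ ρ ⟧ (y , γ)) (cast e z)
  ⟦ botr e π ⟧ (z , γ) = ⟦ π ⟧ γ
  ⟦ topr e ⟧ (z , γ) = ⊥-elim (cast e z)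
  ⟦ tens e ⟧ (z , (x , (y , _))) = proj₂ (cast e z) (x , y)
  ⟦ injl e ⟧ (z , (x , _)) = proj₂ (cast e z) (inj₁ x)
  ⟦ injr e ⟧ (z , (x , _)) = proj₂ (cast e z) (inj₂ x)
  ⟦ oner e ⟧ (z , _) = proj₂ (cast e z) tt

  left-E : ∀ Γ {Δ γ γ'} → E ⌈ Γ ++ Δ ⌉ γ γ' → E ⌈ Γ ⌉ (left Γ γ) (left Γ γ')
  left-E [] p = tt
  left-E (X ∷ Γ) (p , q) = p , left-E Γ q
  right-E : ∀ Γ {Δ γ γ'} → E ⌈ Γ ++ Δ ⌉ γ γ' → E ⌈ Δ ⌉ (right Γ γ) (right Γ γ')
  right-E [] p = p
  right-E (X ∷ Γ) (p , q) = right-E Γ q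
  left-GE : ∀ Γ {Δ γ γ'} → GE ⌈ Γ ++ Δ ⌉ γ γ' → GE ⌈ Γ ⌉ (left Γ γ) (left Γ γ')
  left-GE [] p = tt
  left-GE (X ∷ Γ) (p , q) = p , left-GE Γ q
  right-GE : ∀ Γ {Δ γ γ'} → GE ⌈ Γ ++ Δ ⌉ γ γ' → GE ⌈ Δ ⌉ (right Γ γ) (right Γ γ')
  right-GE [] p = p
  right-GE (X ∷ Γ) (p , q) = right-GE Γ q
  left-Good : ∀ Γ {Δ γ} → Good ⌈ Γ ++ Δ ⌉ γ → Good ⌈ Γ ⌉ (left Γ γ)
  left-Good [] p = tt
  left-Good (X ∷ Γ) (p , q) = p , left-Good Γ q
  right-Good : ∀ Γ {Δ γ} → Good ⌈ Γ ++ Δ ⌉ γ → Good ⌈ Δ ⌉ (right Γ γ)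
  right-Good [] p = p
  right-Good (X ∷ Γ) (p , q) = right-Good Γ q
  gr-++ : ∀ Γ {Δ} (γ : Env (Γ ++ Δ)) → gr ⌈ Γ ++ Δ ⌉ γ ≡ gr ⌈ Γ ⌉ (left Γ γ) ++ gr ⌈ Δ ⌉ (right Γ γ)
  gr-++ [] γ = refl
  gr-++ (X ∷ Γ) (x , γ) = trans (cong (gr (τ X) x ++_) (gr-++ Γ γ)) (sym (++-assoc (gr (τ X) x) _ _))

  perm-E : ∀ {Γ Δ} (σ : Γ ↭ Δ) {γ γ'} → E ⌈ Δ ⌉ γ γ' → E ⌈ Γ ⌉ (perm σ γ) (perm σ γ')
  perm-E ↭-refl p = p
  perm-E (prep X σ) (p , q) = p , perm-E σ q
  perm-E (swap X Y σ) (p , (q , r)) = q , (p , perm-E σ r)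
  perm-E (↭-trans σ ρ) p = perm-E σ (perm-E ρ p)
  perm-GE : ∀ {Γ Δ} (σ : Γ ↭ Δ) {γ γ'} → GE ⌈ Δ ⌉ γ γ' → GE ⌈ Γ ⌉ (perm σ γ) (perm σ γ')
  perm-GE ↭-refl p = p
  perm-GE (prep X σ) (p , q) = p , perm-GE σ q
  perm-GE (swap X Y σ) (p , (q , r)) = q , (p , perm-GE σ r)
  perm-GE (↭-trans σ ρ) p = perm-GE σ (perm-GE ρ p)
  perm-Good : ∀ {Γ Δ} (σ : Γ ↭ Δ) {γ} → Good ⌈ Δ ⌉ γ → Good ⌈ Γ ⌉ (perm σ γ)
  perm-Good ↭-refl p = p
  perm-Good (prep X σ) (p , q) = p , perm-Good σ q
  perm-Good (swap X Y σ) (p , (q , r)) = q , (p , perm-Good σ r)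
  perm-Good (↭-trans σ ρ) p = perm-Good σ (perm-Good ρ p)
  perm-gr : ∀ {Γ Δ} (σ : Γ ↭ Δ) γ → gr ⌈ Γ ⌉ (perm σ γ) ↭ gr ⌈ Δ ⌉ γ
  perm-gr ↭-refl γ = ↭-refl
  perm-gr (prep X σ) (x , γ) = ++⁺ˡ (gr (τ X) x) (perm-gr σ γ)
  perm-gr {X ∷ Y ∷ Γ} {_ ∷ _ ∷ Δ} (swap X Y σ) (y , (x , γ)) =
    ↭-trans (++⁺ˡ (gr (τ X) x) (++⁺ˡ (gr (τ Y) y) (perm-gr σ γ)))
      (lem (gr (τ X) x) (gr (τ Y) y) (gr ⌈ Δ ⌉ γ))
    where
    lem : ∀ a b c → a ++ (b ++ c) ↭ b ++ (a ++ c)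
    lem = solve 3 (λ a b c → a :+ (b :+ c) ⊜ b :+ (a :+ c)) ↭-refl
  perm-gr (↭-trans σ ρ) γ = ↭-trans (perm-gr σ (perm ρ γ)) (perm-gr ρ γ)

  perm-Lin : ∀ {Γ Δ} (σ : Γ ↭ Δ) {f w} → Lin ⌈ Γ ⌉ f w → Lin ⌈ Δ ⌉ (λ γ → f (perm σ γ)) w
  perm-Lin ↭-refl l = l
  perm-Lin (prep X σ) {w = w} (l , r) =
    (λ y gy → Lin-↭ (τ X) (++⁺ˡ w (perm-gr σ y)) (l (perm σ y) (perm-Good σ gy))) ,
    (λ x gx → perm-Lin σ (r x gx))
  perm-Lin {X ∷ Y ∷ Γ} {_ ∷ _ ∷ Δ} (swap X Y σ) {w = w} (l , r) =
    (λ (x , γ) (gx , gγ) → Lin-↭ (τ Y) (lem₁ x γ) (proj₁ (r x gx) _ (perm-Good σ gγ))) ,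
    (λ y gy → (λ γ gγ → Lin-↭ (τ X) (lem₂ y γ) (l (y , perm σ γ) (gy , perm-Good σ gγ))) ,
      λ x gx → Lin-↭ ⌈ Δ ⌉ (lem₃ w (gr (τ X) x) (gr (τ Y) y)) (perm-Lin σ (proj₂ (r x gx) y gy)))
    where
    lem₃ : ∀ a b c → (a ++ b) ++ c ↭ (a ++ c) ++ b
    lem₃ = solve 3 (λ a b c → (a :+ b) :+ c ⊜ (a :+ c) :+ b) ↭-refl
    lem₁ : ∀ x γ → (w ++ gr (τ X) x) ++ gr ⌈ Γ ⌉ (perm σ γ) ↭ w ++ (gr (τ X) x ++ gr ⌈ Δ ⌉ γ)
    lem₁ x γ = ↭-trans (↭-reflexive (++-assoc w _ _)) (++⁺ˡ w (++⁺ˡ (gr (τ X) x) (perm-gr σ γ)))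
    lem₂ : ∀ y γ → w ++ (gr (τ Y) y ++ gr ⌈ Γ ⌉ (perm σ γ)) ↭ (w ++ gr (τ Y) y) ++ gr ⌈ Δ ⌉ γ
    lem₂ y γ = ↭-trans (++⁺ˡ w (++⁺ˡ (gr (τ Y) y) (perm-gr σ γ))) (↭-reflexive (sym (++-assoc w _ _)))
  perm-Lin (↭-trans σ ρ) l = perm-Lin ρ (perm-Lin σ l)

  split-Lin : ∀ Γ {Δ w} {f : Env Γ → Env Δ → Tm} →
    (∀ δ → Good ⌈ Δ ⌉ δ → Lin ⌈ Γ ⌉ (λ γ → f γ δ) (w ++ gr ⌈ Δ ⌉ δ)) →
    (∀ γ → Good ⌈ Γ ⌉ γ → Lin ⌈ Δ ⌉ (λ δ → f γ δ) (w ++ gr ⌈ Γ ⌉ γ)) →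
    Lin ⌈ Γ ++ Δ ⌉ (λ γ → f (left Γ γ) (right Γ γ)) w
  split-Lin [] {Δ} {w} l r = Lin-↭ ⌈ Δ ⌉ (↭-reflexive (++-identityʳ w)) (r tt tt)
  split-Lin (X ∷ Γ) {Δ} {w} l r =
    (λ γ gγ → Lin-↭ (τ X) (lem γ)
      (proj₁ (l (right Γ γ) (right-Good Γ gγ)) (left Γ γ) (left-Good Γ gγ))) ,
    (λ x gx → split-Lin Γ
      (λ δ gδ → Lin-↭ ⌈ Γ ⌉ (lem₂ w (gr ⌈ Δ ⌉ δ) (gr (τ X) x)) (proj₂ (l δ gδ) x gx))
      (λ γ gγ → Lin-↭ ⌈ Δ ⌉ (↭-reflexive (sym (++-assoc w _ _))) (r (x , γ) (gx , gγ))))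
    where
    lem₂ : ∀ a b c → (a ++ b) ++ c ↭ (a ++ c) ++ b
    lem₂ = solve 3 (λ a b c → (a :+ b) :+ c ⊜ (a :+ c) :+ b) ↭-refl
    lem₁ : ∀ a b c → (a ++ b) ++ c ↭ a ++ (c ++ b)
    lem₁ = solve 3 (λ a b c → (a :+ b) :+ c ⊜ a :+ (c :+ b)) ↭-refl
    lem : ∀ γ → (w ++ gr ⌈ Δ ⌉ (right Γ γ)) ++ gr ⌈ Γ ⌉ (left Γ γ) ↭ w ++ gr ⌈ Γ ++ Δ ⌉ γ
    lem γ = ↭-trans (lem₁ w (gr ⌈ Δ ⌉ (right Γ γ)) _) (↭-reflexive (cong (w ++_) (sym (gr-++ Γ γ))))

  axiom-Fn : ∀ {a' a} (e : a' ≡ dual a) →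
             Fn (neg (par a' (neg (par a (neg bot))))) (λ (x , (y , _)) → pair a y (cast e x)) []
  axiom-Fn {a = a} refl = fn
    (λ (p , (q , _)) → pair-E a q p) (λ (p , (q , _)) → pair-GE a q p)
    ((λ (y , _) (gy , _) → Lin-↭ (dual a) (↭-reflexive (sym (++-identityʳ _))) (pair-Linʳ a gy)) ,
     (λ x gx → (λ _ _ → Lin-↭ a (↭-reflexive (sym (++-identityʳ _))) (pair-Linˡ a gx)) , λ _ _ → tt))

  parr-Fn : ∀ {z a b c f} (e : z ≡ neg (par a b)) → Fn (neg (par a (neg (par b c)))) f [] →
            Fn (neg (par z c)) (λ (z , γ) → let (x , y) = cast e z in f (x , (y , γ))) []
  parr-Fn {a = a} {b} {c} refl (fn e g (l , r)) = fn
    (λ ((p , q) , s) → e (p , (q , s))) (λ ((p , q) , s) → g (p , (q , s)))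
    ((λ γ gγ → (λ y gy → Lin-↭ a (↭-++-comm (gr b y) (gr c γ)) (l (y , γ) (gy , gγ))) ,
       λ x gx → Lin-↭ b (↭-++-comm (gr a x) (gr c γ)) (proj₁ (r x gx) γ gγ)) ,
     λ (x , y) (gx , gy) → Lin-↭ c ↭-refl (proj₂ (r x gx) y gy))

  witr-Fn : ∀ {z a b c f f'} (e : z ≡ neg (wit a b)) → Fn (neg (par a c)) f [] → Fn (neg (par b c)) f' [] →
            Fn (neg (par z c)) (λ (z , γ) → either (λ x → f (x , γ)) (λ y → f' (y , γ)) (cast e z)) []
  witr-Fn {a = a} {b} {c} {f} {f'} refl (fn e g (l , r)) (fn e' g' (l' , r')) = fn (λ {x} {y} → ee {x} {y}) (λ {x} {y} → gg {x} {y})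
    ((λ γ gγ → l γ gγ , l' γ gγ) , λ { (inj₁ x) gx → r x gx ; (inj₂ x) gx → r' x gx })
    where
    h : Val (neg (par (neg (wit a b)) c)) → Tm
    h (z , γ) = either (λ x → f (x , γ)) (λ y → f' (y , γ)) z
    ee : ∀ {x y} → E (neg (par (neg (wit a b)) c)) x y → h x ~ h y
    ee {inj₁ x , _} {inj₁ y , _} p = e p
    ee {inj₂ x , _} {inj₂ y , _} p = e' p
    gg : ∀ {x y} → GE (neg (par (neg (wit a b)) c)) x y → h x ~ h y
    gg {inj₁ x , _} {inj₁ y , _} p = g p
    gg {inj₂ x , _} {inj₂ y , _} p = g' p

  botr-Fn : ∀ {z c f} (e : z ≡ neg bot) → Fn c f [] → Fn (neg (par z c)) (λ (z , γ) → f γ) []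
  botr-Fn refl (fn e g l) = fn (λ (_ , p) → e p) (λ (_ , p) → g p) ((λ _ _ → tt) , λ _ _ → l)

  topr-Fn : ∀ {z c} (e : z ≡ neg top) → Fn (neg (par z c)) (λ (z , γ) → ⊥-elim (cast e z)) []
  topr-Fn refl = fn (λ (p , _) → ⊥-elim p) (λ (p , _) → ⊥-elim p) ((λ _ _ → tt) , λ x _ → ⊥-elim x)

  -- Common to `tens`, `injl`, `injr` and `oner`: each applies the continuation `z` to a value
  -- assembled by `i` from the rest of the environment.
  app-Fn : ∀ {z N c} (e : z ≡ pst N) (i : Val c → ValN N) →
           (∀ {x y} → E c x y → EN N (i x) (i y)) → (∀ {x y} → GE c x y → GEN N (i x) (i y)) →
           (∀ x → gr (neg N) (i x) ↭ gr c x) →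
           (∀ {h w} → GoodP N w h → Lin c (λ x → h (i x)) w) →
           Fn (neg (par z c)) (λ (z , x) → proj₂ (cast e z) (i x)) []
  app-Fn {N = N} {c} refl i iE iG ig iL = fn
    (λ ((_ , p) , q) → p _ _ (iE q)) (λ ((_ , p , _) , q) → p (iG q))
    ((λ x gx → Lin-↭ (pst N) (ig x) (leaf-Lin N (GE-left (neg N) (iG (Good-GE c gx))))) ,
     λ k gk → iL gk)

  cast-Fn : ∀ {a b f w} (e : a ≡ b) → Fn a f w → Fn b (λ x → f (cast (sym e) x)) w
  cast-Fn refl p = p

  -- The mirror image of `br-Lin`; polarities are split because `dual (dual a)` reduces only then.
  br-Linʳ : ∀ a c (p : Val (dual a) → Val c → Tm) (σ : Val c → M) {wp} {r : Fun a} →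
    (∀ y → σ y ↭ wp ++ gr c y) →
    (∀ {x x' y y'} → E (dual a) x x' → E c y y' → p x y ~ p x' y') →
    (∀ x → Good (dual a) x → Lin c (p x) (wp ++ gr (dual a) x)) →
    Fn a (proj₂ r) (proj₁ r) →
    Lin c (λ y → br a r (σ y , λ x → p x y)) (wp ++ proj₁ r)
  br-Linʳ (neg N) c = br-Lin (pst N) c
  br-Linʳ (pst N) c = br-Lin (neg N) c

  curry-Fn : ∀ {a c f γ} → Fn (neg (par a c)) f [] → Good c γ → Fn a (λ x → f (x , γ)) (gr c γ)
  curry-Fn {a} {c} (fn e g (l , r)) gγ = fn
    (λ p → e (p , Good-E c gγ)) (λ p → g (p , Good-GE c gγ)) (l _ gγ)

  cutr-Fn : ∀ a {b Γ Δ} (e : b ≡ dual a) {f f'} →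
            Fn (neg (par a ⌈ Γ ⌉)) f [] → Fn (neg (par b ⌈ Δ ⌉)) f' [] →
            Fn ⌈ Γ ++ Δ ⌉ (λ γ → br a (gr ⌈ Γ ⌉ (left Γ γ) , λ x → f (x , left Γ γ))
              (gr ⌈ Δ ⌉ (right Γ γ) , λ y → f' (cast (sym e) y , right Γ γ))) []
  cutr-Fn a {Γ = Γ} {Δ} refl F F' = fn
    (λ p → br-E a (E-gr ⌈ Γ ⌉ (left-E Γ p) , λ _ _ q → fE F (q , left-E Γ p))
      (E-gr ⌈ Δ ⌉ (right-E Γ p) , λ _ _ q → fE F' (q , right-E Γ p)))
    (λ p → let pˡ = left-GE Γ p ; pʳ = right-GE Γ p in br-GE a
      (GE-gr ⌈ Γ ⌉ pˡ , (λ q → fG F (q , pˡ)) ,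
        curry-Fn F (GE-left ⌈ Γ ⌉ pˡ) , curry-Fn F (GE-right ⌈ Γ ⌉ pˡ))
      (GE-gr ⌈ Δ ⌉ pʳ , (λ q → fG F' (q , pʳ)) ,
        curry-Fn F' (GE-left ⌈ Δ ⌉ pʳ) , curry-Fn F' (GE-right ⌈ Δ ⌉ pʳ)))
    (split-Lin Γ
      (λ δ gδ → br-Lin a ⌈ Γ ⌉ _ (gr ⌈ Γ ⌉) (λ _ → ↭-refl) (λ p q → fE F (p , q))
        (λ x gx → proj₂ (fL F) x gx) (curry-Fn F' gδ))
      (λ γ gγ → br-Linʳ a ⌈ Δ ⌉ _ (gr ⌈ Δ ⌉) (λ _ → ↭-refl) (λ p q → fE F' (p , q))
        (λ x gx → proj₂ (fL F') x gx) (curry-Fn F gγ)))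

  -- The fundamental lemma of `Good`. The resource list is empty because all resources of an
  -- interpreted proof come from its environment.
  ⟦⟧-Fn : ∀ {Γ} (π : ⊩ Γ) → Fn ⌈ Γ ⌉ ⟦ π ⟧ []
  ⟦⟧-Fn (axiom e) = axiom-Fn e
  ⟦⟧-Fn (exch σ π) = let F = ⟦⟧-Fn π in fn
    (λ p → fE F (perm-E σ p)) (λ p → fG F (perm-GE σ p)) (perm-Lin σ (fL F))
  ⟦⟧-Fn (cutr {X} {Y} {Γ} {Δ} e π ρ) = cutr-Fn (τ X) {Γ = Γ} {Δ} e (⟦⟧-Fn π) (⟦⟧-Fn ρ)
  ⟦⟧-Fn (parr e π) = parr-Fn e (⟦⟧-Fn π)
  ⟦⟧-Fn (witr e π ρ) = witr-Fn e (⟦⟧-Fn π) (⟦⟧-Fn ρ)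
  ⟦⟧-Fn (botr e π) = botr-Fn e (⟦⟧-Fn π)
  ⟦⟧-Fn (topr e) = topr-Fn e
  ⟦⟧-Fn (tens {X} {Y} e) = app-Fn e (λ (x , (y , _)) → x , y)
    (λ (p , (q , _)) → p , q) (λ (p , (q , _)) → p , q)
    (λ (x , (y , _)) → ++⁺ˡ (gr (τ X) x) (↭-reflexive (sym (++-identityʳ _))))
    (λ {_} {w} (_ , _ , (l , r)) →
      (λ (y , _) (gy , _) → Lin-↭ (τ X) (++⁺ˡ w (↭-reflexive (sym (++-identityʳ _)))) (l y gy)) ,
      (λ x gx → (λ _ _ → Lin-↭ (τ Y) (↭-reflexive (sym (++-identityʳ _))) (r x gx)) , λ _ _ → tt))
  ⟦⟧-Fn (injl {X} e) = app-Fn e (λ (x , _) → inj₁ x) proj₁ proj₁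
    (λ _ → ↭-reflexive (sym (++-identityʳ _)))
    (λ (_ , _ , (l , r)) → (λ _ _ → Lin-↭ (τ X) (↭-reflexive (sym (++-identityʳ _))) l) , λ _ _ → tt)
  ⟦⟧-Fn (injr {_} {Y} e) = app-Fn e (λ (x , _) → inj₂ x) proj₁ proj₁
    (λ _ → ↭-reflexive (sym (++-identityʳ _)))
    (λ (_ , _ , (l , r)) → (λ _ _ → Lin-↭ (τ Y) (↭-reflexive (sym (++-identityʳ _))) r) , λ _ _ → tt)
  ⟦⟧-Fn (oner e) = app-Fn e (λ _ → tt) (λ _ → tt) (λ _ → tt) (λ _ → ↭-refl) (λ _ → tt)

-- Environments under concatenation and exchange

module Plumbing (L : Set) (τ : L → Arg) where
  open Calculus L τ

  app : ∀ Γ Δ → Env Γ → Env Δ → Env (Γ ++ Δ)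
  app [] Δ _ δ = δ
  app (X ∷ Γ) Δ (x , γ) δ = x , app Γ Δ γ δ

  left-app : ∀ Γ Δ γ (δ : Env Δ) → left Γ {Δ} (app Γ Δ γ δ) ≡ γ
  left-app [] Δ γ δ = refl
  left-app (X ∷ Γ) Δ (x , γ) δ = cong (x ,_) (left-app Γ Δ γ δ)

  right-app : ∀ Γ Δ γ (δ : Env Δ) → right Γ {Δ} (app Γ Δ γ δ) ≡ δ
  right-app [] Δ γ δ = refl
  right-app (X ∷ Γ) Δ (x , γ) δ = right-app Γ Δ γ δ

  app-split : ∀ Γ Δ (γ : Env (Γ ++ Δ)) → app Γ Δ (left Γ γ) (right Γ γ) ≡ γ
  app-split [] Δ γ = refl
  app-split (X ∷ Γ) Δ (x , γ) = cong (x ,_) (app-split Γ Δ γ)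

  app-Good : ∀ Γ Δ {γ δ} → Good ⌈ Γ ⌉ γ → Good ⌈ Δ ⌉ δ → Good ⌈ Γ ++ Δ ⌉ (app Γ Δ γ δ)
  app-Good [] Δ p q = q
  app-Good (X ∷ Γ) Δ (g , p) q = g , app-Good Γ Δ p q

  app-E : ∀ Γ Δ {γ γ' δ δ'} → E ⌈ Γ ⌉ γ γ' → E ⌈ Δ ⌉ δ δ' → E ⌈ Γ ++ Δ ⌉ (app Γ Δ γ δ) (app Γ Δ γ' δ')
  app-E [] Δ p q = q
  app-E (X ∷ Γ) Δ (g , p) q = g , app-E Γ Δ p q

  app-gr : ∀ Γ Δ γ (δ : Env Δ) → gr ⌈ Γ ++ Δ ⌉ (app Γ Δ γ δ) ≡ gr ⌈ Γ ⌉ γ ++ gr ⌈ Δ ⌉ δ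
  app-gr [] Δ γ δ = refl
  app-gr (X ∷ Γ) Δ (x , γ) δ = trans (cong (gr (τ X) x ++_) (app-gr Γ Δ γ δ)) (sym (++-assoc (gr (τ X) x) _ _))

  -- `↭.↭-trans` is the library composition that drops `↭-refl`, unlike the constructor `↭-trans`;
  -- library permutations such as `↭-++-comm` are built with it.
  perm-trans : ∀ {Γ Δ Σ} (σ : Γ ↭ Δ) (ρ : Δ ↭ Σ) γ → perm (↭.↭-trans σ ρ) γ ≡ perm σ (perm ρ γ)
  perm-trans ↭-refl ρ γ = refl
  perm-trans (prep x σ) ↭-refl γ = refl
  perm-trans (swap x y σ) ↭-refl γ = refl
  perm-trans (↭-trans σ σ₁) ↭-refl γ = refl
  perm-trans (prep x σ) (prep x₁ ρ) γ = refl
  perm-trans (prep x σ) (swap x₁ y ρ) γ = refl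
  perm-trans (prep x σ) (↭-trans ρ ρ₁) γ = refl
  perm-trans (swap x y σ) (prep x₁ ρ) γ = refl
  perm-trans (swap x y σ) (swap x₁ y₁ ρ) γ = refl
  perm-trans (swap x y σ) (↭-trans ρ ρ₁) γ = refl
  perm-trans (↭-trans σ σ₁) (prep x ρ) γ = refl
  perm-trans (↭-trans σ σ₁) (swap x y ρ) γ = refl
  perm-trans (↭-trans σ σ₁) (↭-trans ρ ρ₁) γ = refl

  perm-sym : ∀ {Γ Δ} (σ : Γ ↭ Δ) γ → perm (↭-sym σ) (perm σ γ) ≡ γ
  perm-sym ↭-refl γ = refl
  perm-sym (prep x σ) (y , γ) = cong (y ,_) (perm-sym σ γ)
  perm-sym (swap x y σ) (z , (w , γ)) = cong (λ v → z , (w , v)) (perm-sym σ γ)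
  perm-sym (↭-trans σ ρ) γ = trans (cong (perm (↭-sym ρ)) (perm-sym σ _)) (perm-sym ρ γ)

  perm-shift : ∀ A Θ₁ Θ₂ θ₁ (θ₂ : Env Θ₂) a →
               perm (shift A Θ₁ Θ₂) (a , app Θ₁ Θ₂ θ₁ θ₂) ≡ app Θ₁ (A ∷ Θ₂) θ₁ (a , θ₂)
  perm-shift A [] Θ₂ θ₁ θ₂ a = refl
  perm-shift A (X ∷ Θ₁) Θ₂ (x , θ₁) θ₂ a = cong (x ,_) (perm-shift A Θ₁ Θ₂ θ₁ θ₂ a)

  perm-unshift : ∀ A Θ₁ Θ₂ θ₁ (θ₂ : Env Θ₂) a →
                 perm (↭-sym (shift A Θ₁ Θ₂)) (app Θ₁ (A ∷ Θ₂) θ₁ (a , θ₂)) ≡ (a , app Θ₁ Θ₂ θ₁ θ₂)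
  perm-unshift A Θ₁ Θ₂ θ₁ θ₂ a =
    trans (cong (perm (↭-sym (shift A Θ₁ Θ₂))) (sym (perm-shift A Θ₁ Θ₂ θ₁ θ₂ a))) (perm-sym (shift A Θ₁ Θ₂) _)

  perm-++ˡ : ∀ Γ {Δ Δ'} (σ : Δ ↭ Δ') γ δ → perm (++⁺ˡ Γ σ) (app Γ Δ' γ δ) ≡ app Γ Δ γ (perm σ δ)
  perm-++ˡ [] σ γ δ = refl
  perm-++ˡ (X ∷ Γ) σ (x , γ) δ = cong (x ,_) (perm-++ˡ Γ σ γ δ)

  perm-++ʳ : ∀ {Γ Γ'} Δ (σ : Γ ↭ Γ') γ δ → perm (++⁺ʳ Δ σ) (app Γ' Δ γ δ) ≡ app Γ Δ (perm σ γ) δ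
  perm-++ʳ Δ ↭-refl γ δ = refl
  perm-++ʳ Δ (prep X σ) (x , γ) δ = cong (x ,_) (perm-++ʳ Δ σ γ δ)
  perm-++ʳ Δ (swap X Y σ) (x , (y , γ)) δ = cong (λ v → y , (x , v)) (perm-++ʳ Δ σ γ δ)
  perm-++ʳ Δ (↭-trans σ ρ) γ δ = trans (cong (perm (++⁺ʳ Δ σ)) (perm-++ʳ Δ ρ γ δ)) (perm-++ʳ Δ σ _ δ)

  recast : ∀ {Γ Δ} → Γ ≡ Δ → Env Γ → Env Δ
  recast refl γ = γ

  perm-reflexive : ∀ {Γ Δ} (e : Γ ≡ Δ) γ → perm (↭-reflexive e) γ ≡ recast (sym e) γ
  perm-reflexive refl γ = refl

  recast-∷ : ∀ {X Γ Δ} (e : X ∷ Γ ≡ X ∷ Δ) (e' : Γ ≡ Δ) x γ → recast e (x , γ) ≡ (x , recast e' γ)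
  recast-∷ refl refl x γ = refl

  recast-refl : ∀ {Γ} (e : Γ ≡ Γ) γ → recast e γ ≡ γ
  recast-refl refl γ = refl

  recast-assoc : ∀ Γ Δ Σ (e : Γ ++ (Δ ++ Σ) ≡ (Γ ++ Δ) ++ Σ) γ δ (σ : Env Σ) →
                 recast e (app Γ (Δ ++ Σ) γ (app Δ Σ δ σ)) ≡ app (Γ ++ Δ) Σ (app Γ Δ γ δ) σ
  recast-assoc [] Δ Σ e γ δ σ = recast-refl e _
  recast-assoc (X ∷ Γ) Δ Σ e (x , γ) δ σ =
    trans (recast-∷ e (sym (++-assoc Γ Δ Σ)) x _) (cong (x ,_) (recast-assoc Γ Δ Σ _ γ δ σ))

  recast-sym : ∀ {Γ Δ} (e : Γ ≡ Δ) (e' : Δ ≡ Γ) γ δ → recast e γ ≡ δ → recast e' δ ≡ γ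
  recast-sym refl refl γ δ p = sym p

  perm-assoc : ∀ Γ Δ Σ γ δ (σ : Env Σ) →
    perm (↭-reflexive (++-assoc Γ Δ Σ)) (app Γ (Δ ++ Σ) γ (app Δ Σ δ σ)) ≡ app (Γ ++ Δ) Σ (app Γ Δ γ δ) σ
  perm-assoc Γ Δ Σ γ δ σ = trans (perm-reflexive (++-assoc Γ Δ Σ) _) (recast-assoc Γ Δ Σ _ γ δ σ)

  perm-assoc' : ∀ Γ Δ Σ γ δ (σ : Env Σ) →
    perm (↭-reflexive (sym (++-assoc Γ Δ Σ))) (app (Γ ++ Δ) Σ (app Γ Δ γ δ) σ) ≡ app Γ (Δ ++ Σ) γ (app Δ Σ δ σ)
  perm-assoc' Γ Δ Σ γ δ σ = trans (perm-reflexive (sym (++-assoc Γ Δ Σ)) _)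
    (recast-sym (sym (++-assoc Γ Δ Σ)) _ _ _ (recast-assoc Γ Δ Σ _ γ δ σ))

  recast-nil : ∀ Γ (e : Γ ≡ Γ ++ []) γ → recast e γ ≡ app Γ [] γ tt
  recast-nil [] e γ = recast-refl e _
  recast-nil (X ∷ Γ) e (x , γ) = trans (recast-∷ e (sym (++-identityʳ Γ)) x _) (cong (x ,_) (recast-nil Γ _ γ))

  perm-idʳ : ∀ Γ γ → perm (↭-reflexive (sym (++-identityʳ Γ))) (app Γ [] γ tt) ≡ γ
  perm-idʳ Γ γ = trans (perm-reflexive (sym (++-identityʳ Γ)) _)
    (recast-sym (sym (++-identityʳ Γ)) _ _ _ (recast-nil Γ _ γ))

  perm-comm : ∀ Γ Δ γ δ → perm (↭-++-comm Γ Δ) (app Δ Γ δ γ) ≡ app Γ Δ γ δ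
  perm-comm [] Δ γ δ = trans
    (cong (perm (↭-sym (↭-reflexive (++-identityʳ Δ))))
      (sym (trans (perm-reflexive (++-identityʳ Δ) δ) (recast-nil Δ (sym (++-identityʳ Δ)) δ))))
    (perm-sym (↭-reflexive (++-identityʳ Δ)) δ)
  perm-comm (X ∷ Γ) Δ (x , γ) δ = trans (perm-trans (prep X (↭-++-comm Γ Δ)) σ _) (trans
    (cong (perm (prep X (↭-++-comm Γ Δ)))
      (trans (perm-trans (↭-sym (shift X Δ Γ)) ↭-refl _) (perm-unshift X Δ Γ δ γ x)))
    (cong (x ,_) (perm-comm Γ Δ γ δ)))
    where
    σ : X ∷ Δ ++ Γ ↭ Δ ++ X ∷ Γ
    σ = ↭.↭-trans (↭-sym (shift X Δ Γ)) ↭-refl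

  perm-∷ʳ : ∀ X Γ γ x → perm (∷↭∷ʳ X Γ) (app Γ (X ∷ []) γ (x , tt)) ≡ (x , γ)
  perm-∷ʳ X Γ γ x = trans (go (++-identityʳ (X ∷ Γ)) (app Γ (X ∷ []) γ (x , tt))) (trans
    (cong (recast (++-identityʳ (X ∷ Γ))) (perm-unshift X Γ [] γ tt x))
    (recast-sym (sym (++-identityʳ (X ∷ Γ))) (++-identityʳ (X ∷ Γ)) _ _ (recast-nil (X ∷ Γ) _ (x , γ))))
    where
    open ↭.PermutationReasoning
    -- The type repeats the library derivation of `∷↭∷ʳ` with its equation generalised to `e`, which
    -- can then be matched against `refl`.
    go : ∀ {Δ} (e : X ∷ (Γ ++ []) ≡ Δ) z →
         perm (↭-sym (begin Γ ++ [ X ] ↭⟨ shift X Γ [] ⟩ X ∷ (Γ ++ []) ≡⟨ e ⟩ Δ ∎)) z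
         ≡ recast e (perm (↭-sym (shift X Γ [])) z)
    go refl z = cong (λ σ → perm (↭-sym σ) z) (lem (shift X Γ []))
      where
      lem : ∀ {Γ Δ : List L} (σ : Γ ↭ Δ) → ↭.↭-trans σ ↭-refl ≡ σ
      lem ↭-refl = refl
      lem (prep x σ) = refl
      lem (swap x y σ) = refl
      lem (↭-trans σ σ₁) = refl

-- Commutation of two cuts, and axioms as units of the cut

≡⇒~ : ∀ {t u} → t ≡ u → t ~ u
≡⇒~ refl = ~refl

br-≡ : ∀ a {S S' T T'} {f f' : Val a → Tm} {g g' : Val (dual a) → Tm} → S ↭ S' → T ↭ T' →
       (∀ x → f x ≡ f' x) → (∀ y → g y ≡ g' y) →
       (∀ {x x'} → E a x x' → f x ~ f x') → (∀ {y y'} → E (dual a) y y' → g y ~ g y') →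
       br a (S , f) (T , g) ~ br a (S' , f') (T' , g')
br-≡ a p q f≡ g≡ fe ge = br-E a
  (p , λ x x' e → ~trans (fe e) (≡⇒~ (f≡ x'))) (q , λ y y' e → ~trans (ge e) (≡⇒~ (g≡ y')))

br-Fn : ∀ a {c} {p : Val a × Val c → Tm} {σ : Val c → M} {wp} {r : Fun (dual a)} →
        Fn (neg (par a c)) p wp → (∀ y → σ y ↭ wp ++ gr c y) → Fn (dual a) (proj₂ r) (proj₁ r) →
        Fn c (λ y → br a (σ y , λ x → p (x , y)) r) (wp ++ proj₁ r)
br-Fn a {c} {p} {σ} F s R = fn
  (λ q → br-E a (↭-trans (s _) (↭-trans (++⁺ˡ _ (E-gr c q)) (↭-sym (s _))) , λ _ _ p → fE F (p , q))
    (↭-refl , λ _ _ → fE R))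
  (λ {x} {x'} q → br-GE a
    (↭-trans (s _) (↭-trans (++⁺ˡ _ (GE-gr c q)) (↭-sym (s _))) , (λ p → fG F (p , q)) ,
      sec (GE-left c q) , sec (GE-right c q))
    (GE-Fn (dual a) R))
  (br-Lin a c (λ x y → p (x , y)) σ s (λ q q' → fE F (q , q')) (λ x gx → proj₂ (fL F) x gx) R)
  where
  sec : ∀ {y} → Good c y → Fn a (λ x → p (x , y)) (σ y)
  sec {y} g = fn (λ q → fE F (q , Good-E c g)) (λ q → fG F (q , Good-GE c g))
    (Lin-↭ a (↭-sym (s y)) (proj₁ (fL F) y g))

Resp₂ : ∀ a b → (Val a → Val b → Tm) → Set
Resp₂ a b t = ∀ {x x' y y'} → E a x x' → E b y y' → t x y ~ t x' y'

-- A cut on a positive type is a substitution, so as soon as one of the types is positive only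
-- annotations need adjusting. If both are negative, the functionals `r` and `k` must commute: `r`
-- is central by `Fn-central` and `k` is linear.
fubini : ∀ a b (t : Val a → Val b → Tm) {S₁ : M} {S₂ : Val a → M} {S₃ : M} {S₄ : Val b → M} {w : M} {r : Fun (dual a)} {k : Fun (dual b)} →
  Resp₂ a b t → Fn (dual a) (proj₂ r) (proj₁ r) → Fn (dual b) (proj₂ k) (proj₁ k) →
  S₁ ↭ w ++ proj₁ k → (∀ x → S₂ x ↭ w ++ gr a x) → S₃ ↭ w ++ proj₁ r → (∀ y → S₄ y ↭ w ++ gr b y) →
  br a (S₁ , λ x → br b (S₂ x , λ y → t x y) k) r ~ br b (S₃ , λ y → br a (S₄ y , λ x → t x y) r) k
fubini (pst N) (pst N') t te R K p₁ p₂ p₃ p₄ = ~refl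
fubini (pst N) (neg N') t te R K p₁ p₂ p₃ p₄ =
  fE K (↭-trans (p₂ _) (↭-sym p₃) , λ _ _ q → te (Good-E (pst N) (good⁺ R)) q)
fubini (neg N) (pst N') t te R K p₁ p₂ p₃ p₄ =
  fE R (↭-trans p₁ (↭-sym (p₄ _)) , λ _ _ q → te q (Good-E (pst N') (good⁺ K)))
fubini (neg N) (neg N') t {S₁} {S₂} {S₃} {S₄} {w} {wr , r} {wk , k} te R K p₁ p₂ p₃ p₄ = ~sym
  (fL K (Fn-central R) w (λ x → S₂ x , λ y → t x y) (S₃ , λ y → r (S₄ y , λ x → t x y))
    (↭-refl , λ _ _ q → fE R (rel₄ q , λ _ _ q' → te q' q))
    (λ q → rel₂ q , λ _ _ q' → te q q')
    (↭-trans p₃ (↭-++-comm w wr)) p₂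
    (λ y gy → fE R (p₄ y , λ _ _ q → te q (Good-E (neg N') gy)))
    S₁ p₁)
  where
  rel₄ : ∀ {y y'} → EN N' y y' → S₄ y ↭ S₄ y'
  rel₄ q = ↭-trans (p₄ _) (↭-trans (++⁺ˡ w (E-gr (neg N') q)) (↭-sym (p₄ _)))
  rel₂ : ∀ {x x'} → EN N x x' → S₂ x ↭ S₂ x'
  rel₂ q = ↭-trans (p₂ _) (↭-trans (++⁺ˡ w (E-gr (neg N) q)) (↭-sym (p₂ _)))

fubiniʳ : ∀ a b (t : Val a → Val (dual b) → Tm) {S₁ : M} {S₂ : Val a → M} {S₃ : M} {S₄ : Val (dual b) → M} {w : M} {r : Fun (dual a)} {k : Fun b} →
  Resp₂ a (dual b) t → Fn (dual a) (proj₂ r) (proj₁ r) → Fn b (proj₂ k) (proj₁ k) →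
  S₁ ↭ w ++ proj₁ k → (∀ x → S₂ x ↭ w ++ gr a x) → S₃ ↭ w ++ proj₁ r → (∀ y → S₄ y ↭ w ++ gr (dual b) y) →
  br a (S₁ , λ x → br b k (S₂ x , λ y → t x y)) r ~ br b k (S₃ , λ y → br a (S₄ y , λ x → t x y) r)
fubiniʳ a (neg N) t {S₁} {S₂} {S₃} {S₄} {w} {r} {k} = fubini a (pst N) t {S₁} {S₂} {S₃} {S₄} {w} {r} {k}
fubiniʳ a (pst N) t {S₁} {S₂} {S₃} {S₄} {w} {r} {k} = fubini a (neg N) t {S₁} {S₂} {S₃} {S₄} {w} {r} {k}

fubiniˡ : ∀ a b (t : Val (dual a) → Val b → Tm) {S₁ : M} {S₂ : Val (dual a) → M} {S₃ : M} {S₄ : Val b → M} {w : M} {r : Fun a} {k : Fun (dual b)} →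
  Resp₂ (dual a) b t → Fn a (proj₂ r) (proj₁ r) → Fn (dual b) (proj₂ k) (proj₁ k) →
  S₁ ↭ w ++ proj₁ k → (∀ x → S₂ x ↭ w ++ gr (dual a) x) → S₃ ↭ w ++ proj₁ r → (∀ y → S₄ y ↭ w ++ gr b y) →
  br a r (S₁ , λ x → br b (S₂ x , λ y → t x y) k) ~ br b (S₃ , λ y → br a r (S₄ y , λ x → t x y)) k
fubiniˡ (neg N) b t {S₁} {S₂} {S₃} {S₄} {w} {r} {k} = fubini (pst N) b t {S₁} {S₂} {S₃} {S₄} {w} {r} {k}
fubiniˡ (pst N) b t {S₁} {S₂} {S₃} {S₄} {w} {r} {k} = fubini (neg N) b t {S₁} {S₂} {S₃} {S₄} {w} {r} {k}

fubiniˡʳ : ∀ a b (t : Val (dual a) → Val (dual b) → Tm) {S₁ : M} {S₂ : Val (dual a) → M} {S₃ : M} {S₄ : Val (dual b) → M} {w : M} {r : Fun a} {k : Fun b} →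
  Resp₂ (dual a) (dual b) t → Fn a (proj₂ r) (proj₁ r) → Fn b (proj₂ k) (proj₁ k) →
  S₁ ↭ w ++ proj₁ k → (∀ x → S₂ x ↭ w ++ gr (dual a) x) → S₃ ↭ w ++ proj₁ r →
  (∀ y → S₄ y ↭ w ++ gr (dual b) y) →
  br a r (S₁ , λ x → br b k (S₂ x , λ y → t x y)) ~ br b k (S₃ , λ y → br a r (S₄ y , λ x → t x y))
fubiniˡʳ (neg N) b t {S₁} {S₂} {S₃} {S₄} {w} {r} {k} = fubiniʳ (pst N) b t {S₁} {S₂} {S₃} {S₄} {w} {r} {k}
fubiniˡʳ (pst N) b t {S₁} {S₂} {S₃} {S₄} {w} {r} {k} = fubiniʳ (neg N) b t {S₁} {S₂} {S₃} {S₄} {w} {r} {k}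

br-pt : ∀ a {S S' T T'} {f f' : Val a → Tm} {g g' : Val (dual a) → Tm} → S ↭ S' → T ↭ T' →
        (∀ x → E a x x → f x ~ f' x) → (∀ {x x'} → E a x x' → f' x ~ f' x') →
        (∀ y → E (dual a) y y → g y ~ g' y) → (∀ {y y'} → E (dual a) y y' → g' y ~ g' y') →
        br a (S , f) (T , g) ~ br a (S' , f') (T' , g')
br-pt a p q f fe g ge = br-E a
  (p , λ x x' e → ~trans (f x (E-left a e)) (fe e)) (q , λ y y' e → ~trans (g y (E-left (dual a) e)) (ge e))

gr-cast : ∀ {a b} (e : a ≡ b) x → gr b (cast e x) ≡ gr a x
gr-cast refl x = refl

cast-trans : ∀ {a b c} (e : a ≡ b) (e' : b ≡ c) (e'' : a ≡ c) x → cast e' (cast e x) ≡ cast e'' x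
cast-trans refl refl refl x = refl

br-Fnʳ : ∀ a {c} {p : Val (dual a) × Val c → Tm} {σ : Val c → M} {wp} {r : Fun a} →
        Fn (neg (par (dual a) c)) p wp → (∀ y → σ y ↭ wp ++ gr c y) → Fn a (proj₂ r) (proj₁ r) →
        Fn c (λ y → br a r (σ y , λ x → p (x , y))) (wp ++ proj₁ r)
br-Fnʳ (neg N) {p = p} {σ} {wp} {r} = br-Fn (pst N) {p = p} {σ} {wp} {r}
br-Fnʳ (pst N) {p = p} {σ} {wp} {r} = br-Fn (neg N) {p = p} {σ} {wp} {r}

-- Agreement on good values is enough because linear functionals also respect `GE`, whose related
-- values are good.
br-good : ∀ a {S S' T T'} {f f' : Val a → Tm} {g g' : Val (dual a) → Tm} → S ↭ S' → T ↭ T' →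
          (∀ x → Good a x → f x ~ f' x) → Fn a f S → Fn a f' S' →
          (∀ y → Good (dual a) y → g y ~ g' y) → Fn (dual a) g T → Fn (dual a) g' T' →
          br a (S , f) (T , g) ~ br a (S' , f') (T' , g')
br-good a p q h F F' k G G' = br-GE a
  (p , (λ e → ~trans (h _ (GE-left a e)) (fG F' e)) , F , F')
  (q , (λ e → ~trans (k _ (GE-left (dual a) e)) (fG G' e)) , G , G')

identityˡ : ∀ a {S T} (x : Val a) {f : Val a → Tm} → T ↭ gr a x → E a x x →
            (∀ {x x'} → E a x x' → f x ~ f x') → br a (S , f) (T , λ y → pair a x y) ~ f x
identityˡ (neg N) x p e fe = ~refl
identityˡ (pst N) x p (_ , e) fe = fe (p , e)

identityʳ : ∀ a {S T} (y : Val (dual a)) {g : Val (dual a) → Tm} → S ↭ gr (dual a) y → E (dual a) y y →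
            (∀ {y y'} → E (dual a) y y' → g y ~ g y') → br a (S , λ x → pair a x y) (T , g) ~ g y
identityʳ (neg N) y p (_ , e) ge = ge (p , e)
identityʳ (pst N) y p e ge = ~refl

identityᶜ : ∀ {a b} (e : b ≡ dual a) (e' : a ≡ dual b) {S T} (x : Val a) {g : Val (dual b) → Tm} →
            S ↭ gr a x → E a x x → (∀ {y y'} → E (dual b) y y' → g y ~ g y') →
            br b (S , λ y → pair a x (cast e y)) (T , g) ~ g (cast e' x)
identityᶜ {neg N} refl refl x p e ge = ~refl
identityᶜ {pst N} refl refl x p (_ , e) ge = ge (p , e)

pair-dual : ∀ {a b c} (e : b ≡ dual a) (e' : c ≡ dual b) (e'' : c ≡ a) x y →
            pair b (cast (sym e) y) (cast e' x) ≡ pair a (cast e'' x) y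
pair-dual {neg N} refl refl refl x y = refl
pair-dual {pst N} refl refl refl x y = refl

cast-E : ∀ {a b} (e : a ≡ b) {x y} → E a x y → E b (cast e x) (cast e y)
cast-E refl p = p

Good-cast : ∀ {a b} (e : a ≡ b) {x} → Good a x → Good b (cast e x)
Good-cast refl g = g

br-swap : ∀ {a b} (e : b ≡ dual a) (e' : a ≡ dual b) {S T} {f : Val b → Tm} {g : Val (dual b) → Tm} →
          br b (S , f) (T , g) ≡ br a (T , λ x → g (cast e' x)) (S , λ y → f (cast (sym e) y))
br-swap {neg N} refl refl = refl
br-swap {pst N} refl refl = refl

curry₂-Fn : ∀ {a b c f γ} → Fn (neg (par a (neg (par b c)))) f [] → Good c γ →
            Fn (neg (par a b)) (λ (x , y) → f (x , (y , γ))) (gr c γ)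
curry₂-Fn {a} {b} {c} {γ = γ} (fn e g (l , r)) gγ = fn
  (λ (p , q) → e (p , (q , Good-E c gγ))) (λ (p , q) → g (p , (q , Good-GE c gγ)))
  ((λ y gy → Lin-↭ a (↭-++-comm (gr b y) (gr c γ)) (l (y , γ) (gy , gγ))) ,
   (λ x gx → Lin-↭ b (↭-++-comm (gr a x) (gr c γ)) (proj₁ (r x gx) γ gγ)))

flip-Fn : ∀ {a b f w} → Fn (neg (par a b)) f w → Fn (neg (par b a)) (λ (y , x) → f (x , y)) w
flip-Fn (fn e g (l , r)) = fn (λ (p , q) → e (q , p)) (λ (p , q) → g (q , p)) (r , l)

-- Polarisation of formulas and soundness of the interpretation for =βη

⌜_⌝ : Fm → Arg
⌜ var x ⌝ = pst (nv x)
⌜ nvar x ⌝ = neg (nv x)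
⌜ A ⊗ B ⌝ = pst (par (dual ⌜ B ⌝) (dual ⌜ A ⌝))
⌜ A ⅋ B ⌝ = neg (par ⌜ A ⌝ ⌜ B ⌝)
⌜ A & B ⌝ = neg (wit ⌜ A ⌝ ⌜ B ⌝)
⌜ A ⊕ B ⌝ = pst (wit (dual ⌜ B ⌝) (dual ⌜ A ⌝))
⌜ 𝟏 ⌝ = pst bot
⌜ ⊥ₘ ⌝ = neg bot
⌜ ⊤ₘ ⌝ = neg top
⌜ 𝟎 ⌝ = pst top

⌜⁻⌝ : ∀ A → ⌜ A ⁻ ⌝ ≡ dual ⌜ A ⌝
dual-⌜⁻⌝ : ∀ A → dual ⌜ A ⁻ ⌝ ≡ ⌜ A ⌝
dual-⌜⁻⌝ A = trans (cong dual (⌜⁻⌝ A)) (dual-dual ⌜ A ⌝)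
⌜⁻⌝ (var x) = refl
⌜⁻⌝ (nvar x) = refl
⌜⁻⌝ (A ⊗ B) = cong₂ (λ p q → neg (par p q)) (⌜⁻⌝ B) (⌜⁻⌝ A)
⌜⁻⌝ (A ⅋ B) = cong₂ (λ p q → pst (par p q)) (dual-⌜⁻⌝ A) (dual-⌜⁻⌝ B)
⌜⁻⌝ (A & B) = cong₂ (λ p q → pst (wit p q)) (dual-⌜⁻⌝ A) (dual-⌜⁻⌝ B)
⌜⁻⌝ (A ⊕ B) = cong₂ (λ p q → neg (wit p q)) (⌜⁻⌝ B) (⌜⁻⌝ A)
⌜⁻⌝ 𝟏 = refl
⌜⁻⌝ ⊥ₘ = refl
⌜⁻⌝ ⊤ₘ = refl
⌜⁻⌝ 𝟎 = refl

module Soundness where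

  open Calculus Fm ⌜_⌝
  open Plumbing Fm ⌜_⌝

  e-⊗ : ∀ A B → ⌜ A ⊗ B ⌝ ≡ pst (par ⌜ B ⁻ ⌝ ⌜ A ⁻ ⌝)
  e-⊗ A B = cong₂ (λ p q → pst (par p q)) (sym (⌜⁻⌝ B)) (sym (⌜⁻⌝ A))
  e-⊕ : ∀ A B → ⌜ A ⊕ B ⌝ ≡ pst (wit ⌜ B ⁻ ⌝ ⌜ A ⁻ ⌝)
  e-⊕ A B = cong₂ (λ p q → pst (wit p q)) (sym (⌜⁻⌝ B)) (sym (⌜⁻⌝ A))

  unsnoc : ∀ (Z : Fm) Γ → Γ ++ Z ∷ [] ↭ Z ∷ Γ
  unsnoc Z Γ = ↭-sym (∷↭∷ʳ Z Γ)

  unsnoc₂ : ∀ (Z : Fm) Γ Δ → Γ ++ (Δ ++ Z ∷ []) ↭ Z ∷ Γ ++ Δ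
  unsnoc₂ Z Γ Δ = ↭-trans (↭-reflexive (sym (++-assoc Γ Δ (Z ∷ [])))) (unsnoc Z (Γ ++ Δ))

  -- The positive rules become cuts against `tens`, `injl` and `injr`. The two injections are
  -- interchanged because negation reverses arguments: the dual of `B` comes first in `⌜ A ⊕ B ⌝`.
  tr : ∀ {Γ} → ⊢ Γ → ⊩ Γ
  tr (ax A) = axiom (⌜⁻⌝ A)
  tr (ex σ π) = exch σ (tr π)
  tr (cut {A} π ρ) = cutr {A} {A ⁻} (⌜⁻⌝ A) (tr π) (tr ρ)
  tr (⊗r {A} {B} {Γ} {Δ} π ρ) = exch (unsnoc₂ (A ⊗ B) Γ Δ)
    (cutr {A} {A ⁻} (⌜⁻⌝ A) (tr π) (exch (shift (A ⁻) Δ (A ⊗ B ∷ []))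
      (cutr {B} {B ⁻} (⌜⁻⌝ B) (tr ρ)
        (exch (↭-trans (swap _ _ ↭-refl) (prep _ (swap _ _ ↭-refl))) (tens {B ⁻} {A ⁻} {A ⊗ B} (e-⊗ A B))))))
  tr (⅋r {A} {B} π) = parr {A} {B} {A ⅋ B} refl (tr π)
  tr 𝟏r = oner {𝟏} refl
  tr (⊥r π) = botr {⊥ₘ} refl (tr π)
  tr (&r {A} {B} π ρ) = witr {A} {B} {A & B} refl (tr π) (tr ρ)
  tr (⊕₁r {A} {B} {Γ} π) = exch (unsnoc (A ⊕ B) Γ) (cutr {A} {A ⁻} (⌜⁻⌝ A) (tr π)
    (exch (swap _ _ ↭-refl) (injr {B ⁻} {A ⁻} {A ⊕ B} (e-⊕ A B))))
  tr (⊕₂r {A} {B} {Γ} π) = exch (unsnoc (A ⊕ B) Γ) (cutr {B} {B ⁻} (⌜⁻⌝ B) (tr π)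
    (exch (swap _ _ ↭-refl) (injl {B ⁻} {A ⁻} {A ⊕ B} (e-⊕ A B))))
  tr (⊤r Γ) = topr {⊤ₘ} refl

  sem : ∀ {Γ} → ⊢ Γ → Env Γ → Tm
  sem π = ⟦ tr π ⟧

  sem-Fn : ∀ {Γ} (π : ⊢ Γ) → Fn ⌈ Γ ⌉ (sem π) []
  sem-Fn π = ⟦⟧-Fn (tr π)

  fun : ∀ {A Γ} → ⊢ A ∷ Γ → Env Γ → Fun ⌜ A ⌝
  fun {Γ = Γ} π γ = gr ⌈ Γ ⌉ γ , λ x → sem π (x , γ)

  co : ∀ {A Γ} → ⊢ A ⁻ ∷ Γ → Env Γ → Fun (dual ⌜ A ⌝)
  co {A} {Γ} π γ = gr ⌈ Γ ⌉ γ , λ x → sem π (cast (sym (⌜⁻⌝ A)) x , γ)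

  fun-Fn : ∀ {A Γ} (π : ⊢ A ∷ Γ) {γ} → Good ⌈ Γ ⌉ γ → Fn ⌜ A ⌝ (proj₂ (fun π γ)) (proj₁ (fun π γ))
  fun-Fn π g = curry-Fn (sem-Fn π) g

  co-Fn : ∀ {A Γ} (π : ⊢ A ⁻ ∷ Γ) {γ} → Good ⌈ Γ ⌉ γ → Fn (dual ⌜ A ⌝) (proj₂ (co {A} π γ)) (proj₁ (co {A} π γ))
  co-Fn {A} π g = cast-Fn (⌜⁻⌝ A) (curry-Fn (sem-Fn π) g)

  cutr-app : ∀ {X Y Γ Δ} (e : ⌜ Y ⌝ ≡ dual ⌜ X ⌝) (π : ⊩ X ∷ Γ) (ρ : ⊩ Y ∷ Δ) γ δ →
    ⟦ cutr {X} {Y} {Γ} {Δ} e π ρ ⟧ (app Γ Δ γ δ) ≡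
    br ⌜ X ⌝ (gr ⌈ Γ ⌉ γ , λ x → ⟦ π ⟧ (x , γ)) (gr ⌈ Δ ⌉ δ , λ y → ⟦ ρ ⟧ (cast (sym e) y , δ))
  cutr-app {X} {Γ = Γ} {Δ} e π ρ γ δ = cong₂
    (λ γ δ → br ⌜ X ⌝ (gr ⌈ Γ ⌉ γ , λ x → ⟦ π ⟧ (x , γ)) (gr ⌈ Δ ⌉ δ , λ y → ⟦ ρ ⟧ (cast (sym e) y , δ)))
    (left-app Γ Δ γ δ) (right-app Γ Δ γ δ)

  sem-cut : ∀ {A Γ Δ} (π : ⊢ A ∷ Γ) (ρ : ⊢ A ⁻ ∷ Δ) γ δ →
    sem (cut π ρ) (app Γ Δ γ δ) ≡ br ⌜ A ⌝ (fun π γ) (co {A} ρ δ)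
  sem-cut {A} π ρ = cutr-app (⌜⁻⌝ A) (tr π) (tr ρ)

  perm-unsnoc : ∀ Z Γ z γ → perm (unsnoc Z Γ) (z , γ) ≡ app Γ (Z ∷ []) γ (z , tt)
  perm-unsnoc Z Γ z γ = trans (cong (perm (unsnoc Z Γ)) (sym (perm-∷ʳ Z Γ γ z))) (perm-sym (∷↭∷ʳ Z Γ) _)

  perm-unsnoc₂ : ∀ Z Γ Δ z γ δ → perm (unsnoc₂ Z Γ Δ) (z , app Γ Δ γ δ)
                 ≡ app Γ (Δ ++ Z ∷ []) γ (app Δ (Z ∷ []) δ (z , tt))
  perm-unsnoc₂ Z Γ Δ z γ δ = trans (cong (perm (↭-reflexive (sym (++-assoc Γ Δ (Z ∷ [])))))
    (perm-unsnoc Z (Γ ++ Δ) z (app Γ Δ γ δ))) (perm-assoc' Γ Δ (Z ∷ []) γ δ (z , tt))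

  cast-par : ∀ {p p' q q'} (e : neg (par p q) ≡ neg (par p' q')) (e₁ : p ≡ p') (e₂ : q ≡ q') x y →
             cast e (x , y) ≡ (cast e₁ x , cast e₂ y)
  cast-par refl refl refl x y = refl

  cast-inj₁ : ∀ {p p' q q'} (e : neg (wit p q) ≡ neg (wit p' q')) (e₁ : p ≡ p') x →
              cast e (inj₁ x) ≡ inj₁ (cast e₁ x)
  cast-inj₁ refl refl x = refl

  cast-inj₂ : ∀ {p p' q q'} (e : neg (wit p q) ≡ neg (wit p' q')) (e₁ : q ≡ q') x →
              cast e (inj₂ x) ≡ inj₂ (cast e₁ x)
  cast-inj₂ refl refl x = refl

  cast-pst-par : ∀ {p p' q q'} (e : pst (par p q) ≡ pst (par p' q')) (e₁ : p' ≡ p) (e₂ : q' ≡ q) k x y →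
                 proj₂ (cast e k) (cast (sym e₁) x , cast (sym e₂) y) ≡ proj₂ k (x , y)
  cast-pst-par refl refl refl k x y = refl

  cast-pst-inj₁ : ∀ {p p' q q'} (e : pst (wit p q) ≡ pst (wit p' q')) (e₁ : p' ≡ p) k x →
                  proj₂ (cast e k) (inj₁ (cast (sym e₁) x)) ≡ proj₂ k (inj₁ x)
  cast-pst-inj₁ refl refl k x = refl

  cast-pst-inj₂ : ∀ {p p' q q'} (e : pst (wit p q) ≡ pst (wit p' q')) (e₁ : q' ≡ q) k x →
                  proj₂ (cast e k) (inj₂ (cast (sym e₁) x)) ≡ proj₂ k (inj₂ x)
  cast-pst-inj₂ refl refl k x = refl

  inj₂-fun : ∀ {p q} → Val (pst (wit p q)) → Fun q
  inj₂-fun (S , h) = S , λ x → h (inj₂ x)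
  inj₁-fun : ∀ {p q} → Val (pst (wit p q)) → Fun p
  inj₁-fun (S , h) = S , λ x → h (inj₁ x)

  inj₁-Fn : ∀ {p q} {k : Val (pst (wit p q))} → Good (pst (wit p q)) k →
            Fn p (proj₂ (inj₁-fun {p} {q} k)) (proj₁ k)
  inj₁-Fn (e , g , l) = fn e g (proj₁ l)
  inj₂-Fn : ∀ {p q} {k : Val (pst (wit p q))} → Good (pst (wit p q)) k →
            Fn q (proj₂ (inj₂-fun {p} {q} k)) (proj₁ k)
  inj₂-Fn (e , g , l) = fn e g (proj₂ l)

  sem-⊕₁ : ∀ {A B Γ} (π : ⊢ A ∷ Γ) {k γ} → Good ⌜ A ⊕ B ⌝ k → Good ⌈ Γ ⌉ γ →
           sem (⊕₁r {A} {B} π) (k , γ) ~ br ⌜ A ⌝ (fun π γ) (inj₂-fun {dual ⌜ B ⌝} {dual ⌜ A ⌝} k)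
  sem-⊕₁ {A} {B} {Γ} π {k} {γ} gk gγ = ~trans
    (≡⇒~ (trans (cong ⟦ κ ⟧ (perm-unsnoc (A ⊕ B) Γ k γ)) (cutr-app (⌜⁻⌝ A) (tr π) κ₀ γ (k , tt))))
    (br-≡ ⌜ A ⌝ ↭-refl (↭-reflexive (++-identityʳ _)) (λ _ → refl)
      (λ y → cast-pst-inj₂ (e-⊕ A B) (⌜⁻⌝ A) k y)
      (λ p → fE (fun-Fn π gγ) p)
      (λ p → ~trans (≡⇒~ (cast-pst-inj₂ (e-⊕ A B) (⌜⁻⌝ A) k _)) (~trans (fE (inj₂-Fn {dual ⌜ B ⌝} {dual ⌜ A ⌝} gk) p)
               (≡⇒~ (sym (cast-pst-inj₂ (e-⊕ A B) (⌜⁻⌝ A) k _))))))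
    where
    κ : ⊩ Γ ++ A ⊕ B ∷ []
    κ₀ : ⊩ A ⁻ ∷ A ⊕ B ∷ []
    κ₀ = exch (swap _ _ ↭-refl) (injr {B ⁻} {A ⁻} {A ⊕ B} (e-⊕ A B))
    κ = cutr {A} {A ⁻} (⌜⁻⌝ A) (tr π) κ₀

  sem-⊕₂ : ∀ {A B Γ} (π : ⊢ B ∷ Γ) {k γ} → Good ⌜ A ⊕ B ⌝ k → Good ⌈ Γ ⌉ γ →
           sem (⊕₂r {A} {B} π) (k , γ) ~ br ⌜ B ⌝ (fun π γ) (inj₁-fun {dual ⌜ B ⌝} {dual ⌜ A ⌝} k)
  sem-⊕₂ {A} {B} {Γ} π {k} {γ} gk gγ = ~trans
    (≡⇒~ (trans (cong ⟦ κ ⟧ (perm-unsnoc (A ⊕ B) Γ k γ)) (cutr-app (⌜⁻⌝ B) (tr π) κ₀ γ (k , tt))))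
    (br-≡ ⌜ B ⌝ ↭-refl (↭-reflexive (++-identityʳ _)) (λ _ → refl)
      (λ y → cast-pst-inj₁ {q' = ⌜ A ⁻ ⌝} (e-⊕ A B) (⌜⁻⌝ B) k y)
      (λ p → fE (fun-Fn π gγ) p)
      (λ p → ~trans (≡⇒~ (cast-pst-inj₁ {q' = ⌜ A ⁻ ⌝} (e-⊕ A B) (⌜⁻⌝ B) k _)) (~trans (fE (inj₁-Fn {dual ⌜ B ⌝} {dual ⌜ A ⌝} gk) p)
               (≡⇒~ (sym (cast-pst-inj₁ {q' = ⌜ A ⁻ ⌝} (e-⊕ A B) (⌜⁻⌝ B) k _))))))
    where
    κ : ⊩ Γ ++ A ⊕ B ∷ []
    κ₀ : ⊩ B ⁻ ∷ A ⊕ B ∷ []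
    κ₀ = exch (swap _ _ ↭-refl) (injl {B ⁻} {A ⁻} {A ⊕ B} (e-⊕ A B))
    κ = cutr {B} {B ⁻} (⌜⁻⌝ B) (tr π) κ₀

  -- The tensor of two functionals, tested by k.
  tens₂ : ∀ p q → Val (pst (par q p)) → Val p → Fun q
  tens₂ p q (S , h) x = S ++ gr p x , λ y → h (y , x)

  tens₁ : ∀ p b → Val (pst (par (dual b) p)) → Fun b → Fun p
  tens₁ p b k F = proj₁ k ++ proj₁ F , λ x → br b F (tens₂ p (dual b) k x)

  tens₂-Fn : ∀ {p q k x} → Good (pst (par q p)) k → Good p x → Fn q (proj₂ (tens₂ p q k x)) (proj₁ (tens₂ p q k x))
  tens₂-Fn {p} (e , g , (l , r)) gx = fn (λ q → e (q , Good-E p gx)) (λ q → g (q , Good-GE p gx)) (l _ gx)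

  tens₁-Fn : ∀ {p b k F} → Good (pst (par (dual b) p)) k → Fn b (proj₂ F) (proj₁ F) →
             Fn p (proj₂ (tens₁ p b k F)) (proj₁ (tens₁ p b k F))
  tens₁-Fn {p} {b} {k} {F} gk G = br-Fnʳ b {p} {proj₂ k} {λ x → proj₁ k ++ gr p x} {proj₁ k} {F}
    (good⁻ gk) (λ _ → ↭-refl) G

  sem-⊗ : ∀ {A B Γ Δ} (π : ⊢ A ∷ Γ) (ρ : ⊢ B ∷ Δ) {k γ δ} →
          Good ⌜ A ⊗ B ⌝ k → Good ⌈ Γ ⌉ γ → Good ⌈ Δ ⌉ δ →
          sem (⊗r π ρ) (k , app Γ Δ γ δ) ~ br ⌜ A ⌝ (fun π γ) (tens₁ (dual ⌜ A ⌝) ⌜ B ⌝ k (fun ρ δ))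
  sem-⊗ {A} {B} {Γ} {Δ} π ρ {k} {γ} {δ} gk gγ gδ = ~trans
    (≡⇒~ (trans (cong ⟦ κ ⟧ (perm-unsnoc₂ (A ⊗ B) Γ Δ k γ δ)) (cutr-app (⌜⁻⌝ A) (tr π) κ₁ γ _)))
    (br-pt ⌜ A ⌝ ↭-refl
      (↭-trans (↭-reflexive (app-gr Δ (A ⊗ B ∷ []) δ (k , tt)))
        (↭-trans (++⁺ˡ _ (↭-reflexive (++-identityʳ (proj₁ k)))) (↭-++-comm (gr ⌈ Δ ⌉ δ) (proj₁ k))))
      (λ _ _ → ~refl) (λ p → fE (fun-Fn π gγ) p)
      (λ x ex → ~trans (≡⇒~ (trans (cong ⟦ κ₂ ⟧ (perm-shift (A ⁻) Δ (A ⊗ B ∷ []) δ (k , tt) (cast (sym (⌜⁻⌝ A)) x)))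
                              (cutr-app (⌜⁻⌝ B) (tr ρ) κ₃ δ _)))
        (br-≡ ⌜ B ⌝ ↭-refl
          (↭-trans (++⁺ (↭-reflexive (gr-cast (sym (⌜⁻⌝ A)) x)) (↭-reflexive (++-identityʳ (proj₁ k))))
            (↭-++-comm (gr (dual ⌜ A ⌝) x) (proj₁ k)))
          (λ _ → refl) (λ y → lem x y) (λ p → fE (fun-Fn ρ gδ) p)
          (λ p → ~trans (≡⇒~ (lem x _)) (~trans (proj₁ gk (p , ex)) (≡⇒~ (sym (lem x _)))))))
      (fE (tens₁-Fn {dual ⌜ A ⌝} {⌜ B ⌝} {k} {fun ρ δ} gk (fun-Fn ρ gδ))))
    where
    κ₃ : ⊩ B ⁻ ∷ A ⁻ ∷ A ⊗ B ∷ []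
    κ₃ = exch (↭-trans (swap _ _ ↭-refl) (prep _ (swap _ _ ↭-refl))) (tens {B ⁻} {A ⁻} {A ⊗ B} (e-⊗ A B))
    κ₂ : ⊩ Δ ++ A ⁻ ∷ A ⊗ B ∷ []
    κ₂ = cutr {B} {B ⁻} (⌜⁻⌝ B) (tr ρ) κ₃
    κ₁ : ⊩ A ⁻ ∷ Δ ++ A ⊗ B ∷ []
    κ₁ = exch (shift (A ⁻) Δ (A ⊗ B ∷ [])) κ₂
    κ : ⊩ Γ ++ (Δ ++ A ⊗ B ∷ [])
    κ = cutr {A} {A ⁻} (⌜⁻⌝ A) (tr π) κ₁
    lem : ∀ x y → proj₂ (cast (e-⊗ A B) k) (cast (sym (⌜⁻⌝ B)) y , cast (sym (⌜⁻⌝ A)) x) ≡ proj₂ k (y , x)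
    lem x y = cast-pst-par (e-⊗ A B) (⌜⁻⌝ B) (⌜⁻⌝ A) k y x

  split : ∀ Γ Δ (z : Env (Γ ++ Δ)) → Good ⌈ Γ ++ Δ ⌉ z →
          Σ (Env Γ) λ γ → Σ (Env Δ) λ δ → z ≡ app Γ Δ γ δ × Good ⌈ Γ ⌉ γ × Good ⌈ Δ ⌉ δ
  split Γ Δ z g = left Γ z , right Γ z , sym (app-split Γ Δ z) , left-Good Γ g , right-Good Γ g

  infix 3 _≋_
  -- Restricted to good environments because the commutation cases use linearity of the
  -- continuations found in the environment.
  _≋_ : ∀ {Γ} → ⊩ Γ → ⊩ Γ → Set
  _≋_ {Γ} π π' = ∀ {γ} → Good ⌈ Γ ⌉ γ → ⟦ π ⟧ γ ~ ⟦ π' ⟧ γ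

  exch-≋ : ∀ {Γ Δ} (σ : Γ ↭ Δ) {π π' : ⊩ Γ} → π ≋ π' → exch σ π ≋ exch σ π'
  exch-≋ σ p g = p (perm-Good σ g)

  cutr-≋ : ∀ {X Y Γ Δ} (e : ⌜ Y ⌝ ≡ dual ⌜ X ⌝) {π π' : ⊩ X ∷ Γ} {ρ ρ' : ⊩ Y ∷ Δ} → π ≋ π' → ρ ≋ ρ' →
           cutr {X} {Y} {Γ} {Δ} e π ρ ≋ cutr {X} {Y} {Γ} {Δ} e π' ρ'
  cutr-≋ {X} {Y} {Γ} {Δ} e {π} {π'} {ρ} {ρ'} p q g = br-good ⌜ X ⌝ ↭-refl ↭-refl
    (λ x gx → p (gx , gˡ)) (curry-Fn (⟦⟧-Fn π) gˡ) (curry-Fn (⟦⟧-Fn π') gˡ)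
    (λ y gy → q (Good-cast (sym e) gy , gʳ))
    (cast-Fn e (curry-Fn (⟦⟧-Fn ρ) gʳ)) (cast-Fn e (curry-Fn (⟦⟧-Fn ρ') gʳ))
    where
    gˡ = left-Good Γ g
    gʳ = right-Good Γ g

  at : ∀ Γ → Env Γ → Fin (length Γ) → Σ Fm λ A → Val ⌜ A ⌝
  at (A ∷ Γ) (x , γ) zero = A , x
  at (A ∷ Γ) (x , γ) (suc i) = at Γ γ i

  at-perm : ∀ {Γ Δ} (σ : Γ ↭ Δ) γ i → at Γ (perm σ γ) i ≡ at Δ γ (pos σ i)
  at-perm ↭-refl γ i = refl
  at-perm (prep x σ) γ zero = refl
  at-perm (prep x σ) (y , γ) (suc i) = at-perm σ γ i
  at-perm (swap x y σ) γ zero = refl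
  at-perm (swap x y σ) γ (suc zero) = refl
  at-perm (swap x y σ) (z , (w , γ)) (suc (suc i)) = at-perm σ γ i
  at-perm (↭-trans σ ρ) γ i = trans (at-perm σ (perm ρ γ) i) (at-perm ρ γ (pos σ i))

  at-ext : ∀ Γ {γ γ'} → (∀ i → at Γ γ i ≡ at Γ γ' i) → γ ≡ γ'
  at-ext [] h = refl
  at-ext (A ∷ Γ) {x , γ} {y , γ'} h with h zero
  ... | refl = cong (x ,_) (at-ext Γ λ i → h (suc i))

  -- By `at-perm` every entry of `perm σ γ` is the entry of `γ` at the position given by `pos σ`, so
  -- `perm` depends on nothing else. This is the soundness of `ex-ext`.
  perm-ext : ∀ {Γ Δ} (σ ρ : Γ ↭ Δ) → (∀ i → pos σ i ≡ pos ρ i) → ∀ γ → perm σ γ ≡ perm ρ γ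
  perm-ext {Γ} {Δ} σ ρ h γ = at-ext Γ λ i →
    trans (at-perm σ γ i) (trans (cong (at Δ γ) (h i)) (sym (at-perm ρ γ i)))

  sem-subst : ∀ {X Y Γ} (p : X ≡ Y) (π : ⊢ X ∷ Γ) (e : ⌜ Y ⌝ ≡ ⌜ X ⌝) y γ →
              sem (subst (λ Z → ⊢ (Z ∷ Γ)) p π) (y , γ) ≡ sem π (cast e y , γ)
  sem-subst refl π refl y γ = refl

  ⌜⁻⁻⌝ : ∀ A → ⌜ A ⁻ ⁻ ⌝ ≡ ⌜ A ⌝
  ⌜⁻⁻⌝ A = cong ⌜_⌝ (⁻⁻ A)

  s-β-axˡ : ∀ {A Δ} (π : ⊢ A ⁻ ⁻ ∷ Δ) →
            tr (cut (ax A) π) ≋ tr (subst (λ X → ⊢ (X ∷ Δ)) (⁻⁻ A) π)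
  s-β-axˡ {A} {Δ} π {a , δ} (ga , gδ) = ~trans
    (identityᶜ (⌜⁻⌝ A) e' a (↭-reflexive (++-identityʳ _)) (Good-E ⌜ A ⌝ ga) (fE (co-Fn {A ⁻} π gδ)))
    (≡⇒~ (trans (cong (λ x → sem π (x , δ)) (cast-trans e' (sym (⌜⁻⌝ (A ⁻))) (sym (⌜⁻⁻⌝ A)) a))
      (sym (sem-subst (⁻⁻ A) π (sym (⌜⁻⁻⌝ A)) a δ))))
    where
    e' : ⌜ A ⌝ ≡ dual ⌜ A ⁻ ⌝
    e' = trans (sym (⌜⁻⁻⌝ A)) (⌜⁻⌝ (A ⁻))

  s-β-axˡ' : ∀ {A Δ} (π : ⊢ A ⁻ ∷ Δ) → tr (cut (ex (swap2 (A ⁻) A) (ax A)) π) ≋ tr π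
  s-β-axˡ' {A} {Δ} π {c , δ} (gc , gδ) = ~trans
    (identityʳ ⌜ A ⌝ (cast (⌜⁻⌝ A) c)
      (↭-trans (↭-reflexive (++-identityʳ _)) (↭-reflexive (sym (gr-cast (⌜⁻⌝ A) c))))
      (cast-E (⌜⁻⌝ A) (Good-E ⌜ A ⁻ ⌝ gc)) (fE (co-Fn {A} π gδ)))
    (≡⇒~ (cong (λ x → sem π (x , δ)) (cast-trans (⌜⁻⌝ A) (sym (⌜⁻⌝ A)) refl c)))

  s-β-axʳ : ∀ {A Γ} (π : ⊢ A ∷ Γ) → tr (cut π (ax A)) ≋ tr (ex (∷↭∷ʳ A Γ) π)
  s-β-axʳ {A} {Γ} π {z} gz with split Γ (A ∷ []) z gz
  ... | γ , (a , _) , refl , gγ , (ga , _) = ~trans (≡⇒~ (sem-cut π (ax A) γ (a , tt))) (~trans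
    (br-≡ ⌜ A ⌝ ↭-refl (↭-reflexive (++-identityʳ _)) (λ _ → refl)
      (λ y → cong (pair ⌜ A ⌝ a) (cast-trans (sym (⌜⁻⌝ A)) (⌜⁻⌝ A) refl y))
      (fE (fun-Fn π gγ)) (fE (co-Fn {A} (ax A) (ga , tt))))
    (~trans (identityˡ ⌜ A ⌝ a ↭-refl (Good-E ⌜ A ⌝ ga) (fE (fun-Fn π gγ)))
    (≡⇒~ (cong (sem π) (sym (perm-∷ʳ A Γ γ a))))))

  s-β-axʳ' : ∀ {A Γ} (π : ⊢ A ∷ Γ) →
    tr (cut π (ex (swap2 (A ⁻ ⁻) (A ⁻)) (ax (A ⁻)))) ≋
    tr (ex (∷↭∷ʳ (A ⁻ ⁻) Γ) (subst (λ X → ⊢ (X ∷ Γ)) (sym (⁻⁻ A)) π))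
  s-β-axʳ' {A} {Γ} π {z} gz with split Γ (A ⁻ ⁻ ∷ []) z gz
  ... | γ , (c , _) , refl , gγ , (gc , _) = ~trans
    (≡⇒~ (sem-cut π (ex (swap2 (A ⁻ ⁻) (A ⁻)) (ax (A ⁻))) γ (c , tt))) (~trans
    (br-≡ ⌜ A ⌝ ↭-refl (↭-trans (↭-reflexive (++-identityʳ _)) (↭-reflexive (sym (gr-cast (⌜⁻⁻⌝ A) c)))) (λ _ → refl)
      (λ y → pair-dual (⌜⁻⌝ A) (⌜⁻⌝ (A ⁻)) (⌜⁻⁻⌝ A) c y)
      (fE (fun-Fn π gγ)) (fE (co-Fn {A} (ex (swap2 (A ⁻ ⁻) (A ⁻)) (ax (A ⁻))) (gc , tt))))
    (~trans (identityˡ ⌜ A ⌝ (cast (⌜⁻⁻⌝ A) c) ↭-refl (cast-E (⌜⁻⁻⌝ A) (Good-E ⌜ A ⁻ ⁻ ⌝ gc)) (fE (fun-Fn π gγ)))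
    (≡⇒~ (trans (sym (sem-subst (sym (⁻⁻ A)) π (⌜⁻⁻⌝ A) c γ))
      (cong (sem (subst (λ X → ⊢ (X ∷ Γ)) (sym (⁻⁻ A)) π)) (sym (perm-∷ʳ (A ⁻ ⁻) Γ γ c)))))))

  s-cut-exˡ : ∀ {A Γ Γ' Δ} (σ : Γ ↭ Γ') (π : ⊢ A ∷ Γ) (ρ : ⊢ A ⁻ ∷ Δ) →
              tr (cut (ex (prep A σ) π) ρ) ≋ tr (ex (++⁺ʳ Δ σ) (cut π ρ))
  s-cut-exˡ {A} {Γ} {Γ'} {Δ} σ π ρ {z} gz with split Γ' Δ z gz
  ... | γ , δ , refl , gγ , gδ = ~trans (≡⇒~ (sem-cut (ex (prep A σ) π) ρ γ δ)) (~trans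
    (br-≡ ⌜ A ⌝ (↭-sym (perm-gr σ γ)) ↭-refl (λ _ → refl) (λ _ → refl)
      (fE (fun-Fn (ex (prep A σ) π) gγ)) (fE (co-Fn {A} ρ gδ)))
    (≡⇒~ (trans (sym (sem-cut π ρ (perm σ γ) δ)) (cong (sem (cut π ρ)) (sym (perm-++ʳ Δ σ γ δ))))))

  s-cut-exʳ : ∀ {A Γ Δ Δ'} (σ : Δ ↭ Δ') (ρ : ⊢ A ∷ Γ) (π : ⊢ A ⁻ ∷ Δ) →
              tr (cut ρ (ex (prep (A ⁻) σ) π)) ≋ tr (ex (++⁺ˡ Γ σ) (cut ρ π))
  s-cut-exʳ {A} {Γ} {Δ} {Δ'} σ ρ π {z} gz with split Γ Δ' z gz
  ... | γ , δ , refl , gγ , gδ = ~trans (≡⇒~ (sem-cut ρ (ex (prep (A ⁻) σ) π) γ δ)) (~trans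
    (br-≡ ⌜ A ⌝ ↭-refl (↭-sym (perm-gr σ δ)) (λ _ → refl) (λ _ → refl)
      (fE (fun-Fn ρ gγ)) (fE (co-Fn {A} (ex (prep (A ⁻) σ) π) gδ)))
    (≡⇒~ (trans (sym (sem-cut ρ π γ (perm σ δ))) (cong (sem (cut ρ π)) (sym (perm-++ˡ Γ σ γ δ))))))

  dual-⌜⁻⌝' : ∀ A → ⌜ A ⌝ ≡ dual ⌜ A ⁻ ⌝
  dual-⌜⁻⌝' A = sym (dual-⌜⁻⌝ A)

  -- By `sem-⊗` the left side is already a cut on `A` enclosing a cut on `B`, as is the right side;
  -- what remains is to rearrange environments and annotations.
  s-β-⊗⅋ : ∀ {A B Γ Δ Σ'} (π₁ : ⊢ A ∷ Γ) (π₂ : ⊢ B ∷ Δ) (π₃ : ⊢ B ⁻ ∷ A ⁻ ∷ Σ') →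
    tr (cut (⊗r π₁ π₂) (⅋r π₃)) ≋
    tr (ex (↭-reflexive (sym (++-assoc Γ Δ Σ'))) (cut π₁ (ex (toFront (A ⁻) Δ Σ') (cut π₂ π₃))))
  s-β-⊗⅋ {A} {B} {Γ} {Δ} {Σ'} π₁ π₂ π₃ {z} gz with split (Γ ++ Δ) Σ' z gz
  ... | γδ , σ , refl , gγδ , gσ with split Γ Δ γδ gγδ
  ... | γ , δ , refl , gγ , gδ = ~trans (≡⇒~ (sem-cut (⊗r π₁ π₂) (⅋r π₃) (app Γ Δ γ δ) σ)) (~trans
    (sem-⊗ π₁ π₂ (good⁺ (co-Fn {A ⊗ B} (⅋r π₃) gσ)) gγ gδ) (~trans
    (br-pt ⌜ A ⌝ ↭-refl (↭-trans (↭-++-comm (gr ⌈ Σ' ⌉ σ) (gr ⌈ Δ ⌉ δ)) (↭-reflexive (sym (app-gr Δ Σ' δ σ))))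
      (λ _ _ → ~refl) (fE (fun-Fn π₁ gγ))
      (λ x ex → ~trans
        (br-≡ ⌜ B ⌝ ↭-refl (↭-trans (↭-++-comm (gr ⌈ Σ' ⌉ σ) (gr (dual ⌜ A ⌝) x))
                  (++⁺ʳ _ (↭-reflexive (sym (gr-cast (sym (⌜⁻⌝ A)) x)))))
          (λ _ → refl) (λ y → lem x y) (fE (fun-Fn π₂ gδ))
          (λ p → ~trans (≡⇒~ (lem x _)) (~trans (fE (sem-Fn π₃)
             (cast-E (sym (⌜⁻⌝ B)) p , (cast-E (sym (⌜⁻⌝ A)) ex , Good-E ⌈ Σ' ⌉ gσ))) (≡⇒~ (sym (lem x _))))))
        (≡⇒~ (sym (trans (cong (sem (cut π₂ π₃)) (perm-shift (A ⁻) Δ Σ' δ σ (cast (sym (⌜⁻⌝ A)) x)))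
           (sem-cut π₂ π₃ δ (cast (sym (⌜⁻⌝ A)) x , σ))))))
      (fE (co-Fn {A} (ex (toFront (A ⁻) Δ Σ') (cut π₂ π₃)) (app-Good Δ Σ' gδ gσ))))
    (≡⇒~ (trans (sym (sem-cut π₁ (ex (toFront (A ⁻) Δ Σ') (cut π₂ π₃)) γ (app Δ Σ' δ σ)))
      (cong (sem (cut π₁ (ex (toFront (A ⁻) Δ Σ') (cut π₂ π₃)))) (sym (perm-assoc' Γ Δ Σ' γ δ σ)))))))
    where
    lem : ∀ x y → proj₂ (co {A ⊗ B} (⅋r π₃) σ) (y , x) ≡ sem π₃ (cast (sym (⌜⁻⌝ B)) y , (cast (sym (⌜⁻⌝ A)) x , σ))
    lem x y = cong (λ p → sem π₃ (proj₁ p , (proj₂ p , σ)))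
      (cast-par (sym (⌜⁻⌝ (A ⊗ B))) (sym (⌜⁻⌝ B)) (sym (⌜⁻⌝ A)) y x)

  -- The tensor is now the right premise, so `sem-⊗` produces cuts on the negations of `B` and `A`;
  -- `br-swap` turns each of them around.
  s-β-⅋⊗ : ∀ {A B Γ Δ Σ'} (π₃ : ⊢ A ∷ B ∷ Σ') (π₁ : ⊢ B ⁻ ∷ Γ) (π₂ : ⊢ A ⁻ ∷ Δ) →
    tr (cut (⅋r π₃) (⊗r π₁ π₂)) ≋
    tr (ex (↭-trans (↭-reflexive (++-assoc Σ' Δ Γ)) (++⁺ˡ Σ' (↭-++-comm Δ Γ))) (cut (cut π₃ π₂) π₁))
  s-β-⅋⊗ {A} {B} {Γ} {Δ} {Σ'} π₃ π₁ π₂ {z} gz with split Σ' (Γ ++ Δ) z gz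
  ... | σ , γδ , refl , gσ , gγδ with split Γ Δ γδ gγδ
  ... | γ , δ , refl , gγ , gδ = ~trans (≡⇒~ (sem-cut (⅋r π₃) (⊗r π₁ π₂) σ (app Γ Δ γ δ))) (~trans
    (sem-⊗ π₁ π₂ {k} (Good-cast eᴷ {fun (⅋r π₃) σ} (good⁺ (fun-Fn (⅋r π₃) gσ))) gγ gδ) (~trans
    (≡⇒~ (br-swap {⌜ B ⌝} (⌜⁻⌝ B) (dual-⌜⁻⌝' B))) (~trans
    (br-pt ⌜ B ⌝
      (↭-trans (++⁺ʳ _ (↭-reflexive (grk eᴷ (fun (⅋r π₃) σ)))) (↭-reflexive (sym (app-gr Σ' Δ σ δ)))) ↭-refl
      (λ b eb → ~trans (≡⇒~ (br-swap {⌜ A ⌝} (⌜⁻⌝ A) (dual-⌜⁻⌝' A))) (~trans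
        (br-≡ ⌜ A ⌝ (↭-trans (↭-reflexive (cong₂ _++_ (grk eᴷ (fun (⅋r π₃) σ)) (gr-cast (dual-⌜⁻⌝' B) b)))
                       (↭-++-comm (gr ⌈ Σ' ⌉ σ) (gr ⌜ B ⌝ b))) ↭-refl
          (λ a → lem a b) (λ _ → refl)
          (λ p → ~trans (≡⇒~ (lem _ b)) (~trans (fE (sem-Fn π₃) (p , (eb , Good-E ⌈ Σ' ⌉ gσ))) (≡⇒~ (sym (lem _ b)))))
          (fE (co-Fn {A} π₂ gδ)))
        (≡⇒~ (sym (sem-cut {A} {B ∷ Σ'} {Δ} π₃ π₂ (b , σ) δ)))))
      (fE (fun-Fn (cut π₃ π₂) (app-Good Σ' Δ gσ gδ))) (λ _ _ → ~refl) (fE (co-Fn {B} π₁ gγ)))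
    (≡⇒~ (trans (sym (sem-cut (cut π₃ π₂) π₁ (app Σ' Δ σ δ) γ))
      (cong (sem (cut (cut π₃ π₂) π₁)) (sym
        (trans (cong (perm (↭-reflexive (++-assoc Σ' Δ Γ)))
          (trans (perm-++ˡ Σ' (↭-++-comm Δ Γ) σ (app Γ Δ γ δ)) (cong (app Σ' (Δ ++ Γ) σ) (perm-comm Δ Γ δ γ))))
          (perm-assoc Σ' Δ Γ σ δ γ)))))))))
    where
    eᴷ : dual ⌜ A ⅋ B ⌝ ≡ ⌜ (A ⅋ B) ⁻ ⌝
    eᴷ = sym (⌜⁻⌝ (A ⅋ B))
    k : Val ⌜ (A ⅋ B) ⁻ ⌝
    k = cast eᴷ (fun (⅋r π₃) σ)
    grk : ∀ {N N'} (e : pst N ≡ pst N') x → proj₁ (cast e x) ≡ proj₁ x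
    grk refl x = refl
    ecast : ∀ {p p' q q'} (e : pst (par p q) ≡ pst (par p' q')) (e₁ : p ≡ p') (e₂ : q ≡ q') k x y →
            proj₂ (cast e k) (cast e₁ x , cast e₂ y) ≡ proj₂ k (x , y)
    ecast refl refl refl k x y = refl
    lem : ∀ a b → proj₂ k (cast (dual-⌜⁻⌝' A) a , cast (dual-⌜⁻⌝' B) b) ≡ sem π₃ (a , (b , σ))
    lem a b = ecast eᴷ (dual-⌜⁻⌝' A) (dual-⌜⁻⌝' B) (fun (⅋r π₃) σ) a b

  pst-inj₁ : ∀ {p p' q q'} (e : pst (wit p q) ≡ pst (wit p' q')) (e₁ : p ≡ p') k x →
             proj₂ (cast e k) (inj₁ (cast e₁ x)) ≡ proj₂ k (inj₁ x)
  pst-inj₁ refl refl k x = refl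
  pst-inj₂ : ∀ {p p' q q'} (e : pst (wit p q) ≡ pst (wit p' q')) (e₁ : q ≡ q') k x →
             proj₂ (cast e k) (inj₂ (cast e₁ x)) ≡ proj₂ k (inj₂ x)
  pst-inj₂ refl refl k x = refl
  pst-gr : ∀ {N N'} (e : pst N ≡ pst N') k → proj₁ (cast e k) ≡ proj₁ k
  pst-gr refl k = refl

  s-β-&⊕₁ : ∀ {A B Γ Δ} (π₁ : ⊢ A ∷ Γ) (π₂ : ⊢ B ∷ Γ) (π₃ : ⊢ B ⁻ ∷ Δ) →
            tr (cut (&r π₁ π₂) (⊕₁r {B ⁻} {A ⁻} π₃)) ≋ tr (cut π₂ π₃)
  s-β-&⊕₁ {A} {B} {Γ} {Δ} π₁ π₂ π₃ {z} gz with split Γ Δ z gz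
  ... | γ , δ , refl , gγ , gδ = ~trans (≡⇒~ (sem-cut (&r π₁ π₂) (⊕₁r π₃) γ δ)) (~trans
    (sem-⊕₁ π₃ {cast e k} (Good-cast e {k} (good⁺ (fun-Fn (&r π₁ π₂) gγ))) gδ) (~trans
    (≡⇒~ (br-swap {⌜ B ⌝} (⌜⁻⌝ B) (dual-⌜⁻⌝' B))) (~trans
    (br-pt ⌜ B ⌝ (↭-reflexive (pst-gr e k)) ↭-refl (λ b _ → ≡⇒~ (pst-inj₂ e (dual-⌜⁻⌝' B) k b))
      (fE (fun-Fn π₂ gγ)) (λ _ _ → ~refl) (fE (co-Fn {B} π₃ gδ)))
    (≡⇒~ (sym (sem-cut π₂ π₃ γ δ))))))
    where
    e : dual ⌜ A & B ⌝ ≡ ⌜ (A & B) ⁻ ⌝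
    e = sym (⌜⁻⌝ (A & B))
    k = fun (&r π₁ π₂) γ

  s-β-&⊕₂ : ∀ {A B Γ Δ} (π₁ : ⊢ A ∷ Γ) (π₂ : ⊢ B ∷ Γ) (π₃ : ⊢ A ⁻ ∷ Δ) →
            tr (cut (&r π₁ π₂) (⊕₂r {B ⁻} {A ⁻} π₃)) ≋ tr (cut π₁ π₃)
  s-β-&⊕₂ {A} {B} {Γ} {Δ} π₁ π₂ π₃ {z} gz with split Γ Δ z gz
  ... | γ , δ , refl , gγ , gδ = ~trans (≡⇒~ (sem-cut (&r π₁ π₂) (⊕₂r π₃) γ δ)) (~trans
    (sem-⊕₂ π₃ {cast e k} (Good-cast e {k} (good⁺ (fun-Fn (&r π₁ π₂) gγ))) gδ) (~trans
    (≡⇒~ (br-swap {⌜ A ⌝} (⌜⁻⌝ A) (dual-⌜⁻⌝' A))) (~trans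
    (br-pt ⌜ A ⌝ (↭-reflexive (pst-gr e k)) ↭-refl (λ b _ → ≡⇒~ (pst-inj₁ e (dual-⌜⁻⌝' A) k b))
      (fE (fun-Fn π₁ gγ)) (λ _ _ → ~refl) (fE (co-Fn {A} π₃ gδ)))
    (≡⇒~ (sym (sem-cut π₁ π₃ γ δ))))))
    where
    e : dual ⌜ A & B ⌝ ≡ ⌜ (A & B) ⁻ ⌝
    e = sym (⌜⁻⌝ (A & B))
    k = fun (&r π₁ π₂) γ

  s-β-⊕₁& : ∀ {A B Γ Δ} (π₃ : ⊢ A ∷ Γ) (π₁ : ⊢ B ⁻ ∷ Δ) (π₂ : ⊢ A ⁻ ∷ Δ) →
            tr (cut (⊕₁r {A} {B} π₃) (&r π₁ π₂)) ≋ tr (cut π₃ π₂)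
  s-β-⊕₁& {A} {B} {Γ} {Δ} π₃ π₁ π₂ {z} gz with split Γ Δ z gz
  ... | γ , δ , refl , gγ , gδ = ~trans (≡⇒~ (sem-cut (⊕₁r {A} {B} π₃) (&r π₁ π₂) γ δ)) (~trans
    (sem-⊕₁ π₃ {k} (good⁺ (co-Fn {A ⊕ B} (&r π₁ π₂) gδ)) gγ) (~trans
    (br-pt ⌜ A ⌝ ↭-refl ↭-refl (λ _ _ → ~refl) (fE (fun-Fn π₃ gγ))
      (λ x _ → ≡⇒~ (cong (either (λ x → sem π₁ (x , δ)) λ y → sem π₂ (y , δ))
        (cast-inj₂ (sym (⌜⁻⌝ (A ⊕ B))) (sym (⌜⁻⌝ A)) x)))
      (fE (co-Fn {A} π₂ gδ)))
    (≡⇒~ (sym (sem-cut π₃ π₂ γ δ)))))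
    where
    k = co {A ⊕ B} (&r π₁ π₂) δ

  s-β-⊕₂& : ∀ {A B Γ Δ} (π₃ : ⊢ B ∷ Γ) (π₁ : ⊢ B ⁻ ∷ Δ) (π₂ : ⊢ A ⁻ ∷ Δ) →
            tr (cut (⊕₂r {A} {B} π₃) (&r π₁ π₂)) ≋ tr (cut π₃ π₁)
  s-β-⊕₂& {A} {B} {Γ} {Δ} π₃ π₁ π₂ {z} gz with split Γ Δ z gz
  ... | γ , δ , refl , gγ , gδ = ~trans (≡⇒~ (sem-cut (⊕₂r {A} {B} π₃) (&r π₁ π₂) γ δ)) (~trans
    (sem-⊕₂ π₃ {k} (good⁺ (co-Fn {A ⊕ B} (&r π₁ π₂) gδ)) gγ) (~trans
    (br-pt ⌜ B ⌝ ↭-refl ↭-refl (λ _ _ → ~refl) (fE (fun-Fn π₃ gγ))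
      (λ x _ → ≡⇒~ (cong (either (λ x → sem π₁ (x , δ)) λ y → sem π₂ (y , δ))
        (cast-inj₁ (sym (⌜⁻⌝ (A ⊕ B))) (sym (⌜⁻⌝ B)) x)))
      (fE (co-Fn {B} π₁ gδ)))
    (≡⇒~ (sym (sem-cut π₃ π₁ γ δ)))))
    where
    k = co {A ⊕ B} (&r π₁ π₂) δ

  s-β-⊥𝟏 : ∀ {Γ} (π : ⊢ Γ) → tr (cut (⊥r π) 𝟏r) ≋ tr (ex (↭-reflexive (sym (++-identityʳ Γ))) π)
  s-β-⊥𝟏 {Γ} π {z} gz with split Γ [] z gz
  ... | γ , _ , refl , gγ , _ = ~trans (≡⇒~ (sem-cut (⊥r π) 𝟏r γ tt)) (≡⇒~ (cong (sem π) (sym (perm-idʳ Γ γ))))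

  -- The left premise of a cut, as a functional on the dual of the right cut formula.
  oc : ∀ {A Γ} → ⊢ A ∷ Γ → Env Γ → Fun (dual ⌜ A ⁻ ⌝)
  oc {A} {Γ} π γ = gr ⌈ Γ ⌉ γ , λ x → sem π (cast (dual-⌜⁻⌝ A) x , γ)

  oc-Fn : ∀ {A Γ} (π : ⊢ A ∷ Γ) {γ} → Good ⌈ Γ ⌉ γ → Fn (dual ⌜ A ⁻ ⌝) (proj₂ (oc {A} π γ)) (proj₁ (oc {A} π γ))
  oc-Fn {A} π g = uncast-Fn (dual-⌜⁻⌝ A) (curry-Fn (sem-Fn π) g)
    where
    uncast-Fn : ∀ {a b f w} (e : b ≡ a) → Fn a f w → Fn b (λ x → f (cast e x)) w
    uncast-Fn refl F = F

  -- The cut read from its right premise, with `A ⁻` as cut formula; it makes the commutations on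
  -- the right instances of `commute` as well.
  sem-cutʳ : ∀ {A Γ Δ} (π : ⊢ A ∷ Γ) (ρ : ⊢ A ⁻ ∷ Δ) {γ δ} → E ⌈ Γ ⌉ γ γ → E ⌈ Δ ⌉ δ δ →
    sem (cut π ρ) (app Γ Δ γ δ) ~ br ⌜ A ⁻ ⌝ (fun ρ δ) (oc {A} π γ)
  sem-cutʳ {A} {Γ} {Δ} π ρ {γ} {δ} gγ gδ = ~trans
    (≡⇒~ (trans (sem-cut π ρ γ δ) (br-swap {⌜ A ⁻ ⌝} (sym (dual-⌜⁻⌝ A)) (⌜⁻⌝ A))))
    (br-≡ ⌜ A ⁻ ⌝ ↭-refl ↭-refl
      (λ x → cong (λ z → sem ρ (z , δ)) (c₁ x)) (λ y → cong (λ z → sem π (z , γ)) (c₂ y))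
      (λ p → ~trans (≡⇒~ (cong (λ z → sem ρ (z , δ)) (c₁ _))) (~trans (fE (sem-Fn ρ) (p , gδ))
        (≡⇒~ (cong (λ z → sem ρ (z , δ)) (sym (c₁ _))))))
      (λ p → ~trans (≡⇒~ (cong (λ z → sem π (z , γ)) (c₂ _))) (~trans (fE (sem-Fn π) (cast-E (dual-⌜⁻⌝ A) p , gγ))
        (≡⇒~ (cong (λ z → sem π (z , γ)) (sym (c₂ _)))))))
    where
    c₁ : ∀ x → cast (sym (⌜⁻⌝ A)) (cast (⌜⁻⌝ A) x) ≡ x
    c₁ x = cast-trans (⌜⁻⌝ A) (sym (⌜⁻⌝ A)) refl x
    c₂ : ∀ y → cast (sym (sym (dual-⌜⁻⌝ A))) y ≡ cast (dual-⌜⁻⌝ A) y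
    c₂ y = cong (λ e → cast e y) (ss (dual-⌜⁻⌝ A))
      where
      ss : ∀ {a b : Arg} (p : a ≡ b) → sym (sym p) ≡ p
      ss refl = refl

  front : ∀ {A B Θ₁ Θ₂} → ⊢ B ∷ Θ₁ ++ A ∷ Θ₂ → ⊢ A ∷ B ∷ Θ₁ ++ Θ₂
  front {A} {B} {Θ₁} {Θ₂} π = ex (toFront A (B ∷ Θ₁) Θ₂) π

  -- If κ is obtained from π by composing with K on B, a cut on A in κ commutes with the composition.
  commute : ∀ {A B Θ₁ Θ₂ Ξ} (π : ⊢ B ∷ Θ₁ ++ A ∷ Θ₂) (κ : ⊢ A ∷ Ξ) {θ ξ} {K : Fun (dual ⌜ B ⌝)} {R : Fun (dual ⌜ A ⌝)} →
    Good ⌈ Θ₁ ++ Θ₂ ⌉ θ → Good ⌈ Ξ ⌉ ξ →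
    Fn (dual ⌜ B ⌝) (proj₂ K) (proj₁ K) → Fn (dual ⌜ A ⌝) (proj₂ R) (proj₁ R) →
    gr ⌈ Ξ ⌉ ξ ↭ gr ⌈ Θ₁ ++ Θ₂ ⌉ θ ++ proj₁ K →
    (∀ a → Good ⌜ A ⌝ a → sem κ (a , ξ) ~ br ⌜ B ⌝ (fun π (perm (shift A Θ₁ Θ₂) (a , θ))) K) →
    br ⌜ A ⌝ (fun κ ξ) R ~
    br ⌜ B ⌝ (gr ⌈ Θ₁ ++ Θ₂ ⌉ θ ++ proj₁ R , λ b → br ⌜ A ⌝ (fun (front {A} {B} {Θ₁} {Θ₂} π) (b , θ)) R) K
  commute {A} {B} {Θ₁} {Θ₂} π κ {θ} {ξ} {K} {R} gθ gξ FK FR p h = ~trans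
    (br-good ⌜ A ⌝ p ↭-refl h (fun-Fn κ gξ)
      (br-Fn ⌜ B ⌝ {⌜ A ⌝} {λ (b , a) → q b a} {S₂} {w} {K} F s₂ FK)
      (λ _ _ → ~refl) FR FR)
    (fubini ⌜ A ⌝ ⌜ B ⌝ (λ a b → q b a) {w ++ proj₁ K} {S₂} {w ++ proj₁ R} {λ b → gr ⌜ B ⌝ b ++ w} {w} {R} {K}
      (λ p p' → fE F (p' , p)) FR FK ↭-refl s₂ ↭-refl (λ b → ↭-++-comm (gr ⌜ B ⌝ b) w))
    where
    w = gr ⌈ Θ₁ ++ Θ₂ ⌉ θ
    S₂ : Val ⌜ A ⌝ → M
    S₂ a = gr ⌈ Θ₁ ++ A ∷ Θ₂ ⌉ (perm (shift A Θ₁ Θ₂) (a , θ))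
    s₂ : ∀ a → S₂ a ↭ w ++ gr ⌜ A ⌝ a
    s₂ a = ↭-trans (perm-gr (shift A Θ₁ Θ₂) (a , θ)) (↭-++-comm (gr ⌜ A ⌝ a) w)
    q : Val ⌜ B ⌝ → Val ⌜ A ⌝ → Tm
    q b a = sem π (b , perm (shift A Θ₁ Θ₂) (a , θ))
    F : Fn (neg (par ⌜ B ⌝ ⌜ A ⌝)) (λ (b , a) → q b a) w
    F = curry₂-Fn (sem-Fn (ex (prep B (shift A Θ₁ Θ₂)) π)) gθ

  commuteˡ : ∀ {A B Θ₁ Θ₂ Ξ Δ} (π : ⊢ B ∷ Θ₁ ++ A ∷ Θ₂) (κ : ⊢ A ∷ Ξ) (ρ : ⊢ A ⁻ ∷ Δ) {θ ξ δ} {K : Fun (dual ⌜ B ⌝)} →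
    Good ⌈ Θ₁ ++ Θ₂ ⌉ θ → Good ⌈ Ξ ⌉ ξ → Good ⌈ Δ ⌉ δ → Fn (dual ⌜ B ⌝) (proj₂ K) (proj₁ K) →
    gr ⌈ Ξ ⌉ ξ ↭ gr ⌈ Θ₁ ++ Θ₂ ⌉ θ ++ proj₁ K →
    (∀ a → Good ⌜ A ⌝ a → sem κ (a , ξ) ~ br ⌜ B ⌝ (fun π (perm (shift A Θ₁ Θ₂) (a , θ))) K) →
    sem (cut κ ρ) (app Ξ Δ ξ δ) ~ br ⌜ B ⌝ (fun (cut (front {A} {B} {Θ₁} {Θ₂} π) ρ) (app (Θ₁ ++ Θ₂) Δ θ δ)) K
  commuteˡ {A} {B} {Θ₁} {Θ₂} {Ξ} {Δ} π κ ρ {θ} {ξ} {δ} {K} gθ gξ gδ FK p h = ~trans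
    (≡⇒~ (sem-cut κ ρ ξ δ)) (~trans
    (commute {A} {B} {Θ₁} {Θ₂} π κ {K = K} gθ gξ FK (co-Fn {A} ρ gδ) p h)
    (br-pt ⌜ B ⌝ (↭-reflexive (sym (app-gr (Θ₁ ++ Θ₂) Δ θ δ))) ↭-refl
      (λ b eb → ≡⇒~ (sym (sem-cut {A} {B ∷ Θ₁ ++ Θ₂} {Δ} π' ρ (b , θ) δ)))
      (fE (fun-Fn {B} (cut π' ρ) (app-Good (Θ₁ ++ Θ₂) Δ gθ gδ)))
      (λ _ _ → ~refl) (fE FK)))
    where
    π' = front {A} {B} {Θ₁} {Θ₂} π

  commuteʳ : ∀ {A B Θ₁ Θ₂ Ξ Γ} (ρ : ⊢ A ∷ Γ) (π : ⊢ B ∷ Θ₁ ++ A ⁻ ∷ Θ₂) (κ : ⊢ A ⁻ ∷ Ξ) {θ ξ γ} {K : Fun (dual ⌜ B ⌝)} →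
    Good ⌈ Θ₁ ++ Θ₂ ⌉ θ → Good ⌈ Ξ ⌉ ξ → Good ⌈ Γ ⌉ γ → Fn (dual ⌜ B ⌝) (proj₂ K) (proj₁ K) →
    gr ⌈ Ξ ⌉ ξ ↭ gr ⌈ Θ₁ ++ Θ₂ ⌉ θ ++ proj₁ K →
    (∀ a → Good ⌜ A ⁻ ⌝ a → sem κ (a , ξ) ~ br ⌜ B ⌝ (fun π (perm (shift (A ⁻) Θ₁ Θ₂) (a , θ))) K) →
    sem (cut ρ κ) (app Γ Ξ γ ξ) ~
    br ⌜ B ⌝ (fun (ex (toFront B Γ (Θ₁ ++ Θ₂)) (cut ρ (front {A ⁻} {B} {Θ₁} {Θ₂} π))) (app Γ (Θ₁ ++ Θ₂) γ θ)) K
  commuteʳ {A} {B} {Θ₁} {Θ₂} {Ξ} {Γ} ρ π κ {θ} {ξ} {γ} {K} gθ gξ gγ FK p h = ~trans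
    (sem-cutʳ ρ κ (Good-E ⌈ Γ ⌉ gγ) (Good-E ⌈ Ξ ⌉ gξ)) (~trans
    (commute {A ⁻} {B} {Θ₁} {Θ₂} π κ {K = K} gθ gξ FK (oc-Fn {A} ρ gγ) p h)
    (br-pt ⌜ B ⌝ (↭-trans (↭-++-comm (gr ⌈ Θ₁ ++ Θ₂ ⌉ θ) (gr ⌈ Γ ⌉ γ)) (↭-reflexive (sym (app-gr Γ (Θ₁ ++ Θ₂) γ θ)))) ↭-refl
      (λ b eb → ~sym (~trans (≡⇒~ (cong (sem (cut ρ π')) (perm-shift B Γ (Θ₁ ++ Θ₂) γ θ b)))
        (sem-cutʳ ρ π' (Good-E ⌈ Γ ⌉ gγ) (eb , Good-E ⌈ Θ₁ ++ Θ₂ ⌉ gθ))))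
      (fE (fun-Fn {B} κ' (app-Good Γ (Θ₁ ++ Θ₂) gγ gθ)))
      (λ _ _ → ~refl) (fE FK)))
    where
    π' = front {A ⁻} {B} {Θ₁} {Θ₂} π
    κ' = ex (toFront B Γ (Θ₁ ++ Θ₂)) (cut ρ π')

  s-c-⅋ˡ : ∀ {A B C Θ₁ Θ₂ Δ} (π : ⊢ B ∷ C ∷ Θ₁ ++ A ∷ Θ₂) (ρ : ⊢ A ⁻ ∷ Δ) →
    tr (cut (ex (toFront A (B ⅋ C ∷ Θ₁) Θ₂) (⅋r π)) ρ) ≋ tr (⅋r (cut (ex (toFront A (B ∷ C ∷ Θ₁) Θ₂) π) ρ))
  s-c-⅋ˡ {A} {B} {C} {Θ₁} {Θ₂} {Δ} π ρ {(b , c) , z} ((gb , gc) , gz) with split (Θ₁ ++ Θ₂) Δ z gz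
  ... | θ , δ , refl , gθ , gδ = ~trans
    (≡⇒~ (sem-cut {A} {B ⅋ C ∷ Θ₁ ++ Θ₂} {Δ} κ ρ ((b , c) , θ) δ)) (~trans
    (br-≡ ⌜ A ⌝ (↭-reflexive (++-assoc (gr ⌜ B ⌝ b) _ _)) ↭-refl (λ _ → refl) (λ _ → refl)
      (fE (fun-Fn {A} {B ⅋ C ∷ Θ₁ ++ Θ₂} κ ((gb , gc) , gθ))) (fE (co-Fn {A} ρ gδ)))
    (≡⇒~ (sym (sem-cut {A} {B ∷ C ∷ Θ₁ ++ Θ₂} {Δ} (ex (toFront A (B ∷ C ∷ Θ₁) Θ₂) π) ρ (b , (c , θ)) δ))))
    where
    κ = ex (toFront A (B ⅋ C ∷ Θ₁) Θ₂) (⅋r π)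

  s-c-⊥ˡ : ∀ {A Θ₁ Θ₂ Δ} (π : ⊢ Θ₁ ++ A ∷ Θ₂) (ρ : ⊢ A ⁻ ∷ Δ) →
    tr (cut (ex (toFront A (⊥ₘ ∷ Θ₁) Θ₂) (⊥r π)) ρ) ≋ tr (⊥r (cut (ex (toFront A Θ₁ Θ₂) π) ρ))
  s-c-⊥ˡ {A} {Θ₁} {Θ₂} {Δ} π ρ {tt , z} (_ , gz) with split (Θ₁ ++ Θ₂) Δ z gz
  ... | θ , δ , refl , gθ , gδ = ≡⇒~ (trans (sem-cut {A} {⊥ₘ ∷ Θ₁ ++ Θ₂} {Δ} κ ρ (tt , θ) δ)
    (sym (sem-cut {A} {Θ₁ ++ Θ₂} {Δ} (ex (toFront A Θ₁ Θ₂) π) ρ θ δ)))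
    where
    κ = ex (toFront A (⊥ₘ ∷ Θ₁) Θ₂) (⊥r π)

  s-c-&ˡ : ∀ {A B C Θ₁ Θ₂ Δ} (π₁ : ⊢ B ∷ Θ₁ ++ A ∷ Θ₂) (π₂ : ⊢ C ∷ Θ₁ ++ A ∷ Θ₂) (ρ : ⊢ A ⁻ ∷ Δ) →
    tr (cut (ex (toFront A (B & C ∷ Θ₁) Θ₂) (&r π₁ π₂)) ρ) ≋
    tr (&r (cut (ex (toFront A (B ∷ Θ₁) Θ₂) π₁) ρ) (cut (ex (toFront A (C ∷ Θ₁) Θ₂) π₂) ρ))
  s-c-&ˡ {A} {B} {C} {Θ₁} {Θ₂} {Δ} π₁ π₂ ρ {i , z} (gi , gz) with split (Θ₁ ++ Θ₂) Δ z gz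
  s-c-&ˡ {A} {B} {C} {Θ₁} {Θ₂} {Δ} π₁ π₂ ρ {inj₁ b , _} _ | θ , δ , refl , gθ , gδ = ≡⇒~ (trans
    (sem-cut {A} {B & C ∷ Θ₁ ++ Θ₂} {Δ} (ex (toFront A (B & C ∷ Θ₁) Θ₂) (&r π₁ π₂)) ρ (inj₁ b , θ) δ)
    (sym (sem-cut {A} {B ∷ Θ₁ ++ Θ₂} {Δ} (ex (toFront A (B ∷ Θ₁) Θ₂) π₁) ρ (b , θ) δ)))
  s-c-&ˡ {A} {B} {C} {Θ₁} {Θ₂} {Δ} π₁ π₂ ρ {inj₂ c , _} _ | θ , δ , refl , gθ , gδ = ≡⇒~ (trans
    (sem-cut {A} {B & C ∷ Θ₁ ++ Θ₂} {Δ} (ex (toFront A (B & C ∷ Θ₁) Θ₂) (&r π₁ π₂)) ρ (inj₂ c , θ) δ)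
    (sym (sem-cut {A} {C ∷ Θ₁ ++ Θ₂} {Δ} (ex (toFront A (C ∷ Θ₁) Θ₂) π₂) ρ (c , θ) δ)))

  s-c-⅋ʳ : ∀ {A B C Γ Θ₁ Θ₂} (ρ : ⊢ A ∷ Γ) (π : ⊢ B ∷ C ∷ Θ₁ ++ A ⁻ ∷ Θ₂) →
    tr (cut ρ (ex (toFront (A ⁻) (B ⅋ C ∷ Θ₁) Θ₂) (⅋r π))) ≋
    tr (ex (fromFront (B ⅋ C) Γ (Θ₁ ++ Θ₂)) (⅋r (ex (toFront2 B C Γ (Θ₁ ++ Θ₂))
      (cut ρ (ex (toFront (A ⁻) (B ∷ C ∷ Θ₁) Θ₂) π)))))
  s-c-⅋ʳ {A} {B} {C} {Γ} {Θ₁} {Θ₂} ρ π {z} gz with split Γ (B ⅋ C ∷ Θ₁ ++ Θ₂) z gz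
  ... | γ , ((b , c) , θ) , refl , gγ , ((gb , gc) , gθ) = ~trans
    (≡⇒~ (sem-cut {A} {Γ} {B ⅋ C ∷ Θ₁ ++ Θ₂} ρ κ γ ((b , c) , θ))) (~trans
    (br-≡ ⌜ A ⌝ ↭-refl (↭-reflexive (++-assoc (gr ⌜ B ⌝ b) _ _)) (λ _ → refl) (λ _ → refl)
      (fE (fun-Fn ρ gγ)) (fE (co-Fn {A} {B ⅋ C ∷ Θ₁ ++ Θ₂} κ ((gb , gc) , gθ))))
    (≡⇒~ (trans (sym (sem-cut {A} {Γ} {B ∷ C ∷ Θ₁ ++ Θ₂} ρ π' γ (b , (c , θ)))) (cong (sem (cut ρ π')) (sym e)))))
    where
    κ = ex (toFront (A ⁻) (B ⅋ C ∷ Θ₁) Θ₂) (⅋r π)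
    π' = ex (toFront (A ⁻) (B ∷ C ∷ Θ₁) Θ₂) π
    unpar : Env (B ⅋ C ∷ Γ ++ (Θ₁ ++ Θ₂)) → Env (B ∷ C ∷ Γ ++ (Θ₁ ++ Θ₂))
    unpar ((b , c) , γ) = b , (c , γ)
    e : perm (toFront2 B C Γ (Θ₁ ++ Θ₂)) (unpar (perm (fromFront (B ⅋ C) Γ (Θ₁ ++ Θ₂))
          (app Γ (B ⅋ C ∷ Θ₁ ++ Θ₂) γ ((b , c) , θ)))) ≡ app Γ (B ∷ C ∷ Θ₁ ++ Θ₂) γ (b , (c , θ))
    e = trans (cong (λ v → perm (toFront2 B C Γ (Θ₁ ++ Θ₂)) (unpar v))
          (perm-unshift (B ⅋ C) Γ (Θ₁ ++ Θ₂) γ θ (b , c)))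
      (trans (cong (λ v → perm (shift B Γ (C ∷ Θ₁ ++ Θ₂)) (b , v)) (perm-shift C Γ (Θ₁ ++ Θ₂) γ θ c))
        (perm-shift B Γ (C ∷ Θ₁ ++ Θ₂) γ (c , θ) b))

  s-c-⊥ʳ : ∀ {A Γ Θ₁ Θ₂} (ρ : ⊢ A ∷ Γ) (π : ⊢ Θ₁ ++ A ⁻ ∷ Θ₂) →
    tr (cut ρ (ex (toFront (A ⁻) (⊥ₘ ∷ Θ₁) Θ₂) (⊥r π))) ≋
    tr (ex (fromFront ⊥ₘ Γ (Θ₁ ++ Θ₂)) (⊥r (cut ρ (ex (toFront (A ⁻) Θ₁ Θ₂) π))))
  s-c-⊥ʳ {A} {Γ} {Θ₁} {Θ₂} ρ π {z} gz with split Γ (⊥ₘ ∷ Θ₁ ++ Θ₂) z gz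
  ... | γ , (tt , θ) , refl , gγ , (_ , gθ) = ≡⇒~ (trans
    (sem-cut {A} {Γ} {⊥ₘ ∷ Θ₁ ++ Θ₂} ρ κ γ (tt , θ)) (trans
    (sym (sem-cut {A} {Γ} {Θ₁ ++ Θ₂} ρ π' γ θ))
    (cong (λ v → sem (cut ρ π') (proj₂ v)) (sym (perm-unshift ⊥ₘ Γ (Θ₁ ++ Θ₂) γ θ tt)))))
    where
    κ = ex (toFront (A ⁻) (⊥ₘ ∷ Θ₁) Θ₂) (⊥r π)
    π' = ex (toFront (A ⁻) Θ₁ Θ₂) π

  s-c-&ʳ : ∀ {A B C Γ Θ₁ Θ₂} (ρ : ⊢ A ∷ Γ) (π₁ : ⊢ B ∷ Θ₁ ++ A ⁻ ∷ Θ₂) (π₂ : ⊢ C ∷ Θ₁ ++ A ⁻ ∷ Θ₂) →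
    tr (cut ρ (ex (toFront (A ⁻) (B & C ∷ Θ₁) Θ₂) (&r π₁ π₂))) ≋
    tr (ex (fromFront (B & C) Γ (Θ₁ ++ Θ₂))
         (&r (ex (toFront B Γ (Θ₁ ++ Θ₂)) (cut ρ (ex (toFront (A ⁻) (B ∷ Θ₁) Θ₂) π₁)))
             (ex (toFront C Γ (Θ₁ ++ Θ₂)) (cut ρ (ex (toFront (A ⁻) (C ∷ Θ₁) Θ₂) π₂)))))
  s-c-&ʳ {A} {B} {C} {Γ} {Θ₁} {Θ₂} ρ π₁ π₂ {z} gz with split Γ (B & C ∷ Θ₁ ++ Θ₂) z gz
  ... | γ , (i , θ) , refl , gγ , (gi , gθ) = ≡⇒~ (trans
    (sem-cut {A} {Γ} {B & C ∷ Θ₁ ++ Θ₂} ρ κ γ (i , θ)) (trans (sym (e i))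
    (cong (sem (&r π₁' π₂')) (sym (perm-unshift (B & C) Γ (Θ₁ ++ Θ₂) γ θ i)))))
    where
    κ = ex (toFront (A ⁻) (B & C ∷ Θ₁) Θ₂) (&r π₁ π₂)
    π₁' = ex (toFront B Γ (Θ₁ ++ Θ₂)) (cut ρ (ex (toFront (A ⁻) (B ∷ Θ₁) Θ₂) π₁))
    π₂' = ex (toFront C Γ (Θ₁ ++ Θ₂)) (cut ρ (ex (toFront (A ⁻) (C ∷ Θ₁) Θ₂) π₂))
    e : ∀ i → sem (&r π₁' π₂') (i , app Γ (Θ₁ ++ Θ₂) γ θ) ≡ br ⌜ A ⌝ (fun ρ γ) (co {A} {B & C ∷ Θ₁ ++ Θ₂} κ (i , θ))
    e (inj₁ b) = trans (cong (sem (cut ρ (ex (toFront (A ⁻) (B ∷ Θ₁) Θ₂) π₁))) (perm-shift B Γ (Θ₁ ++ Θ₂) γ θ b))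
      (sem-cut {A} {Γ} {B ∷ Θ₁ ++ Θ₂} ρ (ex (toFront (A ⁻) (B ∷ Θ₁) Θ₂) π₁) γ (b , θ))
    e (inj₂ c) = trans (cong (sem (cut ρ (ex (toFront (A ⁻) (C ∷ Θ₁) Θ₂) π₂))) (perm-shift C Γ (Θ₁ ++ Θ₂) γ θ c))
      (sem-cut {A} {Γ} {C ∷ Θ₁ ++ Θ₂} ρ (ex (toFront (A ⁻) (C ∷ Θ₁) Θ₂) π₂) γ (c , θ))

  s-c-⊤ʳ : ∀ {A Γ Θ₁ Θ₂} (ρ : ⊢ A ∷ Γ) →
    tr (cut ρ (ex (toFront (A ⁻) (⊤ₘ ∷ Θ₁) Θ₂) (⊤r (Θ₁ ++ A ⁻ ∷ Θ₂)))) ≋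
    tr (ex (fromFront ⊤ₘ Γ (Θ₁ ++ Θ₂)) (⊤r (Γ ++ Θ₁ ++ Θ₂)))
  s-c-⊤ʳ {A} {Γ} {Θ₁} {Θ₂} ρ {z} gz with split Γ (⊤ₘ ∷ Θ₁ ++ Θ₂) z gz
  ... | γ , (() , θ) , refl , gγ , (gi , gθ)

  -- An injection is the composition with the functional that `k` induces on one summand, so this
  -- and the three cases that follow are instances of `commuteˡ` and `commuteʳ`.
  s-c-⊕₁ˡ : ∀ {A B C Θ₁ Θ₂ Δ} (π : ⊢ B ∷ Θ₁ ++ A ∷ Θ₂) (ρ : ⊢ A ⁻ ∷ Δ) →
    tr (cut (ex (toFront A (B ⊕ C ∷ Θ₁) Θ₂) (⊕₁r {B} {C} π)) ρ) ≋ tr (⊕₁r {B} {C} (cut (ex (toFront A (B ∷ Θ₁) Θ₂) π) ρ))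
  s-c-⊕₁ˡ {A} {B} {C} {Θ₁} {Θ₂} {Δ} π ρ {k , z} (gk , gz) with split (Θ₁ ++ Θ₂) Δ z gz
  ... | θ , δ , refl , gθ , gδ = ~trans
    (commuteˡ {A} {B} {Θ₁} {Θ₂} {B ⊕ C ∷ Θ₁ ++ Θ₂} {Δ} π (ex (toFront A (B ⊕ C ∷ Θ₁) Θ₂) (⊕₁r π)) ρ {θ} {k , θ} {δ}
      gθ (gk , gθ) gδ (inj₂-Fn {dual ⌜ C ⌝} {dual ⌜ B ⌝} gk) (↭-++-comm (proj₁ k) (gr ⌈ Θ₁ ++ Θ₂ ⌉ θ))
      (λ a ga → sem-⊕₁ π gk (perm-Good (shift A Θ₁ Θ₂) (ga , gθ))))
    (~sym (sem-⊕₁ (cut (ex (toFront A (B ∷ Θ₁) Θ₂) π) ρ) gk (app-Good (Θ₁ ++ Θ₂) Δ gθ gδ)))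

  s-c-⊕₂ˡ : ∀ {A B C Θ₁ Θ₂ Δ} (π : ⊢ C ∷ Θ₁ ++ A ∷ Θ₂) (ρ : ⊢ A ⁻ ∷ Δ) →
    tr (cut (ex (toFront A (B ⊕ C ∷ Θ₁) Θ₂) (⊕₂r {B} {C} π)) ρ) ≋ tr (⊕₂r {B} {C} (cut (ex (toFront A (C ∷ Θ₁) Θ₂) π) ρ))
  s-c-⊕₂ˡ {A} {B} {C} {Θ₁} {Θ₂} {Δ} π ρ {k , z} (gk , gz) with split (Θ₁ ++ Θ₂) Δ z gz
  ... | θ , δ , refl , gθ , gδ = ~trans
    (commuteˡ {A} {C} {Θ₁} {Θ₂} {B ⊕ C ∷ Θ₁ ++ Θ₂} {Δ} π (ex (toFront A (B ⊕ C ∷ Θ₁) Θ₂) (⊕₂r π)) ρ {θ} {k , θ} {δ}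
      gθ (gk , gθ) gδ (inj₁-Fn {dual ⌜ C ⌝} {dual ⌜ B ⌝} gk) (↭-++-comm (proj₁ k) (gr ⌈ Θ₁ ++ Θ₂ ⌉ θ))
      (λ a ga → sem-⊕₂ π gk (perm-Good (shift A Θ₁ Θ₂) (ga , gθ))))
    (~sym (sem-⊕₂ (cut (ex (toFront A (C ∷ Θ₁) Θ₂) π) ρ) gk (app-Good (Θ₁ ++ Θ₂) Δ gθ gδ)))

  s-c-⊕₁ʳ : ∀ {A B C Γ Θ₁ Θ₂} (ρ : ⊢ A ∷ Γ) (π : ⊢ B ∷ Θ₁ ++ A ⁻ ∷ Θ₂) →
    tr (cut ρ (ex (toFront (A ⁻) (B ⊕ C ∷ Θ₁) Θ₂) (⊕₁r {B} {C} π))) ≋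
    tr (ex (fromFront (B ⊕ C) Γ (Θ₁ ++ Θ₂)) (⊕₁r {B} {C} (ex (toFront B Γ (Θ₁ ++ Θ₂))
      (cut ρ (ex (toFront (A ⁻) (B ∷ Θ₁) Θ₂) π)))))
  s-c-⊕₁ʳ {A} {B} {C} {Γ} {Θ₁} {Θ₂} ρ π {z} gz with split Γ (B ⊕ C ∷ Θ₁ ++ Θ₂) z gz
  ... | γ , (k , θ) , refl , gγ , (gk , gθ) = ~trans
    (commuteʳ {A} {B} {Θ₁} {Θ₂} {B ⊕ C ∷ Θ₁ ++ Θ₂} {Γ} ρ π (ex (toFront (A ⁻) (B ⊕ C ∷ Θ₁) Θ₂) (⊕₁r π)) {θ} {k , θ} {γ}
      gθ (gk , gθ) gγ (inj₂-Fn {dual ⌜ C ⌝} {dual ⌜ B ⌝} gk) (↭-++-comm (proj₁ k) (gr ⌈ Θ₁ ++ Θ₂ ⌉ θ))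
      (λ a ga → sem-⊕₁ π gk (perm-Good (shift (A ⁻) Θ₁ Θ₂) (ga , gθ))))
    (~trans (~sym (sem-⊕₁ κ gk (app-Good Γ (Θ₁ ++ Θ₂) gγ gθ)))
    (≡⇒~ (cong (sem (⊕₁r {B} {C} κ)) (sym (perm-unshift (B ⊕ C) Γ (Θ₁ ++ Θ₂) γ θ k)))))
    where
    κ = ex (toFront B Γ (Θ₁ ++ Θ₂)) (cut ρ (ex (toFront (A ⁻) (B ∷ Θ₁) Θ₂) π))

  s-c-⊕₂ʳ : ∀ {A B C Γ Θ₁ Θ₂} (ρ : ⊢ A ∷ Γ) (π : ⊢ C ∷ Θ₁ ++ A ⁻ ∷ Θ₂) →
    tr (cut ρ (ex (toFront (A ⁻) (B ⊕ C ∷ Θ₁) Θ₂) (⊕₂r {B} {C} π))) ≋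
    tr (ex (fromFront (B ⊕ C) Γ (Θ₁ ++ Θ₂)) (⊕₂r {B} {C} (ex (toFront C Γ (Θ₁ ++ Θ₂))
      (cut ρ (ex (toFront (A ⁻) (C ∷ Θ₁) Θ₂) π)))))
  s-c-⊕₂ʳ {A} {B} {C} {Γ} {Θ₁} {Θ₂} ρ π {z} gz with split Γ (B ⊕ C ∷ Θ₁ ++ Θ₂) z gz
  ... | γ , (k , θ) , refl , gγ , (gk , gθ) = ~trans
    (commuteʳ {A} {C} {Θ₁} {Θ₂} {B ⊕ C ∷ Θ₁ ++ Θ₂} {Γ} ρ π (ex (toFront (A ⁻) (B ⊕ C ∷ Θ₁) Θ₂) (⊕₂r π)) {θ} {k , θ} {γ}
      gθ (gk , gθ) gγ (inj₁-Fn {dual ⌜ C ⌝} {dual ⌜ B ⌝} gk) (↭-++-comm (proj₁ k) (gr ⌈ Θ₁ ++ Θ₂ ⌉ θ))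
      (λ a ga → sem-⊕₂ π gk (perm-Good (shift (A ⁻) Θ₁ Θ₂) (ga , gθ))))
    (~trans (~sym (sem-⊕₂ κ gk (app-Good Γ (Θ₁ ++ Θ₂) gγ gθ)))
    (≡⇒~ (cong (sem (⊕₂r {B} {C} κ)) (sym (perm-unshift (B ⊕ C) Γ (Θ₁ ++ Θ₂) γ θ k)))))
    where
    κ = ex (toFront C Γ (Θ₁ ++ Θ₂)) (cut ρ (ex (toFront (A ⁻) (C ∷ Θ₁) Θ₂) π))

  perm-reflexive-trans : ∀ {Γ Δ Σ : List Fm} (e : Γ ≡ Δ) (e' : Δ ≡ Σ) γ →
    perm (↭-reflexive (trans e e')) γ ≡ perm (↭-reflexive e) (perm (↭-reflexive e') γ)
  perm-reflexive-trans refl refl γ = refl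

  perm-reflexiveʳ : ∀ {Γ Γ'} Δ (e : Γ ≡ Γ') γ δ →
    perm (↭-reflexive (cong (_++ Δ) e)) (app Γ' Δ γ δ) ≡ app Γ Δ (perm (↭-reflexive e) γ) δ
  perm-reflexiveʳ Δ refl γ δ = refl

  perm-reflexiveˡ : ∀ Γ {Δ Δ'} (e : Δ ≡ Δ') γ δ →
    perm (↭-reflexive (cong (Γ ++_) e)) (app Γ Δ' γ δ) ≡ app Γ Δ γ (perm (↭-reflexive e) δ)
  perm-reflexiveˡ Γ refl γ δ = refl

  perm-perm1 : ∀ Θ₁ Θ₂ Δ Γ₂ θ₁ θ₂ δ (γ₂ : Env Γ₂) →
    perm (perm1 Θ₁ Θ₂ Δ Γ₂) (app (Θ₁ ++ (Θ₂ ++ Γ₂)) Δ (app Θ₁ (Θ₂ ++ Γ₂) θ₁ (app Θ₂ Γ₂ θ₂ γ₂)) δ)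
    ≡ app ((Θ₁ ++ Θ₂) ++ Δ) Γ₂ (app (Θ₁ ++ Θ₂) Δ (app Θ₁ Θ₂ θ₁ θ₂) δ) γ₂
  perm-perm1 Θ₁ Θ₂ Δ Γ₂ θ₁ θ₂ δ γ₂ = trans
    (cong (λ v → p₁ (p₂ (p₃ v))) (trans (perm-++ʳ Δ (↭-reflexive (++-assoc Θ₁ Θ₂ Γ₂)) _ δ)
      (cong (λ v → app ((Θ₁ ++ Θ₂) ++ Γ₂) Δ v δ) (perm-assoc Θ₁ Θ₂ Γ₂ θ₁ θ₂ γ₂)))) (trans
    (cong (λ v → p₁ (p₂ v)) (perm-assoc' (Θ₁ ++ Θ₂) Γ₂ Δ (app Θ₁ Θ₂ θ₁ θ₂) γ₂ δ)) (trans
    (cong p₁ (trans (perm-++ˡ (Θ₁ ++ Θ₂) (↭-++-comm Δ Γ₂) _ _) (cong (app (Θ₁ ++ Θ₂) _ (app Θ₁ Θ₂ θ₁ θ₂)) (perm-comm Δ Γ₂ δ γ₂))))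
    (perm-assoc (Θ₁ ++ Θ₂) Δ Γ₂ (app Θ₁ Θ₂ θ₁ θ₂) δ γ₂)))
    where
    p₁ = perm (↭-reflexive (++-assoc (Θ₁ ++ Θ₂) Δ Γ₂))
    p₂ = perm (++⁺ˡ (Θ₁ ++ Θ₂) (↭-++-comm Δ Γ₂))
    p₃ = perm (↭-reflexive (sym (++-assoc (Θ₁ ++ Θ₂) Γ₂ Δ)))

  perm-eq2 : ∀ Γ₁ Θ₁ Θ₂ Δ γ₁ θ₁ θ₂ (δ : Env Δ) →
    perm (↭-reflexive (eq2 Γ₁ Θ₁ Θ₂ Δ)) (app ((Γ₁ ++ Θ₁) ++ Θ₂) Δ (app (Γ₁ ++ Θ₁) Θ₂ (app Γ₁ Θ₁ γ₁ θ₁) θ₂) δ)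
    ≡ app Γ₁ ((Θ₁ ++ Θ₂) ++ Δ) γ₁ (app (Θ₁ ++ Θ₂) Δ (app Θ₁ Θ₂ θ₁ θ₂) δ)
  perm-eq2 Γ₁ Θ₁ Θ₂ Δ γ₁ θ₁ θ₂ δ = trans
    (perm-reflexive-trans (sym (++-assoc Γ₁ (Θ₁ ++ Θ₂) Δ)) (cong (_++ Δ) (sym (++-assoc Γ₁ Θ₁ Θ₂))) _) (trans
    (cong (perm (↭-reflexive (sym (++-assoc Γ₁ (Θ₁ ++ Θ₂) Δ))))
      (trans (perm-reflexiveʳ Δ (sym (++-assoc Γ₁ Θ₁ Θ₂)) _ δ)
        (cong (λ v → app (Γ₁ ++ (Θ₁ ++ Θ₂)) Δ v δ) (perm-assoc' Γ₁ Θ₁ Θ₂ γ₁ θ₁ θ₂))))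
    (perm-assoc' Γ₁ (Θ₁ ++ Θ₂) Δ γ₁ (app Θ₁ Θ₂ θ₁ θ₂) δ))

  perm-eq3 : ∀ Γ Θ₁ Θ₂ Γ₂ γ θ₁ θ₂ (γ₂ : Env Γ₂) →
    perm (↭-reflexive (eq3 Γ Θ₁ Θ₂ Γ₂)) (app Γ (Θ₁ ++ (Θ₂ ++ Γ₂)) γ (app Θ₁ (Θ₂ ++ Γ₂) θ₁ (app Θ₂ Γ₂ θ₂ γ₂)))
    ≡ app (Γ ++ (Θ₁ ++ Θ₂)) Γ₂ (app Γ (Θ₁ ++ Θ₂) γ (app Θ₁ Θ₂ θ₁ θ₂)) γ₂
  perm-eq3 Γ Θ₁ Θ₂ Γ₂ γ θ₁ θ₂ γ₂ = trans
    (perm-reflexive-trans (++-assoc Γ (Θ₁ ++ Θ₂) Γ₂) (cong (Γ ++_) (++-assoc Θ₁ Θ₂ Γ₂)) _) (trans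
    (cong (perm (↭-reflexive (++-assoc Γ (Θ₁ ++ Θ₂) Γ₂)))
      (trans (perm-reflexiveˡ Γ (++-assoc Θ₁ Θ₂ Γ₂) γ _)
        (cong (app Γ _ γ) (perm-assoc Θ₁ Θ₂ Γ₂ θ₁ θ₂ γ₂))))
    (perm-assoc Γ (Θ₁ ++ Θ₂) Γ₂ γ (app Θ₁ Θ₂ θ₁ θ₂) γ₂))

  perm-perm4 : ∀ Γ₁ Γ Θ₁ Θ₂ γ₁ γ θ₁ (θ₂ : Env Θ₂) →
    perm (perm4 Γ₁ Γ Θ₁ Θ₂) (app Γ ((Γ₁ ++ Θ₁) ++ Θ₂) γ (app (Γ₁ ++ Θ₁) Θ₂ (app Γ₁ Θ₁ γ₁ θ₁) θ₂))
    ≡ app Γ₁ (Γ ++ (Θ₁ ++ Θ₂)) γ₁ (app Γ (Θ₁ ++ Θ₂) γ (app Θ₁ Θ₂ θ₁ θ₂))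
  perm-perm4 Γ₁ Γ Θ₁ Θ₂ γ₁ γ θ₁ θ₂ = trans
    (cong (λ v → p₁ (p₂ (p₃ v))) (trans (perm-reflexiveˡ Γ (sym (++-assoc Γ₁ Θ₁ Θ₂)) γ _)
      (cong (app Γ _ γ) (perm-assoc' Γ₁ Θ₁ Θ₂ γ₁ θ₁ θ₂)))) (trans
    (cong (λ v → p₁ (p₂ v)) (perm-assoc Γ Γ₁ (Θ₁ ++ Θ₂) γ γ₁ (app Θ₁ Θ₂ θ₁ θ₂))) (trans
    (cong p₁ (trans (perm-++ʳ (Θ₁ ++ Θ₂) (↭-++-comm Γ₁ Γ) _ _) (cong (λ v → app (Γ₁ ++ Γ) (Θ₁ ++ Θ₂) v (app Θ₁ Θ₂ θ₁ θ₂)) (perm-comm Γ₁ Γ γ₁ γ))))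
    (perm-assoc' Γ₁ Γ (Θ₁ ++ Θ₂) γ₁ γ (app Θ₁ Θ₂ θ₁ θ₂))))
    where
    p₁ = perm (↭-reflexive (sym (++-assoc Γ₁ Γ (Θ₁ ++ Θ₂))))
    p₂ = perm (++⁺ʳ (Θ₁ ++ Θ₂) (↭-++-comm Γ₁ Γ))
    p₃ = perm (↭-reflexive (++-assoc Γ Γ₁ (Θ₁ ++ Θ₂)))

  perm-insert₁ : ∀ A Θ₁ Θ₂ Γ₂ a θ₁ θ₂ (γ₂ : Env Γ₂) →
    perm (↭-reflexive (++-assoc Θ₁ (A ∷ Θ₂) Γ₂)) (perm (shift A Θ₁ (Θ₂ ++ Γ₂)) (a , app Θ₁ (Θ₂ ++ Γ₂) θ₁ (app Θ₂ Γ₂ θ₂ γ₂)))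
    ≡ app (Θ₁ ++ A ∷ Θ₂) Γ₂ (perm (shift A Θ₁ Θ₂) (a , app Θ₁ Θ₂ θ₁ θ₂)) γ₂
  perm-insert₁ A Θ₁ Θ₂ Γ₂ a θ₁ θ₂ γ₂ = trans
    (cong (perm (↭-reflexive (++-assoc Θ₁ (A ∷ Θ₂) Γ₂))) (perm-shift A Θ₁ (Θ₂ ++ Γ₂) θ₁ (app Θ₂ Γ₂ θ₂ γ₂) a)) (trans
    (perm-assoc Θ₁ (A ∷ Θ₂) Γ₂ θ₁ (a , θ₂) γ₂)
    (cong (λ v → app (Θ₁ ++ A ∷ Θ₂) Γ₂ v γ₂) (sym (perm-shift A Θ₁ Θ₂ θ₁ θ₂ a))))

  perm-insert₂ : ∀ A Γ₁ Θ₁ Θ₂ a γ₁ θ₁ (θ₂ : Env Θ₂) →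
    perm (↭-reflexive (sym (++-assoc Γ₁ Θ₁ (A ∷ Θ₂)))) (perm (shift A (Γ₁ ++ Θ₁) Θ₂) (a , app (Γ₁ ++ Θ₁) Θ₂ (app Γ₁ Θ₁ γ₁ θ₁) θ₂))
    ≡ app Γ₁ (Θ₁ ++ A ∷ Θ₂) γ₁ (perm (shift A Θ₁ Θ₂) (a , app Θ₁ Θ₂ θ₁ θ₂))
  perm-insert₂ A Γ₁ Θ₁ Θ₂ a γ₁ θ₁ θ₂ = trans
    (cong (perm (↭-reflexive (sym (++-assoc Γ₁ Θ₁ (A ∷ Θ₂))))) (perm-shift A (Γ₁ ++ Θ₁) Θ₂ (app Γ₁ Θ₁ γ₁ θ₁) θ₂ a)) (trans
    (perm-assoc' Γ₁ Θ₁ (A ∷ Θ₂) γ₁ θ₁ (a , θ₂))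
    (cong (app Γ₁ (Θ₁ ++ A ∷ Θ₂) γ₁) (sym (perm-shift A Θ₁ Θ₂ θ₁ θ₂ a))))

  split₃ : ∀ Γ Δ Σ (z : Env (Γ ++ (Δ ++ Σ))) → Good ⌈ Γ ++ (Δ ++ Σ) ⌉ z →
    ∃ λ γ → ∃ λ δ → ∃ λ σ → z ≡ app Γ (Δ ++ Σ) γ (app Δ Σ δ σ) × Good ⌈ Γ ⌉ γ × Good ⌈ Δ ⌉ δ × Good ⌈ Σ ⌉ σ
  split₃ Γ Δ Σ z g with split Γ (Δ ++ Σ) z g
  ... | γ , δσ , refl , gγ , g' with split Δ Σ δσ g'
  ... | δ , σ , refl , gδ , gσ = γ , δ , σ , refl , gγ , gδ , gσ

  split₃' : ∀ Γ Δ Σ (z : Env ((Γ ++ Δ) ++ Σ)) → Good ⌈ (Γ ++ Δ) ++ Σ ⌉ z →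
    ∃ λ γ → ∃ λ δ → ∃ λ σ → z ≡ app (Γ ++ Δ) Σ (app Γ Δ γ δ) σ × Good ⌈ Γ ⌉ γ × Good ⌈ Δ ⌉ δ × Good ⌈ Σ ⌉ σ
  split₃' Γ Δ Σ z g with split (Γ ++ Δ) Σ z g
  ... | γδ , σ , refl , g' , gσ with split Γ Δ γδ g'
  ... | γ , δ , refl , gγ , gδ = γ , δ , σ , refl , gγ , gδ , gσ

  app-gr₃ : ∀ Γ Δ Σ γ δ (σ : Env Σ) → gr ⌈ Γ ++ (Δ ++ Σ) ⌉ (app Γ (Δ ++ Σ) γ (app Δ Σ δ σ)) ↭
            gr ⌈ Γ ++ Δ ⌉ (app Γ Δ γ δ) ++ gr ⌈ Σ ⌉ σ
  app-gr₃ Γ Δ Σ γ δ σ = ↭-reflexive (trans (app-gr Γ (Δ ++ Σ) γ (app Δ Σ δ σ)) (trans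
    (cong (gr ⌈ Γ ⌉ γ ++_) (app-gr Δ Σ δ σ)) (trans (sym (++-assoc (gr ⌈ Γ ⌉ γ) _ _))
    (cong (_++ gr ⌈ Σ ⌉ σ) (sym (app-gr Γ Δ γ δ))))))

  app-gr₃' : ∀ Γ Δ Σ γ δ (σ : Env Σ) → gr ⌈ (Γ ++ Δ) ++ Σ ⌉ (app (Γ ++ Δ) Σ (app Γ Δ γ δ) σ) ↭
             gr ⌈ Δ ++ Σ ⌉ (app Δ Σ δ σ) ++ gr ⌈ Γ ⌉ γ
  app-gr₃' Γ Δ Σ γ δ σ = ↭-trans (↭-reflexive (trans (app-gr (Γ ++ Δ) Σ (app Γ Δ γ δ) σ) (trans
    (cong (_++ gr ⌈ Σ ⌉ σ) (app-gr Γ Δ γ δ)) (trans (++-assoc (gr ⌈ Γ ⌉ γ) _ _)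
    (cong (gr ⌈ Γ ⌉ γ ++_) (sym (app-gr Δ Σ δ σ))))))) (↭-++-comm (gr ⌈ Γ ⌉ γ) _)

  s-c-cutˡ₁ : ∀ {A B Θ₁ Θ₂ Γ₂ Δ} (π₁ : ⊢ B ∷ Θ₁ ++ A ∷ Θ₂) (π₂ : ⊢ B ⁻ ∷ Γ₂) (ρ : ⊢ A ⁻ ∷ Δ) →
    tr (cut (ex (↭-trans (↭-reflexive (++-assoc Θ₁ (A ∷ Θ₂) Γ₂)) (toFront A Θ₁ (Θ₂ ++ Γ₂))) (cut π₁ π₂)) ρ) ≋
    tr (ex (perm1 Θ₁ Θ₂ Δ Γ₂) (cut (cut (ex (toFront A (B ∷ Θ₁) Θ₂) π₁) ρ) π₂))
  s-c-cutˡ₁ {A} {B} {Θ₁} {Θ₂} {Γ₂} {Δ} π₁ π₂ ρ {z} gz with split (Θ₁ ++ (Θ₂ ++ Γ₂)) Δ z gz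
  ... | ξ , δ , refl , gξ , gδ with split₃ Θ₁ Θ₂ Γ₂ ξ gξ
  ... | θ₁ , θ₂ , γ₂ , refl , gθ₁ , gθ₂ , gγ₂ = ~trans
    (commuteˡ {A} {B} {Θ₁} {Θ₂} {Θ₁ ++ (Θ₂ ++ Γ₂)} {Δ} π₁ κ ρ {K = co {B} π₂ γ₂}
      (app-Good Θ₁ Θ₂ gθ₁ gθ₂) gξ gδ (co-Fn {B} π₂ gγ₂) (app-gr₃ Θ₁ Θ₂ Γ₂ θ₁ θ₂ γ₂)
      (λ a ga → ≡⇒~ (trans (cong (sem (cut π₁ π₂)) (perm-insert₁ A Θ₁ Θ₂ Γ₂ a θ₁ θ₂ γ₂))
        (sem-cut {B} {Θ₁ ++ A ∷ Θ₂} {Γ₂} π₁ π₂ (perm (shift A Θ₁ Θ₂) (a , app Θ₁ Θ₂ θ₁ θ₂)) γ₂))))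
    (≡⇒~ (trans (sym (sem-cut {B} {(Θ₁ ++ Θ₂) ++ Δ} {Γ₂} π₁' π₂ (app (Θ₁ ++ Θ₂) Δ (app Θ₁ Θ₂ θ₁ θ₂) δ) γ₂))
      (cong (sem (cut π₁' π₂)) (sym (perm-perm1 Θ₁ Θ₂ Δ Γ₂ θ₁ θ₂ δ γ₂)))))
    where
    κ = ex (↭-trans (↭-reflexive (++-assoc Θ₁ (A ∷ Θ₂) Γ₂)) (toFront A Θ₁ (Θ₂ ++ Γ₂))) (cut π₁ π₂)
    π₁' : ⊢ B ∷ (Θ₁ ++ Θ₂) ++ Δ
    π₁' = cut (ex (toFront A (B ∷ Θ₁) Θ₂) π₁) ρ

  s-c-cutˡ₂ : ∀ {A B Γ₁ Θ₁ Θ₂ Δ} (π₁ : ⊢ B ∷ Γ₁) (π₂ : ⊢ B ⁻ ∷ Θ₁ ++ A ∷ Θ₂) (ρ : ⊢ A ⁻ ∷ Δ) →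
    tr (cut (ex (↭-trans (↭-reflexive (sym (++-assoc Γ₁ Θ₁ (A ∷ Θ₂)))) (toFront A (Γ₁ ++ Θ₁) Θ₂)) (cut π₁ π₂)) ρ) ≋
    tr (ex (↭-reflexive (eq2 Γ₁ Θ₁ Θ₂ Δ)) (cut π₁ (cut (ex (toFront A (B ⁻ ∷ Θ₁) Θ₂) π₂) ρ)))
  s-c-cutˡ₂ {A} {B} {Γ₁} {Θ₁} {Θ₂} {Δ} π₁ π₂ ρ {z} gz with split ((Γ₁ ++ Θ₁) ++ Θ₂) Δ z gz
  ... | ξ , δ , refl , gξ , gδ with split₃' Γ₁ Θ₁ Θ₂ ξ gξ
  ... | γ₁ , θ₁ , θ₂ , refl , gγ₁ , gθ₁ , gθ₂ = ~trans
    (commuteˡ {A} {B ⁻} {Θ₁} {Θ₂} {(Γ₁ ++ Θ₁) ++ Θ₂} {Δ} π₂ κ ρ {K = oc {B} π₁ γ₁}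
      gθ gξ gδ (oc-Fn {B} π₁ gγ₁) (app-gr₃' Γ₁ Θ₁ Θ₂ γ₁ θ₁ θ₂)
      (λ a ga → ~trans (≡⇒~ (cong (sem (cut π₁ π₂)) (perm-insert₂ A Γ₁ Θ₁ Θ₂ a γ₁ θ₁ θ₂)))
        (sem-cutʳ {B} {Γ₁} {Θ₁ ++ A ∷ Θ₂} π₁ π₂ (Good-E ⌈ Γ₁ ⌉ gγ₁)
          (Good-E ⌈ Θ₁ ++ A ∷ Θ₂ ⌉ (perm-Good (shift A Θ₁ Θ₂) (ga , gθ))))))
    (~trans (~sym (sem-cutʳ {B} {Γ₁} {(Θ₁ ++ Θ₂) ++ Δ} π₁ π₂' (Good-E ⌈ Γ₁ ⌉ gγ₁)
       (Good-E ⌈ (Θ₁ ++ Θ₂) ++ Δ ⌉ (app-Good (Θ₁ ++ Θ₂) Δ gθ gδ))))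
      (≡⇒~ (cong (sem (cut π₁ π₂')) (sym (perm-eq2 Γ₁ Θ₁ Θ₂ Δ γ₁ θ₁ θ₂ δ)))))
    where
    κ = ex (↭-trans (↭-reflexive (sym (++-assoc Γ₁ Θ₁ (A ∷ Θ₂)))) (toFront A (Γ₁ ++ Θ₁) Θ₂)) (cut π₁ π₂)
    π₂' : ⊢ B ⁻ ∷ (Θ₁ ++ Θ₂) ++ Δ
    π₂' = cut (ex (toFront A (B ⁻ ∷ Θ₁) Θ₂) π₂) ρ
    gθ = app-Good Θ₁ Θ₂ gθ₁ gθ₂

  s-c-cutʳ₁ : ∀ {A B Γ Θ₁ Θ₂ Γ₂} (ρ : ⊢ A ∷ Γ) (π₁ : ⊢ B ∷ Θ₁ ++ A ⁻ ∷ Θ₂) (π₂ : ⊢ B ⁻ ∷ Γ₂) →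
    tr (cut ρ (ex (↭-trans (↭-reflexive (++-assoc Θ₁ (A ⁻ ∷ Θ₂) Γ₂)) (toFront (A ⁻) Θ₁ (Θ₂ ++ Γ₂))) (cut π₁ π₂))) ≋
    tr (ex (↭-reflexive (eq3 Γ Θ₁ Θ₂ Γ₂))
      (cut (ex (toFront B Γ (Θ₁ ++ Θ₂)) (cut ρ (ex (toFront (A ⁻) (B ∷ Θ₁) Θ₂) π₁))) π₂))
  s-c-cutʳ₁ {A} {B} {Γ} {Θ₁} {Θ₂} {Γ₂} ρ π₁ π₂ {z} gz with split Γ (Θ₁ ++ (Θ₂ ++ Γ₂)) z gz
  ... | γ , ξ , refl , gγ , gξ with split₃ Θ₁ Θ₂ Γ₂ ξ gξ
  ... | θ₁ , θ₂ , γ₂ , refl , gθ₁ , gθ₂ , gγ₂ = ~trans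
    (commuteʳ {A} {B} {Θ₁} {Θ₂} {Θ₁ ++ (Θ₂ ++ Γ₂)} {Γ} ρ π₁ κ {K = co {B} π₂ γ₂}
      (app-Good Θ₁ Θ₂ gθ₁ gθ₂) gξ gγ (co-Fn {B} π₂ gγ₂) (app-gr₃ Θ₁ Θ₂ Γ₂ θ₁ θ₂ γ₂)
      (λ a ga → ≡⇒~ (trans (cong (sem (cut π₁ π₂)) (perm-insert₁ (A ⁻) Θ₁ Θ₂ Γ₂ a θ₁ θ₂ γ₂))
        (sem-cut {B} {Θ₁ ++ A ⁻ ∷ Θ₂} {Γ₂} π₁ π₂ (perm (shift (A ⁻) Θ₁ Θ₂) (a , app Θ₁ Θ₂ θ₁ θ₂)) γ₂))))
    (≡⇒~ (trans (sym (sem-cut {B} {Γ ++ (Θ₁ ++ Θ₂)} {Γ₂} π₁' π₂ (app Γ (Θ₁ ++ Θ₂) γ (app Θ₁ Θ₂ θ₁ θ₂)) γ₂))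
      (cong (sem (cut π₁' π₂)) (sym (perm-eq3 Γ Θ₁ Θ₂ Γ₂ γ θ₁ θ₂ γ₂)))))
    where
    κ = ex (↭-trans (↭-reflexive (++-assoc Θ₁ (A ⁻ ∷ Θ₂) Γ₂)) (toFront (A ⁻) Θ₁ (Θ₂ ++ Γ₂))) (cut π₁ π₂)
    π₁' : ⊢ B ∷ Γ ++ (Θ₁ ++ Θ₂)
    π₁' = ex (toFront B Γ (Θ₁ ++ Θ₂)) (cut ρ (ex (toFront (A ⁻) (B ∷ Θ₁) Θ₂) π₁))

  s-c-cutʳ₂ : ∀ {A B Γ Γ₁ Θ₁ Θ₂} (ρ : ⊢ A ∷ Γ) (π₁ : ⊢ B ∷ Γ₁) (π₂ : ⊢ B ⁻ ∷ Θ₁ ++ A ⁻ ∷ Θ₂) →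
    tr (cut ρ (ex (↭-trans (↭-reflexive (sym (++-assoc Γ₁ Θ₁ (A ⁻ ∷ Θ₂)))) (toFront (A ⁻) (Γ₁ ++ Θ₁) Θ₂)) (cut π₁ π₂))) ≋
    tr (ex (perm4 Γ₁ Γ Θ₁ Θ₂)
      (cut π₁ (ex (toFront (B ⁻) Γ (Θ₁ ++ Θ₂)) (cut ρ (ex (toFront (A ⁻) (B ⁻ ∷ Θ₁) Θ₂) π₂)))))
  s-c-cutʳ₂ {A} {B} {Γ} {Γ₁} {Θ₁} {Θ₂} ρ π₁ π₂ {z} gz with split Γ ((Γ₁ ++ Θ₁) ++ Θ₂) z gz
  ... | γ , ξ , refl , gγ , gξ with split₃' Γ₁ Θ₁ Θ₂ ξ gξ
  ... | γ₁ , θ₁ , θ₂ , refl , gγ₁ , gθ₁ , gθ₂ = ~trans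
    (commuteʳ {A} {B ⁻} {Θ₁} {Θ₂} {(Γ₁ ++ Θ₁) ++ Θ₂} {Γ} ρ π₂ κ {K = oc {B} π₁ γ₁}
      gθ gξ gγ (oc-Fn {B} π₁ gγ₁) (app-gr₃' Γ₁ Θ₁ Θ₂ γ₁ θ₁ θ₂)
      (λ a ga → ~trans (≡⇒~ (cong (sem (cut π₁ π₂)) (perm-insert₂ (A ⁻) Γ₁ Θ₁ Θ₂ a γ₁ θ₁ θ₂)))
        (sem-cutʳ {B} {Γ₁} {Θ₁ ++ A ⁻ ∷ Θ₂} π₁ π₂ (Good-E ⌈ Γ₁ ⌉ gγ₁)
          (Good-E ⌈ Θ₁ ++ A ⁻ ∷ Θ₂ ⌉ (perm-Good (shift (A ⁻) Θ₁ Θ₂) (ga , gθ))))))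
    (~trans (~sym (sem-cutʳ {B} {Γ₁} {Γ ++ (Θ₁ ++ Θ₂)} π₁ π₂' (Good-E ⌈ Γ₁ ⌉ gγ₁)
       (Good-E ⌈ Γ ++ (Θ₁ ++ Θ₂) ⌉ (app-Good Γ (Θ₁ ++ Θ₂) gγ gθ))))
      (≡⇒~ (cong (sem (cut π₁ π₂')) (sym (perm-perm4 Γ₁ Γ Θ₁ Θ₂ γ₁ γ θ₁ θ₂)))))
    where
    κ = ex (↭-trans (↭-reflexive (sym (++-assoc Γ₁ Θ₁ (A ⁻ ∷ Θ₂)))) (toFront (A ⁻) (Γ₁ ++ Θ₁) Θ₂)) (cut π₁ π₂)
    π₂' : ⊢ B ⁻ ∷ Γ ++ (Θ₁ ++ Θ₂)
    π₂' = ex (toFront (B ⁻) Γ (Θ₁ ++ Θ₂)) (cut ρ (ex (toFront (A ⁻) (B ⁻ ∷ Θ₁) Θ₂) π₂))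
    gθ = app-Good Θ₁ Θ₂ gθ₁ gθ₂

  tens₁' : ∀ a q → Val (pst (par q (dual a))) → Fun a → Fun q
  tens₁' a q k F = proj₁ k ++ proj₁ F , λ y → br a F (proj₁ k ++ gr q y , λ x → proj₂ k (y , x))

  tens₁'-Fn : ∀ {a q k F} → Good (pst (par q (dual a))) k → Fn a (proj₂ F) (proj₁ F) →
              Fn q (proj₂ (tens₁' a q k F)) (proj₁ (tens₁' a q k F))
  tens₁'-Fn {a} {q} {k} {F} gk G = br-Fnʳ a {q} {λ (x , y) → proj₂ k (y , x)} {λ y → proj₁ k ++ gr q y} {proj₁ k} {F}
    (flip-Fn (good⁻ gk)) (λ _ → ↭-refl) G

  -- `sem-⊗` makes the first premise the outermost cut. Fubini puts the second outermost instead, as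
  -- `commute` requires when the cut formula lies in the context of the second premise.
  sem-⊗' : ∀ {A B Γ Δ} (π : ⊢ A ∷ Γ) (ρ : ⊢ B ∷ Δ) {k γ δ} →
           Good ⌜ A ⊗ B ⌝ k → Good ⌈ Γ ⌉ γ → Good ⌈ Δ ⌉ δ →
           sem (⊗r π ρ) (k , app Γ Δ γ δ) ~ br ⌜ B ⌝ (fun ρ δ) (tens₁' ⌜ A ⌝ (dual ⌜ B ⌝) k (fun π γ))
  sem-⊗' {A} {B} π ρ {k} {γ} {δ} gk gγ gδ = ~trans (sem-⊗ π ρ gk gγ gδ)
    (fubiniˡʳ ⌜ A ⌝ ⌜ B ⌝ (λ x y → proj₂ k (y , x)) {S₂ = λ x → proj₁ k ++ gr (dual ⌜ A ⌝) x}
      {S₄ = λ y → proj₁ k ++ gr (dual ⌜ B ⌝) y} {w = proj₁ k} {r = fun π γ} {k = fun ρ δ}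
      (λ p q → proj₁ gk (q , p)) (fun-Fn π gγ) (fun-Fn ρ gδ)
      ↭-refl (λ _ → ↭-refl) ↭-refl (λ _ → ↭-refl))

  swap-ann : ∀ a b c → a ++ (b ++ c) ↭ b ++ (a ++ c)
  swap-ann = solve 3 (λ a b c → a :+ (b :+ c) ⊜ b :+ (a :+ c)) ↭-refl

  s-c-⊗ˡ₁ : ∀ {A B C Θ₁ Θ₂ Γ₂ Δ} (π₁ : ⊢ B ∷ Θ₁ ++ A ∷ Θ₂) (π₂ : ⊢ C ∷ Γ₂) (ρ : ⊢ A ⁻ ∷ Δ) →
    tr (cut (ex (↭-trans (prep (B ⊗ C) (↭-reflexive (++-assoc Θ₁ (A ∷ Θ₂) Γ₂)))
                         (toFront A (B ⊗ C ∷ Θ₁) (Θ₂ ++ Γ₂))) (⊗r π₁ π₂)) ρ) ≋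
    tr (ex (prep (B ⊗ C) (perm1 Θ₁ Θ₂ Δ Γ₂)) (⊗r (cut (ex (toFront A (B ∷ Θ₁) Θ₂) π₁) ρ) π₂))
  s-c-⊗ˡ₁ {A} {B} {C} {Θ₁} {Θ₂} {Γ₂} {Δ} π₁ π₂ ρ {k , z} (gk , gz) with split (Θ₁ ++ (Θ₂ ++ Γ₂)) Δ z gz
  ... | ξ , δ , refl , gξ , gδ with split₃ Θ₁ Θ₂ Γ₂ ξ gξ
  ... | θ₁ , θ₂ , γ₂ , refl , gθ₁ , gθ₂ , gγ₂ = ~trans
    (commuteˡ {A} {B} {Θ₁} {Θ₂} {B ⊗ C ∷ Θ₁ ++ (Θ₂ ++ Γ₂)} {Δ} π₁ κ ρ {ξ = k , app Θ₁ (Θ₂ ++ Γ₂) θ₁ (app Θ₂ Γ₂ θ₂ γ₂)} {K = K}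
      gθ (gk , gξ) gδ (tens₁-Fn {dual ⌜ B ⌝} {⌜ C ⌝} {k} gk (fun-Fn π₂ gγ₂))
      (↭-trans (++⁺ˡ (proj₁ k) (app-gr₃ Θ₁ Θ₂ Γ₂ θ₁ θ₂ γ₂)) (swap-ann (proj₁ k) (gr ⌈ Θ₁ ++ Θ₂ ⌉ (app Θ₁ Θ₂ θ₁ θ₂)) (gr ⌈ Γ₂ ⌉ γ₂)))
      (λ a ga → ~trans (≡⇒~ (cong (λ v → sem (⊗r π₁ π₂) (k , v)) (perm-insert₁ A Θ₁ Θ₂ Γ₂ a θ₁ θ₂ γ₂)))
        (sem-⊗ {B} {C} {Θ₁ ++ A ∷ Θ₂} {Γ₂} π₁ π₂ gk (perm-Good (shift A Θ₁ Θ₂) (ga , gθ)) gγ₂)))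
    (~trans (~sym (sem-⊗ {B} {C} {(Θ₁ ++ Θ₂) ++ Δ} {Γ₂} π₁' π₂ gk (app-Good (Θ₁ ++ Θ₂) Δ gθ gδ) gγ₂))
      (≡⇒~ (cong (λ v → sem (⊗r π₁' π₂) (k , v)) (sym (perm-perm1 Θ₁ Θ₂ Δ Γ₂ θ₁ θ₂ δ γ₂)))))
    where
    K = tens₁ (dual ⌜ B ⌝) ⌜ C ⌝ k (fun π₂ γ₂)
    κ = ex (↭-trans (prep (B ⊗ C) (↭-reflexive (++-assoc Θ₁ (A ∷ Θ₂) Γ₂))) (toFront A (B ⊗ C ∷ Θ₁) (Θ₂ ++ Γ₂))) (⊗r π₁ π₂)
    π₁' : ⊢ B ∷ (Θ₁ ++ Θ₂) ++ Δ
    π₁' = cut (ex (toFront A (B ∷ Θ₁) Θ₂) π₁) ρ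
    gθ = app-Good Θ₁ Θ₂ gθ₁ gθ₂

  s-c-⊗ˡ₂ : ∀ {A B C Γ₁ Θ₁ Θ₂ Δ} (π₁ : ⊢ B ∷ Γ₁) (π₂ : ⊢ C ∷ Θ₁ ++ A ∷ Θ₂) (ρ : ⊢ A ⁻ ∷ Δ) →
    tr (cut (ex (↭-trans (prep (B ⊗ C) (↭-reflexive (sym (++-assoc Γ₁ Θ₁ (A ∷ Θ₂)))))
                         (toFront A (B ⊗ C ∷ Γ₁ ++ Θ₁) Θ₂)) (⊗r π₁ π₂)) ρ) ≋
    tr (ex (prep (B ⊗ C) (↭-reflexive (eq2 Γ₁ Θ₁ Θ₂ Δ))) (⊗r π₁ (cut (ex (toFront A (C ∷ Θ₁) Θ₂) π₂) ρ)))
  s-c-⊗ˡ₂ {A} {B} {C} {Γ₁} {Θ₁} {Θ₂} {Δ} π₁ π₂ ρ {k , z} (gk , gz) with split ((Γ₁ ++ Θ₁) ++ Θ₂) Δ z gz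
  ... | ξ , δ , refl , gξ , gδ with split₃' Γ₁ Θ₁ Θ₂ ξ gξ
  ... | γ₁ , θ₁ , θ₂ , refl , gγ₁ , gθ₁ , gθ₂ = ~trans
    (commuteˡ {A} {C} {Θ₁} {Θ₂} {B ⊗ C ∷ (Γ₁ ++ Θ₁) ++ Θ₂} {Δ} π₂ κ ρ {ξ = k , app (Γ₁ ++ Θ₁) Θ₂ (app Γ₁ Θ₁ γ₁ θ₁) θ₂} {K = K}
      gθ (gk , gξ) gδ (tens₁'-Fn {⌜ B ⌝} {dual ⌜ C ⌝} {k} gk (fun-Fn π₁ gγ₁))
      (↭-trans (++⁺ˡ (proj₁ k) (app-gr₃' Γ₁ Θ₁ Θ₂ γ₁ θ₁ θ₂)) (swap-ann (proj₁ k) (gr ⌈ Θ₁ ++ Θ₂ ⌉ (app Θ₁ Θ₂ θ₁ θ₂)) (gr ⌈ Γ₁ ⌉ γ₁)))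
      (λ a ga → ~trans (≡⇒~ (cong (λ v → sem (⊗r π₁ π₂) (k , v)) (perm-insert₂ A Γ₁ Θ₁ Θ₂ a γ₁ θ₁ θ₂)))
        (sem-⊗' {B} {C} {Γ₁} {Θ₁ ++ A ∷ Θ₂} π₁ π₂ gk gγ₁ (perm-Good (shift A Θ₁ Θ₂) (ga , gθ)))))
    (~trans (~sym (sem-⊗' {B} {C} {Γ₁} {(Θ₁ ++ Θ₂) ++ Δ} π₁ π₂' gk gγ₁ (app-Good (Θ₁ ++ Θ₂) Δ gθ gδ)))
      (≡⇒~ (cong (λ v → sem (⊗r π₁ π₂') (k , v)) (sym (perm-eq2 Γ₁ Θ₁ Θ₂ Δ γ₁ θ₁ θ₂ δ)))))
    where
    K = tens₁' ⌜ B ⌝ (dual ⌜ C ⌝) k (fun π₁ γ₁)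
    κ = ex (↭-trans (prep (B ⊗ C) (↭-reflexive (sym (++-assoc Γ₁ Θ₁ (A ∷ Θ₂))))) (toFront A (B ⊗ C ∷ Γ₁ ++ Θ₁) Θ₂)) (⊗r π₁ π₂)
    π₂' : ⊢ C ∷ (Θ₁ ++ Θ₂) ++ Δ
    π₂' = cut (ex (toFront A (C ∷ Θ₁) Θ₂) π₂) ρ
    gθ = app-Good Θ₁ Θ₂ gθ₁ gθ₂

  s-c-⊗ʳ₁ : ∀ {A B C Γ Θ₁ Θ₂ Γ₂} (ρ : ⊢ A ∷ Γ) (π₁ : ⊢ B ∷ Θ₁ ++ A ⁻ ∷ Θ₂) (π₂ : ⊢ C ∷ Γ₂) →
    tr (cut ρ (ex (↭-trans (prep (B ⊗ C) (↭-reflexive (++-assoc Θ₁ (A ⁻ ∷ Θ₂) Γ₂)))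
                           (toFront (A ⁻) (B ⊗ C ∷ Θ₁) (Θ₂ ++ Γ₂))) (⊗r π₁ π₂))) ≋
    tr (ex (↭-trans (prep (B ⊗ C) (↭-reflexive (eq3 Γ Θ₁ Θ₂ Γ₂))) (fromFront (B ⊗ C) Γ (Θ₁ ++ (Θ₂ ++ Γ₂))))
      (⊗r (ex (toFront B Γ (Θ₁ ++ Θ₂)) (cut ρ (ex (toFront (A ⁻) (B ∷ Θ₁) Θ₂) π₁))) π₂))
  s-c-⊗ʳ₁ {A} {B} {C} {Γ} {Θ₁} {Θ₂} {Γ₂} ρ π₁ π₂ {z} gz with split Γ (B ⊗ C ∷ Θ₁ ++ (Θ₂ ++ Γ₂)) z gz
  ... | γ , (k , ξ) , refl , gγ , (gk , gξ) with split₃ Θ₁ Θ₂ Γ₂ ξ gξ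
  ... | θ₁ , θ₂ , γ₂ , refl , gθ₁ , gθ₂ , gγ₂ = ~trans
    (commuteʳ {A} {B} {Θ₁} {Θ₂} {B ⊗ C ∷ Θ₁ ++ (Θ₂ ++ Γ₂)} {Γ} ρ π₁ κ {ξ = k , app Θ₁ (Θ₂ ++ Γ₂) θ₁ (app Θ₂ Γ₂ θ₂ γ₂)} {K = K}
      gθ (gk , gξ) gγ (tens₁-Fn {dual ⌜ B ⌝} {⌜ C ⌝} {k} gk (fun-Fn π₂ gγ₂))
      (↭-trans (++⁺ˡ (proj₁ k) (app-gr₃ Θ₁ Θ₂ Γ₂ θ₁ θ₂ γ₂)) (swap-ann (proj₁ k) (gr ⌈ Θ₁ ++ Θ₂ ⌉ (app Θ₁ Θ₂ θ₁ θ₂)) (gr ⌈ Γ₂ ⌉ γ₂)))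
      (λ a ga → ~trans (≡⇒~ (cong (λ v → sem (⊗r π₁ π₂) (k , v)) (perm-insert₁ (A ⁻) Θ₁ Θ₂ Γ₂ a θ₁ θ₂ γ₂)))
        (sem-⊗ {B} {C} {Θ₁ ++ A ⁻ ∷ Θ₂} {Γ₂} π₁ π₂ gk (perm-Good (shift (A ⁻) Θ₁ Θ₂) (ga , gθ)) gγ₂)))
    (~trans (~sym (sem-⊗ {B} {C} {Γ ++ (Θ₁ ++ Θ₂)} {Γ₂} π₁' π₂ gk (app-Good Γ (Θ₁ ++ Θ₂) gγ gθ) gγ₂))
      (≡⇒~ (cong (sem (⊗r π₁' π₂)) (sym (trans
        (cong (perm (prep (B ⊗ C) (↭-reflexive (eq3 Γ Θ₁ Θ₂ Γ₂)))) (perm-unshift (B ⊗ C) Γ (Θ₁ ++ (Θ₂ ++ Γ₂)) γ _ k))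
        (cong (k ,_) (perm-eq3 Γ Θ₁ Θ₂ Γ₂ γ θ₁ θ₂ γ₂)))))))
    where
    K = tens₁ (dual ⌜ B ⌝) ⌜ C ⌝ k (fun π₂ γ₂)
    κ = ex (↭-trans (prep (B ⊗ C) (↭-reflexive (++-assoc Θ₁ (A ⁻ ∷ Θ₂) Γ₂))) (toFront (A ⁻) (B ⊗ C ∷ Θ₁) (Θ₂ ++ Γ₂))) (⊗r π₁ π₂)
    π₁' : ⊢ B ∷ Γ ++ (Θ₁ ++ Θ₂)
    π₁' = ex (toFront B Γ (Θ₁ ++ Θ₂)) (cut ρ (ex (toFront (A ⁻) (B ∷ Θ₁) Θ₂) π₁))
    gθ = app-Good Θ₁ Θ₂ gθ₁ gθ₂

  s-c-⊗ʳ₂ : ∀ {A B C Γ Γ₁ Θ₁ Θ₂} (ρ : ⊢ A ∷ Γ) (π₁ : ⊢ B ∷ Γ₁) (π₂ : ⊢ C ∷ Θ₁ ++ A ⁻ ∷ Θ₂) →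
    tr (cut ρ (ex (↭-trans (prep (B ⊗ C) (↭-reflexive (sym (++-assoc Γ₁ Θ₁ (A ⁻ ∷ Θ₂)))))
                           (toFront (A ⁻) (B ⊗ C ∷ Γ₁ ++ Θ₁) Θ₂)) (⊗r π₁ π₂))) ≋
    tr (ex (↭-trans (prep (B ⊗ C) (perm4 Γ₁ Γ Θ₁ Θ₂)) (fromFront (B ⊗ C) Γ ((Γ₁ ++ Θ₁) ++ Θ₂)))
      (⊗r π₁ (ex (toFront C Γ (Θ₁ ++ Θ₂)) (cut ρ (ex (toFront (A ⁻) (C ∷ Θ₁) Θ₂) π₂)))))
  s-c-⊗ʳ₂ {A} {B} {C} {Γ} {Γ₁} {Θ₁} {Θ₂} ρ π₁ π₂ {z} gz with split Γ (B ⊗ C ∷ (Γ₁ ++ Θ₁) ++ Θ₂) z gz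
  ... | γ , (k , ξ) , refl , gγ , (gk , gξ) with split₃' Γ₁ Θ₁ Θ₂ ξ gξ
  ... | γ₁ , θ₁ , θ₂ , refl , gγ₁ , gθ₁ , gθ₂ = ~trans
    (commuteʳ {A} {C} {Θ₁} {Θ₂} {B ⊗ C ∷ (Γ₁ ++ Θ₁) ++ Θ₂} {Γ} ρ π₂ κ {ξ = k , app (Γ₁ ++ Θ₁) Θ₂ (app Γ₁ Θ₁ γ₁ θ₁) θ₂} {K = K}
      gθ (gk , gξ) gγ (tens₁'-Fn {⌜ B ⌝} {dual ⌜ C ⌝} {k} gk (fun-Fn π₁ gγ₁))
      (↭-trans (++⁺ˡ (proj₁ k) (app-gr₃' Γ₁ Θ₁ Θ₂ γ₁ θ₁ θ₂)) (swap-ann (proj₁ k) (gr ⌈ Θ₁ ++ Θ₂ ⌉ (app Θ₁ Θ₂ θ₁ θ₂)) (gr ⌈ Γ₁ ⌉ γ₁)))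
      (λ a ga → ~trans (≡⇒~ (cong (λ v → sem (⊗r π₁ π₂) (k , v)) (perm-insert₂ (A ⁻) Γ₁ Θ₁ Θ₂ a γ₁ θ₁ θ₂)))
        (sem-⊗' {B} {C} {Γ₁} {Θ₁ ++ A ⁻ ∷ Θ₂} π₁ π₂ gk gγ₁ (perm-Good (shift (A ⁻) Θ₁ Θ₂) (ga , gθ)))))
    (~trans (~sym (sem-⊗' {B} {C} {Γ₁} {Γ ++ (Θ₁ ++ Θ₂)} π₁ π₂' gk gγ₁ (app-Good Γ (Θ₁ ++ Θ₂) gγ gθ)))
      (≡⇒~ (cong (sem (⊗r π₁ π₂')) (sym (trans
        (cong (perm (prep (B ⊗ C) (perm4 Γ₁ Γ Θ₁ Θ₂))) (perm-unshift (B ⊗ C) Γ ((Γ₁ ++ Θ₁) ++ Θ₂) γ _ k))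
        (cong (k ,_) (perm-perm4 Γ₁ Γ Θ₁ Θ₂ γ₁ γ θ₁ θ₂)))))))
    where
    K = tens₁' ⌜ B ⌝ (dual ⌜ C ⌝) k (fun π₁ γ₁)
    κ = ex (↭-trans (prep (B ⊗ C) (↭-reflexive (sym (++-assoc Γ₁ Θ₁ (A ⁻ ∷ Θ₂))))) (toFront (A ⁻) (B ⊗ C ∷ Γ₁ ++ Θ₁) Θ₂)) (⊗r π₁ π₂)
    π₂' : ⊢ C ∷ Γ ++ (Θ₁ ++ Θ₂)
    π₂' = ex (toFront C Γ (Θ₁ ++ Θ₂)) (cut ρ (ex (toFront (A ⁻) (C ∷ Θ₁) Θ₂) π₂))
    gθ = app-Good Θ₁ Θ₂ gθ₁ gθ₂

  -- The expanded axiom is interpreted by a cut against the axiom of each component, and `identityʳ`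
  -- removes these one by one.
  s-η-⊗ : ∀ {A B} → tr (ax (A ⊗ B)) ≋ tr (⅋r (ex (rev3 (A ⊗ B) (A ⁻) (B ⁻))
                   (⊗r (ex (swap2 (A ⁻) A) (ax A)) (ex (swap2 (B ⁻) B) (ax B)))))
  s-η-⊗ {A} {B} {(b , a) , (k , _)} ((gb , ga) , (gk , _)) = ~trans
    (≡⇒~ (cong (proj₂ k) (cast-par (⌜⁻⌝ (A ⊗ B)) (⌜⁻⌝ B) (⌜⁻⌝ A) b a))) (~sym (~trans
    (sem-⊗ {A} {B} {A ⁻ ∷ []} {B ⁻ ∷ []} π ρ gk (ga , tt) (gb , tt)) (~trans
    (identityʳ ⌜ A ⌝ (cast (⌜⁻⌝ A) a) (↭-reflexive (trans (++-identityʳ _) (sym (gr-cast (⌜⁻⌝ A) a)))) (Good-E (dual ⌜ A ⌝) ga')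
      (fE (tens₁-Fn {dual ⌜ A ⌝} {⌜ B ⌝} {k} gk (fun-Fn {B} {B ⁻ ∷ []} ρ (gb , tt)))))
    (identityʳ ⌜ B ⌝ (cast (⌜⁻⌝ B) b) (↭-reflexive (trans (++-identityʳ _) (sym (gr-cast (⌜⁻⌝ B) b)))) (Good-E (dual ⌜ B ⌝) gb')
      (fE (tens₂-Fn {dual ⌜ A ⌝} {dual ⌜ B ⌝} {k} gk ga'))))))
    where
    π = ex (swap2 (A ⁻) A) (ax A)
    ρ = ex (swap2 (B ⁻) B) (ax B)
    ga' = Good-cast (⌜⁻⌝ A) {a} ga
    gb' = Good-cast (⌜⁻⌝ B) {b} gb

  pst-cast-par : ∀ {p p' q q'} (e : pst (par p q) ≡ pst (par p' q')) (e₁ : p' ≡ p) (e₂ : q' ≡ q) k x y →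
    proj₂ (cast e k) (x , y) ≡ proj₂ k (cast e₁ x , cast e₂ y)
  pst-cast-par refl refl refl k x y = refl

  pst-cast-inj₁ : ∀ {p p' q q'} (e : pst (wit p q) ≡ pst (wit p' q')) (e₁ : p' ≡ p) k x →
    proj₂ (cast e k) (inj₁ x) ≡ proj₂ k (inj₁ (cast e₁ x))
  pst-cast-inj₁ refl refl k x = refl

  pst-cast-inj₂ : ∀ {p p' q q'} (e : pst (wit p q) ≡ pst (wit p' q')) (e₁ : q' ≡ q) k x →
    proj₂ (cast e k) (inj₂ x) ≡ proj₂ k (inj₂ (cast e₁ x))
  pst-cast-inj₂ refl refl k x = refl

  s-η-⅋ : ∀ {A B} → tr (ax (A ⅋ B)) ≋ tr (ex (swap2 (A ⅋ B) (B ⁻ ⊗ A ⁻))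
             (⅋r (ex (rev3 (B ⁻ ⊗ A ⁻) B A) (⊗r (ax B) (ax A)))))
  s-η-⅋ {A} {B} {k , ((a , b) , _)} (gk , ((ga , gb) , _)) = ~trans
    (≡⇒~ (pst-cast-par (⌜⁻⌝ (A ⅋ B)) (dual-⌜⁻⌝' A) (dual-⌜⁻⌝' B) k a b)) (~sym (~trans
    (sem-⊗ {B ⁻} {A ⁻} {B ∷ []} {A ∷ []} (ax B) (ax A) gk (gb , tt) (ga , tt)) (~trans
    (identityᶜ (⌜⁻⌝ B) (dual-⌜⁻⌝' B) b (↭-reflexive (++-identityʳ _)) (Good-E ⌜ B ⌝ gb)
      (fE (tens₁-Fn {dual ⌜ B ⁻ ⌝} {⌜ A ⁻ ⌝} {k} gk (fun-Fn {A ⁻} {A ∷ []} (ax A) (ga , tt)))))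
    (identityᶜ (⌜⁻⌝ A) (dual-⌜⁻⌝' A) a (↭-reflexive (++-identityʳ _)) (Good-E ⌜ A ⌝ ga)
      (fE (tens₂-Fn {dual ⌜ B ⁻ ⌝} {dual ⌜ A ⁻ ⌝} {k} {cast (dual-⌜⁻⌝' B) b} gk (Good-cast (dual-⌜⁻⌝' B) {b} gb)))))))

  s-η-& : ∀ {A B} → tr (ax (A & B)) ≋ tr (ex (swap2 (A & B) (B ⁻ ⊕ A ⁻))
             (&r (ex (swap2 (B ⁻ ⊕ A ⁻) A) (⊕₂r {B ⁻} {A ⁻} (ax A)))
                 (ex (swap2 (B ⁻ ⊕ A ⁻) B) (⊕₁r {B ⁻} {A ⁻} (ax B)))))
  s-η-& {A} {B} {k , (inj₁ a , _)} (gk , (ga , _)) = ~trans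
    (≡⇒~ (pst-cast-inj₁ (⌜⁻⌝ (A & B)) (dual-⌜⁻⌝' A) k a)) (~sym (~trans
    (sem-⊕₂ {B ⁻} {A ⁻} {A ∷ []} (ax A) gk (ga , tt))
    (identityᶜ (⌜⁻⌝ A) (dual-⌜⁻⌝' A) a (↭-reflexive (++-identityʳ _)) (Good-E ⌜ A ⌝ ga)
      (fE (inj₁-Fn {dual ⌜ A ⁻ ⌝} {dual ⌜ B ⁻ ⌝} gk)))))
  s-η-& {A} {B} {k , (inj₂ b , _)} (gk , (gb , _)) = ~trans
    (≡⇒~ (pst-cast-inj₂ (⌜⁻⌝ (A & B)) (dual-⌜⁻⌝' B) k b)) (~sym (~trans
    (sem-⊕₁ {B ⁻} {A ⁻} {B ∷ []} (ax B) gk (gb , tt))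
    (identityᶜ (⌜⁻⌝ B) (dual-⌜⁻⌝' B) b (↭-reflexive (++-identityʳ _)) (Good-E ⌜ B ⌝ gb)
      (fE (inj₂-Fn {dual ⌜ A ⁻ ⌝} {dual ⌜ B ⁻ ⌝} gk)))))

  s-η-⊕ : ∀ {A B} → tr (ax (A ⊕ B)) ≋ tr (&r {B ⁻} {A ⁻}
             (ex (swap2 (A ⊕ B) (B ⁻)) (⊕₂r {A} {B} (ex (swap2 (B ⁻) B) (ax B))))
             (ex (swap2 (A ⊕ B) (A ⁻)) (⊕₁r {A} {B} (ex (swap2 (A ⁻) A) (ax A)))))
  s-η-⊕ {A} {B} {inj₁ b , (k , _)} (gb , (gk , _)) = ~trans
    (≡⇒~ (cong (proj₂ k) (cast-inj₁ (⌜⁻⌝ (A ⊕ B)) (⌜⁻⌝ B) b))) (~sym (~trans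
    (sem-⊕₂ {A} {B} {B ⁻ ∷ []} (ex (swap2 (B ⁻) B) (ax B)) gk (gb , tt))
    (identityʳ ⌜ B ⌝ (cast (⌜⁻⌝ B) b) (↭-reflexive (trans (++-identityʳ _) (sym (gr-cast (⌜⁻⌝ B) b))))
      (cast-E (⌜⁻⌝ B) (Good-E ⌜ B ⁻ ⌝ gb)) (fE (inj₁-Fn {dual ⌜ B ⌝} {dual ⌜ A ⌝} gk)))))
  s-η-⊕ {A} {B} {inj₂ a , (k , _)} (ga , (gk , _)) = ~trans
    (≡⇒~ (cong (proj₂ k) (cast-inj₂ (⌜⁻⌝ (A ⊕ B)) (⌜⁻⌝ A) a))) (~sym (~trans
    (sem-⊕₁ {A} {B} {A ⁻ ∷ []} (ex (swap2 (A ⁻) A) (ax A)) gk (ga , tt))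
    (identityʳ ⌜ A ⌝ (cast (⌜⁻⌝ A) a) (↭-reflexive (trans (++-identityʳ _) (sym (gr-cast (⌜⁻⌝ A) a))))
      (cast-E (⌜⁻⌝ A) (Good-E ⌜ A ⁻ ⌝ ga)) (fE (inj₂-Fn {dual ⌜ B ⌝} {dual ⌜ A ⌝} gk)))))

  sound : ∀ {Γ} {π π' : ⊢ Γ} → π ≈ π' → tr π ≋ tr π'
  sound ≈-refl g = ~refl
  sound (≈-sym p) g = ~sym (sound p g)
  sound (≈-trans p q) g = ~trans (sound p g) (sound q g)
  sound (ex-cong σ {π} {π'} p) = exch-≋ σ {tr π} {tr π'} (sound p)
  sound (cut-cong {A} {Γ} {Δ} {π} {π'} {ρ} {ρ'} p q) =
    cutr-≋ {A} {A ⁻} {Γ} {Δ} (⌜⁻⌝ A) {tr π} {tr π'} {tr ρ} {tr ρ'} (sound p) (sound q)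
  sound (⊗-cong {A} {Γ} {B} {Δ} {π} {π'} {ρ} {ρ'} p q) g =
    cutr-≋ {A} {A ⁻} {Γ} {Δ ++ A ⊗ B ∷ []} (⌜⁻⌝ A) {tr π} {tr π'}
      {exch (shift (A ⁻) Δ (A ⊗ B ∷ [])) (cutr {B} {B ⁻} (⌜⁻⌝ B) (tr ρ) κ)}
      {exch (shift (A ⁻) Δ (A ⊗ B ∷ [])) (cutr {B} {B ⁻} (⌜⁻⌝ B) (tr ρ') κ)} (sound p)
      (λ h → cutr-≋ {B} {B ⁻} {Δ} {A ⁻ ∷ A ⊗ B ∷ []} (⌜⁻⌝ B) {tr ρ} {tr ρ'} {κ} {κ} (sound q) (λ _ → ~refl)
        (perm-Good (shift (A ⁻) Δ (A ⊗ B ∷ [])) h))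
      (perm-Good (unsnoc₂ (A ⊗ B) Γ Δ) g)
    where
    κ = exch (↭-trans (swap _ _ ↭-refl) (prep _ (swap _ _ ↭-refl))) (tens {B ⁻} {A ⁻} {A ⊗ B} (e-⊗ A B))
  sound (⅋-cong p) ((gb , gc) , g) = sound p (gb , (gc , g))
  sound (⊥-cong p) (_ , g) = sound p g
  sound (&-cong p q) {inj₁ b , γ} (gb , g) = sound p (gb , g)
  sound (&-cong p q) {inj₂ c , γ} (gc , g) = sound q (gc , g)
  sound (⊕₁-cong {A} {Γ} {B} {π} {π'} p) g =
    cutr-≋ {A} {A ⁻} {Γ} {A ⊕ B ∷ []} (⌜⁻⌝ A) {tr π} {tr π'} {κ} {κ} (sound p) (λ _ → ~refl) (perm-Good (unsnoc (A ⊕ B) Γ) g)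
    where κ = exch (swap _ _ ↭-refl) (injr {B ⁻} {A ⁻} {A ⊕ B} (e-⊕ A B))
  sound (⊕₂-cong {B} {Γ} {A} {π} {π'} p) g =
    cutr-≋ {B} {B ⁻} {Γ} {A ⊕ B ∷ []} (⌜⁻⌝ B) {tr π} {tr π'} {κ} {κ} (sound p) (λ _ → ~refl) (perm-Good (unsnoc (A ⊕ B) Γ) g)
    where κ = exch (swap _ _ ↭-refl) (injl {B ⁻} {A ⁻} {A ⊕ B} (e-⊕ A B))
  sound (ex-id π) g = ~refl
  sound (ex-comp σ τ π) g = ~refl
  sound (ex-ext σ τ h π) {γ} g = ≡⇒~ (cong (sem π) (perm-ext σ τ h γ))
  sound (cut-exˡ σ π ρ) = s-cut-exˡ σ π ρ
  sound (cut-exʳ σ π ρ) = s-cut-exʳ σ π ρ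
  sound (β-axˡ π) = s-β-axˡ π
  sound (β-axˡ' π) = s-β-axˡ' π
  sound (β-axʳ π) = s-β-axʳ π
  sound (β-axʳ' π) = s-β-axʳ' π
  sound (β-⊗⅋ π₁ π₂ π₃) = s-β-⊗⅋ π₁ π₂ π₃
  sound (β-⅋⊗ π₃ π₁ π₂) = s-β-⅋⊗ π₃ π₁ π₂
  sound (β-&⊕₁ π₁ π₂ π₃) = s-β-&⊕₁ π₁ π₂ π₃
  sound (β-&⊕₂ π₁ π₂ π₃) = s-β-&⊕₂ π₁ π₂ π₃
  sound (β-⊕₁& π₃ π₁ π₂) = s-β-⊕₁& π₃ π₁ π₂
  sound (β-⊕₂& π₃ π₁ π₂) = s-β-⊕₂& π₃ π₁ π₂
  sound (β-𝟏⊥ π) g = ~refl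
  sound (β-⊥𝟏 π) = s-β-⊥𝟏 π
  sound (c-⅋ˡ {B} {C} {Θ₁} {A} π ρ) = s-c-⅋ˡ {A} {B} {C} {Θ₁} π ρ
  sound (c-⊥ˡ {Θ₁} {A} π ρ) = s-c-⊥ˡ {A} {Θ₁} π ρ
  sound (c-⊕₁ˡ {B} {Θ₁} {A} π ρ) = s-c-⊕₁ˡ {A} {B} {_} {Θ₁} π ρ
  sound (c-⊕₂ˡ {C} {Θ₁} {A} π ρ) = s-c-⊕₂ˡ {A} {_} {C} {Θ₁} π ρ
  sound (c-&ˡ {B} {Θ₁} {A} {_} {C} π₁ π₂ ρ) {γ} g = s-c-&ˡ {A} {B} {C} {Θ₁} π₁ π₂ ρ {γ} g
  sound (c-⊤ˡ ρ) {() , _} g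
  sound (c-⊗ˡ₁ {B} {Θ₁} {A} π₁ π₂ ρ) = s-c-⊗ˡ₁ {A} {B} {_} {Θ₁} π₁ π₂ ρ
  sound (c-⊗ˡ₂ {B} {Γ₁} {C} {Θ₁} {A} π₁ π₂ ρ) = s-c-⊗ˡ₂ {A} {B} {C} {Γ₁} {Θ₁} π₁ π₂ ρ
  sound (c-cutˡ₁ {B} {Θ₁} {A} π₁ π₂ ρ) = s-c-cutˡ₁ {A} {B} {Θ₁} π₁ π₂ ρ
  sound (c-cutˡ₂ {B} {Γ₁} {Θ₁} {A} π₁ π₂ ρ) = s-c-cutˡ₂ {A} {B} {Γ₁} {Θ₁} π₁ π₂ ρ
  sound (c-⅋ʳ {Θ₁ = Θ₁} ρ π) = s-c-⅋ʳ {Θ₁ = Θ₁} ρ π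
  sound (c-⊥ʳ {Θ₁ = Θ₁} ρ π) = s-c-⊥ʳ {Θ₁ = Θ₁} ρ π
  sound (c-⊕₁ʳ {Θ₁ = Θ₁} ρ π) = s-c-⊕₁ʳ {Θ₁ = Θ₁} ρ π
  sound (c-⊕₂ʳ {Θ₁ = Θ₁} ρ π) = s-c-⊕₂ʳ {Θ₁ = Θ₁} ρ π
  sound (c-&ʳ {Θ₁ = Θ₁} ρ π₁ π₂) = s-c-&ʳ {Θ₁ = Θ₁} ρ π₁ π₂
  sound (c-⊤ʳ {Θ₁ = Θ₁} ρ) = s-c-⊤ʳ {Θ₁ = Θ₁} ρ
  sound (c-⊗ʳ₁ {Θ₁ = Θ₁} ρ π₁ π₂) = s-c-⊗ʳ₁ {Θ₁ = Θ₁} ρ π₁ π₂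
  sound (c-⊗ʳ₂ {Θ₁ = Θ₁} ρ π₁ π₂) = s-c-⊗ʳ₂ {Θ₁ = Θ₁} ρ π₁ π₂
  sound (c-cutʳ₁ {Θ₁ = Θ₁} ρ π₁ π₂) = s-c-cutʳ₁ {Θ₁ = Θ₁} ρ π₁ π₂
  sound (c-cutʳ₂ {Θ₁ = Θ₁} ρ π₁ π₂) = s-c-cutʳ₂ {Θ₁ = Θ₁} ρ π₁ π₂
  sound (η-⊗ {A} {B}) {γ} g = s-η-⊗ {A} {B} {γ} g
  sound (η-⅋ {A} {B}) {γ} g = s-η-⅋ {A} {B} {γ} g
  sound η-𝟏 g = ~refl
  sound η-⊥ g = ~refl
  sound (η-& {A} {B}) {γ} g = s-η-& {A} {B} {γ} g
  sound (η-⊕ {A} {B}) {γ} g = s-η-⊕ {A} {B} {γ} g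
  sound η-⊤ {_ , (() , _)} g
  sound η-𝟎 {() , _} g

-- Normal forms

-- A skeleton resolves the choices of a negative type and stops at its positive subtypes, the slots
-- listed by `sl`. `neg top` has no skeleton; `neg bot` has one, without slots.
Sk : Arg → Set
Sk (neg (par a b)) = Sk a × Sk b
Sk (neg (wit a b)) = Sk a ⊎ Sk b
Sk (neg bot) = ⊤
Sk (neg top) = ⊥
Sk (neg (nv x)) = ⊤
Sk (pst N) = ⊤

sl : ∀ a → Sk a → List Arg
sl (neg (par a b)) (s , t) = sl a s ++ sl b t
sl (neg (wit a b)) (inj₁ s) = sl a s
sl (neg (wit a b)) (inj₂ t) = sl b t
sl (neg bot) _ = []
sl (neg (nv x)) _ = neg (nv x) ∷ []
sl (pst N) _ = pst N ∷ []

open Calculus Arg (λ a → a) using (Env; ⌈_⌉; left; right; perm; left-E; right-E; perm-E; perm-gr; gr-++)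
open Plumbing Arg (λ a → a) using (app; left-app; right-app; app-split; app-E; app-gr; perm-comm; perm-++ˡ; perm-++ʳ; perm-assoc; perm-assoc'; perm-∷ʳ; perm-idʳ)

re : ∀ a s → Env (sl a s) → Val a
re (neg (par a b)) (s , t) e = re a s (left (sl a s) e) , re b t (right (sl a s) e)
re (neg (wit a b)) (inj₁ s) e = inj₁ (re a s e)
re (neg (wit a b)) (inj₂ t) e = inj₂ (re b t e)
re (neg bot) _ _ = tt
re (neg (nv x)) _ (n , _) = n
re (pst N) _ (k , _) = k

-- The inverse of `re` in continuation form: a value is a skeleton together with values for its
-- slots.
elim : ∀ a → (∀ s → Env (sl a s) → Tm) → Val a → Tm
elim (neg (par a b)) F (x , y) =
  elim a (λ s e → elim b (λ t e' → F (s , t) (app (sl a s) (sl b t) e e')) y) x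
elim (neg (wit a b)) F (inj₁ x) = elim a (λ s → F (inj₁ s)) x
elim (neg (wit a b)) F (inj₂ y) = elim b (λ t → F (inj₂ t)) y
elim (neg bot) F _ = F tt tt
elim (neg (nv x)) F n = F tt (n , tt)
elim (pst N) F k = F tt (k , tt)

elim-re : ∀ a (F : ∀ s → Env (sl a s) → Tm) s e → elim a F (re a s e) ≡ F s e
elim-re (neg (par a b)) F (s , t) e = trans (elim-re a _ s _) (trans (elim-re b _ t _)
  (cong (F (s , t)) (app-split (sl a s) (sl b t) e)))
elim-re (neg (wit a b)) F (inj₁ s) e = elim-re a _ s e
elim-re (neg (wit a b)) F (inj₂ t) e = elim-re b _ t e
elim-re (neg bot) F s e = refl
elim-re (neg (nv x)) F s e = refl
elim-re (pst N) F s e = refl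

elim-E : ∀ a {F F' : ∀ s → Env (sl a s) → Tm} → (∀ s {e e'} → E ⌈ sl a s ⌉ e e' → F s e ~ F' s e') →
         ∀ {x x'} → E a x x' → elim a F x ~ elim a F' x'
elim-E (neg (par a b)) h (p , q) = elim-E a (λ s p → elim-E b (λ t q → h (s , t) (app-E (sl a s) (sl b t) p q)) q) p
elim-E (neg (wit a b)) h {inj₁ x} {inj₁ y} p = elim-E a (λ s → h (inj₁ s)) p
elim-E (neg (wit a b)) h {inj₂ x} {inj₂ y} p = elim-E b (λ s → h (inj₂ s)) p
elim-E (neg bot) h p = h tt tt
elim-E (neg (nv x)) h refl = h tt (refl , tt)
elim-E (pst N) h p = h tt (p , tt)

re-onto : ∀ a x → E a x x → Σ (Sk a) λ s → Σ (Env (sl a s)) λ e → x ≡ re a s e × E ⌈ sl a s ⌉ e e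
re-onto (neg (par a b)) (x , y) (p , q) with re-onto a x p | re-onto b y q
... | s , e , refl , p' | t , e' , refl , q' = (s , t) , app (sl a s) (sl b t) e e' ,
  cong₂ (λ u v → re a s u , re b t v) (sym (left-app (sl a s) (sl b t) e e')) (sym (right-app (sl a s) (sl b t) e e')) ,
  app-E (sl a s) (sl b t) p' q'
re-onto (neg (wit a b)) (inj₁ x) p with re-onto a x p
... | s , e , refl , p' = inj₁ s , e , refl , p'
re-onto (neg (wit a b)) (inj₂ x) p with re-onto b x p
... | s , e , refl , p' = inj₂ s , e , refl , p'
re-onto (neg bot) x p = tt , tt , refl , tt
re-onto (neg (nv x)) n p = tt , (n , tt) , refl , (refl , tt)
re-onto (pst N) k p = tt , (k , tt) , refl , (p , tt)

-- Focused proofs with linear contexts; a leaf has one branch per skeleton.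
data Nf : List Arg → Set
data NB : Arg → List Arg → Set
data Nf where
  n-node : ∀ {N Θ Θ'} → pst N ∷ Θ' ↭ Θ → NB (neg N) Θ' → Nf Θ
data NB where
  n-par : ∀ {a b Θ₁ Θ₂ Θ} → Θ₁ ++ Θ₂ ↭ Θ → NB a Θ₁ → NB b Θ₂ → NB (neg (par a b)) Θ
  n-inl : ∀ {a b Θ} → NB a Θ → NB (neg (wit a b)) Θ
  n-inr : ∀ {a b Θ} → NB b Θ → NB (neg (wit a b)) Θ
  n-bot : ∀ {Θ} → [] ↭ Θ → NB (neg bot) Θ
  n-nv : ∀ {x Θ} → neg (nv x) ∷ [] ↭ Θ → NB (neg (nv x)) Θ
  n-leaf : ∀ {N Θ} → (∀ s → Nf (sl (neg N) s ++ Θ)) → NB (pst N) Θ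

ev : ∀ {Θ} → Nf Θ → Env Θ → Tm
evB : ∀ {a Θ} → NB a Θ → Env Θ → Val a
ev (n-node σ b) e = proj₂ (proj₁ (perm σ e)) (evB b (proj₂ (perm σ e)))
evB (n-par {Θ₁ = Θ₁} σ b c) e = evB b (left Θ₁ (perm σ e)) , evB c (right Θ₁ (perm σ e))
evB (n-inl b) e = inj₁ (evB b e)
evB (n-inr b) e = inj₂ (evB b e)
evB (n-bot σ) e = tt
evB (n-nv σ) e = proj₁ (perm σ e)
evB (n-leaf {N} {Θ} ch) e = gr ⌈ Θ ⌉ e , elim (neg N) λ s e' → ev (ch s) (app (sl (neg N) s) Θ e' e)

perm-Nf : ∀ {Θ Θ'} → Θ ↭ Θ' → Nf Θ → Nf Θ'
perm-Nf σ (n-node ρ b) = n-node (↭-trans ρ σ) b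

ev-perm : ∀ {Θ Θ'} (σ : Θ ↭ Θ') t e → ev (perm-Nf σ t) e ≡ ev t (perm σ e)
ev-perm σ (n-node ρ b) e = refl

split-gr : ∀ {Θ} Θ₁ {Θ₂} (σ : Θ₁ ++ Θ₂ ↭ Θ) e →
           gr ⌈ Θ₁ ⌉ (left Θ₁ (perm σ e)) ++ gr ⌈ Θ₂ ⌉ (right Θ₁ (perm σ e)) ↭ gr ⌈ Θ ⌉ e
split-gr Θ₁ σ e = ↭-trans (↭-reflexive (sym (gr-++ Θ₁ (perm σ e)))) (perm-gr σ e)

gr-evB : ∀ {a Θ} (b : NB a Θ) e → gr a (evB b e) ↭ gr ⌈ Θ ⌉ e
gr-evB (n-par {Θ₁ = Θ₁} σ b c) e = ↭-trans (++⁺ (gr-evB b _) (gr-evB c _)) (split-gr Θ₁ σ e)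
gr-evB (n-inl b) e = gr-evB b e
gr-evB (n-inr b) e = gr-evB b e
gr-evB (n-bot σ) e = perm-gr σ e
gr-evB (n-nv σ) e = perm-gr σ e
gr-evB (n-leaf ch) e = ↭-refl

ev-E : ∀ {Θ} (t : Nf Θ) {e e'} → E ⌈ Θ ⌉ e e' → ev t e ~ ev t e'
evB-E : ∀ {a Θ} (b : NB a Θ) {e e'} → E ⌈ Θ ⌉ e e' → E a (evB b e) (evB b e')
ev-E (n-node σ b) p = proj₂ (proj₁ (perm-E σ p)) _ _ (evB-E b (proj₂ (perm-E σ p)))
evB-E (n-par {Θ₁ = Θ₁} σ b c) p = evB-E b (left-E Θ₁ (perm-E σ p)) , evB-E c (right-E Θ₁ (perm-E σ p))
evB-E (n-inl b) p = evB-E b p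
evB-E (n-inr b) p = evB-E b p
evB-E (n-bot σ) p = tt
evB-E (n-nv σ) p = proj₁ (perm-E σ p)
evB-E (n-leaf {N} {Θ} ch) p = E-gr ⌈ Θ ⌉ p , λ x x' q →
  elim-E (neg N) (λ s q → ev-E (ch s) (app-E (sl (neg N) s) Θ q p)) q

-- The logical relation "c is given by normal forms"; no Kripke structure is needed, as contexts are linear.
H : ∀ a Θ → (Env Θ → Val a) → Set
HN : ∀ N Θ → (Env Θ → ValN N) → Set
H (neg N) Θ c = HN N Θ c
H (pst N) Θ c = (∀ e → proj₁ (c e) ↭ gr ⌈ Θ ⌉ e) × (∀ {e e'} → E ⌈ Θ ⌉ e e' → E (pst N) (c e) (c e')) ×
  (∀ Θ' x → HN N Θ' x → Σ (Nf (Θ' ++ Θ)) λ t → ∀ e' e → E ⌈ Θ' ⌉ e' e' → E ⌈ Θ ⌉ e e →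
    proj₂ (c e) (x e') ~ ev t (app Θ' Θ e' e))
HN (par a b) Θ c = ∃ λ Θ₁ → ∃ λ Θ₂ → Σ (Θ₁ ++ Θ₂ ↭ Θ) λ σ → ∃ λ c₁ → ∃ λ c₂ → H a Θ₁ c₁ × H b Θ₂ c₂ ×
  (∀ e → c e ≡ (c₁ (left Θ₁ (perm σ e)) , c₂ (right Θ₁ (perm σ e))))
HN (wit a b) Θ c = (∃ λ c₁ → H a Θ c₁ × ∀ e → c e ≡ inj₁ (c₁ e)) ⊎ (∃ λ c₂ → H b Θ c₂ × ∀ e → c e ≡ inj₂ (c₂ e))
HN bot Θ c = [] ↭ Θ
HN top Θ c = ⊥
HN (nv x) Θ c = Σ (neg (nv x) ∷ [] ↭ Θ) λ σ → ∀ e → c e ≡ proj₁ (perm σ e)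

E-≡ : ∀ a {x x' y y'} → x ≡ x' → y ≡ y' → E a x' y' → E a x y
E-≡ a refl refl p = p

H-E : ∀ a {Θ c} → H a Θ c → ∀ {e e'} → E ⌈ Θ ⌉ e e' → E a (c e) (c e')
H-E (neg (par a b)) (Θ₁ , Θ₂ , σ , c₁ , c₂ , h₁ , h₂ , q) p = E-≡ (neg (par a b)) (q _) (q _)
  (H-E a h₁ (left-E Θ₁ (perm-E σ p)) , H-E b h₂ (right-E Θ₁ (perm-E σ p)))
H-E (neg (wit a b)) (inj₁ (c₁ , h , q)) p = E-≡ (neg (wit a b)) (q _) (q _) (H-E a h p)
H-E (neg (wit a b)) (inj₂ (c₁ , h , q)) p = E-≡ (neg (wit a b)) (q _) (q _) (H-E b h p)
H-E (neg bot) h p = tt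
H-E (neg (nv x)) (σ , q) p = E-≡ (neg (nv x)) (q _) (q _) (proj₁ (perm-E σ p))
H-E (pst N) (_ , h , _) p = h p

H-gr : ∀ a {Θ c} → H a Θ c → ∀ e → gr a (c e) ↭ gr ⌈ Θ ⌉ e
H-gr (neg (par a b)) (Θ₁ , Θ₂ , σ , c₁ , c₂ , h₁ , h₂ , q) e = ↭-trans (↭-reflexive (cong (gr (neg (par a b))) (q e)))
  (↭-trans (++⁺ (H-gr a h₁ _) (H-gr b h₂ _)) (split-gr Θ₁ σ e))
H-gr (neg (wit a b)) (inj₁ (c₁ , h , q)) e = ↭-trans (↭-reflexive (cong (gr (neg (wit a b))) (q e))) (H-gr a h e)
H-gr (neg (wit a b)) (inj₂ (c₁ , h , q)) e = ↭-trans (↭-reflexive (cong (gr (neg (wit a b))) (q e))) (H-gr b h e)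
H-gr (neg bot) {Θ} σ e = ↭-sym (↭-trans (↭-sym (perm-gr σ e)) ↭-refl)
H-gr (neg (nv x)) (σ , q) e = ↭-trans (↭-reflexive (cong (gr (neg (nv x))) (q e))) (perm-gr σ e)
H-gr (pst N) (h , _) e = h e

-- Normalisation by evaluation for `H`: `reH` shows that the slots of a skeleton, taken as
-- variables, form a related value, and `reifyH` reads a continuation off at these. `re-onto` makes
-- the skeletons exhaust the self-related inputs.
reifyH : ∀ a {Θ c} → H a Θ c → Σ (NB a Θ) λ b → ∀ e → E ⌈ Θ ⌉ e e → E a (c e) (evB b e)
reifyHN : ∀ N {Θ c} → HN N Θ c → Σ (NB (neg N) Θ) λ b → ∀ e → E ⌈ Θ ⌉ e e → EN N (c e) (evB b e)
reH : ∀ a s → H a (sl a s) (re a s)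
reHN : ∀ N s → HN N (sl (neg N) s) (re (neg N) s)
reifyH (neg N) h = reifyHN N h
reifyH (pst N) {Θ} {c} (h₁ , h₂ , h₃) = n-leaf ch , λ e p → h₁ e , λ x x' q → ok e p x x' q
  where
  ch : ∀ s → Nf (sl (neg N) s ++ Θ)
  ch s = proj₁ (h₃ (sl (neg N) s) (re (neg N) s) (reHN N s))
  ok : ∀ e → E ⌈ Θ ⌉ e e → ∀ x x' → EN N x x' →
       proj₂ (c e) x ~ elim (neg N) (λ s e' → ev (ch s) (app (sl (neg N) s) Θ e' e)) x'
  ok e p x x' q with re-onto (neg N) x' (E-right (neg N) q)
  ... | s , e' , refl , p' = ~trans (proj₂ (h₂ p) _ _ q) (~trans
    (proj₂ (h₃ (sl (neg N) s) (re (neg N) s) (reHN N s)) e' e p' p) (≡⇒~ (sym (elim-re (neg N) _ s e'))))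
reifyHN (par a b) (Θ₁ , Θ₂ , σ , c₁ , c₂ , h₁ , h₂ , q) with reifyH a h₁ | reifyH b h₂
... | b₁ , r₁ | b₂ , r₂ = n-par σ b₁ b₂ , λ e p → E-≡ (neg (par a b)) (q e) refl
  (r₁ _ (left-E Θ₁ (perm-E σ p)) , r₂ _ (right-E Θ₁ (perm-E σ p)))
reifyHN (wit a b) (inj₁ (c₁ , h , q)) with reifyH a h
... | b₁ , r = n-inl b₁ , λ e p → E-≡ (neg (wit a b)) (q e) refl (r e p)
reifyHN (wit a b) (inj₂ (c₁ , h , q)) with reifyH b h
... | b₁ , r = n-inr b₁ , λ e p → E-≡ (neg (wit a b)) (q e) refl (r e p)
reifyHN bot σ = n-bot σ , λ _ _ → tt
reifyHN (nv x) (σ , q) = n-nv σ , λ e p → q e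
reH (neg N) s = reHN N s
reH (pst N) s = (λ e → ↭-reflexive (sym (++-identityʳ _))) , proj₁ , λ Θ' x h →
  let (b , r) = reifyHN N h in n-node (∷↭∷ʳ (pst N) Θ') b , λ e' e p' p →
    ~trans (proj₂ (proj₁ p) _ _ (r e' p'))
      (≡⇒~ (sym (cong (λ v → proj₂ (proj₁ v) (evB b (proj₂ v))) (perm-∷ʳ (pst N) Θ' e' (proj₁ e)))))
reHN (par a b) (s , t) = sl a s , sl b t , ↭-refl , re a s , re b t , reH a s , reH b t , λ _ → refl
reHN (wit a b) (inj₁ s) = inj₁ (re a s , reH a s , λ _ → refl)
reHN (wit a b) (inj₂ s) = inj₂ (re b s , reH b s , λ _ → refl)
reHN bot s = ↭-refl
reHN (nv x) s = ↭-refl , λ _ → refl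

Real : ∀ Θ → (Env Θ → Tm) → Set
Real Θ f = Σ (Nf Θ) λ t → ∀ e → E ⌈ Θ ⌉ e e → f e ~ ev t e

Real-~ : ∀ {Θ f f'} → (∀ e → E ⌈ Θ ⌉ e e → f e ~ f' e) → Real Θ f' → Real Θ f
Real-~ h (t , r) = t , λ e p → ~trans (h e p) (r e p)

-- The clause of `H` for continuations, extended to functionals on a type of either polarity; for
-- `neg N` it is `H` at `pst N`.
HFn : ∀ a Θ → (Env Θ → Fun a) → Set
HFn a Θ f = (∀ e → proj₁ (f e) ↭ gr ⌈ Θ ⌉ e) ×
  (∀ {e e'} → E ⌈ Θ ⌉ e e' → EF a (f e) (f e')) ×
  (∀ Θ' x → H a Θ' x → Σ (Nf (Θ' ++ Θ)) λ t → ∀ e' e → E ⌈ Θ' ⌉ e' e' → E ⌈ Θ ⌉ e e →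
    proj₂ (f e) (x e') ~ ev t (app Θ' Θ e' e))

br-H : ∀ a {Θ₁ Θ₂ Θ f g} (σ : Θ₁ ++ Θ₂ ↭ Θ) → HFn a Θ₁ f → HFn (dual a) Θ₂ g →
       Real Θ (λ e → br a (f (left Θ₁ (perm σ e))) (g (right Θ₁ (perm σ e))))
apply : ∀ a {Θ₁ Θ₂ Θ k x} (σ : Θ₁ ++ Θ₂ ↭ Θ) → HFn a Θ₁ k → H a Θ₂ x →
        Real Θ (λ e → proj₂ (k (left Θ₁ (perm σ e))) (x (right Θ₁ (perm σ e))))
apply' : ∀ a {Θ₁ Θ₂ Θ k x} (σ : Θ₂ ++ Θ₁ ↭ Θ) → HFn a Θ₁ k → H a Θ₂ x →
         Real Θ (λ e → proj₂ (k (right Θ₂ (perm σ e))) (x (left Θ₂ (perm σ e))))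
apply' a {Θ₁} {Θ₂} {Θ} {k} {x} σ (_ , _ , h) hx = perm-Nf σ t , λ e p → ~trans
  (r _ _ (left-E Θ₂ (perm-E σ p)) (right-E Θ₂ (perm-E σ p)))
  (≡⇒~ (trans (cong (ev t) (app-split Θ₂ Θ₁ (perm σ e))) (sym (ev-perm σ t e))))
  where
  t = proj₁ (h Θ₂ x hx)
  r = proj₂ (h Θ₂ x hx)
apply a {Θ₁} {Θ₂} {Θ} {k} {x} σ hk hx =
  Real-~ (λ e p → ≡⇒~ (cong₂ (λ u v → proj₂ (k u) (x v)) (sym (eq e .proj₁)) (sym (eq e .proj₂))))
    (apply' a (↭-trans (↭-++-comm Θ₂ Θ₁) σ) hk hx)
  where
  eq' : ∀ e → perm (↭-++-comm Θ₂ Θ₁) (perm σ e) ≡ app Θ₂ Θ₁ (right Θ₁ (perm σ e)) (left Θ₁ (perm σ e))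
  eq' e = trans (cong (perm (↭-++-comm Θ₂ Θ₁)) (sym (app-split Θ₁ Θ₂ (perm σ e)))) (perm-comm Θ₂ Θ₁ _ _)
  eq : ∀ e → right Θ₂ (perm (↭-++-comm Θ₂ Θ₁) (perm σ e)) ≡ left Θ₁ (perm σ e) ×
             left Θ₂ (perm (↭-++-comm Θ₂ Θ₁) (perm σ e)) ≡ right Θ₁ (perm σ e)
  eq e = trans (cong (right Θ₂) (eq' e)) (right-app Θ₂ Θ₁ _ _) , trans (cong (left Θ₂) (eq' e)) (left-app Θ₂ Θ₁ _ _)

br-H (neg N) σ f g = apply' (pst N) σ g f
br-H (pst N) σ f g = apply (pst N) σ f g

H-perm : ∀ a {Θ Θ' c} (σ : Θ ↭ Θ') → H a Θ c → H a Θ' (λ e → c (perm σ e))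
H-perm (neg (par a b)) σ (Θ₁ , Θ₂ , ρ , c₁ , c₂ , h₁ , h₂ , q) =
  Θ₁ , Θ₂ , ↭-trans ρ σ , c₁ , c₂ , h₁ , h₂ , λ e → q (perm σ e)
H-perm (neg (wit a b)) σ (inj₁ (c , h , q)) = inj₁ ((λ e → c (perm σ e)) , H-perm a σ h , λ e → q (perm σ e))
H-perm (neg (wit a b)) σ (inj₂ (c , h , q)) = inj₂ ((λ e → c (perm σ e)) , H-perm b σ h , λ e → q (perm σ e))
H-perm (neg bot) σ ρ = ↭-trans ρ σ
H-perm (neg (nv x)) σ (ρ , q) = ↭-trans ρ σ , λ e → q (perm σ e)
H-perm (pst N) {Θ} {Θ'} σ (h₁ , h₂ , h₃) = (λ e → ↭-trans (h₁ (perm σ e)) (perm-gr σ e)) , (λ p → h₂ (perm-E σ p)) ,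
  λ Ξ x hx → let (t , r) = h₃ Ξ x hx in perm-Nf (++⁺ˡ Ξ σ) t , λ e' e p' p → ~trans (r e' (perm σ e) p' (perm-E σ p))
    (≡⇒~ (trans (cong (ev t) (sym (perm-++ˡ Ξ σ e' e))) (sym (ev-perm (++⁺ˡ Ξ σ) t (app Ξ Θ' e' e)))))

assocʳ : ∀ {Θ Θ' : List Arg} Θ₁ Θ₃ Θ₄ → Θ₃ ++ Θ₄ ↭ Θ' → Θ₁ ++ Θ' ↭ Θ → (Θ₁ ++ Θ₃) ++ Θ₄ ↭ Θ
assocʳ Θ₁ Θ₃ Θ₄ σ₂ σ = ↭-trans (↭-reflexive (++-assoc Θ₁ Θ₃ Θ₄)) (↭-trans (++⁺ˡ Θ₁ σ₂) σ)

perm-assocʳ : ∀ {Θ Θ'} Θ₁ Θ₃ Θ₄ (σ₂ : Θ₃ ++ Θ₄ ↭ Θ') (σ : Θ₁ ++ Θ' ↭ Θ) (e : Env Θ) →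
  let v = perm σ e ; w = perm σ₂ (right Θ₁ v) in
  perm (assocʳ {Θ} {Θ'} Θ₁ Θ₃ Θ₄ σ₂ σ) e ≡ app (Θ₁ ++ Θ₃) Θ₄ (app Θ₁ Θ₃ (left Θ₁ v) (left Θ₃ w)) (right Θ₃ w)
perm-assocʳ {Θ} {Θ'} Θ₁ Θ₃ Θ₄ σ₂ σ e = trans
  (cong (λ z → perm α (perm (++⁺ˡ Θ₁ σ₂) z)) (sym (app-split Θ₁ Θ' v))) (trans
  (cong (perm α) (trans (perm-++ˡ Θ₁ σ₂ (left Θ₁ v) (right Θ₁ v)) (cong (app Θ₁ (Θ₃ ++ Θ₄) (left Θ₁ v)) (sym (app-split Θ₃ Θ₄ w)))))
  (perm-assoc Θ₁ Θ₃ Θ₄ (left Θ₁ v) (left Θ₃ w) (right Θ₃ w)))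
  where
  v = perm σ e
  w = perm σ₂ (right Θ₁ v)
  α = ↭-reflexive (++-assoc Θ₁ Θ₃ Θ₄)

assocˡ : ∀ {Θ Θ' : List Arg} Θ₃ Θ₄ Θ₂ → Θ₃ ++ Θ₄ ↭ Θ' → Θ' ++ Θ₂ ↭ Θ → Θ₃ ++ (Θ₄ ++ Θ₂) ↭ Θ
assocˡ Θ₃ Θ₄ Θ₂ σ₁ σ = ↭-trans (↭-reflexive (sym (++-assoc Θ₃ Θ₄ Θ₂))) (↭-trans (++⁺ʳ Θ₂ σ₁) σ)

perm-assocˡ : ∀ {Θ Θ'} Θ₃ Θ₄ Θ₂ (σ₁ : Θ₃ ++ Θ₄ ↭ Θ') (σ : Θ' ++ Θ₂ ↭ Θ) (e : Env Θ) →
  let v = perm σ e ; w = perm σ₁ (left Θ' v) in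
  perm (assocˡ {Θ} {Θ'} Θ₃ Θ₄ Θ₂ σ₁ σ) e ≡ app Θ₃ (Θ₄ ++ Θ₂) (left Θ₃ w) (app Θ₄ Θ₂ (right Θ₃ w) (right Θ' v))
perm-assocˡ {Θ' = Θ'} Θ₃ Θ₄ Θ₂ σ₁ σ e = trans
  (cong (perm (↭-reflexive (sym (++-assoc Θ₃ Θ₄ Θ₂)))) (trans
    (cong (perm (++⁺ʳ Θ₂ σ₁)) (sym (app-split Θ' Θ₂ (perm σ e)))) (trans
    (perm-++ʳ Θ₂ σ₁ _ _) (cong (λ u → app (Θ₃ ++ Θ₄) Θ₂ u (right Θ' (perm σ e))) (sym (app-split Θ₃ Θ₄ _))))))
  (perm-assoc' Θ₃ Θ₄ Θ₂ _ _ _)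

commᶜ : ∀ {Θ : List Arg} Θ₁ Θ₂ → Θ₁ ++ Θ₂ ↭ Θ → Θ₂ ++ Θ₁ ↭ Θ
commᶜ Θ₁ Θ₂ σ = ↭-trans (↭-++-comm Θ₂ Θ₁) σ

perm-commᶜ : ∀ {Θ} Θ₁ Θ₂ (σ : Θ₁ ++ Θ₂ ↭ Θ) (e : Env Θ) → let v = perm σ e in
  perm (commᶜ Θ₁ Θ₂ σ) e ≡ app Θ₂ Θ₁ (right Θ₁ v) (left Θ₁ v)
perm-commᶜ Θ₁ Θ₂ σ e = trans (cong (perm (↭-++-comm Θ₂ Θ₁)) (sym (app-split Θ₁ Θ₂ (perm σ e)))) (perm-comm Θ₂ Θ₁ _ _)

H-assocˡ : ∀ a b c {Θ x} → H (neg (par (neg (par a b)) c)) Θ x →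
  H (neg (par a (neg (par b c)))) Θ (λ e → let ((u , v) , w) = x e in u , (v , w))
H-assocˡ a b c (Θ' , Θ₂ , σ , x₁ , x₂ , (Θ₃ , Θ₄ , σ₁ , y₁ , y₂ , h₁ , h₂ , q') , h₃ , q) =
  Θ₃ , Θ₄ ++ Θ₂ , assocˡ Θ₃ Θ₄ Θ₂ σ₁ σ , y₁ , (λ e → y₂ (left Θ₄ e) , x₂ (right Θ₄ e)) , h₁ ,
  (Θ₄ , Θ₂ , ↭-refl , y₂ , x₂ , h₂ , h₃ , λ _ → refl) , λ e → let v = perm σ e ; w = perm σ₁ (left Θ' v) in trans
    (cong (λ z → proj₁ (proj₁ z) , (proj₂ (proj₁ z) , proj₂ z)) (trans (q e) (cong (_, x₂ (right Θ' v)) (q' (left Θ' v)))))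
    (sym (trans (cong (λ z → y₁ (left Θ₃ z) , (y₂ (left Θ₄ (right Θ₃ z)) , x₂ (right Θ₄ (right Θ₃ z)))) (perm-assocˡ Θ₃ Θ₄ Θ₂ σ₁ σ e))
      (cong₂ (λ i j → y₁ i , (y₂ (left Θ₄ j) , x₂ (right Θ₄ j))) (left-app Θ₃ (Θ₄ ++ Θ₂) _ _) (right-app Θ₃ (Θ₄ ++ Θ₂) _ _)
      ∙ cong₂ (λ i j → y₁ (left Θ₃ w) , (y₂ i , x₂ j)) (left-app Θ₄ Θ₂ _ _) (right-app Θ₄ Θ₂ _ _))))
  where
  _∙_ = trans

H-assocʳ : ∀ a b c {Θ x} → H (neg (par a (neg (par b c)))) Θ x →
  H (neg (par (neg (par a b)) c)) Θ (λ e → let (u , (v , w)) = x e in (u , v) , w)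
H-assocʳ a b c (Θ₁ , Θ' , σ , x₁ , x₂ , h₁ , (Θ₃ , Θ₄ , σ₂ , y₁ , y₂ , h₂ , h₃ , q') , q) =
  Θ₁ ++ Θ₃ , Θ₄ , assocʳ Θ₁ Θ₃ Θ₄ σ₂ σ , (λ e → x₁ (left Θ₁ e) , y₁ (right Θ₁ e)) , y₂ ,
  (Θ₁ , Θ₃ , ↭-refl , x₁ , y₁ , h₁ , h₂ , λ _ → refl) , h₃ , λ e → let v = perm σ e ; w = perm σ₂ (right Θ₁ v) in trans
    (cong (λ z → (proj₁ z , proj₁ (proj₂ z)) , proj₂ (proj₂ z)) (trans (q e) (cong (x₁ (left Θ₁ v) ,_) (q' (right Θ₁ v)))))
    (sym (trans (cong (λ z → (x₁ (left Θ₁ (left (Θ₁ ++ Θ₃) z)) , y₁ (right Θ₁ (left (Θ₁ ++ Θ₃) z))) , y₂ (right (Θ₁ ++ Θ₃) z)) (perm-assocʳ Θ₁ Θ₃ Θ₄ σ₂ σ e))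
      (cong₂ (λ i j → (x₁ (left Θ₁ i) , y₁ (right Θ₁ i)) , y₂ j) (left-app (Θ₁ ++ Θ₃) Θ₄ _ _) (right-app (Θ₁ ++ Θ₃) Θ₄ _ _)
      ∙ cong₂ (λ i j → (x₁ i , y₁ j) , y₂ (right Θ₃ w)) (left-app Θ₁ Θ₃ _ _) (right-app Θ₁ Θ₃ _ _))))
  where
  _∙_ = trans

H-comm : ∀ a b {Θ x} → H (neg (par a b)) Θ x → H (neg (par b a)) Θ (λ e → proj₂ (x e) , proj₁ (x e))
H-comm a b (Θ₁ , Θ₂ , σ , x₁ , x₂ , h₁ , h₂ , q) = Θ₂ , Θ₁ , commᶜ Θ₁ Θ₂ σ , x₂ , x₁ , h₂ , h₁ , λ e → trans
  (cong (λ z → proj₂ z , proj₁ z) (q e)) (sym (trans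
    (cong (λ z → x₂ (left Θ₂ z) , x₁ (right Θ₂ z)) (perm-commᶜ Θ₁ Θ₂ σ e))
    (cong₂ (λ i j → x₂ i , x₁ j) (left-app Θ₂ Θ₁ _ _) (right-app Θ₂ Θ₁ _ _))))

H-first : ∀ a b {c Θ x} {f : Val a → Val b} → (∀ {Ξ y} → H a Ξ y → H b Ξ (λ e → f (y e))) → H (neg (par a c)) Θ x →
          H (neg (par b c)) Θ (λ e → f (proj₁ (x e)) , proj₂ (x e))
H-first a b {f = f} k (Θ₁ , Θ₂ , σ , x₁ , x₂ , h₁ , h₂ , q) = Θ₁ , Θ₂ , σ , (λ e → f (x₁ e)) , x₂ , k h₁ , h₂ ,
  λ e → cong (λ z → f (proj₁ z) , proj₂ z) (q e)

H-second : ∀ a b {c Θ x} {f : Val a → Val b} → (∀ {Ξ y} → H a Ξ y → H b Ξ (λ e → f (y e))) → H (neg (par c a)) Θ x →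
           H (neg (par c b)) Θ (λ e → proj₁ (x e) , f (proj₂ (x e)))
H-second a b {f = f} k (Θ₁ , Θ₂ , σ , x₁ , x₂ , h₁ , h₂ , q) = Θ₁ , Θ₂ , σ , x₁ , (λ e → f (x₂ e)) , h₁ , k h₂ ,
  λ e → cong (λ z → proj₁ z , f (proj₂ z)) (q e)

H-swap : ∀ a b c {Θ x} → H (neg (par a (neg (par b c)))) Θ x →
  H (neg (par b (neg (par a c)))) Θ (λ e → let (u , (v , w)) = x e in v , (u , w))
H-swap a b c h = H-assocˡ b a c (H-first (neg (par a b)) (neg (par b a)) {c = c} {f = λ (x , y) → y , x} (H-comm a b) (H-assocʳ a b c h))

H-≡ : ∀ a {Θ c c'} → (∀ e → c' e ≡ c e) → H a Θ c → H a Θ c'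
H-≡ (neg (par a b)) p (Θ₁ , Θ₂ , σ , c₁ , c₂ , h₁ , h₂ , q) = Θ₁ , Θ₂ , σ , c₁ , c₂ , h₁ , h₂ , λ e → trans (p e) (q e)
H-≡ (neg (wit a b)) p (inj₁ (c , h , q)) = inj₁ (c , h , λ e → trans (p e) (q e))
H-≡ (neg (wit a b)) p (inj₂ (c , h , q)) = inj₂ (c , h , λ e → trans (p e) (q e))
H-≡ (neg bot) p h = h
H-≡ (neg (nv x)) p (σ , q) = σ , λ e → trans (p e) (q e)
H-≡ (pst N) p (h₁ , h₂ , h₃) = (λ e → ↭-trans (↭-reflexive (cong proj₁ (p e))) (h₁ e)) ,
  (λ q → E-≡ (pst N) (p _) (p _) (h₂ q)) , λ Ξ x hx → let (t , r) = h₃ Ξ x hx in t , λ e' e p' p'' →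
    ~trans (≡⇒~ (cong (λ z → proj₂ z (x e')) (p e))) (r e' e p' p'')

H-unit : ∀ a {Θ x} → H (neg (par a (neg bot))) Θ x → H a Θ (λ e → proj₁ (x e))
H-unit a {Θ} (Θ₁ , Θ₂ , σ , x₁ , x₂ , h₁ , ρ , q) = H-≡ a eq (H-perm a τ h₁)
  where
  τ : Θ₁ ↭ Θ
  τ = ↭-trans (↭-reflexive (sym (++-identityʳ Θ₁))) (↭-trans (++⁺ˡ Θ₁ ρ) σ)
  eq : ∀ e → _ ≡ x₁ (perm τ e)
  eq e = trans (cong proj₁ (q e)) (cong x₁ (sym (trans
    (cong (λ z → perm (↭-reflexive (sym (++-identityʳ Θ₁))) (perm (++⁺ˡ Θ₁ ρ) z)) (sym (app-split Θ₁ Θ₂ (perm σ e)))) (trans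
    (cong (perm (↭-reflexive (sym (++-identityʳ Θ₁)))) (perm-++ˡ Θ₁ ρ _ _)) (perm-idʳ Θ₁ _)))))

-- Every proof has a normal form

module Realisation (L : Set) (τ : L → Arg) where
  private module C = Calculus L τ
  open C using (⊩_; axiom; exch; cutr; parr; witr; botr; topr; tens; injl; injr; oner; ⟦_⟧; ⟦⟧-Fn)

  H-exch : ∀ {Γ Δ} (σ : Γ ↭ Δ) {Θ γ} → H C.⌈ Δ ⌉ Θ γ → H C.⌈ Γ ⌉ Θ (λ e → C.perm σ (γ e))
  H-exch ↭-refl h = h
  H-exch {X ∷ Γ} {_ ∷ Δ} (prep X σ) h = H-second C.⌈ Δ ⌉ C.⌈ Γ ⌉ {c = τ X} {f = C.perm σ} (H-exch σ) h
  H-exch {Γ = X ∷ Y ∷ Γ} {Y ∷ X ∷ Δ} (swap X Y σ) h = H-swap (τ Y) (τ X) C.⌈ Γ ⌉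
    (H-second (neg (par (τ X) C.⌈ Δ ⌉)) (neg (par (τ X) C.⌈ Γ ⌉)) {c = τ Y} {f = λ (x , γ) → x , C.perm σ γ}
      (λ h → H-second C.⌈ Δ ⌉ C.⌈ Γ ⌉ {c = τ X} {f = C.perm σ} (H-exch σ) h) h)
  H-exch (↭-trans σ ρ) h = H-exch σ (H-exch ρ h)

  H-split : ∀ Γ {Δ Θ γ} → H C.⌈ Γ ++ Δ ⌉ Θ γ →
            H (neg (par C.⌈ Γ ⌉ C.⌈ Δ ⌉)) Θ (λ e → C.left Γ (γ e) , C.right Γ (γ e))
  H-split [] {Θ = Θ} {γ} h = [] , Θ , ↭-refl , (λ _ → tt) , γ , ↭-refl , h , λ _ → refl
  H-split (X ∷ Γ) {Δ} h = H-assocʳ (τ X) C.⌈ Γ ⌉ C.⌈ Δ ⌉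
    (H-second C.⌈ Γ ++ Δ ⌉ (neg (par C.⌈ Γ ⌉ C.⌈ Δ ⌉)) {c = τ X} {f = λ γ → C.left Γ γ , C.right Γ γ} (H-split Γ) h)

  H-cast : ∀ {a b} (e : a ≡ b) {Θ c} → H a Θ c → H b Θ (λ z → cast e (c z))
  H-cast refl h = h

  curry-H : ∀ {X Γ Θ γ} (π : ⊩ X ∷ Γ) → (∀ Ξ γ → H C.⌈ X ∷ Γ ⌉ Ξ γ → Real Ξ (λ e → ⟦ π ⟧ (γ e))) →
            H C.⌈ Γ ⌉ Θ γ → HFn (τ X) Θ (λ e → gr C.⌈ Γ ⌉ (γ e) , λ x → ⟦ π ⟧ (x , γ e))
  curry-H {X} {Γ} {Θ} {γ} π ih h = H-gr C.⌈ Γ ⌉ h ,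
    (λ p → E-gr C.⌈ Γ ⌉ (H-E C.⌈ Γ ⌉ h p) , λ _ _ q → fE (⟦⟧-Fn π) (q , H-E C.⌈ Γ ⌉ h p)) ,
    λ Ξ x hx → let (t , r) = ih (Ξ ++ Θ) (λ e → x (left Ξ e) , γ (right Ξ e))
                     (Ξ , Θ , ↭-refl , x , γ , hx , h , λ _ → refl) in
      t , λ e' e p' p → ~trans (≡⇒~ (cong₂ (λ u v → ⟦ π ⟧ (x u , γ v)) (sym (left-app Ξ Θ e' e)) (sym (right-app Ξ Θ e' e))))
        (r (app Ξ Θ e' e) (app-E Ξ Θ p' p))

  HFn-cast : ∀ {a b} (e : a ≡ b) {Θ} {S : Env Θ → M} {f : Env Θ → Val a → Tm} → HFn a Θ (λ z → S z , f z) → HFn b Θ (λ z → S z , λ y → f z (cast (sym e) y))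
  HFn-cast refl h = h

  pair-H : ∀ {a b Θ z} (e : b ≡ dual a) → H (neg (par b a)) Θ z → Real Θ (λ v → pair a (proj₂ (z v)) (cast e (proj₁ (z v))))
  pair-H {neg N} refl (Θ₁ , Θ₂ , σ , x , y , hx , hy , q) = Real-~ (λ v _ → ≡⇒~ (cong (λ z → proj₂ (proj₁ z) (proj₂ z)) (q v))) (apply (neg N) σ hx hy)
  pair-H {pst N} refl (Θ₁ , Θ₂ , σ , x , y , hx , hy , q) = Real-~ (λ v _ → ≡⇒~ (cong (λ z → proj₂ (proj₂ z) (proj₁ z)) (q v))) (apply' (neg N) σ hy hx)

  app-H : ∀ {z N c Θ γ} (e : z ≡ pst N) {i : Val c → ValN N} → (∀ {Ξ y} → H c Ξ y → HN N Ξ (λ v → i (y v))) →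
          H (neg (par z c)) Θ γ → Real Θ (λ v → proj₂ (cast e (proj₁ (γ v))) (i (proj₂ (γ v))))
  app-H {N = N} refl {i} hi (Θ₁ , Θ₂ , σ , x , y , hx , hy , q) =
    Real-~ (λ v _ → ≡⇒~ (cong (λ z → proj₂ (proj₁ z) (i (proj₂ z))) (q v))) (apply (neg N) σ hx (hi hy))

  -- The fundamental lemma of `H`. A related negative value comes with its choices already made,
  -- uniformly in the environment; so `witr` continues in one premise and `topr` is vacuous.
  realise : ∀ {Γ} (π : ⊩ Γ) Θ γ → H C.⌈ Γ ⌉ Θ γ → Real Θ (λ e → ⟦ π ⟧ (γ e))
  realise (axiom {X} {Y} e) Θ γ h = pair-H {τ Y} {τ X} e
    (H-second (neg (par (τ Y) (neg bot))) (τ Y) {c = τ X} {f = proj₁} (H-unit (τ Y)) h)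
  realise (exch σ π) Θ γ h = realise π Θ _ (H-exch σ h)
  realise (cutr {X} {Y} {Γ} {Δ} e π ρ) Θ γ h with H-split Γ {Δ} h
  ... | Θ₁ , Θ₂ , σ , γ₁ , γ₂ , h₁ , h₂ , q = Real-~
    (λ v p → ≡⇒~ (cong (λ z → br (τ X) (gr C.⌈ Γ ⌉ (proj₁ z) , λ x → ⟦ π ⟧ (x , proj₁ z))
       (gr C.⌈ Δ ⌉ (proj₂ z) , λ y → ⟦ ρ ⟧ (cast (sym e) y , proj₂ z))) (q v)))
    (br-H (τ X) {f = λ v → gr C.⌈ Γ ⌉ (γ₁ v) , λ x → ⟦ π ⟧ (x , γ₁ v)}
      {g = λ v → gr C.⌈ Δ ⌉ (γ₂ v) , λ y → ⟦ ρ ⟧ (cast (sym e) y , γ₂ v)} σ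
      (curry-H π (realise π) h₁) (HFn-cast e {f = λ v y → ⟦ ρ ⟧ (y , γ₂ v)} (curry-H ρ (realise ρ) h₂)))
  realise (parr {X} {Y} {Z} {Γ} e π) Θ γ h = realise π Θ _ (H-assocˡ (τ X) (τ Y) C.⌈ Γ ⌉
    (H-first (τ Z) (neg (par (τ X) (τ Y))) {c = C.⌈ Γ ⌉} {f = cast e} (H-cast e) h))
  realise (witr {X} {Y} {Z} {Γ} e π ρ) Θ γ h
    with H-first (τ Z) (neg (wit (τ X) (τ Y))) {c = C.⌈ Γ ⌉} {f = cast e} (H-cast e) h
  ... | Θ₁ , Θ₂ , σ , z , γ₂ , inj₁ (x , hx , qx) , h₂ , q = Real-~
    (λ v _ → ≡⇒~ (cong (λ z → either (λ x → ⟦ π ⟧ (x , proj₂ z)) (λ y → ⟦ ρ ⟧ (y , proj₂ z)) (proj₁ z))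
      (trans (q v) (cong (_, γ₂ (right Θ₁ (perm σ v))) (qx _)))))
    (realise π Θ (λ v → x (left Θ₁ (perm σ v)) , γ₂ (right Θ₁ (perm σ v))) (Θ₁ , Θ₂ , σ , x , γ₂ , hx , h₂ , λ _ → refl))
  ... | Θ₁ , Θ₂ , σ , z , γ₂ , inj₂ (x , hx , qx) , h₂ , q = Real-~
    (λ v _ → ≡⇒~ (cong (λ z → either (λ x → ⟦ π ⟧ (x , proj₂ z)) (λ y → ⟦ ρ ⟧ (y , proj₂ z)) (proj₁ z))
      (trans (q v) (cong (_, γ₂ (right Θ₁ (perm σ v))) (qx _)))))
    (realise ρ Θ (λ v → x (left Θ₁ (perm σ v)) , γ₂ (right Θ₁ (perm σ v))) (Θ₁ , Θ₂ , σ , x , γ₂ , hx , h₂ , λ _ → refl))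
  realise (botr {Z} {Γ} e π) Θ γ h = realise π Θ _ (H-unit C.⌈ Γ ⌉ (H-comm (neg bot) C.⌈ Γ ⌉
    (H-first (τ Z) (neg bot) {c = C.⌈ Γ ⌉} {f = cast e} (H-cast e) h)))
  realise (topr {Z} e) Θ γ (Θ₁ , Θ₂ , σ , z , _ , hz , _) = ⊥-elim (H-cast e {c = z} hz)
  realise (tens {X} {Y} e) Θ γ h = app-H {c = neg (par (τ X) (neg (par (τ Y) (neg bot))))} e {i = λ (x , (y , _)) → x , y}
    (H-second (neg (par (τ Y) (neg bot))) (τ Y) {c = τ X} {f = proj₁} (H-unit (τ Y))) h
  realise (injl {X} {Y} e) Θ γ h = app-H {c = neg (par (τ X) (neg bot))} e {i = λ (x , _) → inj₁ x} (λ {_} {y} h → inj₁ ((λ v → proj₁ (y v)) , H-unit (τ X) h , λ _ → refl)) h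
  realise (injr {X} {Y} e) Θ γ h = app-H {c = neg (par (τ Y) (neg bot))} e {i = λ (x , _) → inj₂ x} (λ {_} {y} h → inj₂ ((λ v → proj₁ (y v)) , H-unit (τ Y) h , λ _ → refl)) h
  realise (oner e) Θ γ h = app-H {c = neg bot} e {i = λ _ → tt} (λ h → h) h

-- Rigidity of identities

skG : ∀ a → Gn a → Sk a
skG (neg (par a b)) (g , h) = skG a g , skG b h
skG (neg (wit a b)) (inj₁ g) = inj₁ (skG a g)
skG (neg (wit a b)) (inj₂ h) = inj₂ (skG b h)
skG (neg bot) _ = tt
skG (neg (nv x)) _ = tt
skG (pst N) _ = tt

-- The tree t is, literally, the identity on the generic input g.
Id : ∀ N → Nm → Gn (neg N) → Tm → Set
IdB : ∀ a → Gn a → Bd a → Set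
IdBN : ∀ N → Gn (neg N) → Bd (neg N) → Set
Id N n g t = Σ (Bd (neg N)) λ b → t ≡ node N n b × IdBN N g b
IdB (neg N) g b = IdBN N g b
IdB (pst P) m (b-leaf S T) = S ↭ [ pst P , m ] × (∀ g → Id P m g (T g))
IdBN (par a b) (g , h) (b-par x y) = IdB a g x × IdB b h y
IdBN (wit a b) (inj₁ g) (b-inl x) = IdB a g x
IdBN (wit a b) (inj₁ g) (b-inr x) = ⊥
IdBN (wit a b) (inj₂ g) (b-inl x) = ⊥
IdBN (wit a b) (inj₂ g) (b-inr x) = IdB b g x
IdBN bot g b = ⊤
IdBN (nv x) n (b-nv m) = m ≡ n

gen-Id : ∀ a g → IdB a g (reify a (gen a g))
gen-IdN : ∀ N g → IdBN N g (reifyN N (genN N g))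
gen-Id (neg N) g = gen-IdN N g
gen-Id (pst N) m = ↭-refl , λ g → _ , refl , gen-IdN N g
gen-IdN (par a b) (g , h) = gen-Id a g , gen-Id b h
gen-IdN (wit a b) (inj₁ g) = gen-Id a g
gen-IdN (wit a b) (inj₂ g) = gen-Id b g
gen-IdN bot g = tt
gen-IdN (nv x) n = refl

gr-IdB : ∀ a {g b} → IdB a g b → grB b ↭ grG a g
gr-IdBN : ∀ N {g b} → IdBN N g b → grB b ↭ grG (neg N) g
gr-IdB (neg N) i = gr-IdBN N i
gr-IdB (pst N) {b = b-leaf S T} (p , _) = p
gr-IdBN (par a b) {_ , _} {b-par _ _} (i , j) = ++⁺ (gr-IdB a i) (gr-IdB b j)
gr-IdBN (wit a b) {inj₁ _} {b-inl _} i = gr-IdB a i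
gr-IdBN (wit a b) {inj₂ _} {b-inr _} i = gr-IdB b i
gr-IdBN bot {b = b-bot} i = ↭-refl
gr-IdBN (nv x) {b = b-nv _} refl = ↭-refl

-- The variables of such a type P are η-expanded into the only variable of their unique skeleton,
-- so that two nested foci on them may be exchanged.
Deg : Ng → Set
Deg P = Gn (neg P) × (∀ g g' → skG (neg P) g ≡ skG (neg P) g') ×
        (∀ g → ∃ λ Q → ∃ λ m → grG (neg P) g ≡ [ pst Q , m ])

Nd : Arg → Set
NdN : Ng → Set
Nd (neg N) = NdN N
Nd (pst P) = ¬ Deg P × NdN P
NdN (par a b) = Nd a × Nd b
NdN (wit a b) = Nd a × Nd b
NdN bot = ⊤
NdN top = ⊤
NdN (nv x) = ⊤

someG : ∀ {a} → Bd a → Gn a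
someG (b-par b c) = someG b , someG c
someG (b-inl b) = inj₁ (someG b)
someG (b-inr b) = inj₂ (someG b)
someG b-bot = tt
someG (b-nv n) = n
someG (b-leaf S T) = []

holeG : ∀ {N a} → Hl N a → Gn a
holeG h-leaf = []
holeG (h-parˡ H b) = holeG H , someG b
holeG (h-parʳ b H) = someG b , holeG H
holeG (h-inl H) = inj₁ (holeG H)
holeG (h-inr H) = inj₂ (holeG H)

gr-plug : ∀ {N a} (H : Hl N a) S F → grB (plug H S F) ↭ grH H ++ S
gr-plug h-leaf S F = ↭-refl
gr-plug (h-parˡ H b) S F = ↭-trans (++⁺ʳ (grB b) (gr-plug H S F)) (lem (grH H) S (grB b))
  where
  lem : ∀ a b c → (a ++ b) ++ c ↭ (a ++ c) ++ b
  lem = solve 3 (λ a b c → (a :+ b) :+ c ⊜ (a :+ c) :+ b) ↭-refl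
gr-plug (h-parʳ b H) S F = ↭-trans (++⁺ˡ (grB b) (gr-plug H S F)) (↭-reflexive (sym (++-assoc (grB b) _ _)))
gr-plug (h-inl H) S F = gr-plug H S F
gr-plug (h-inr H) S F = gr-plug H S F

IdB-sk : ∀ {a} (b : Bd a) {g g'} → IdB a g b → IdB a g' b → skG a g ≡ skG a g'
IdB-sk (b-par b c) {_ , _} {_ , _} (i , j) (i' , j') = cong₂ _,_ (IdB-sk b i i') (IdB-sk c j j')
IdB-sk (b-inl b) {inj₁ _} {inj₁ _} i i' = cong inj₁ (IdB-sk b i i')
IdB-sk (b-inr b) {inj₂ _} {inj₂ _} i i' = cong inj₂ (IdB-sk b i i')
IdB-sk b-bot i i' = refl
IdB-sk (b-nv n) i i' = refl
IdB-sk (b-leaf S T) i i' = refl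

IdB-skH : ∀ {P a} (H : Hl P a) {S F S' F' g g'} → IdB a g (plug H S F) → IdB a g' (plug H S' F') → skG a g ≡ skG a g'
IdB-skH h-leaf i i' = refl
IdB-skH (h-parˡ H b) {g = _ , _} {_ , _} (i , j) (i' , j') = cong₂ _,_ (IdB-skH H i i') (IdB-sk b j j')
IdB-skH (h-parʳ b H) {g = _ , _} {_ , _} (i , j) (i' , j') = cong₂ _,_ (IdB-sk b i i') (IdB-skH H j j')
IdB-skH (h-inl H) {g = inj₁ _} {inj₁ _} i i' = cong inj₁ (IdB-skH H i i')
IdB-skH (h-inr H) {g = inj₂ _} {inj₂ _} i i' = cong inj₂ (IdB-skH H i i')

IdB-hole : ∀ {P a} (H : Hl P a) {S F g} → IdB a g (plug H S F) →
           ∃ λ m → S ↭ [ pst P , m ] × (∀ g → Id P m g (F g))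
IdB-hole h-leaf {g = m} (p , q) = m , p , q
IdB-hole (h-parˡ H b) {g = _ , _} (i , j) = IdB-hole H i
IdB-hole (h-parʳ b H) {g = _ , _} (i , j) = IdB-hole H j
IdB-hole (h-inl H) {g = inj₁ _} i = IdB-hole H i
IdB-hole (h-inr H) {g = inj₂ _} i = IdB-hole H i

Nd-hole : ∀ {P a} → Hl P a → Nd a → ¬ Deg P
Nd-hole h-leaf (d , _) = d
Nd-hole (h-parˡ H b) (p , q) = Nd-hole H p
Nd-hole (h-parʳ b H) (p , q) = Nd-hole H q
Nd-hole (h-inl H) (p , q) = Nd-hole H p
Nd-hole (h-inr H) (p , q) = Nd-hole H q

-- In an identity the leaf at the hole of `H` uses exactly one variable, of type `pst P`; so the
-- second focus is on it, `N'` is `P`, and `grH H'` is empty. As `H'` is fixed while the input of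
-- `P` varies, all inputs share one skeleton, and their only resource is that of the leaf at the
-- hole of `H'`, a positive variable. This makes `P` degenerate.
no-comm : ∀ {N₀ N P P' n₀ g} → NdN N₀ → ∀ n N' n' (H : Hl P (neg N)) (H' : Hl P' (neg N')) (U : M)
          (V : Gn (neg P) → M) (T : Gn (neg P) → Gn (neg P') → Tm) →
          ¬ Id N₀ n₀ g (node N n (plug H (((pst N' , n') ∷ grH H') ++ U) λ g → node N' n' (plug H' (V g) (T g))))
no-comm nd n N' n' H H' U V T (_ , refl , i) with IdB-hole H i
... | m , p , q with ∷-injective (↭-singleton-inv p)
... | refl , e = Nd-hole H nd (holeG H' ,
    (λ g g' → IdB-skH H' (inner g) (inner g')) ,
    (λ g → let (m' , s , _) = IdB-hole H' (inner g) in _ , m' , ↭-singleton-inv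
      (↭-trans (↭-sym (gr-IdBN N' {g} {plug H' (V g) (T g)} (inner g))) (↭-trans (gr-plug H' (V g) (T g))
        (↭-trans (↭-reflexive (cong (_++ V g) (++-conicalˡ (grH H') U e))) s)))))
  where
  inner : ∀ g → IdBN _ g (plug H' (V g) (T g))
  inner g with q g
  ... | _ , refl , j = j

-- Both directions are carried together because `~` has symmetry as a constructor; `~comm` never
-- meets an identity, by `no-comm`.
Id-~ : ∀ {N} → NdN N → ∀ {t t' n g} → t ~ t' → (Id N n g t → Id N n g t') × (Id N n g t' → Id N n g t)
IdB-~ : ∀ {a} → Nd a → ∀ {b b' g} → b ~B b' → (IdB a g b → IdB a g b') × (IdB a g b' → IdB a g b)
Id-~ nd ~refl = (λ i → i) , (λ i → i)
Id-~ nd (~sym p) = let (f , g) = Id-~ nd p in g , f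
Id-~ nd (~trans p q) = let (f , g) = Id-~ nd p ; (h , k) = Id-~ nd q in (λ i → h (f i)) , (λ i → g (k i))
Id-~ nd (~node p) = (λ { (_ , refl , i) → _ , refl , proj₁ (IdB-~ nd p) i }) ,
                    (λ { (_ , refl , i) → _ , refl , proj₂ (IdB-~ nd p) i })
Id-~ nd (~comm n n' H H' U T) =
  (λ i → ⊥-elim (no-comm nd n _ n' H H' U _ T i)) ,
  (λ i → ⊥-elim (no-comm nd n' _ n H' H U _ (λ g' g → T g g') i))
IdB-~ (nd , nd') {g = _ , _} (~par p q) = (λ (i , j) → proj₁ (IdB-~ nd p) i , proj₁ (IdB-~ nd' q) j) ,
                                          (λ (i , j) → proj₂ (IdB-~ nd p) i , proj₂ (IdB-~ nd' q) j)
IdB-~ (nd , nd') {g = inj₁ _} (~inl p) = IdB-~ nd p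
IdB-~ (nd , nd') {g = inj₂ _} (~inl p) = (λ i → i) , (λ i → i)
IdB-~ (nd , nd') {g = inj₁ _} (~inr p) = (λ i → i) , (λ i → i)
IdB-~ (nd , nd') {g = inj₂ _} (~inr p) = IdB-~ nd' p
IdB-~ nd ~bot = (λ i → i) , (λ i → i)
IdB-~ nd ~nv = (λ i → i) , (λ i → i)
IdB-~ (_ , nd) (~leaf p q) = (λ (r , i) → ↭-trans (↭-sym p) r , λ g → proj₁ (Id-~ nd (q g)) (i g)) ,
                             (λ (r , i) → ↭-trans p r , λ g → proj₂ (Id-~ nd (q g)) (i g))

-- Decoding isomorphisms

data Ins {A : Set} (q : A) (Θ' : List A) : List A → Set where
  here : Ins q Θ' (q ∷ Θ')
  there : ∀ {x Ξ Θ} → Θ' ≡ x ∷ Ξ → Ins q Ξ Θ → Ins q Θ' (x ∷ Θ)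

get : ∀ {q Θ' Θ} → Ins q Θ' Θ → Env Θ → Val q
get here (x , e) = x
get (there _ i) (x , e) = get i e

rest : ∀ {q Θ' Θ} → Ins q Θ' Θ → Env Θ → Env Θ'
rest here (x , e) = e
rest (there refl i) (x , e) = x , rest i e

-- Finds which variable of the context an `n-node` focuses on, and keeps the residual permutation of
-- the others.
pull : ∀ {Γ Δ q Γ'} (σ : Γ ↭ Δ) (i : Ins q Γ' Γ) → ∃ λ Δ' → Σ (Ins q Δ' Δ) λ j → Σ (Γ' ↭ Δ') λ τ →
       ∀ e → get i (perm σ e) ≡ get j e × rest i (perm σ e) ≡ perm τ (rest j e)
pull ↭-refl i = _ , i , ↭-refl , λ e → refl , refl
pull (prep x σ) here = _ , here , σ , λ e → refl , refl
pull (prep x σ) (there refl i) with pull σ i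
... | Δ' , j , τ , h = _ , there refl j , prep x τ , λ (y , e) → proj₁ (h e) , cong (y ,_) (proj₂ (h e))
pull (swap x y σ) here = _ , there refl here , prep y σ , λ e → refl , refl
pull (swap x y σ) (there refl here) = _ , here , prep x σ , λ e → refl , refl
pull (swap x y σ) (there refl (there refl i)) with pull σ i
... | Δ' , j , τ , h = _ , there refl (there refl j) , swap x y τ ,
  λ (z , (w , e)) → proj₁ (h e) , cong (λ v → w , (z , v)) (proj₂ (h e))
pull (↭-trans σ ρ) i with pull σ i
... | Δ' , j , τ , h with pull ρ j
... | Ξ' , k , τ' , h' = _ , k , ↭-trans τ τ' , λ e →
  trans (proj₁ (h (perm ρ e))) (proj₁ (h' e)) , trans (proj₂ (h (perm ρ e))) (cong (perm τ) (proj₂ (h' e)))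

-- In a branch of a leaf, the context is the list of slots bound by the branch followed by the one
-- variable from outside; the head variable is either that last one or a bound slot.
data LastView {q₀} qs : ∀ {q Δ'} → Ins q Δ' (qs ++ q₀ ∷ []) → Set where
  isLast : ∀ {j : Ins q₀ qs (qs ++ q₀ ∷ [])} →
           (∀ e y → get j (app qs (q₀ ∷ []) e (y , tt)) ≡ y × rest j (app qs (q₀ ∷ []) e (y , tt)) ≡ e) → LastView qs j
  isIn : ∀ {q Δ' j Ξ} (i : Ins q Ξ qs) → (∀ e y → get j (app qs (q₀ ∷ []) e (y , tt)) ≡ get i e) → LastView qs {q} {Δ'} j

lastView : ∀ {q₀ q Δ'} qs (j : Ins q Δ' (qs ++ q₀ ∷ [])) → LastView qs j
lastView [] here = isLast λ e y → refl , refl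
lastView [] (there _ ())
lastView (x ∷ qs) here = isIn here λ e y → refl
lastView (x ∷ qs) (there refl j) with lastView qs j
... | isLast h = isLast λ (z , e) y → proj₁ (h e y) , cong (z ,_) (proj₂ (h e y))
... | isIn i h = isIn (there refl i) λ (z , e) y → h e y

permΓ : ∀ qs {Θ Θ'} → Θ ↭ Θ' → NB ⌈ qs ⌉ Θ → NB ⌈ qs ⌉ Θ'
permΓ [] σ (n-bot ρ) = n-bot (↭-trans ρ σ)
permΓ (q ∷ qs) σ (n-par ρ b c) = n-par (↭-trans ρ σ) b c

evB-permΓ : ∀ qs {Θ Θ'} (σ : Θ ↭ Θ') (b : NB ⌈ qs ⌉ Θ) e → evB (permΓ qs σ b) e ≡ evB b (perm σ e)
evB-permΓ [] σ (n-bot ρ) e = refl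
evB-permΓ (q ∷ qs) σ (n-par ρ b c) e = refl

joinΓ : ∀ qs rs {Θ₁ Θ₂ Θ} → Θ₁ ++ Θ₂ ↭ Θ → NB ⌈ qs ⌉ Θ₁ → NB ⌈ rs ⌉ Θ₂ → NB ⌈ qs ++ rs ⌉ Θ
joinΓ [] rs {Θ₂ = Θ₂} σ (n-bot ρ) c = permΓ rs (↭-trans (++⁺ʳ Θ₂ ρ) σ) c
joinΓ (q ∷ qs) rs {Θ₂ = Θ₂} σ (n-par {Θ₁ = Θ₃} {Θ₄} ρ x y) c =
  n-par (assocˡ Θ₃ Θ₄ Θ₂ ρ σ) x (joinΓ qs rs ↭-refl y c)

evB-joinΓ : ∀ qs rs {Θ₁ Θ₂ Θ} (σ : Θ₁ ++ Θ₂ ↭ Θ) (b : NB ⌈ qs ⌉ Θ₁) (c : NB ⌈ rs ⌉ Θ₂) (e : Env Θ) →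
  evB (joinΓ qs rs σ b c) e ≡ app qs rs (evB b (left Θ₁ (perm σ e))) (evB c (right Θ₁ (perm σ e)))
evB-joinΓ [] rs {Θ₁} {Θ₂} σ (n-bot ρ) c e = trans (evB-permΓ rs (↭-trans (++⁺ʳ Θ₂ ρ) σ) c e)
  (cong (evB c) (trans (cong (perm (++⁺ʳ Θ₂ ρ)) (sym (app-split Θ₁ Θ₂ (perm σ e)))) (perm-++ʳ Θ₂ ρ _ _)))
evB-joinΓ (q ∷ qs) rs {Θ₁} {Θ₂} σ (n-par {Θ₁ = Θ₃} {Θ₄} ρ x y) c e = trans
  (cong (evB x (left Θ₃ v) ,_) (evB-joinΓ qs rs ↭-refl y c (right Θ₃ v))) (trans
  (cong (λ z → evB x (left Θ₃ z) , app qs rs (evB y (left Θ₄ (right Θ₃ z))) (evB c (right Θ₄ (right Θ₃ z))))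
    (perm-assocˡ Θ₃ Θ₄ Θ₂ ρ σ e)) (trans
  (cong₂ (λ i j → evB x i , app qs rs (evB y (left Θ₄ j)) (evB c (right Θ₄ j)))
    (left-app Θ₃ (Θ₄ ++ Θ₂) _ _) (right-app Θ₃ (Θ₄ ++ Θ₂) _ _))
  (cong₂ (λ i j → evB x (left Θ₃ w) , app qs rs (evB y i) (evB c j)) (left-app Θ₄ Θ₂ _ _) (right-app Θ₄ Θ₂ _ _))))
  where
  v = perm (assocˡ Θ₃ Θ₄ Θ₂ ρ σ) e
  w = perm ρ (left Θ₁ (perm σ e))

open Plumbing Arg (λ a → a) using (perm-sym)

-- The choices of a normal body do not depend on its environment, so its value has a constant
-- skeleton and only the contents of the slots vary.
frame : ∀ {a Θ} (b : NB a Θ) → Σ (Sk a) λ s → Σ (NB ⌈ sl a s ⌉ Θ) λ c → ∀ e → evB b e ≡ re a s (evB c e)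
frame (n-par {a} {b} {Θ₁} σ x y) with frame x | frame y
... | s , c , p | t , d , q = (s , t) , joinΓ (sl a s) (sl b t) σ c d , λ e → trans
  (cong₂ _,_ (p (left Θ₁ (perm σ e))) (q (right Θ₁ (perm σ e))))
  (sym (trans (cong (re (neg (par a b)) (s , t)) (evB-joinΓ (sl a s) (sl b t) σ c d e))
    (cong₂ (λ u v → re a s u , re b t v) (left-app (sl a s) (sl b t) _ _) (right-app (sl a s) (sl b t) _ _))))
frame (n-inl x) with frame x
... | s , c , p = inj₁ s , c , λ e → cong inj₁ (p e)
frame (n-inr x) with frame x
... | s , c , p = inj₂ s , c , λ e → cong inj₂ (p e)
frame (n-bot σ) = tt , n-bot σ , λ e → refl
frame (n-nv σ) = tt , n-par σ (n-nv ↭-refl) (n-bot ↭-refl) , λ e → refl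
frame {Θ = Θ} (n-leaf ch) = tt , n-par (↭-sym σ) (n-leaf ch) (n-bot ↭-refl) , λ e →
  cong (evB (n-leaf ch)) (sym (trans (cong (left Θ) (eq e)) (left-app Θ [] e tt)))
  where
  σ : Θ ↭ Θ ++ []
  σ = ↭-reflexive (sym (++-identityʳ Θ))
  eq : ∀ e → perm (↭-sym σ) e ≡ app Θ [] e tt
  eq e = trans (cong (perm (↭-sym σ)) (sym (perm-idʳ Θ e))) (perm-sym σ (app Θ [] e tt))

data Slot : Arg → Set where
  s-pst : ∀ {N} → Slot (pst N)
  s-nv : ∀ {x} → Slot (neg (nv x))

slots : ∀ a s → All Slot (sl a s)
slots (neg (par a b)) (s , t) = All.++⁺ (slots a s) (slots b t)
slots (neg (wit a b)) (inj₁ s) = slots a s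
slots (neg (wit a b)) (inj₂ s) = slots b s
slots (neg bot) s = []
slots (neg (nv x)) s = s-nv ∷ []
slots (pst N) s = s-pst ∷ []

nm : ∀ {q} → Slot q → Nm → Gn q
nm s-pst n = n
nm s-nv n = n

gr-nm : ∀ {q} (S : Slot q) n → gr q (gen q (nm S n)) ≡ [ q , n ]
gr-nm s-pst n = refl
gr-nm s-nv n = refl

grG-nm : ∀ {q} (S : Slot q) n → grG q (nm S n) ≡ [ q , n ]
grG-nm s-pst n = refl
grG-nm s-nv n = refl

names : ∀ {qs} → All Slot qs → (Fin (length qs) → Nm) → Gn ⌈ qs ⌉
names [] f = tt
names (S ∷ Ss) f = nm S (f zero) , names Ss (λ i → f (suc i))

at : ∀ {qs} {P : Arg → Set} → All P qs → ∀ i → P (lookup qs i)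
at (p ∷ ps) zero = p
at (p ∷ ps) (suc i) = at ps i

pr : ∀ qs → Env qs → ∀ i → Val (lookup qs i)
pr (q ∷ qs) (x , e) zero = x
pr (q ∷ qs) (x , e) (suc i) = pr qs e i

pr-names : ∀ {qs} (Ss : All Slot qs) f i → pr qs (gen ⌈ qs ⌉ (names Ss f)) i ≡ gen (lookup qs i) (nm (at Ss i) (f i))
pr-names (S ∷ Ss) f zero = refl
pr-names (S ∷ Ss) f (suc i) = pr-names Ss (λ i → f (suc i)) i

IdB-at : ∀ {qs} (Ss : All Slot qs) f e → IdB ⌈ qs ⌉ (names Ss f) (reify ⌈ qs ⌉ e) →
         ∀ i → IdB (lookup qs i) (nm (at Ss i) (f i)) (reify (lookup qs i) (pr qs e i))
IdB-at (S ∷ Ss) f (x , e) (p , q) zero = p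
IdB-at (S ∷ Ss) f (x , e) (p , q) (suc i) = IdB-at Ss (λ i → f (suc i)) e q i

leftG : ∀ qs {rs} → Gn ⌈ qs ++ rs ⌉ → Gn ⌈ qs ⌉
leftG [] g = tt
leftG (q ∷ qs) (x , g) = x , leftG qs g
rightG : ∀ qs {rs} → Gn ⌈ qs ++ rs ⌉ → Gn ⌈ rs ⌉
rightG [] g = g
rightG (q ∷ qs) (x , g) = rightG qs g

left-gen : ∀ qs {rs} g → left qs {rs} (gen ⌈ qs ++ rs ⌉ g) ≡ gen ⌈ qs ⌉ (leftG qs g)
left-gen [] g = refl
left-gen (q ∷ qs) (x , g) = cong (gen q x ,_) (left-gen qs g)
right-gen : ∀ qs {rs} g → right qs {rs} (gen ⌈ qs ++ rs ⌉ g) ≡ gen ⌈ rs ⌉ (rightG qs g)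
right-gen [] g = refl
right-gen (q ∷ qs) (x , g) = right-gen qs g

un : ∀ a s → Gn ⌈ sl a s ⌉ → Gn a
un (neg (par a b)) (s , t) g = un a s (leftG (sl a s) g) , un b t (rightG (sl a s) g)
un (neg (wit a b)) (inj₁ s) g = inj₁ (un a s g)
un (neg (wit a b)) (inj₂ s) g = inj₂ (un b s g)
un (neg bot) s g = tt
un (neg (nv x)) s (n , _) = n
un (pst N) s (n , _) = n

gen-un : ∀ a s g → gen a (un a s g) ≡ re a s (gen ⌈ sl a s ⌉ g)
gen-un (neg (par a b)) (s , t) g = cong₂ _,_
  (trans (gen-un a s _) (cong (re a s) (sym (left-gen (sl a s) g))))
  (trans (gen-un b t _) (cong (re b t) (sym (right-gen (sl a s) g))))
gen-un (neg (wit a b)) (inj₁ s) g = cong inj₁ (gen-un a s g)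
gen-un (neg (wit a b)) (inj₂ s) g = cong inj₂ (gen-un b s g)
gen-un (neg bot) s g = refl
gen-un (neg (nv x)) s g = refl
gen-un (pst N) s g = refl

IdB-un : ∀ a s g s' e → IdB a (un a s g) (reify a (re a s' e)) → s' ≡ s
IdB-un (neg (par a b)) (s , t) g (s' , t') e (p , q) =
  cong₂ _,_ (IdB-un a s _ s' _ p) (IdB-un b t _ t' _ q)
IdB-un (neg (wit a b)) (inj₁ s) g (inj₁ s') e p = cong inj₁ (IdB-un a s g s' e p)
IdB-un (neg (wit a b)) (inj₂ s) g (inj₂ s') e p = cong inj₂ (IdB-un b s g s' e p)
IdB-un (neg bot) s g s' e p = refl
IdB-un (neg (nv x)) s g s' e p = refl
IdB-un (pst N) s g s' e p = refl

IdB-join : ∀ qs rs g e → IdB ⌈ qs ⌉ (leftG qs {rs} g) (reify ⌈ qs ⌉ (left qs e)) →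
           IdB ⌈ rs ⌉ (rightG qs g) (reify ⌈ rs ⌉ (right qs e)) → IdB ⌈ qs ++ rs ⌉ g (reify ⌈ qs ++ rs ⌉ e)
IdB-join [] rs g e p q = q
IdB-join (r ∷ qs) rs (x , g) (y , e) (p , p') q = p , IdB-join qs rs g e p' q

IdB-slots : ∀ a s g e → IdB a (un a s g) (reify a (re a s e)) → IdB ⌈ sl a s ⌉ g (reify ⌈ sl a s ⌉ e)
IdB-slots (neg (par a b)) (s , t) g e (p , q) = IdB-join (sl a s) (sl b t) g e
  (IdB-slots a s _ _ p) (IdB-slots b t _ _ q)
IdB-slots (neg (wit a b)) (inj₁ s) g e p = IdB-slots a s g e p
IdB-slots (neg (wit a b)) (inj₂ s) g e p = IdB-slots b s g e p
IdB-slots (neg bot) s g e p = tt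
IdB-slots (neg (nv x)) s (n , _) (m , _) p = p , tt
IdB-slots (pst N) s (n , _) (m , _) p = p , tt

gr-reify : ∀ a x → grB (reify a x) ≡ gr a x
gr-reify (neg (par a b)) (x , y) = cong₂ _++_ (gr-reify a x) (gr-reify b y)
gr-reify (neg (wit a b)) (inj₁ x) = gr-reify a x
gr-reify (neg (wit a b)) (inj₂ x) = gr-reify b x
gr-reify (neg bot) x = refl
gr-reify (neg (nv x)) n = refl
gr-reify (pst N) k = refl

IdB-gr : ∀ a {g x} → IdB a g (reify a x) → gr a x ↭ grG a g
IdB-gr a {x = x} i = ↭-trans (↭-reflexive (sym (gr-reify a x))) (gr-IdB a i)

-- A part of the context rs, as a list of positions.
record Emb (Θ rs : List Arg) : Set where
  constructor emb
  field
    res : Env rs → Env Θ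
    idx : Fin (length Θ) → Fin (length rs)
    lab : ∀ j → lookup rs (idx j) ≡ lookup Θ j
    val : ∀ e j → pr Θ (res e) j ≡ cast (lab j) (pr rs e (idx j))
open Emb

cast-∘ : ∀ {a b c} (p : a ≡ b) (q : b ≡ c) x → cast q (cast p x) ≡ cast (trans p q) x
cast-∘ refl refl x = refl

emb-∘ : ∀ {Θ Δ rs} → Emb Θ Δ → Emb Δ rs → Emb Θ rs
emb-∘ α β = emb (λ e → res α (res β e)) (λ j → idx β (idx α j)) (λ j → trans (lab β (idx α j)) (lab α j))
  λ e j → trans (val α (res β e) j) (trans (cong (cast (lab α j)) (val β e (idx α j))) (cast-∘ (lab β (idx α j)) (lab α j) _))

emb-left : ∀ Γ {Δ} → Emb Γ (Γ ++ Δ)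
emb-left [] = emb (λ _ → tt) (λ ()) (λ ()) (λ _ ())
emb-left (x ∷ Γ) {Δ} = let α = emb-left Γ {Δ} in emb (λ (y , e) → y , res α e)
  (λ { zero → zero ; (suc i) → suc (idx α i) }) (λ { zero → refl ; (suc i) → lab α i })
  λ { e zero → refl ; (_ , e) (suc i) → val α e i }

res-left : ∀ Γ {Δ} e → res (emb-left Γ {Δ}) e ≡ left Γ e
res-left [] e = refl
res-left (x ∷ Γ) (y , e) = cong (y ,_) (res-left Γ e)

emb-right : ∀ Γ {Δ} → Emb Δ (Γ ++ Δ)
emb-right [] = emb (λ e → e) (λ i → i) (λ _ → refl) (λ _ _ → refl)
emb-right (x ∷ Γ) {Δ} = let α = emb-right Γ {Δ} in emb (λ (y , e) → res α e) (λ i → suc (idx α i)) (lab α) (λ (_ , e) → val α e)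

res-right : ∀ Γ {Δ} e → res (emb-right Γ {Δ}) e ≡ right Γ e
res-right [] e = refl
res-right (x ∷ Γ) (y , e) = res-right Γ e

emb-perm : ∀ {Γ Δ} → Γ ↭ Δ → Emb Γ Δ
emb-perm ↭-refl = emb (λ e → e) (λ i → i) (λ _ → refl) (λ _ _ → refl)
emb-perm (prep x σ) = let α = emb-perm σ in emb (λ (y , e) → y , res α e)
  (λ { zero → zero ; (suc i) → suc (idx α i) }) (λ { zero → refl ; (suc i) → lab α i })
  λ { e zero → refl ; (_ , e) (suc i) → val α e i }
emb-perm (swap x y σ) = let α = emb-perm σ in emb (λ (z , (w , e)) → w , (z , res α e))
  (λ { zero → suc zero ; (suc zero) → zero ; (suc (suc i)) → suc (suc (idx α i)) })
  (λ { zero → refl ; (suc zero) → refl ; (suc (suc i)) → lab α i })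
  λ { e zero → refl ; e (suc zero) → refl ; (_ , (_ , e)) (suc (suc i)) → val α e i }
emb-perm (↭-trans σ ρ) = emb-∘ (emb-perm σ) (emb-perm ρ)

res-perm : ∀ {Γ Δ} (σ : Γ ↭ Δ) e → res (emb-perm σ) e ≡ perm σ e
res-perm ↭-refl e = refl
res-perm (prep x σ) (y , e) = cong (y ,_) (res-perm σ e)
res-perm (swap x y σ) (z , (w , e)) = cong (λ u → w , (z , u)) (res-perm σ e)
res-perm (↭-trans σ ρ) e = trans (res-perm σ (res (emb-perm ρ) e)) (cong (perm σ) (res-perm ρ e))

-- Linearity divides the context among the components; the share of component `i` is located inside
-- `rs` by an `Emb`.
pick : ∀ qs {rs} (F : NB ⌈ qs ⌉ rs) i → ∃ λ Θ → Σ (NB (lookup qs i) Θ) λ b → Σ (Emb Θ rs) λ α →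
       ∀ e → pr qs (evB F e) i ≡ evB b (res α e)
pick (q ∷ qs) (n-par {Θ₁ = Θ₁} σ x y) zero = Θ₁ , x , emb-∘ (emb-left Θ₁) (emb-perm σ) , λ e →
  cong (evB x) (sym (trans (res-left Θ₁ _) (cong (left Θ₁) (res-perm σ e))))
pick (q ∷ qs) (n-par {Θ₁ = Θ₁} σ x y) (suc i) with pick qs y i
... | Θ , b , α , h = Θ , b , emb-∘ α (emb-∘ (emb-right Θ₁) (emb-perm σ)) , λ e →
  trans (h (right Θ₁ (perm σ e))) (cong (λ v → evB b (res α v))
    (sym (trans (res-right Θ₁ _) (cong (right Θ₁) (res-perm σ e)))))

Inverse : ∀ {qs rs} → All Slot qs → NB ⌈ qs ⌉ rs → NB ⌈ rs ⌉ qs → Set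
Inverse {qs} S F G = ∀ f → IdB ⌈ qs ⌉ (names S f) (reify ⌈ qs ⌉ (evB F (evB G (gen ⌈ qs ⌉ (names S f)))))

size : ∀ a → Val a → ℕ
size a x = length (gr a x)

size-cast : ∀ {a b} (e : a ≡ b) x → size b (cast e x) ≡ size a x
size-cast refl x = refl

Single : ∀ {qs rs} → NB ⌈ qs ⌉ rs → Set
Single {qs} {rs} F = ∀ l → Σ (Fin (length rs)) λ k → Σ (NB (lookup qs l) (lookup rs k ∷ [])) λ b →
  ∀ e → pr qs (evB F e) l ≡ evB b (pr rs e k , tt)

module _ {qs rs} (S : All Slot qs) (R : All Slot rs) (F : NB ⌈ qs ⌉ rs) (G : NB ⌈ rs ⌉ qs)
         (inv : Inverse S F G) (inv' : Inverse R G F) where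

  private
    -- Sizes are independent of names, so all names are `[]`.
    n₀ : ∀ {ps} → All Slot ps → Env ps
    n₀ {ps} S = gen ⌈ ps ⌉ (names S λ _ → [])

    unit-size : ∀ {ps} (S : All Slot ps) (f : Fin (length ps) → Nm) e → IdB ⌈ ps ⌉ (names S f) (reify ⌈ ps ⌉ e) →
                ∀ i → size (lookup ps i) (pr ps e i) ≡ 1
    unit-size {ps} S f e h i = trans (↭-length (IdB-gr (lookup ps i) (IdB-at S f e h i)))
      (cong length (grG-nm (at S i) (f i)))

  -- Every part of G uses some resource, hence has positive size.
  positive : ∀ k → 1 ≤ size (lookup rs k) (pr rs (evB G (n₀ S)) k)
  positive k with pick rs G k
  ... | Θ , b , α , h = ≤-trans (pos-Θ Θ α u) (≤-reflexive (sym
          (trans (cong (size (lookup rs k)) (h (n₀ S))) (↭-length (gr-evB b (res α (n₀ S)))))))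
    where
    u : size ⌈ Θ ⌉ (res α (evB F (n₀ R))) ≡ 1
    u = trans (sym (trans (cong (size (lookup rs k)) (h (evB F (n₀ R)))) (↭-length (gr-evB b _))))
          (unit-size R (λ _ → []) _ (inv' λ _ → []) k)
    pos-Θ : ∀ Θ (α : Emb Θ qs) → size ⌈ Θ ⌉ (res α (evB F (n₀ R))) ≡ 1 → 1 ≤ size ⌈ Θ ⌉ (res α (n₀ S))
    pos-Θ (q ∷ Θ) α _ = ≤-trans (≤-reflexive (sym (trans (cong (size q) (val α (n₀ S) zero))
      (trans (size-cast (lab α zero) _) (trans (cong (size (lookup qs (idx α zero))) (pr-names S (λ _ → []) (idx α zero)))
        (cong length (gr-nm (at S (idx α zero)) [])))))))
      (≤-trans (m≤m+n _ _) (≤-reflexive (sym (length-++ (gr q (proj₁ (res α (n₀ S))))))))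

  -- A part of F of size one uses exactly one resource, since all resources have positive size.
  single : ∀ l → Σ (Fin (length rs)) λ k → Σ (NB (lookup qs l) (lookup rs k ∷ [])) λ b →
           ∀ e → pr qs (evB F e) l ≡ evB b (pr rs e k , tt)
  single l with pick qs F l
  ... | Θ , b , α , h = go Θ b α h (trans (sym (trans (cong (size (lookup qs l)) (h _)) (↭-length (gr-evB b _))))
                          (unit-size S (λ _ → []) _ (inv λ _ → []) l))
    where
    go : ∀ Θ (b : NB (lookup qs l) Θ) (α : Emb Θ rs) → (∀ e → pr qs (evB F e) l ≡ evB b (res α e)) →
         size ⌈ Θ ⌉ (res α (evB G (n₀ S))) ≡ 1 →
         Σ (Fin (length rs)) λ k → Σ (NB (lookup qs l) (lookup rs k ∷ [])) λ b →
           ∀ e → pr qs (evB F e) l ≡ evB b (pr rs e k , tt)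
    go (q ∷ []) b α h u = idx α zero , subst (λ q → NB (lookup qs l) (q ∷ [])) (sym (lab α zero)) b , λ e →
      trans (h e) (trans (cong (λ x → evB b (x , tt)) (val α e zero)) (lem (lab α zero) b _))
      where
      lem : ∀ {q q' a} (p : q' ≡ q) (b : NB a (q ∷ [])) x →
            evB b (cast p x , tt) ≡ evB (subst (λ q → NB a (q ∷ [])) (sym p) b) (x , tt)
      lem refl b x = refl
    go (q ∷ q' ∷ Θ) b α h u = ⊥-elim (two (≤-trans (+-mono-≤ (big zero) (big (suc zero))) (≤-trans
        (≤-reflexive refl) (≤-trans (lem (gr q (proj₁ e)) (gr q' (proj₁ (proj₂ e))) _) (≤-reflexive u)))))
      where
      e = res α (evB G (n₀ S))
      big : ∀ j → 1 ≤ size (lookup (q ∷ q' ∷ Θ) j) (pr (q ∷ q' ∷ Θ) e j)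
      big j = ≤-trans (positive (idx α j)) (≤-reflexive (sym (trans (cong (size (lookup (q ∷ q' ∷ Θ) j)) (val α (evB G (n₀ S)) j)) (size-cast (lab α j) _))))
      two : 2 ≤ 1 → ⊥
      two (s≤s ())
      lem : ∀ (a b c : M) → length a + length b ≤ length (a ++ (b ++ c))
      lem a b c = ≤-trans (+-mono-≤ {length a} ≤-refl (≤-trans (m≤m+n _ _) (≤-reflexive (sym (length-++ b)))))
        (≤-reflexive (sym (length-++ a)))

unary : ∀ {n} → Fin n → Nm
unary zero = []
unary (suc i) = true ∷ unary i

unary-inj : ∀ {n} (i j : Fin n) → unary i ≡ unary j → i ≡ j
unary-inj zero zero p = refl
unary-inj (suc i) (suc j) p = cong suc (unary-inj i j (proj₂ (∷-injective p)))

record Match {qs rs} (S : All Slot qs) (R : All Slot rs) : Set where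
  field
    α : Fin (length qs) → Fin (length rs)
    β : Fin (length rs) → Fin (length qs)
    βα : ∀ l → β (α l) ≡ l
    αβ : ∀ k → α (β k) ≡ k
    there′ : ∀ l → NB (lookup qs l) (lookup rs (α l) ∷ [])
    back′ : ∀ l → NB (lookup rs (α l)) (lookup qs l ∷ [])
    inv₁ : ∀ l n → IdB (lookup qs l) (nm (at S l) n) (reify (lookup qs l)
             (evB (there′ l) (evB (back′ l) (gen (lookup qs l) (nm (at S l) n) , tt) , tt)))
    inv₂ : ∀ l n → IdB (lookup rs (α l)) (nm (at R (α l)) n) (reify (lookup rs (α l))
             (evB (back′ l) (evB (there′ l) (gen (lookup rs (α l)) (nm (at R (α l)) n) , tt) , tt)))

module _ {qs rs} (S : All Slot qs) (R : All Slot rs) (F : NB ⌈ qs ⌉ rs) (G : NB ⌈ rs ⌉ qs)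
         (inv : Inverse S F G) (inv' : Inverse R G F) where
  private
    one = single S R F G inv inv'
    two = single R S G F inv' inv

  -- Distinct names make the round trip traceable: slot `l` ends up with the resource that entered
  -- at `l'`, named `unary l'`, while the identity property says that it is named `unary l`.
  round : ∀ l → proj₁ (two (proj₁ (one l))) ≡ l
  round l with one l
  ... | k , b , h with two k
  ... | l' , b' , h' = unary-inj l' l (cong proj₂ (proj₁ (∷-injective (↭-singleton-inv
        (↭-trans (↭-reflexive (sym (grν l'))) (↭-trans (↭-sym grF) (↭-trans (IdB-gr (lookup qs l) (IdB-at S unary _ (inv unary) l))
          (↭-reflexive (grG-nm (at S l) (unary l))))))))))
    where
    ν = gen ⌈ qs ⌉ (names S unary)
    grν : ∀ l' → gr (lookup qs l') (pr qs ν l') ≡ [ lookup qs l' , unary l' ]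
    grν l' = trans (cong (gr (lookup qs l')) (pr-names S unary l')) (gr-nm (at S l') (unary l'))
    grF : gr (lookup qs l) (pr qs (evB F (evB G ν)) l) ↭ gr (lookup qs l') (pr qs ν l')
    grF = ↭-trans (↭-reflexive (cong (gr (lookup qs l)) (trans (h (evB G ν)) (cong (λ x → evB b (x , tt)) (h' ν)))))
      (↭-trans (gr-evB b _) (↭-trans (↭-reflexive (++-identityʳ _)) (↭-trans (gr-evB b' _) (↭-reflexive (++-identityʳ _)))))

module _ {qs rs} (S : All Slot qs) (R : All Slot rs) (F : NB ⌈ qs ⌉ rs) (G : NB ⌈ rs ⌉ qs)
         (inv : Inverse S F G) (inv' : Inverse R G F) (one : Single F) (two : Single G)
         (βα-id : ∀ l → proj₁ (two (proj₁ (one l))) ≡ l) (αβ-id : ∀ k → proj₁ (one (proj₁ (two k))) ≡ k) where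
  private
    back : ∀ l → Σ (NB (lookup rs (proj₁ (one l))) (lookup qs l ∷ [])) λ b → ∀ e → pr rs (evB G e) (proj₁ (one l)) ≡ evB b (pr qs e l , tt)
    -- `two` returns a body over the slot that it found; `βα-id` identifies this slot with `l`, over
    -- which `back′` has to be typed.
    back l with two (proj₁ (one l)) | βα-id l
    ... | .l , b , h | refl = b , h

  build : Match S R
  build = record
    { α = λ l → proj₁ (one l)
    ; β = λ k → proj₁ (two k)
    ; βα = βα-id
    ; αβ = αβ-id
    ; there′ = λ l → proj₁ (proj₂ (one l))
    ; back′ = λ l → proj₁ (back l)
    -- One name `n` for all slots: only the component at `l` is inspected.
    ; inv₁ = λ l n → subst (λ x → IdB (lookup qs l) (nm (at S l) n) (reify (lookup qs l) x))
        (trans (proj₂ (proj₂ (one l)) _) (cong (λ x → evB (proj₁ (proj₂ (one l))) (x , tt))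
          (trans (proj₂ (back l) _) (cong (λ x → evB (proj₁ (back l)) (x , tt)) (pr-names S (λ _ → n) l)))))
        (IdB-at S (λ _ → n) _ (inv λ _ → n) l)
    ; inv₂ = λ l n → let k = proj₁ (one l) in subst (λ x → IdB (lookup rs k) (nm (at R k) n) (reify (lookup rs k) x))
        (trans (proj₂ (back l) _) (cong (λ x → evB (proj₁ (back l)) (x , tt))
          (trans (proj₂ (proj₂ (one l)) _) (cong (λ x → evB (proj₁ (proj₂ (one l))) (x , tt)) (pr-names R (λ _ → n) k)))))
        (IdB-at R (λ _ → n) _ (inv' λ _ → n) k)
    }

match : ∀ {qs rs} (S : All Slot qs) (R : All Slot rs) (F : NB ⌈ qs ⌉ rs) (G : NB ⌈ rs ⌉ qs) → Inverse S F G → Inverse R G F → Match S R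
match S R F G inv inv' = build S R F G inv inv' (single S R F G inv inv') (single R S G F inv' inv)
  (round S R F G inv inv') (round R S G F inv' inv)

open Match

-- Isomorphism of negative formulas, read as a bijection of skeletons together with bijections of slots.
data D : Arg → Arg → Set
data DQ : Arg → Arg → Set
data D where
  mkD : ∀ {a b} (φ : Sk a → Sk b) (ψ : Sk b → Sk a) → (∀ s → ψ (φ s) ≡ s) → (∀ t → φ (ψ t) ≡ t) →
        (α : ∀ s → Fin (length (sl a s)) → Fin (length (sl b (φ s))))
        (β : ∀ s → Fin (length (sl b (φ s))) → Fin (length (sl a s))) →
        (∀ s l → β s (α s l) ≡ l) → (∀ s k → α s (β s k) ≡ k) →
        (∀ s l → DQ (lookup (sl a s) l) (lookup (sl b (φ s)) (α s l))) → D a b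
data DQ where
  d-pst : ∀ {N N'} → D (neg N) (neg N') → DQ (pst N) (pst N')
  d-nv : ∀ {x} → DQ (neg (nv x)) (neg (nv x))

-- Accessibility through the positive slots of skeletons, since `lookup` hides from the termination
-- checker that a slot is a subterm.
data WF : Ng → Set where
  wf : ∀ {N} → (∀ s l P → lookup (sl (neg N) s) l ≡ pst P → WF P) → WF N

wf-slots : ∀ a s → All (λ q → ∀ P → q ≡ pst P → WF P) (sl a s)
wf-slotsN : ∀ N s → All (λ q → ∀ P → q ≡ pst P → WF P) (sl (neg N) s)
wf-N : ∀ N → WF N
wf-N N = wf λ s l → at (wf-slotsN N s) l
wf-slots (neg N) s = wf-slotsN N s
wf-slots (pst N) s = (λ { .N refl → wf-N N }) ∷ []
wf-slotsN (par a b) (s , t) = All.++⁺ (wf-slots a s) (wf-slots b t)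
wf-slotsN (wit a b) (inj₁ s) = wf-slots a s
wf-slotsN (wit a b) (inj₂ s) = wf-slots b s
wf-slotsN bot s = []
wf-slotsN (nv x) s = (λ P ()) ∷ []

ν : ∀ a s → (Fin (length (sl a s)) → Nm) → Gn ⌈ sl a s ⌉
ν a s f = names (slots a s) f

Last : ∀ N N' s → Nf (sl (neg N) s ++ pst N' ∷ []) → Set
Last N N' s t = Σ (Sk (neg N')) λ t' → Σ (NB ⌈ sl (neg N') t' ⌉ (sl (neg N) s)) λ G →
  ∀ e y → ev t (app (sl (neg N) s) (pst N' ∷ []) e (y , tt)) ≡ proj₂ y (re (neg N') t' (evB G e))

get-names : ∀ {qs Q Ξ} (S : All Slot qs) n (i : Ins (pst Q) Ξ qs) → get i (gen ⌈ qs ⌉ (names S λ _ → n)) ≡ gen (pst Q) n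
get-names (s-pst ∷ S) n here = refl
get-names (_ ∷ S) n (there _ i) = get-names S n i

-- A composite that is the identity focuses on the name `n`. If the head variable were a slot bound
-- by the branch, the focus would carry the name of that slot; naming the slots `true ∷ []` and
-- taking `n` to be `[]` rules this out.
head-last : ∀ {N N' s} (t : Nf (sl (neg N) s ++ pst N' ∷ [])) (y : Nm → Val (pst N')) →
  (∀ n f → Id N n (un (neg N) s (ν (neg N) s f)) (ev t (app (sl (neg N) s) (pst N' ∷ []) (gen ⌈ sl (neg N) s ⌉ (ν (neg N) s f)) (y n , tt)))) →
  Last N N' s t
head-last {N} {N'} {s} (n-node σ b) y h with pull σ here
... | Δ' , j , τ , p with lastView (sl (neg N) s) j
... | isIn i q = ⊥-elim (clash (trans (sym (cong (λ k → proj₂ k x)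
    (trans (proj₁ (p e)) (trans (q _ _) (get-names (slots (neg N) s) _ i))))) (proj₁ (proj₂ (h [] λ _ → true ∷ [])))))
  where
  e = app (sl (neg N) s) (pst N' ∷ []) (gen ⌈ sl (neg N) s ⌉ (ν (neg N) s λ _ → true ∷ [])) (y [] , tt)
  x = evB b (proj₂ (perm σ e))
  clash : ∀ {Q b N b'} → node Q (true ∷ []) b ≡ node N [] b' → ⊥
  clash ()
... | isLast q with frame b
... | t' , c , r = t' , permΓ (sl (neg N') t') τ c , λ e y → trans
  (cong₂ (λ k e → proj₂ k (evB b e)) (trans (proj₁ (p _)) (proj₁ (q e y)))
    (trans (proj₂ (p _)) (cong (perm τ) (proj₂ (q e y)))))
  (cong (proj₂ y) (trans (r _) (cong (re (neg N') t') (sym (evB-permΓ (sl (neg N') t') τ c e)))))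

Children : Ng → Ng → Set
Children N N' = ∀ s → Nf (sl (neg N) s ++ pst N' ∷ [])

Inv : ∀ q r → Slot q → NB q (r ∷ []) → NB r (q ∷ []) → Set
Inv q r S b b' = ∀ n → IdB q (nm S n) (reify q (evB b (evB b' (gen q (nm S n) , tt) , tt)))

module _ {N N'} (ch : Children N N') (ch' : Children N' N) (c : Inv (pst N) (pst N') s-pst (n-leaf ch) (n-leaf ch')) where

  partner : Nm → Val (pst N')
  partner n = evB (n-leaf ch') (gen (pst N) n , tt)

  child-Id : ∀ s n f → Id N n (un (neg N) s (ν (neg N) s f))
    (ev (ch s) (app (sl (neg N) s) (pst N' ∷ []) (gen ⌈ sl (neg N) s ⌉ (ν (neg N) s f)) (partner n , tt)))
  child-Id s n f = subst (Id N n (un (neg N) s (ν (neg N) s f)))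
    (trans (cong (elim (neg N) F) (gen-un (neg N) s (ν (neg N) s f))) (elim-re (neg N) F s _))
    (proj₂ (c n) (un (neg N) s (ν (neg N) s f)))
    where
    F : ∀ s → Env (sl (neg N) s) → Tm
    F s e = ev (ch s) (app (sl (neg N) s) (pst N' ∷ []) e (partner n , tt))

  last : ∀ s → Last N N' s (ch s)
  last s = head-last (ch s) partner (child-Id s)

  module _ (last' : ∀ t → Last N' N t (ch' t)) where
    -- The branch of `ch` at `s` hands the skeleton `t` to the other leaf, whose branch at `t`
    -- answers on the original variable. What remains below that focus is the composite of the
    -- slotwise bodies, hence an identity.
    roundtrip : ∀ s f → let (t , G , _) = last s ; (s' , F , _) = last' t in
      IdBN N (un (neg N) s (ν (neg N) s f)) (reifyN N (re (neg N) s' (evB F (evB G (gen ⌈ sl (neg N) s ⌉ (ν (neg N) s f))))))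
    roundtrip s f with last s
    ... | t , G , g with last' t in eq
    ... | s' , F , h with subst (Id N [] (un (neg N) s (ν (neg N) s f)))
        (trans (g _ (partner [])) (trans (elim-re (neg N') (λ t e → ev (ch' t) (app (sl (neg N') t) (pst N ∷ []) e (gen (pst N) [] , tt))) t _)
          (h _ (gen (pst N) [])))) (child-Id s [] f)
    ... | _ , refl , i = i

-- The skeleton with which the branch `s` answers is `φ s`. The composites being identities, `φ` and
-- `ψ` are inverse, and over each skeleton the slotwise bodies are inverse too, so `match` pairs the
-- slots and the recursion proceeds on their types.
decode : ∀ N → WF N → ∀ N' (b : NB (pst N) (pst N' ∷ [])) (b' : NB (pst N') (pst N ∷ [])) →
  Inv (pst N) (pst N') s-pst b b' → Inv (pst N') (pst N) s-pst b' b → D (neg N) (neg N')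
decodeQ : ∀ q → (∀ P → q ≡ pst P → WF P) → ∀ r (S : Slot q) (R : Slot r) (b : NB q (r ∷ [])) (b' : NB r (q ∷ [])) →
  Inv q r S b b' → Inv r q R b' b → DQ q r
decodeQ (pst N) w (pst N') s-pst s-pst b b' c c' = d-pst (decode N (w N refl) N' b b' c c')
decodeQ (pst N) w (neg (nv x)) s-pst s-nv b (n-nv σ) c c' with () ← ↭-singleton-inv σ
decodeQ (neg (nv x)) w (pst N) s-nv s-pst (n-nv σ) b' c c' with () ← ↭-singleton-inv σ
decodeQ (neg (nv x)) w (neg (nv y)) s-nv s-nv (n-nv σ) b' c c' with refl ← ↭-singleton-inv σ = d-nv
decode N (wf w) N' (n-leaf ch) (n-leaf ch') c c' =
  mkD φ ψ ψφ (λ t → IdB-un (neg N') t _ _ _ (round' t λ _ → []))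
    (λ s → α (m s)) (λ s → β (m s)) (λ s → βα (m s)) (λ s → αβ (m s))
    (λ s l → decodeQ (lookup (sl (neg N) s) l) (w s l) _ (at (slots (neg N) s) l) (at (slots (neg N') (φ s)) (α (m s) l))
      (there′ (m s) l) (back′ (m s) l) (inv₁ (m s) l) (inv₂ (m s) l))
  where
  L = last ch ch' c
  L' = last ch' ch c'
  φ : Sk (neg N) → Sk (neg N')
  φ s = proj₁ (L s)
  ψ : Sk (neg N') → Sk (neg N)
  ψ t = proj₁ (L' t)
  round₁ = roundtrip ch ch' c L'
  round' = roundtrip ch' ch c' L
  ψφ : ∀ s → ψ (φ s) ≡ s
  ψφ s = IdB-un (neg N) s _ _ _ (round₁ s λ _ → [])
  -- The equation `ψ (φ s) ≡ s` is a parameter here, so that it can be matched before bodies over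
  -- the two skeletons are composed.
  core : ∀ s s' (F : NB ⌈ sl (neg N) s' ⌉ (sl (neg N') (φ s))) → s' ≡ s →
    (∀ f → IdBN N (un (neg N) s (ν (neg N) s f)) (reifyN N (re (neg N) s' (evB F (evB (proj₁ (proj₂ (L s))) (gen ⌈ sl (neg N) s ⌉ (ν (neg N) s f))))))) →
    (∀ f → IdBN N' (un (neg N') (φ s) (ν (neg N') (φ s) f)) (reifyN N' (re (neg N') (φ s') (evB (proj₁ (proj₂ (L s'))) (evB F (gen ⌈ sl (neg N') (φ s) ⌉ (ν (neg N') (φ s) f))))))) →
    Match (slots (neg N) s) (slots (neg N') (φ s))
  core s .s F refl h h' = match (slots (neg N) s) (slots (neg N') (φ s)) F (proj₁ (proj₂ (L s)))
    (λ f → IdB-slots (neg N) s _ _ (h f)) (λ f → IdB-slots (neg N') (φ s) _ _ (h' f))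
  m : ∀ s → Match (slots (neg N) s) (slots (neg N') (φ s))
  m s = core s (ψ (φ s)) (proj₁ (proj₂ (L' (φ s)))) (ψφ s) (round₁ s) (round' (φ s))

open Calculus Arg (λ a → a) using (⊩_; axiom; exch; cutr; parr; witr; botr; topr; tens; injl; injr; oner; ⟦_⟧; ⟦⟧-Fn)

-- Semantic isomorphisms

Mor : Arg → Arg → Set
Mor a b = ⊩ dual a ∷ b ∷ []

ap : ∀ {a b} → Mor a b → Val (dual a) → Val b → Tm
ap p x̄ y = ⟦ p ⟧ (x̄ , (y , tt))

ap-Fn : ∀ {a b} (p : Mor a b) → Fn (neg (par (dual a) b)) (λ (x̄ , y) → ap p x̄ y) []
ap-Fn p = curry₂-Fn (⟦⟧-Fn p) tt

ap-Fnˡ : ∀ {a b} (p : Mor a b) {x̄} → Good (dual a) x̄ → Fn b (ap p x̄) (gr (dual a) x̄)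
ap-Fnˡ {a} {b} p {x̄} g = fn (λ q → fE (ap-Fn p) (Good-E (dual a) g , q)) (λ q → fG (ap-Fn p) (Good-GE (dual a) g , q)) (proj₂ (fL (ap-Fn p)) x̄ g)

ap-Fnʳ : ∀ {a b} (p : Mor a b) {y} → Good b y → Fn (dual a) (λ x̄ → ap p x̄ y) (gr b y)
ap-Fnʳ {a} {b} p {y} g = fn (λ q → fE (ap-Fn p) (q , Good-E b g)) (λ q → fG (ap-Fn p) (q , Good-GE b g)) (proj₁ (fL (ap-Fn p)) y g)

ap-E : ∀ {a b} (p : Mor a b) → Resp₂ (dual a) b (ap p)
ap-E p q r = fE (ap-Fn p) (q , r)

_⨟_ : ∀ {a b c} → Mor a b → Mor b c → Val (dual a) → Val c → Tm
_⨟_ {a} {b} {c} p q x̄ z = br b (gr (dual a) x̄ , ap p x̄) (gr c z , λ ȳ → ap q ȳ z)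

Section : ∀ {a b} → Mor a b → Mor b a → Set
Section {a} {b} p q = ∀ x̄ x → Good (dual a) x̄ → Good a x → (p ⨟ q) x̄ x ~ pair a x x̄

record Iso (a b : Arg) : Set where
  field
    to : Mor a b
    from : Mor b a
    section : Section to from
    retraction : Section from to
open Iso

Iso-sym : ∀ {a b} → Iso a b → Iso b a
Iso-sym I = record { to = from I ; from = to I ; section = retraction I ; retraction = section I }

Iso-refl : ∀ a → Iso a a
Iso-refl a = record { to = axiom refl ; from = axiom refl ; section = ok ; retraction = ok }
  where
  ok : Section {a} {a} (axiom refl) (axiom refl)
  ok x̄ x gx̄ gx = identityˡ a {gr (dual a) x̄} {gr a x} x ↭-refl (Good-E a gx) (λ p → pair-E a p (Good-E (dual a) gx̄))

br-compose : ∀ {a b} (p : Mor a b) (h : Fun a) → Fn a (proj₂ h) (proj₁ h) → Fn b (λ y → br a h (gr b y , λ x̄ → ap p x̄ y)) (proj₁ h)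
br-compose {a} {b} p h F = br-Fnʳ a {b} {λ (x̄ , y) → ap p x̄ y} {λ y → gr b y} {[]} {h} (ap-Fn p) (λ _ → ↭-refl) F

-- Fubini moves the cut with `h` to the outside, which leaves `p` composed with `q` inside, where
-- `Section` applies; `identityˡ` then removes the resulting identity.
cancel : ∀ {a b} (p : Mor a b) (q : Mor b a) → Section p q → ∀ (h : Fun a) {w x S} → Fn a (proj₂ h) (proj₁ h) → Good a x → w ↭ proj₁ h → S ↭ gr a x →
         br b (w , λ y → br a h (gr b y , λ x̄ → ap p x̄ y)) (S , λ ȳ → ap q ȳ x) ~ proj₂ h x
cancel {a} {b} p q sec h {w} {x} {S} F gx e e' = ~trans
  (fubiniʳ b a (λ y x̄ → ap p x̄ y) {w} {λ y → gr b y} {S} {λ x̄ → gr (dual a) x̄} {[]} {S , λ ȳ → ap q ȳ x} {h}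
    (λ r r' → ap-E p r' r) (Fn-↭ {dual b} (↭-sym e') (ap-Fnʳ q gx)) F e (λ _ → ↭-refl) ↭-refl (λ _ → ↭-refl)) (~trans
  (br-good a {proj₁ h} {proj₁ h} {S} {gr a x} ↭-refl e' (λ _ _ → ~refl) F F
    (λ x̄ gx̄ → ~trans (br-E b (↭-refl , λ _ _ → fE (ap-Fnˡ p gx̄)) (e' , λ _ _ → fE (ap-Fnʳ q gx))) (sec x̄ x gx̄ gx))
    (br-Fn b {dual a} {λ (y , x̄) → ap p x̄ y} {λ x̄ → gr (dual a) x̄} {[]} {S , λ ȳ → ap q ȳ x} (flip-Fn (ap-Fn p)) (λ _ → ↭-refl)
      (Fn-↭ {dual b} (↭-sym e') (ap-Fnʳ q gx)))
    (fn (λ r → pair-E a (Good-E a gx) r) (λ r → pair-GE a (Good-GE a gx) r) (pair-Linʳ a gx)))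
  (identityˡ a x ↭-refl (Good-E a gx) (fE F)))

comp : ∀ {a b c} → Mor a b → Mor b c → Mor a c
comp {a} {b} {c} p q = cutr {b} {dual b} {dual a ∷ []} {c ∷ []} refl (exch (swap _ _ ↭-refl) p) q

ap-comp : ∀ {a b c} (p : Mor a b) (q : Mor b c) {x̄ z} → Good (dual a) x̄ → Good c z → ap (comp {a} {b} {c} p q) x̄ z ~ (p ⨟ q) x̄ z
ap-comp {a} {b} {c} p q gx̄ gz = br-E b (↭-reflexive (++-identityʳ _) , λ _ _ → fE (ap-Fnˡ p gx̄))
  (↭-reflexive (++-identityʳ _) , λ _ _ → fE (ap-Fnʳ q gz))

-- Once the cut on `c` is moved below the cut on `b`, the inner pair `p'`, `q'` cancels first and
-- the outer pair is left.
section-trans : ∀ {a b c} (p : Mor a b) (q : Mor b a) (p' : Mor b c) (q' : Mor c b) → Section p q → Section p' q' →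
                Section (comp {a} {b} {c} p p') (comp {c} {b} {a} q' q)
section-trans {a} {b} {c} p q p' q' sec sec' x̄ x gx̄ gx = ~trans
  (br-good c ↭-refl ↭-refl (λ z gz → ap-comp p p' gx̄ gz) (ap-Fnˡ (comp {a} {b} {c} p p') gx̄) (br-compose {b} {c} p' h H₁)
    (λ z̄ gz̄ → ap-comp q' q gz̄ gx) (ap-Fnʳ (comp {c} {b} {a} q' q) gx) K) (~trans
  (fubiniˡ c b (λ z̄ y → ap q' z̄ y) {gr a x} {λ z̄ → gr (dual c) z̄} {gr (dual a) x̄} {λ y → gr b y} {[]} {gr (dual a) x̄ , λ z → (p ⨟ p') x̄ z} {R}
    (ap-E q') (br-compose {b} {c} p' h H₁) FR ↭-refl (λ _ → ↭-refl) ↭-refl (λ _ → ↭-refl)) (~trans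
  (br-good b ↭-refl ↭-refl (λ y gy → cancel {b} {c} p' q' sec' h H₁ gy ↭-refl ↭-refl)
    (br-Fnʳ c {b} {λ (z̄ , y) → ap q' z̄ y} {λ y → gr b y} {[]} {gr (dual a) x̄ , λ z → (p ⨟ p') x̄ z} (ap-Fn q') (λ _ → ↭-refl) (br-compose {b} {c} p' h H₁))
    H₁ (λ _ _ → ~refl) FR FR)
  (sec x̄ x gx̄ gx)))
  where
  h : Fun b
  h = gr (dual a) x̄ , ap p x̄
  H₁ = ap-Fnˡ p gx̄
  R : Fun (dual b)
  R = gr a x , λ ȳ → ap q ȳ x
  FR = ap-Fnʳ q gx
  K : Fn (dual c) (λ z̄ → (q' ⨟ q) z̄ x) (gr a x)
  K = br-Fn b {dual c} {λ (y , z̄) → ap q' z̄ y} {λ z̄ → gr (dual c) z̄} {[]} {R} (flip-Fn (ap-Fn q')) (λ _ → ↭-refl) FR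

Iso-trans : ∀ {a b c} → Iso a b → Iso b c → Iso a c
Iso-trans {a} {b} {c} I J = record
  { to = comp {a} {b} {c} (to I) (to J) ; from = comp {c} {b} {a} (from J) (from I)
  ; section = section-trans (to I) (from I) (to J) (from J) (section I) (section J)
  ; retraction = section-trans (from J) (to J) (from I) (to I) (retraction J) (retraction I) }

flipM : ∀ {a b} → ⊩ a ∷ b ∷ [] → ⊩ b ∷ a ∷ []
flipM p = exch (swap _ _ ↭-refl) p

Iso-dual : ∀ {a b} → Iso a b → Iso (dual a) (dual b)
Iso-dual {neg _} {neg _} I = record { to = flipM (from I) ; from = flipM (to I)
  ; section = λ x̄ x gx̄ gx → section I x x̄ gx gx̄ ; retraction = λ x̄ x gx̄ gx → retraction I x x̄ gx gx̄ }
Iso-dual {neg _} {pst _} I = record { to = flipM (from I) ; from = flipM (to I)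
  ; section = λ x̄ x gx̄ gx → section I x x̄ gx gx̄ ; retraction = λ x̄ x gx̄ gx → retraction I x x̄ gx gx̄ }
Iso-dual {pst _} {neg _} I = record { to = flipM (from I) ; from = flipM (to I)
  ; section = λ x̄ x gx̄ gx → section I x x̄ gx gx̄ ; retraction = λ x̄ x gx̄ gx → retraction I x x̄ gx gx̄ }
Iso-dual {pst _} {pst _} I = record { to = flipM (from I) ; from = flipM (to I)
  ; section = λ x̄ x gx̄ gx → section I x x̄ gx gx̄ ; retraction = λ x̄ x gx̄ gx → retraction I x x̄ gx gx̄ }

rot : ∀ {a b c : Arg} {Γ} → a ∷ b ∷ c ∷ Γ ↭ b ∷ c ∷ a ∷ Γ
rot = ↭-trans (swap _ _ ↭-refl) (prep _ (swap _ _ ↭-refl))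

par-map : ∀ {a b} c → Mor a b → Mor (neg (par a c)) (neg (par b c))
par-map {a} {b} c p = flipM (parr {b} {c} refl (exch (↭-trans rot rot)
  (cutr {a} {dual a} {c ∷ pst (par a c) ∷ []} {b ∷ []} refl (exch rot (tens {a} {c} refl)) p)))

wit-map : ∀ {a b} c → Mor a b → Mor (neg (wit a c)) (neg (wit b c))
wit-map {a} {b} c p = flipM (witr {b} {c} refl
  (flipM (cutr {a} {dual a} {pst (wit a c) ∷ []} {b ∷ []} refl (flipM (injl {a} {c} refl)) p))
  (flipM (injr {a} {c} refl)))

par-section : ∀ {a b} c (p : Mor a b) (q : Mor b a) → Section p q → Section (par-map {a} {b} c p) (par-map {b} {a} c q)
par-section {a} {b} c p q sec k (x , z) (ek , gk , (lk , _)) (gx , gz) = ~trans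
  (br-E b (e₂ , λ y y' r → br-E a (↭-trans (↭-++-comm (gr c z) _) (↭-trans (++⁺ʳ (gr c z) (↭-reflexive (++-identityʳ _))) ↭-refl) ,
      λ x x' q → ek (q , Good-E c gz)) (↭-trans (↭-reflexive (++-identityʳ _)) (E-gr b r) , λ x̄ x̄' q → ap-E p q r))
    (↭-refl , λ ȳ ȳ' r → ap-E q r (Good-E a gx)))
  (cancel {a} {b} p q sec h (fn (λ q → ek (q , Good-E c gz)) (λ q → gk (q , Good-GE c gz)) (lk z gz)) gx ↭-refl (↭-reflexive (++-identityʳ _)))
  where
  h : Fun a
  h = proj₁ k ++ gr c z , λ x → proj₂ k (x , z)
  e₂ : gr c z ++ (proj₁ k ++ []) ↭ proj₁ k ++ gr c z
  e₂ = ↭-trans (↭-++-comm (gr c z) _) (++⁺ʳ (gr c z) (↭-reflexive (++-identityʳ (proj₁ k))))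

wit-section : ∀ {a b} c (p : Mor a b) (q : Mor b a) → Section p q → Section (wit-map {a} {b} c p) (wit-map {b} {a} c q)
wit-section {a} {b} c p q sec k (inj₁ x) (ek , gk , (lk , _)) gx = ~trans
  (br-E b (↭-reflexive (++-identityʳ _) , λ y y' r → br-E a (↭-reflexive (++-identityʳ _) , λ x x' q → ek q)
      (↭-trans (↭-reflexive (++-identityʳ _)) (E-gr b r) , λ x̄ x̄' q → ap-E p q r))
    (↭-refl , λ ȳ ȳ' r → ap-E q r (Good-E a gx)))
  (cancel {a} {b} p q sec (proj₁ k , λ x → proj₂ k (inj₁ x)) (fn ek gk lk) gx ↭-refl (↭-reflexive (++-identityʳ _)))
wit-section {a} {b} c p q sec k (inj₂ z) gk gz = ~refl

Iso-par : ∀ {a b} c → Iso a b → Iso (neg (par a c)) (neg (par b c))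
Iso-par c I = record { to = par-map c (to I) ; from = par-map c (from I)
  ; section = par-section c (to I) (from I) (section I) ; retraction = par-section c (from I) (to I) (retraction I) }

Iso-wit : ∀ {a b} c → Iso a b → Iso (neg (wit a c)) (neg (wit b c))
Iso-wit c I = record { to = wit-map c (to I) ; from = wit-map c (from I)
  ; section = wit-section c (to I) (from I) (section I) ; retraction = wit-section c (from I) (to I) (retraction I) }

-- Morphisms that merely re-index the input of a continuation compose by computation. Commutativity,
-- associativity and distributivity are of this kind.
bijection-Iso : ∀ {N N'} (p : Mor (neg N) (neg N')) (q : Mor (neg N') (neg N)) (u : ValN N → ValN N') (v : ValN N' → ValN N) →
  (∀ k y → ap p k y ≡ proj₂ k (v y)) → (∀ k x → ap q k x ≡ proj₂ k (u x)) → (∀ x → v (u x) ≡ x) → (∀ y → u (v y) ≡ y) →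
  Iso (neg N) (neg N')
bijection-Iso p q u v hp hq vu uv = record
  { to = p ; from = q
  ; section = λ k x _ _ → ≡⇒~ (trans (hq (_ , ap p k) x) (trans (hp k (u x)) (cong (proj₂ k) (vu x))))
  ; retraction = λ k y _ _ → ≡⇒~ (trans (hp (_ , ap q k) y) (trans (hq k (v y)) (cong (proj₂ k) (uv y)))) }

par-comm : ∀ a b → Iso (neg (par a b)) (neg (par b a))
par-comm a b = bijection-Iso (m a b) (m b a) (λ (x , y) → y , x) (λ (x , y) → y , x)
  (λ _ _ → refl) (λ _ _ → refl) (λ _ → refl) (λ _ → refl)
  where
  m : ∀ a b → Mor (neg (par a b)) (neg (par b a))
  m a b = flipM (parr {b} {a} refl (exch (↭-trans rot (swap _ _ ↭-refl)) (tens {a} {b} refl)))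

wit-comm : ∀ a b → Iso (neg (wit a b)) (neg (wit b a))
wit-comm a b = bijection-Iso (m a b) (m b a) (sw {a} {b}) (sw {b} {a}) (λ { _ (inj₁ _) → refl ; _ (inj₂ _) → refl })
  (λ { _ (inj₁ _) → refl ; _ (inj₂ _) → refl }) (λ { (inj₁ _) → refl ; (inj₂ _) → refl }) (λ { (inj₁ _) → refl ; (inj₂ _) → refl })
  where
  sw : ∀ {a b} → Val a ⊎ Val b → Val b ⊎ Val a
  sw (inj₁ x) = inj₂ x
  sw (inj₂ x) = inj₁ x
  m : ∀ a b → Mor (neg (wit a b)) (neg (wit b a))
  m a b = flipM (witr {b} {a} refl (flipM (injr {a} {b} refl)) (flipM (injl {a} {b} refl)))

par-assoc : ∀ a b c → Iso (neg (par a (neg (par b c)))) (neg (par (neg (par a b)) c))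
par-assoc a b c = bijection-Iso
  (flipM (parr {neg (par a b)} {c} refl (parr {a} {b} refl
    (exch (↭-trans (swap _ _ ↭-refl) (prep _ rot))
      (cutr {neg (par b c)} {pst (par b c)} {pst (par a (neg (par b c))) ∷ a ∷ []} {b ∷ c ∷ []} refl
        (exch (↭-trans rot rot) (tens {a} {neg (par b c)} refl)) (tens {b} {c} refl))))))
  (flipM (parr {a} {neg (par b c)} refl (exch (swap _ _ ↭-refl) (parr {b} {c} refl
    (exch (↭-trans (prep _ rot) (↭-trans rot rot))
      (cutr {neg (par a b)} {pst (par a b)} {c ∷ pst (par (neg (par a b)) c) ∷ []} {a ∷ b ∷ []} refl
        (exch rot (tens {neg (par a b)} {c} refl)) (tens {a} {b} refl)))))))
  (λ (x , (y , z)) → (x , y) , z) (λ ((x , y) , z) → x , (y , z))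
  (λ _ _ → refl) (λ _ _ → refl) (λ _ → refl) (λ _ → refl)

wit-assoc : ∀ a b c → Iso (neg (wit a (neg (wit b c)))) (neg (wit (neg (wit a b)) c))
wit-assoc a b c = bijection-Iso
  (flipM (witr {neg (wit a b)} {c} refl (witr {a} {b} refl (flipM (injl {a} {neg (wit b c)} refl)) (left₂ (injl {b} {c} refl))) (left₂ (injr {b} {c} refl))))
  (flipM (witr {a} {neg (wit b c)} refl (left₁ (injl {a} {b} refl)) (witr {b} {c} refl (left₁ (injr {a} {b} refl)) (flipM (injr {neg (wit a b)} {c} refl)))))
  (λ { (inj₁ x) → inj₁ (inj₁ x) ; (inj₂ (inj₁ x)) → inj₁ (inj₂ x) ; (inj₂ (inj₂ x)) → inj₂ x })
  (λ { (inj₁ (inj₁ x)) → inj₁ x ; (inj₁ (inj₂ x)) → inj₂ (inj₁ x) ; (inj₂ x) → inj₂ (inj₂ x) })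
  (λ { _ (inj₁ (inj₁ x)) → refl ; _ (inj₁ (inj₂ x)) → refl ; _ (inj₂ x) → refl })
  (λ { _ (inj₁ x) → refl ; _ (inj₂ (inj₁ x)) → refl ; _ (inj₂ (inj₂ x)) → refl })
  (λ { (inj₁ x) → refl ; (inj₂ (inj₁ x)) → refl ; (inj₂ (inj₂ x)) → refl })
  (λ { (inj₁ (inj₁ x)) → refl ; (inj₁ (inj₂ x)) → refl ; (inj₂ x) → refl })
  where
  left₂ : ∀ {d} → ⊩ pst (wit b c) ∷ d ∷ [] → ⊩ d ∷ pst (wit a (neg (wit b c))) ∷ []
  left₂ {d} p = flipM (cutr {neg (wit b c)} {pst (wit b c)} {pst (wit a (neg (wit b c))) ∷ []} {d ∷ []} refl
    (flipM (injr {a} {neg (wit b c)} refl)) p)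
  left₁ : ∀ {d} → ⊩ pst (wit a b) ∷ d ∷ [] → ⊩ d ∷ pst (wit (neg (wit a b)) c) ∷ []
  left₁ {d} p = flipM (cutr {neg (wit a b)} {pst (wit a b)} {pst (wit (neg (wit a b)) c) ∷ []} {d ∷ []} refl
    (flipM (injl {neg (wit a b)} {c} refl)) p)

par-wit : ∀ a b c → Iso (neg (par a (neg (wit b c)))) (neg (wit (neg (par a b)) (neg (par a c))))
par-wit a b c = bijection-Iso
  (flipM (witr {neg (par a b)} {neg (par a c)} refl (parr {a} {b} refl (pick₁ (injl {b} {c} refl))) (parr {a} {c} refl (pick₁ (injr {b} {c} refl)))))
  (flipM (parr {a} {neg (wit b c)} refl (exch (swap _ _ ↭-refl) (witr {b} {c} refl
    (pick₂ (flipM (injl {neg (par a b)} {neg (par a c)} refl)))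
    (pick₂ (flipM (injr {neg (par a b)} {neg (par a c)} refl)))))))
  (λ { (x , inj₁ y) → inj₁ (x , y) ; (x , inj₂ y) → inj₂ (x , y) })
  (λ { (inj₁ (x , y)) → x , inj₁ y ; (inj₂ (x , y)) → x , inj₂ y })
  (λ { _ (inj₁ x) → refl ; _ (inj₂ x) → refl }) (λ { _ (_ , inj₁ x) → refl ; _ (_ , inj₂ x) → refl })
  (λ { (_ , inj₁ x) → refl ; (_ , inj₂ x) → refl }) (λ { (inj₁ x) → refl ; (inj₂ x) → refl })
  where
  pick₁ : ∀ {d} → ⊩ pst (wit b c) ∷ d ∷ [] → ⊩ a ∷ d ∷ pst (par a (neg (wit b c))) ∷ []
  pick₁ {d} p = exch rot
    (cutr {neg (wit b c)} {pst (wit b c)} {pst (par a (neg (wit b c))) ∷ a ∷ []} {d ∷ []} refl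
      (exch (↭-trans rot rot) (tens {a} {neg (wit b c)} refl)) p)
  pick₂ : ∀ {d Z} → ⊩ neg (par a d) ∷ Z ∷ [] → ⊩ d ∷ a ∷ Z ∷ []
  pick₂ {d} {Z} p = exch (↭-trans rot (swap _ _ ↭-refl))
    (cutr {neg (par a d)} {pst (par a d)} {Z ∷ []} {a ∷ d ∷ []} refl p (tens {a} {d} refl))

-- For positive `a` the two sides have opposite polarities, so this is not a re-indexing. It is also
-- the typical degenerate type, of the kind that `mixed` has to exclude.
par-bot : ∀ a → Iso (neg (par a (neg bot))) a
par-bot a = record
  { to = p ; from = q
  ; section = λ k (x , _) (ek , _) (gx , _) → identityˡ a x (↭-reflexive (++-identityʳ _)) (Good-E a gx) (λ r → ek (r , tt))
  ; retraction = λ ȳ y gȳ gy → ~refl }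
  where
  p : Mor (neg (par a (neg bot))) a
  p = cutr {neg bot} {pst bot} {pst (par a (neg bot)) ∷ a ∷ []} {[]} refl (exch (↭-trans rot rot) (tens {a} {neg bot} refl)) (oner refl)
  q : Mor a (neg (par a (neg bot)))
  q = flipM (parr {a} {neg bot} refl (exch (swap _ _ ↭-refl) (botr refl (flipM (axiom {dual a} {a} refl)))))

wit-top : ∀ a → Iso (neg (wit a (neg top))) a
wit-top a = record
  { to = injl refl ; from = flipM (witr {a} {neg top} refl (flipM (axiom {dual a} {a} refl)) (topr refl))
  ; section = λ { k (inj₁ x) (ek , _) gx → identityˡ a x ↭-refl (Good-E a gx) ek }
  ; retraction = λ ȳ y gȳ gy → ~refl }

par-top : ∀ a → Iso (neg (par a (neg top))) (neg top)
par-top a = record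
  { to = flipM (topr refl) ; from = flipM (parr {a} {neg top} refl (exch (swap _ _ ↭-refl) (topr refl)))
  ; section = λ { k (_ , ()) _ _ } ; retraction = λ { k () _ _ } }

Iso-par₂ : ∀ {a b c d} → Iso a b → Iso c d → Iso (neg (par a c)) (neg (par b d))
Iso-par₂ {a} {b} {c} {d} I J = Iso-trans (Iso-par c I) (Iso-trans (par-comm b c) (Iso-trans (Iso-par b J) (par-comm d b)))

Iso-wit₂ : ∀ {a b c d} → Iso a b → Iso c d → Iso (neg (wit a c)) (neg (wit b d))
Iso-wit₂ {a} {b} {c} {d} I J = Iso-trans (Iso-wit c I) (Iso-trans (wit-comm b c) (Iso-trans (Iso-wit b J) (wit-comm d b)))

undual : ∀ {a b} → Iso a (dual (dual b)) → Iso a b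
undual {b = neg _} I = I
undual {b = pst _} I = I

-- The positive equations are the duals of the negative ones, with arguments in reverse order.
Th-Iso : ∀ {P A B} → Th P A B → Iso ⌜ A ⌝ ⌜ B ⌝
Th-Iso {A = A} th-refl = Iso-refl ⌜ A ⌝
Th-Iso (th-sym p) = Iso-sym (Th-Iso p)
Th-Iso (th-trans p q) = Iso-trans (Th-Iso p) (Th-Iso q)
Th-Iso (th-⊗ p q) = Iso-dual {neg _} {neg _} (Iso-par₂ (Iso-dual (Th-Iso q)) (Iso-dual (Th-Iso p)))
Th-Iso (th-⅋ p q) = Iso-par₂ (Th-Iso p) (Th-Iso q)
Th-Iso (th-& p q) = Iso-wit₂ (Th-Iso p) (Th-Iso q)
Th-Iso (th-⊕ p q) = Iso-dual {neg _} {neg _} (Iso-wit₂ (Iso-dual (Th-Iso q)) (Iso-dual (Th-Iso p)))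
Th-Iso (ax-⊗-assoc _ A B C) = Iso-dual {neg _} {neg _} (Iso-sym (par-assoc (dual ⌜ C ⌝) (dual ⌜ B ⌝) (dual ⌜ A ⌝)))
Th-Iso (ax-⊗-comm _ A B) = Iso-dual {neg _} {neg _} (par-comm (dual ⌜ B ⌝) (dual ⌜ A ⌝))
Th-Iso (ax-⅋-assoc _ A B C) = par-assoc ⌜ A ⌝ ⌜ B ⌝ ⌜ C ⌝
Th-Iso (ax-⅋-comm _ A B) = par-comm ⌜ A ⌝ ⌜ B ⌝
Th-Iso (ax-⊕-assoc _ A B C) = Iso-dual {neg _} {neg _} (Iso-sym (wit-assoc (dual ⌜ C ⌝) (dual ⌜ B ⌝) (dual ⌜ A ⌝)))
Th-Iso (ax-⊕-comm _ A B) = Iso-dual {neg _} {neg _} (wit-comm (dual ⌜ B ⌝) (dual ⌜ A ⌝))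
Th-Iso (ax-&-assoc _ A B C) = wit-assoc ⌜ A ⌝ ⌜ B ⌝ ⌜ C ⌝
Th-Iso (ax-&-comm _ A B) = wit-comm ⌜ A ⌝ ⌜ B ⌝
Th-Iso (ax-⊗⊕-distr _ A B C) = Iso-dual {neg _} {neg _} (Iso-trans (par-comm (neg (wit c b)) a)
  (Iso-trans (par-wit a c b) (Iso-wit₂ (par-comm a c) (par-comm a b))))
  where
  a = dual ⌜ A ⌝
  b = dual ⌜ B ⌝
  c = dual ⌜ C ⌝
Th-Iso (ax-⅋&-distr _ A B C) = par-wit ⌜ A ⌝ ⌜ B ⌝ ⌜ C ⌝
Th-Iso (ax-⊗-unit _ A) = undual (Iso-dual (Iso-trans (par-comm (neg bot) (dual ⌜ A ⌝)) (par-bot (dual ⌜ A ⌝))))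
Th-Iso (ax-⅋-unit _ A) = par-bot ⌜ A ⌝
Th-Iso (ax-⊕-unit _ A) = undual (Iso-dual (Iso-trans (wit-comm (neg top) (dual ⌜ A ⌝)) (wit-top (dual ⌜ A ⌝))))
Th-Iso (ax-&-unit _ A) = wit-top ⌜ A ⌝
Th-Iso (ax-⊗-𝟎 _ A) = Iso-dual {neg _} {neg _} (Iso-trans (par-comm (neg top) (dual ⌜ A ⌝)) (par-top (dual ⌜ A ⌝)))
Th-Iso (ax-⅋-⊤ _ A) = par-top ⌜ A ⌝

-- From sequents of formulas to sequents of polarised types

module Forget (L : Set) (τ : L → Arg) where
  private module C = Calculus L τ
  open C using () renaming (⊩_ to ⊩ᴸ_; ⟦_⟧ to ⟦_⟧ᴸ)

  conv : ∀ Γ → C.Env Γ → Env (map τ Γ)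
  conv [] _ = tt
  conv (X ∷ Γ) (x , γ) = x , conv Γ γ

  conv-gr : ∀ Γ γ → gr ⌈ map τ Γ ⌉ (conv Γ γ) ≡ gr C.⌈ Γ ⌉ γ
  conv-gr [] γ = refl
  conv-gr (X ∷ Γ) (x , γ) = cong (gr (τ X) x ++_) (conv-gr Γ γ)

  conv-perm : ∀ {Γ Δ} (σ : Γ ↭ Δ) γ → perm (map⁺ τ σ) (conv Δ γ) ≡ conv Γ (C.perm σ γ)
  conv-perm ↭-refl γ = refl
  conv-perm (prep X σ) (x , γ) = cong (x ,_) (conv-perm σ γ)
  conv-perm (swap X Y σ) (x , (y , γ)) = cong (λ v → y , (x , v)) (conv-perm σ γ)
  conv-perm (↭-trans σ ρ) γ = trans (cong (perm (map⁺ τ σ)) (conv-perm ρ γ)) (conv-perm σ _)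

  -- The equation `map-++` as a permutation made of `prep` and `↭-refl` only, so that `perm` along
  -- it computes.
  append : ∀ Γ Δ → map τ Γ ++ map τ Δ ↭ map τ (Γ ++ Δ)
  append [] Δ = ↭-refl
  append (X ∷ Γ) Δ = prep (τ X) (append Γ Δ)

  conv-left : ∀ Γ {Δ} γ → left (map τ Γ) (perm (append Γ Δ) (conv (Γ ++ Δ) γ)) ≡ conv Γ (C.left Γ γ)
  conv-left [] γ = refl
  conv-left (X ∷ Γ) (x , γ) = cong (x ,_) (conv-left Γ γ)

  conv-right : ∀ Γ {Δ} γ → right (map τ Γ) (perm (append Γ Δ) (conv (Γ ++ Δ) γ)) ≡ conv Δ (C.right Γ γ)
  conv-right [] γ = refl
  conv-right (X ∷ Γ) (x , γ) = conv-right Γ γ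

  forget : ∀ {Γ} → ⊩ᴸ Γ → ⊩ map τ Γ
  forget (C.axiom e) = axiom e
  forget (C.exch σ π) = exch (map⁺ τ σ) (forget π)
  forget (C.cutr {X} {Y} {Γ} {Δ} e π ρ) = exch (append Γ Δ) (cutr {τ X} {τ Y} {map τ Γ} {map τ Δ} e (forget π) (forget ρ))
  forget (C.parr {X} {Y} e π) = parr {τ X} {τ Y} e (forget π)
  forget (C.witr {X} {Y} e π ρ) = witr {τ X} {τ Y} e (forget π) (forget ρ)
  forget (C.botr e π) = botr e (forget π)
  forget (C.topr e) = topr e
  forget (C.tens {X} {Y} e) = tens {τ X} {τ Y} e
  forget (C.injl {X} {Y} e) = injl {τ X} {τ Y} e
  forget (C.injr {X} {Y} e) = injr {τ X} {τ Y} e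
  forget (C.oner e) = oner e

  forget-~ : ∀ {Γ} (π : ⊩ᴸ Γ) {γ} → E C.⌈ Γ ⌉ γ γ → ⟦ forget π ⟧ (conv Γ γ) ~ ⟦ π ⟧ᴸ γ
  forget-~ (C.axiom e) p = ~refl
  forget-~ (C.exch σ π) {γ} p = ~trans (≡⇒~ (cong ⟦ forget π ⟧ (conv-perm σ γ))) (forget-~ π (C.perm-E σ p))
  forget-~ (C.cutr {X} {Y} {Γ} {Δ} e π ρ) {γ} p = ~trans
    (≡⇒~ (cong₂ (λ u v → br (τ X) (gr ⌈ map τ Γ ⌉ u , λ x → ⟦ forget π ⟧ (x , u))
      (gr ⌈ map τ Δ ⌉ v , λ y → ⟦ forget ρ ⟧ (cast (sym e) y , v))) (conv-left Γ γ) (conv-right Γ γ)))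
    (br-pt (τ X) (↭-reflexive (conv-gr Γ _)) (↭-reflexive (conv-gr Δ _))
      (λ x q → forget-~ π (q , C.left-E Γ p)) (λ q → fE (C.⟦⟧-Fn π) (q , C.left-E Γ p))
      (λ y q → forget-~ ρ (cast-E (sym e) q , C.right-E Γ p)) (λ q → fE (C.⟦⟧-Fn ρ) (cast-E (sym e) q , C.right-E Γ p)))
  forget-~ (C.parr {X} {Y} e π) (p , q) = let (p₁ , p₂) = cast-E e p in forget-~ π (p₁ , (p₂ , q))
  forget-~ (C.witr {X} {Y} e π ρ) {z , γ} (p , q) with cast e z | cast-E e p
  ... | inj₁ x | p' = forget-~ π (p' , q)
  ... | inj₂ x | p' = forget-~ ρ (p' , q)
  forget-~ (C.botr e π) (p , q) = forget-~ π q
  forget-~ (C.topr e) {z , γ} (p , q) = ⊥-elim (cast e z)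
  forget-~ (C.tens e) p = ~refl
  forget-~ (C.injl e) p = ~refl
  forget-~ (C.injr e) p = ~refl
  forget-~ (C.oner e) p = ~refl

-- A context with a as its hole, described by its action on holes inside a.
record Ctx (a : Arg) (N : Ng) (w : M) : Set where
  field
    fill : Bd a → Bd (neg N)
    hole : ∀ {P} → Hl P a → Hl P (neg N)
    fill-plug : ∀ {P} (H : Hl P a) S T → fill (plug H S T) ≡ plug (hole H) S T
    hole-gr : ∀ {P} (H : Hl P a) → grH (hole H) ↭ w ++ grH H
    fill-~ : ∀ {b b'} → b ~B b' → fill b ~B fill b'
open Ctx

gen-Good : ∀ a g → Good a (gen a g)
gen-GoodN : ∀ N g → GoodN N (genN N g)
-- At a leaf the whole tree is an `op` applied to that leaf, so the commutation of a central
-- functional with nodes is exactly what is required. Elsewhere the context `C` grows by one layer.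
ctx-Lin : ∀ a {N n w} (C : Ctx a N w) → Lin a (λ x → node N n (fill C (reify a x))) ((pst N , n) ∷ w)
ctx-LinN : ∀ N' {N n w} (C : Ctx (neg N') N w) → LinN N' (λ x → node N n (fill C (reifyN N' x))) ((pst N , n) ∷ w)
focus-GE : ∀ N n {x x'} → GEN N x x' → focus N n x ~ focus N n x'
reify-GE : ∀ a {x x'} → GE a x x' → reify a x ~B reify a x'
reifyN-GE : ∀ N {x x'} → GEN N x x' → reifyN N x ~B reifyN N x'
focus-Good : ∀ N n → GoodP N [ pst N , n ] (focus N n)
gen-Good (neg N) g = gen-GoodN N g
gen-Good (pst N) n = focus-Good N n
gen-GoodN (par a b) (g , h) = gen-Good a g , gen-Good b h
gen-GoodN (wit a b) (inj₁ g) = gen-Good a g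
gen-GoodN (wit a b) (inj₂ g) = gen-Good b g
gen-GoodN bot g = tt
gen-GoodN (nv x) g = tt
reify-GE (neg N) p = reifyN-GE N p
reify-GE (pst N) (p , q , _) = ~leaf p λ g → q (Good-GE (neg N) (gen-GoodN N g))
reifyN-GE (par a b) (p , q) = ~par (reify-GE a p) (reify-GE b q)
reifyN-GE (wit a b) {inj₁ _} {inj₁ _} p = ~inl (reify-GE a p)
reifyN-GE (wit a b) {inj₂ _} {inj₂ _} p = ~inr (reify-GE b p)
reifyN-GE bot p = ~bot
reifyN-GE (nv x) refl = ~nv
focus-GE N n p = ~node (reifyN-GE N p)
focus-Good N n = (λ p → ~node (reifyN-E N p)) , focus-GE N n , ctx-LinN N (record
  { fill = λ b → b ; hole = λ H → H ; fill-plug = λ _ _ _ → refl ; hole-gr = λ _ → ↭-refl ; fill-~ = λ p → p })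
ctx-Lin (neg N) C = ctx-LinN N C
ctx-Lin (pst P) {N} {n} {w} C {N'} {w'} {Φ} c U fam base e₁ e₂ e₃ e₄ e₅ W q = ~trans
  (~node (fill-~ C (~leaf e₃ λ g → e₅ (genN P g) (gen-GoodN P g)))) (~trans
  (≡⇒~ (cong (node N n) (fill-plug C h-leaf _ _))) (~trans
  (~sym (comm c N n (hole C h-leaf) U (λ x y → proj₂ (fam x) y) (λ p q → proj₂ (e₂ p) _ _ q)))
  (resp c (↭-trans (↭-++-comm (wop N n (hole C h-leaf)) U) (↭-trans (++⁺ˡ U (prep _ (↭-trans (hole-gr C h-leaf) (↭-reflexive (++-identityʳ w))))) (↭-sym q)) ,
    λ x x' p → ~trans (op-E N n (hole C h-leaf) (↭-sym (e₄ x) , λ _ _ r → proj₂ (e₂ (E-left (neg N') p)) _ _ r))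
      (~trans (≡⇒~ (cong (node N n) (sym (fill-plug C h-leaf _ _)))) (~node (fill-~ C (reify-E (pst P) (e₂ p)))))))))
ctx-LinN (par a b) {N} {n} {w} C =
  (λ y gy → Lin-↭ a ↭-refl (ctx-Lin a (record
    { fill = λ x → fill C (b-par x (reify b y)) ; hole = λ H → hole C (h-parˡ H (reify b y))
    ; fill-plug = λ H S T → fill-plug C (h-parˡ H (reify b y)) S T
    ; hole-gr = λ H → ↭-trans (hole-gr C (h-parˡ H (reify b y))) (↭-trans (lem w (grH H) (grB (reify b y)))
        (++⁺ʳ (grH H) (++⁺ˡ w (↭-reflexive (gr-reify b y)))))
    ; fill-~ = λ p → fill-~ C (~par p ~B-refl) }))) ,
  (λ x gx → ctx-Lin b (record
    { fill = λ y → fill C (b-par (reify a x) y) ; hole = λ H → hole C (h-parʳ (reify a x) H)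
    ; fill-plug = λ H S T → fill-plug C (h-parʳ (reify a x) H) S T
    ; hole-gr = λ H → ↭-trans (hole-gr C (h-parʳ (reify a x) H)) (↭-trans (↭-reflexive (sym (++-assoc w _ _)))
        (++⁺ʳ (grH H) (++⁺ˡ w (↭-reflexive (gr-reify a x)))))
    ; fill-~ = λ p → fill-~ C (~par ~B-refl p) }))
  where
  lem : ∀ a b c → a ++ (b ++ c) ↭ (a ++ c) ++ b
  lem = solve 3 (λ a b c → a :+ (b :+ c) ⊜ (a :+ c) :+ b) ↭-refl
ctx-LinN (wit a b) C =
  ctx-Lin a (record { fill = λ x → fill C (b-inl x) ; hole = λ H → hole C (h-inl H)
    ; fill-plug = λ H S T → fill-plug C (h-inl H) S T ; hole-gr = λ H → hole-gr C (h-inl H) ; fill-~ = λ p → fill-~ C (~inl p) }) ,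
  ctx-Lin b (record { fill = λ x → fill C (b-inr x) ; hole = λ H → hole C (h-inr H)
    ; fill-plug = λ H S T → fill-plug C (h-inr H) S T ; hole-gr = λ H → hole-gr C (h-inr H) ; fill-~ = λ p → fill-~ C (~inr p) })
ctx-LinN bot C = tt
ctx-LinN top C = tt
ctx-LinN (nv x) C = tt

open Realisation Arg (λ a → a) using (realise)

-- From semantic isomorphisms to bijections of skeletons and slots

Realises : ∀ {N N'} → Mor (neg N) (neg N') → NB (pst N') (pst N ∷ []) → Set
Realises {N} {N'} p b = ∀ k → E (pst N) k k → E (pst N') (gr (pst N) k , ap p k) (evB b (k , tt))

-- With its first argument kept as a variable, `p` is a continuation related by `H`, because
-- `realise` evaluates it on every related input; `reifyH` reads off its branches.
normal : ∀ {N N'} (p : Mor (neg N) (neg N')) → Σ (NB (pst N') (pst N ∷ [])) (Realises p)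
normal {N} {N'} p = let (b , r) = reifyH (pst N') h in b , λ k e → E-≡ (pst N') refl refl (r (k , tt) (e , tt))
  where
  h : H (pst N') (pst N ∷ []) (λ e → gr (pst N) (proj₁ e) , ap p (proj₁ e))
  h = (λ e → ↭-reflexive (sym (++-identityʳ _))) , (λ (q , _) → E-gr (pst N) q , λ _ _ r → ap-E p q r) , λ Θ' x hx →
    let (t , r) = realise p (Θ' ++ pst N ∷ []) (λ e → proj₁ (right Θ' e) , (x (left Θ' e) , tt))
                    (H-swap (neg N') (pst N) (neg bot) {x = λ e → x (left Θ' e) , (proj₁ (right Θ' e) , tt)}
                      (Θ' , pst N ∷ [] , ↭-refl , x , (λ e → proj₁ e , tt) , hx ,
                        (pst N ∷ [] , [] , ↭-refl , proj₁ , (λ _ → tt) , reH (pst N) tt , ↭-refl , λ _ → refl) , λ _ → refl)) in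
    t , λ e' e q' q → ~trans (≡⇒~ (cong₂ (λ u v → ap p (proj₁ u) (x v)) (sym (right-app Θ' (pst N ∷ []) e' e)) (sym (left-app Θ' (pst N ∷ []) e' e))))
      (r (app Θ' (pst N ∷ []) e' e) (app-E Θ' (pst N ∷ []) q' q))

-- The section law makes the composite of the normal forms `~`-equal to the identity; `Id-~` turns
-- this into the literal identity that `Inv` demands.
realises-Inv : ∀ {N N'} → NdN N → (p : Mor (neg N) (neg N')) (q : Mor (neg N') (neg N)) → Section p q →
               (b : NB (pst N) (pst N' ∷ [])) (b' : NB (pst N') (pst N ∷ [])) → Realises q b → Realises p b' →
               Inv (pst N) (pst N') s-pst b b'
realises-Inv {N} {N'} nd p q sec b b' r r' n =
  ↭-trans (↭-sym (proj₁ q')) (↭-sym (proj₁ p')) , λ g → proj₂ (Id-~ nd (~trans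
    (~sym (proj₂ q' _ _ (genN-E N g))) (~trans (ap-E q (E-sym (pst N') p') (genN-E N g))
      (sec k (genN N g) (focus-Good N n) (gen-GoodN N g))))) (_ , refl , gen-IdN N g)
  where
  k = gen (pst N) n
  p' = r' k (gen-E (pst N) n)
  q' = r (evB b' (k , tt)) (E-right (pst N') p')

Iso-D : ∀ {N N'} → NdN N → NdN N' → Iso (neg N) (neg N') → D (neg N) (neg N')
Iso-D {N} {N'} nd nd' I with normal (from I) | normal (to I)
... | b , r | b' , r' = decode N (wf-N N) N' b b'
  (realises-Inv nd (to I) (from I) (section I) b b' r r') (realises-Inv nd' (from I) (to I) (retraction I) b' b r' r)

labels : ∀ a g → map proj₁ (grG a g) ≡ sl a (skG a g)
labels (neg (par a b)) (g , h) = trans (map-++ proj₁ (grG a g) (grG b h)) (cong₂ _++_ (labels a g) (labels b h))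
labels (neg (wit a b)) (inj₁ g) = labels a g
labels (neg (wit a b)) (inj₂ g) = labels b g
labels (neg bot) g = refl
labels (neg (nv x)) g = refl
labels (pst N) g = refl

IdB-skeleton : ∀ a {g s e} → IdB a g (reify a (re a s e)) → skG a g ≡ s
IdB-skeleton (neg (par a b)) {_ , _} (i , j) = cong₂ _,_ (IdB-skeleton a i) (IdB-skeleton b j)
IdB-skeleton (neg (wit a b)) {inj₁ _} {inj₁ _} i = cong inj₁ (IdB-skeleton a i)
IdB-skeleton (neg (wit a b)) {inj₂ _} {inj₂ _} i = cong inj₂ (IdB-skeleton b i)
IdB-skeleton (neg bot) i = refl
IdB-skeleton (neg (nv x)) i = refl
IdB-skeleton (pst N) i = refl

-- If one resource suffices for a value equal to every input, the inputs have one slot each.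
one-slot : ∀ {qs R} (S : All Slot qs) (c : NB ⌈ qs ⌉ (pst R ∷ [])) e f →
           IdB ⌈ qs ⌉ (names S f) (reify ⌈ qs ⌉ (evB c e)) → ∃ λ Q → qs ≡ pst Q ∷ []
one-slot [] (n-bot σ) e f i with () ← ↭-singleton-inv σ
one-slot (s-pst ∷ []) c e f i = _ , refl
one-slot (s-nv ∷ []) (n-par σ (n-nv ρ) (n-bot ρ')) e f i
  with () ← ↭-singleton-inv (↭-trans (++⁺ ρ ρ') σ)
one-slot (S ∷ S' ∷ Ss) (n-par {Θ₁ = Θ₁} σ x (n-par {Θ₁ = Θ₃} ρ y z)) e f (i , (j , _)) = ⊥-elim (go Θ₁ Θ₃ σ ρ (used x S i) (used y S' j))
  where
  used : ∀ {q Θ n e} (b : NB q Θ) (S : Slot q) → IdB q (nm S n) (reify q (evB b e)) → length Θ ≡ 0 → ⊥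
  used {q} {[]} {n} {e} b S i _ with () ← ↭-length (↭-trans (↭-sym (gr-evB b e)) (↭-trans (IdB-gr q i) (↭-reflexive (grG-nm S n))))
  go : ∀ Θ₁ Θ₃ {Θ₂ Θ₄ R} → Θ₁ ++ Θ₂ ↭ pst R ∷ [] → Θ₃ ++ Θ₄ ↭ Θ₂ → (length Θ₁ ≡ 0 → ⊥) → (length Θ₃ ≡ 0 → ⊥) → ⊥
  go [] Θ₃ σ ρ u v = u refl
  go (_ ∷ _) [] σ ρ u v = v refl
  go (_ ∷ Θ₁) (_ ∷ Θ₃) σ ρ u v = nonzero Θ₁ (suc-injective (↭-length (↭-trans (++⁺ˡ (_ ∷ Θ₁) ρ) σ)))
    where
    nonzero : ∀ (Θ : List Arg) {q Ξ} → length (Θ ++ q ∷ Ξ) ≡ 0 → ⊥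
    nonzero [] ()
    nonzero (_ ∷ Θ) ()

-- By `frame` the skeleton of `b` is constant, so a body equal to every input forces all inputs to
-- share it; with a single resource available, `one-slot` leaves one positive slot.
deg : ∀ {N R} (b : NB (neg N) (pst R ∷ [])) (K : Gn (neg N) → Env (pst R ∷ [])) →
      (∀ g → IdBN N g (reifyN N (evB b (K g)))) → Deg N
deg {N} b K i with frame b
... | s , c , p = un (neg N) s (ν (neg N) s λ _ → []) , (λ g g' → trans (sk g) (sym (sk g'))) , λ g → label g
  where
  i' : ∀ g → IdBN N g (reifyN N (re (neg N) s (evB c (K g))))
  i' g = subst (λ v → IdBN N g (reifyN N v)) (p (K g)) (i g)
  sk : ∀ g → skG (neg N) g ≡ s
  sk g = IdB-skeleton (neg N) (i' g)
  single-slot : ∃ λ Q → sl (neg N) s ≡ pst Q ∷ []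
  single-slot = one-slot (slots (neg N) s) c _ (λ _ → []) (IdB-slots (neg N) s _ _ (i' _))
  label : ∀ g → ∃ λ Q → ∃ λ m → grG (neg N) g ≡ [ pst Q , m ]
  label g with grG (neg N) g | trans (labels (neg N) g) (trans (cong (sl (neg N)) (sk g)) (proj₂ single-slot))
  ... | (_ , m) ∷ [] | refl = _ , m , refl

-- The head variable of a morphism between types of opposite polarities is one of its two
-- arguments; the other one is then the only resource of a value equal to every input.
mixed : ∀ {N N'} → Nd (pst N) → Nd (pst N') → ¬ Iso (neg N) (pst N')
mixed {N} {N'} (¬deg , nd) (¬deg' , nd') I with realise (to I) (pst N ∷ pst N' ∷ []) (λ e → e)
    (pst N ∷ [] , pst N' ∷ [] , ↭-refl , proj₁ , (λ e → e) , reH (pst N) tt ,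
      (pst N' ∷ [] , [] , ↭-refl , proj₁ , (λ _ → tt) , reH (pst N') tt , ↭-refl , λ _ → refl) , λ _ → refl)
... | n-node σ b , r with pull σ here
... | _ , here , τ , h with refl ← ↭-singleton-inv τ = ¬deg (deg b (λ g → perm τ (K g , tt)) λ g → id g)
  where
  k = gen (pst N) []
  K : Gn (neg N) → Val (pst N')
  K g = gr (neg N) (genN N g) , λ y → ap (from I) y (genN N g)
  id : ∀ g → IdBN N g (reifyN N (evB b (perm τ (K g , tt))))
  id g with proj₂ (Id-~ nd (~trans
      (≡⇒~ (sym (cong₂ (λ k e → proj₂ k (evB b e)) (proj₁ (h (k , (K g , tt)))) (proj₂ (h (k , (K g , tt))))))) (~trans
      (~sym (r (k , (K g , tt)) (gen-E (pst N) [] , ((↭-refl , λ y y' p → ap-E (from I) p (genN-E N g)) , tt))))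
      (section I k (genN N g) (focus-Good N []) (gen-GoodN N g))))) (_ , refl , gen-IdN N g)
  ... | _ , refl , i = i
... | _ , there refl here , τ , h with refl ← ↭-singleton-inv τ = ¬deg' (deg b (λ g → perm τ (K g , tt)) λ g → id g)
  where
  k = gen (pst N') []
  K : Gn (neg N') → Val (pst N)
  K g = gr (neg N') (genN N' g) , λ x → ap (from I) (genN N' g) x
  id : ∀ g → IdBN N' g (reifyN N' (evB b (perm τ (K g , tt))))
  id g with proj₂ (Id-~ nd' (~trans
      (≡⇒~ (sym (cong₂ (λ k e → proj₂ k (evB b e)) (proj₁ (h (K g , (k , tt)))) (proj₂ (h (K g , (k , tt))))))) (~trans
      (~sym (r (K g , (k , tt)) ((↭-refl , λ x x' p → ap-E (from I) (genN-E N' g) p) , (gen-E (pst N') [] , tt))))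
      (retraction I (genN N' g) k (gen-GoodN N' g) (focus-Good N' []))))) (_ , refl , gen-IdN N' g)
  ... | _ , refl , i = i
... | _ , there refl (there _ ()) , τ , h

-- Distributed formulas

ParArg WithArg : Arg → Set
ParArg (neg (wit a b)) = ⊥
ParArg (neg bot) = ⊥
ParArg (neg top) = ⊥
ParArg _ = ⊤
WithArg (neg top) = ⊥
WithArg _ = ⊤

DN : Ng → Set
DA : Arg → Set
DN (par a b) = (ParArg a × ParArg b) × DA a × DA b
DN (wit a b) = (WithArg a × WithArg b) × DA a × DA b
DN bot = ⊤
DN top = ⊤
DN (nv x) = ⊤
DA (neg N) = DN N
DA (pst N) = DN N

DA-dual : ∀ a → DA a → DA (dual a)
DA-dual (neg N) d = d
DA-dual (pst N) d = d

okPar⇒ : ∀ A B → T (okPar A B) → ParArg ⌜ A ⌝ × ParArg ⌜ B ⌝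
okPar⇒ A B p = let (u , v) = bool (isWith A) (isWith B) (is⊥ A) (is⊥ B) (is⊤ A) (is⊤ B) p in one A u , one B v
  where
  bool : ∀ a b c d e g → T (not (a ∨ b ∨ c ∨ d ∨ e ∨ g)) → T (not (a ∨ c ∨ e)) × T (not (b ∨ d ∨ g))
  bool false false false false false false _ = tt , tt
  one : ∀ A → T (not (isWith A ∨ is⊥ A ∨ is⊤ A)) → ParArg ⌜ A ⌝
  one (var x) _ = tt
  one (nvar x) _ = tt
  one (A ⊗ B) _ = tt
  one (A ⅋ B) _ = tt
  one (A ⊕ B) _ = tt
  one 𝟏 _ = tt
  one 𝟎 _ = tt

okTensor⇒ : ∀ A B → T (okTensor A B) → ParArg (dual ⌜ A ⌝) × ParArg (dual ⌜ B ⌝)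
okTensor⇒ A B p = let (u , v) = bool (isPlus A) (isPlus B) (is𝟏 A) (is𝟏 B) (is𝟎 A) (is𝟎 B) p in one A u , one B v
  where
  bool : ∀ a b c d e g → T (not (a ∨ b ∨ c ∨ d ∨ e ∨ g)) → T (not (a ∨ c ∨ e)) × T (not (b ∨ d ∨ g))
  bool false false false false false false _ = tt , tt
  one : ∀ A → T (not (isPlus A ∨ is𝟏 A ∨ is𝟎 A)) → ParArg (dual ⌜ A ⌝)
  one (var x) _ = tt
  one (nvar x) _ = tt
  one (A ⊗ B) _ = tt
  one (A ⅋ B) _ = tt
  one (A & B) _ = tt
  one ⊥ₘ _ = tt
  one ⊤ₘ _ = tt

okWith⇒ : ∀ A B → T (okWith A B) → WithArg ⌜ A ⌝ × WithArg ⌜ B ⌝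
okWith⇒ A B p = let (u , v) = bool (is⊤ A) (is⊤ B) p in one A u , one B v
  where
  bool : ∀ a b → T (not (a ∨ b)) → T (not a) × T (not b)
  bool false false _ = tt , tt
  one : ∀ A → T (not (is⊤ A)) → WithArg ⌜ A ⌝
  one (var x) _ = tt
  one (nvar x) _ = tt
  one (A ⊗ B) _ = tt
  one (A ⅋ B) _ = tt
  one (A & B) _ = tt
  one (A ⊕ B) _ = tt
  one 𝟏 _ = tt
  one ⊥ₘ _ = tt
  one 𝟎 _ = tt

okPlus⇒ : ∀ A B → T (okPlus A B) → WithArg (dual ⌜ A ⌝) × WithArg (dual ⌜ B ⌝)
okPlus⇒ A B p = let (u , v) = bool (is𝟎 A) (is𝟎 B) p in one A u , one B v
  where
  bool : ∀ a b → T (not (a ∨ b)) → T (not a) × T (not b)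
  bool false false _ = tt , tt
  one : ∀ A → T (not (is𝟎 A)) → WithArg (dual ⌜ A ⌝)
  one (var x) _ = tt
  one (nvar x) _ = tt
  one (A ⊗ B) _ = tt
  one (A ⅋ B) _ = tt
  one (A & B) _ = tt
  one (A ⊕ B) _ = tt
  one 𝟏 _ = tt
  one ⊥ₘ _ = tt
  one ⊤ₘ _ = tt

Distributed⇒DA : ∀ A → Distributed A → DA ⌜ A ⌝
Distributed⇒DA (var x) d = tt
Distributed⇒DA (nvar x) d = tt
Distributed⇒DA (A ⊗ B) (o , d , e) = let (p , q) = okTensor⇒ A B o in
  (q , p) , DA-dual ⌜ B ⌝ (Distributed⇒DA B e) , DA-dual ⌜ A ⌝ (Distributed⇒DA A d)
Distributed⇒DA (A ⅋ B) (o , d , e) = okPar⇒ A B o , Distributed⇒DA A d , Distributed⇒DA B e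
Distributed⇒DA (A & B) (o , d , e) = okWith⇒ A B o , Distributed⇒DA A d , Distributed⇒DA B e
Distributed⇒DA (A ⊕ B) (o , d , e) = let (p , q) = okPlus⇒ A B o in
  (q , p) , DA-dual ⌜ B ⌝ (Distributed⇒DA B e) , DA-dual ⌜ A ⌝ (Distributed⇒DA A d)
Distributed⇒DA 𝟏 d = tt
Distributed⇒DA ⊥ₘ d = tt
Distributed⇒DA ⊤ₘ d = tt
Distributed⇒DA 𝟎 d = tt

Par⇒With : ∀ a → ParArg a → WithArg a
Par⇒With (neg (par a b)) p = tt
Par⇒With (neg (nv x)) p = tt
Par⇒With (pst N) p = tt

inhabited : ∀ a → WithArg a → DA a → Gn a
inhabited (neg (par a b)) w ((p , q) , d , e) = inhabited a (Par⇒With a p) d , inhabited b (Par⇒With b q) e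
inhabited (neg (wit a b)) w ((p , q) , d , e) = inj₁ (inhabited a p d)
inhabited (neg bot) w d = tt
inhabited (neg (nv x)) w d = []
inhabited (pst N) w d = []

nonnull : ∀ a → ParArg a → DA a → ∀ g → 1 ≤ length (grG a g)
nonnull (neg (par a b)) p ((u , v) , d , e) (g , h) = ≤-trans (nonnull a u d g)
  (≤-trans (m≤m+n _ _) (≤-reflexive (sym (length-++ (grG a g)))))
nonnull (neg (nv x)) p d g = s≤s z≤n
nonnull (pst N) p d g = s≤s z≤n

-- A `par` has at least two slots, a `wit` two skeletons, `bot` no slot, `nv` only a negative one,
-- and `top` no input.
not-Deg : ∀ N → DN N → ¬ Deg N
not-Deg (par a b) ((u , v) , d , e) ((g , h) , _ , l) = two (≤-trans (+-mono-≤ (nonnull a u d g) (nonnull b v e h))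
  (≤-trans (≤-reflexive (sym (length-++ (grG a g)))) (≤-reflexive (cong length (proj₂ (proj₂ (l (g , h))))))))
  where
  two : ¬ 2 ≤ 1
  two (s≤s ())
not-Deg (wit a b) ((u , v) , d , e) (_ , same , _) with () ← same (inj₁ (inhabited a u d)) (inj₂ (inhabited b v e))
not-Deg bot d (g , _ , l) with () ← proj₂ (proj₂ (l g))
not-Deg (nv x) d (g , _ , l) with () ← proj₂ (proj₂ (l g))

DN⇒NdN : ∀ N → DN N → NdN N
DA⇒Nd : ∀ a → DA a → Nd a
DA⇒Nd (neg N) d = DN⇒NdN N d
DA⇒Nd (pst N) d = not-Deg N d , DN⇒NdN N d
DN⇒NdN (par a b) (_ , d , e) = DA⇒Nd a d , DA⇒Nd b e
DN⇒NdN (wit a b) (_ , d , e) = DA⇒Nd a d , DA⇒Nd b e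
DN⇒NdN bot d = tt
DN⇒NdN top d = tt
DN⇒NdN (nv x) d = tt

-- Distributed formulas as conjunctions of clauses

en : ∀ a → List (Sk a)
en (neg (par a b)) = cartesianProduct (en a) (en b)
en (neg (wit a b)) = map inj₁ (en a) ++ map inj₂ (en b)
en (neg bot) = tt ∷ []
en (neg top) = []
en (neg (nv x)) = tt ∷ []
en (pst N) = tt ∷ []

en-unique : ∀ a → Unique (en a)
en-unique (neg (par a b)) = Unique.cartesianProduct⁺ (en-unique a) (en-unique b)
en-unique (neg (wit a b)) = Unique.++⁺ (Unique.map⁺ inj₁-injective (en-unique a)) (Unique.map⁺ inj₂-injective (en-unique b))
  λ (p , q) → clash (∈.∈-map⁻ inj₁ p) (∈.∈-map⁻ inj₂ q)
  where
  clash : ∀ {v} → (∃ λ s → s ∈ en a × v ≡ inj₁ s) → (∃ λ s → s ∈ en b × v ≡ inj₂ s) → ⊥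
  clash (_ , _ , refl) (_ , _ , ())
en-unique (neg bot) = [] ∷ []
en-unique (neg top) = []
en-unique (neg (nv x)) = [] ∷ []
en-unique (pst N) = [] ∷ []

en-complete : ∀ a s → s ∈ en a
en-complete (neg (par a b)) (s , t) = ∈.∈-cartesianProduct⁺ (en-complete a s) (en-complete b t)
en-complete (neg (wit a b)) (inj₁ s) = ∈.∈-++⁺ˡ (∈.∈-map⁺ inj₁ (en-complete a s))
en-complete (neg (wit a b)) (inj₂ s) = ∈.∈-++⁺ʳ (map inj₁ (en a)) (∈.∈-map⁺ inj₂ (en-complete b s))
en-complete (neg bot) s = here refl
en-complete (neg (nv x)) s = here refl
en-complete (pst N) s = here refl

module Big (_∘_ : Fm → Fm → Fm) (u : Fm)
  (∘-cong : ∀ {A A' B B'} → A =AC A' → B =AC B' → (A ∘ B) =AC (A' ∘ B'))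
  (∘-assoc : ∀ A B C → (A ∘ (B ∘ C)) =AC ((A ∘ B) ∘ C)) (∘-comm : ∀ A B → (A ∘ B) =AC (B ∘ A)) where

  -- The unit appears for the empty list only, as no unit law is available in AC.
  big : List Fm → Fm
  big [] = u
  big (A ∷ []) = A
  big (A ∷ B ∷ Γ) = A ∘ big (B ∷ Γ)

  big-++ : ∀ A Γ B Δ → big ((A ∷ Γ) ++ B ∷ Δ) =AC (big (A ∷ Γ) ∘ big (B ∷ Δ))
  big-++ A [] B Δ = th-refl
  big-++ A (A' ∷ Γ) B Δ = th-trans (∘-cong th-refl (big-++ A' Γ B Δ)) (∘-assoc _ _ _)

  big-∷ : ∀ A {Γ Δ} → Γ ↭ Δ → big Γ =AC big Δ → big (A ∷ Γ) =AC big (A ∷ Δ)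
  big-∷ A {[]} {[]} σ p = th-refl
  big-∷ A {[]} {_ ∷ _} σ p with () ← ↭-empty-inv (↭-sym σ)
  big-∷ A {_ ∷ _} {[]} σ p with () ← ↭-empty-inv σ
  big-∷ A {_ ∷ _} {_ ∷ _} σ p = ∘-cong th-refl p

  big-swap : ∀ A B Γ → big (A ∷ B ∷ Γ) =AC big (B ∷ A ∷ Γ)
  big-swap A B [] = ∘-comm A B
  big-swap A B (C ∷ Γ) = th-trans (∘-assoc _ _ _) (th-trans (∘-cong (∘-comm A B) th-refl) (th-sym (∘-assoc _ _ _)))

  big-↭ : ∀ {Γ Δ} → Γ ↭ Δ → big Γ =AC big Δ
  big-↭ ↭-refl = th-refl
  big-↭ (prep A σ) = big-∷ A σ (big-↭ σ)
  big-↭ {Δ = _ ∷ _ ∷ Δ} (swap A B σ) = th-trans (big-∷ A (prep B σ) (big-∷ B σ (big-↭ σ))) (big-swap A B Δ)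
  big-↭ (↭-trans σ ρ) = th-trans (big-↭ σ) (big-↭ ρ)

  big-cong : ∀ {I : Set} (f g : I → Fm) (xs : List I) → (∀ i → f i =AC g i) → big (map f xs) =AC big (map g xs)
  big-cong f g [] h = th-refl
  big-cong f g (x ∷ []) h = h x
  big-cong f g (x ∷ y ∷ xs) h = ∘-cong (h x) (big-cong f g (y ∷ xs) h)

  -- The image of `xs` under `φ` and the list `ys` are duplicate-free with the same elements, hence
  -- permutations of each other.
  big-bijection : ∀ {I J : Set} (f : I → Fm) (g : J → Fm) {xs ys} → Unique xs → Unique ys → (∀ i → i ∈ xs) → (∀ j → j ∈ ys) →
    (φ : I → J) (ψ : J → I) → (∀ i → ψ (φ i) ≡ i) → (∀ j → φ (ψ j) ≡ j) → (∀ i → f i =AC g (φ i)) →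
    big (map f xs) =AC big (map g ys)
  big-bijection f g {xs} {ys} u v p q φ ψ ψφ φψ h = th-trans (big-cong f (λ i → g (φ i)) xs h)
    (subst (λ zs → big zs =AC big (map g ys)) (sym (map-∘ xs)) (big-↭ (map⁺ g (∼bag⇒↭ (unique∧set⇒bag
      (Unique.map⁺ (λ {i} {j} e → trans (sym (ψφ i)) (trans (cong ψ e) (ψφ j))) u) v
      (λ {j} → mk⇔ (λ _ → q j) (λ _ → subst (_∈ map φ xs) (φψ j) (∈.∈-map⁺ φ (p (ψ j))))))))))

open Big _⅋_ ⊥ₘ th-⅋ (ax-⅋-assoc tt) (ax-⅋-comm tt) using () renaming (big to ⋁; big-++ to ⋁-++; big-bijection to ⋁-bijection)
open Big _&_ ⊤ₘ th-& (ax-&-assoc tt) (ax-&-comm tt) using () renaming (big to ⋀; big-++ to ⋀-++; big-bijection to ⋀-bijection)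

-- The slots of a skeleton as formulas rather than polarised types, ready to be recombined.
clause : ∀ A → Sk ⌜ A ⌝ → List Fm
clause (A ⅋ B) (s , t) = clause A s ++ clause B t
clause (A & B) (inj₁ s) = clause A s
clause (A & B) (inj₂ t) = clause B t
clause ⊥ₘ _ = []
clause (nvar x) _ = nvar x ∷ []
clause A@(var _) _ = A ∷ []
clause A@(_ ⊗ _) _ = A ∷ []
clause A@(_ ⊕ _) _ = A ∷ []
clause A@𝟏 _ = A ∷ []
clause A@𝟎 _ = A ∷ []

clause-sl : ∀ A s → map ⌜_⌝ (clause A s) ≡ sl ⌜ A ⌝ s
clause-sl (var x) s = refl
clause-sl (nvar x) s = refl
clause-sl (A ⊗ B) s = refl
clause-sl (A ⅋ B) (s , t) = trans (map-++ ⌜_⌝ (clause A s) (clause B t)) (cong₂ _++_ (clause-sl A s) (clause-sl B t))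
clause-sl (A & B) (inj₁ s) = clause-sl A s
clause-sl (A & B) (inj₂ s) = clause-sl B s
clause-sl (A ⊕ B) s = refl
clause-sl 𝟏 s = refl
clause-sl ⊥ₘ s = refl
clause-sl 𝟎 s = refl

clause-DA : ∀ A s → DA ⌜ A ⌝ → All (λ C → DA ⌜ C ⌝) (clause A s)
clause-DA (var x) s d = d ∷ []
clause-DA (nvar x) s d = d ∷ []
clause-DA (A ⊗ B) s d = d ∷ []
clause-DA (A ⅋ B) (s , t) (_ , d , e) = All.++⁺ (clause-DA A s d) (clause-DA B t e)
clause-DA (A & B) (inj₁ s) (_ , d , e) = clause-DA A s d
clause-DA (A & B) (inj₂ s) (_ , d , e) = clause-DA B s e
clause-DA (A ⊕ B) s d = d ∷ []
clause-DA 𝟏 s d = d ∷ []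
clause-DA ⊥ₘ s d = []
clause-DA 𝟎 s d = d ∷ []

NonEmpty : ∀ {A : Set} → List A → Set
NonEmpty xs = ∃ λ x → ∃ λ ys → xs ≡ x ∷ ys

∈⇒NonEmpty : ∀ {A : Set} {x} {xs : List A} → x ∈ xs → NonEmpty xs
∈⇒NonEmpty {xs = _ ∷ _} _ = _ , _ , refl

-- In a distributed formula no `wit` is reached from an argument of `par` through further `par`s, so
-- there is no choice to make.
unique-skeleton : ∀ a → ParArg a → DA a → ∃ λ s → en a ≡ s ∷ []
unique-skeleton (neg (par a b)) p ((u , v) , d , e) with unique-skeleton a u d | unique-skeleton b v e
... | s , q | t , r = (s , t) , cong₂ cartesianProduct q r
unique-skeleton (neg (nv x)) p d = tt , refl
unique-skeleton (pst N) p d = tt , refl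

clause-NonEmpty : ∀ A → ParArg ⌜ A ⌝ → DA ⌜ A ⌝ → ∀ s → NonEmpty (clause A s)
clause-NonEmpty (var x) p d s = _ , _ , refl
clause-NonEmpty (nvar x) p d s = _ , _ , refl
clause-NonEmpty (A ⊗ B) p d s = _ , _ , refl
clause-NonEmpty (A ⅋ B) p ((u , v) , d , e) (s , t) with clause-NonEmpty A u d s
... | C , Γ , q = C , _ , cong (_++ clause B t) q
clause-NonEmpty (A ⊕ B) p d s = _ , _ , refl
clause-NonEmpty 𝟏 p d s = _ , _ , refl
clause-NonEmpty 𝟎 p d s = _ , _ , refl

expand : Fm → Fm
expand A = ⋀ (map (λ s → ⋁ (clause A s)) (en ⌜ A ⌝))

⋁-++' : ∀ {Γ Δ} → NonEmpty Γ → NonEmpty Δ → ⋁ (Γ ++ Δ) =AC (⋁ Γ ⅋ ⋁ Δ)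
⋁-++' (A , Γ , refl) (B , Δ , refl) = ⋁-++ A Γ B Δ

⋀-++' : ∀ {Γ Δ} → NonEmpty Γ → NonEmpty Δ → ⋀ (Γ ++ Δ) =AC (⋀ Γ & ⋀ Δ)
⋀-++' (A , Γ , refl) (B , Δ , refl) = ⋀-++ A Γ B Δ

map-NonEmpty : ∀ {A B : Set} {f : A → B} {xs} → NonEmpty xs → NonEmpty (map f xs)
map-NonEmpty (_ , _ , refl) = _ , _ , refl

-- Before the first positive connective, every `&` of a distributed formula already lies above every
-- `⅋`; the two sides differ by bracketing alone. Non-emptiness is tracked because splitting an
-- empty `⋁` or `⋀` would take a unit law.
expand-AC : ∀ A → DA ⌜ A ⌝ → A =AC expand A
expand-AC (var x) d = th-refl
expand-AC (nvar x) d = th-refl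
expand-AC (A ⊗ B) d = th-refl
expand-AC (A ⅋ B) ((u , v) , d , e) with unique-skeleton ⌜ A ⌝ u d | unique-skeleton ⌜ B ⌝ v e | expand-AC A d | expand-AC B e
-- Both arguments have a single skeleton, so each `⋀` is a single clause and only `⋁` has to be
-- split.
... | s , p | t , q | h | k rewrite p | q = th-trans (th-⅋ h k)
  (th-sym (⋁-++' (clause-NonEmpty A u d s) (clause-NonEmpty B v e t)))
expand-AC (A & B) ((u , v) , d , e) = th-trans (th-& (expand-AC A d) (expand-AC B e))
  (th-sym (subst (λ Γ → ⋀ Γ =AC (expand A & expand B))
    (sym (trans (map-++ c (map inj₁ (en ⌜ A ⌝)) (map inj₂ (en ⌜ B ⌝))) (cong₂ _++_ (sym (map-∘ (en ⌜ A ⌝))) (sym (map-∘ (en ⌜ B ⌝))))))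
    (⋀-++' (map-NonEmpty (ne A u d)) (map-NonEmpty (ne B v e)))))
  where
  c : Sk ⌜ A & B ⌝ → Fm
  c s = ⋁ (clause (A & B) s)
  ne : ∀ A → WithArg ⌜ A ⌝ → DA ⌜ A ⌝ → NonEmpty (en ⌜ A ⌝)
  ne A w d = ∈⇒NonEmpty (en-complete ⌜ A ⌝ (skG ⌜ A ⌝ (inhabited ⌜ A ⌝ w d)))
expand-AC (A ⊕ B) d = th-refl
expand-AC 𝟏 d = th-refl
expand-AC ⊥ₘ d = th-refl
expand-AC ⊤ₘ d = th-refl
expand-AC 𝟎 d = th-refl

nth : ∀ cs → Fin (length (map ⌜_⌝ cs)) → Fm
nth (C ∷ cs) zero = C
nth (C ∷ cs) (suc i) = nth cs i

nth-⌜⌝ : ∀ cs i → lookup (map ⌜_⌝ cs) i ≡ ⌜ nth cs i ⌝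
nth-⌜⌝ (C ∷ cs) zero = refl
nth-⌜⌝ (C ∷ cs) (suc i) = nth-⌜⌝ cs i

nth-DA : ∀ {cs} → All (λ C → DA ⌜ C ⌝) cs → ∀ i → DA ⌜ nth cs i ⌝
nth-DA (d ∷ ds) zero = d
nth-DA (d ∷ ds) (suc i) = nth-DA ds i

map-nth : ∀ cs → map (nth cs) (allFin (length (map ⌜_⌝ cs))) ≡ cs
map-nth cs = trans (map-tabulate (λ i → i) (nth cs)) (go cs)
  where
  go : ∀ cs → tabulate (nth cs) ≡ cs
  go [] = refl
  go (C ∷ cs) = cong (C ∷_) (go cs)

⋁-match : ∀ cs ds {qs rs} → map ⌜_⌝ cs ≡ qs → map ⌜_⌝ ds ≡ rs → All (λ C → DA ⌜ C ⌝) cs → All (λ C → DA ⌜ C ⌝) ds →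
  (α : Fin (length qs) → Fin (length rs)) (β : Fin (length rs) → Fin (length qs)) →
  (∀ l → β (α l) ≡ l) → (∀ k → α (β k) ≡ k) →
  (∀ l C C' → lookup qs l ≡ ⌜ C ⌝ → lookup rs (α l) ≡ ⌜ C' ⌝ → DA ⌜ C ⌝ → DA ⌜ C' ⌝ → C =AC C') → ⋁ cs =AC ⋁ ds
⋁-match cs ds refl refl dc dd α β βα αβ h = subst₂' (map-nth cs) (map-nth ds)
  (⋁-bijection (nth cs) (nth ds) (Unique.allFin⁺ _) (Unique.allFin⁺ _) ∈.∈-allFin ∈.∈-allFin α β βα αβ
    (λ l → h l (nth cs l) (nth ds (α l)) (nth-⌜⌝ cs l) (nth-⌜⌝ ds (α l)) (nth-DA dc l) (nth-DA dd (α l))))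
  where
  subst₂' : ∀ {Γ Γ' Δ Δ'} → Γ ≡ Γ' → Δ ≡ Δ' → ⋁ Γ =AC ⋁ Δ → ⋁ Γ' =AC ⋁ Δ'
  subst₂' refl refl p = p

AC-dual : ∀ {A B} → A =AC B → (A ⁻) =AC (B ⁻)
AC-dual th-refl = th-refl
AC-dual (th-sym p) = th-sym (AC-dual p)
AC-dual (th-trans p q) = th-trans (AC-dual p) (AC-dual q)
AC-dual (th-⊗ p q) = th-⅋ (AC-dual q) (AC-dual p)
AC-dual (th-⅋ p q) = th-⊗ (AC-dual q) (AC-dual p)
AC-dual (th-& p q) = th-⊕ (AC-dual q) (AC-dual p)
AC-dual (th-⊕ p q) = th-& (AC-dual q) (AC-dual p)
AC-dual (ax-⊗-assoc _ A B C) = th-sym (ax-⅋-assoc tt (C ⁻) (B ⁻) (A ⁻))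
AC-dual (ax-⊗-comm _ A B) = ax-⅋-comm tt (B ⁻) (A ⁻)
AC-dual (ax-⅋-assoc _ A B C) = th-sym (ax-⊗-assoc tt (C ⁻) (B ⁻) (A ⁻))
AC-dual (ax-⅋-comm _ A B) = ax-⊗-comm tt (B ⁻) (A ⁻)
AC-dual (ax-⊕-assoc _ A B C) = th-sym (ax-&-assoc tt (C ⁻) (B ⁻) (A ⁻))
AC-dual (ax-⊕-comm _ A B) = ax-&-comm tt (B ⁻) (A ⁻)
AC-dual (ax-&-assoc _ A B C) = th-sym (ax-⊕-assoc tt (C ⁻) (B ⁻) (A ⁻))
AC-dual (ax-&-comm _ A B) = ax-⊕-comm tt (B ⁻) (A ⁻)

AC-undual : ∀ A B → (A ⁻) =AC (B ⁻) → A =AC B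
AC-undual A B p = subst (λ C → C =AC B) (⁻⁻ A) (subst (λ C → (A ⁻ ⁻) =AC C) (⁻⁻ B) (AC-dual p))

-- Positive slots are compared through their negations, where `D` relates negative types again.
-- Equations `a ≡ ⌜ A ⌝` replace indices because slots are obtained by `lookup`.
D-AC : ∀ {a b} → D a b → ∀ A B → a ≡ ⌜ A ⌝ → b ≡ ⌜ B ⌝ → DA ⌜ A ⌝ → DA ⌜ B ⌝ → A =AC B
DQ-AC : ∀ {q r} → DQ q r → ∀ A B → q ≡ ⌜ A ⌝ → r ≡ ⌜ B ⌝ → DA ⌜ A ⌝ → DA ⌜ B ⌝ → A =AC B
DQ-AC (d-pst d) A B p q dA dB = AC-undual A B (D-AC d (A ⁻) (B ⁻) (trans (cong dual p) (sym (⌜⁻⌝ A))) (trans (cong dual q) (sym (⌜⁻⌝ B)))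
  (subst DA (sym (⌜⁻⌝ A)) (DA-dual ⌜ A ⌝ dA)) (subst DA (sym (⌜⁻⌝ B)) (DA-dual ⌜ B ⌝ dB)))
DQ-AC d-nv (nvar x) (nvar .x) refl refl dA dB = th-refl
D-AC (mkD φ ψ ψφ φψ α β βα αβ dq) A B refl refl dA dB = th-trans (expand-AC A dA) (th-trans
  (⋀-bijection (λ s → ⋁ (clause A s)) (λ t → ⋁ (clause B t)) (en-unique ⌜ A ⌝) (en-unique ⌜ B ⌝)
    (en-complete ⌜ A ⌝) (en-complete ⌜ B ⌝) φ ψ ψφ φψ
    (λ s → ⋁-match (clause A s) (clause B (φ s)) (clause-sl A s) (clause-sl B (φ s)) (clause-DA A s dA) (clause-DA B (φ s) dB)
      (α s) (β s) (βα s) (αβ s) (λ l C C' → DQ-AC (dq s l) C C')))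
  (th-sym (expand-AC B dB)))

Iso-AC : ∀ {a b} A B → a ≡ ⌜ A ⌝ → b ≡ ⌜ B ⌝ → DA a → DA b → Iso a b → A =AC B
Iso-AC {neg N} {neg N'} A B p q d e I = D-AC (Iso-D (DN⇒NdN N d) (DN⇒NdN N' e) I) A B p q (subst DA p d) (subst DA q e)
Iso-AC {pst N} {pst N'} A B p q d e I = DQ-AC (d-pst (Iso-D (DN⇒NdN N d) (DN⇒NdN N' e) (Iso-dual I))) A B p q (subst DA p d) (subst DA q e)
Iso-AC {neg N} {pst N'} A B p q d e I = ⊥-elim (mixed (DA⇒Nd (pst N) d) (DA⇒Nd (pst N') e) I)
Iso-AC {pst N} {neg N'} A B p q d e I = ⊥-elim (mixed (DA⇒Nd (pst N') e) (DA⇒Nd (pst N) d) (Iso-sym I))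

-- Distributed forms

module Normalise (S : Sub) where

  Normal : Fm → Set
  Normal A = Σ Fm λ B → Distributed B × Uses S B × (A =E[ S ] B)

  step : ∀ {A B} → A =E[ S ] B → Normal B → Normal A
  step p (C , d , u , q) = C , d , u , th-trans p q

  -- Multiplying out with respect to _∙_, which distributes over _∔_; the units of _∙_ and _∔_ are e and z.
  module Expand (_∙_ _∔_ : Fm → Fm → Fm) (e z : Fm) (c∙ c∔ ce cz : Conn) (isSum isE isZ : Fm → Bool)
    (z-only : ∀ A → T (isZ A) → A ≡ z)
    (u∔ : ∀ {A B} → Uses S (A ∔ B) → T (S c∔) × Uses S A × Uses S B)
    (u∔' : ∀ {A B} → T (S c∔) × Uses S A × Uses S B → Uses S (A ∔ B))
    (u∙' : ∀ {A B} → T (S c∙) × Uses S A × Uses S B → Uses S (A ∙ B))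
    (ue : Uses S e → T (S ce)) (uz : Uses S z → T (S cz))
    (d∔ : ∀ {A B} → Distributed (A ∔ B) → Distributed A × Distributed B)
    (d∔' : ∀ A B → T (not (isZ A)) → T (not (isZ B)) → Distributed A → Distributed B → Distributed (A ∔ B))
    (d∙' : ∀ A B → T (not (isSum A ∨ isE A ∨ isZ A)) → T (not (isSum B ∨ isE B ∨ isZ B)) →
           Distributed A → Distributed B → Distributed (A ∙ B))
    (dz : Distributed z)
    (∔-cong : ∀ {A A' B B'} → A =E[ S ] A' → B =E[ S ] B' → (A ∔ B) =E[ S ] (A' ∔ B'))
    (∙-comm : T (S c∙) → ∀ A B → (A ∙ B) =E[ S ] (B ∙ A))
    (∔-comm : T (S c∔) → ∀ A B → (A ∔ B) =E[ S ] (B ∔ A))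
    (distr : T (S c∙) → T (S c∔) → ∀ A B C → (A ∙ (B ∔ C)) =E[ S ] ((A ∙ B) ∔ (A ∙ C)))
    (∙-e : T (S c∙) → T (S ce) → ∀ A → (A ∙ e) =E[ S ] A)
    (∙-z : T (S c∙) → T (S cz) → ∀ A → (A ∙ z) =E[ S ] z)
    (∔-z : T (S c∔) → T (S cz) → ∀ A → (A ∔ z) =E[ S ] A)
    where

    -- The shape of a factor, as data: `_∔_`, `e` and `z` are parameters and cannot be matched on.
    data View : Fm → Set where
      v-sum : ∀ {A B} → View A → View B → View (A ∔ B)
      v-e : View e
      v-z : View z
      v-other : ∀ {A} → T (not (isSum A ∨ isE A ∨ isZ A)) → View A

    dec : ∀ b → T b ⊎ T (not b)
    dec true = inj₁ tt
    dec false = inj₂ tt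

    sum : ∀ {A B} → T (S c∔) → Normal A → Normal B → Normal (A ∔ B)
    sum s (C , dC , uC , p) (D , dD , uD , q) with dec (isZ C) | dec (isZ D)
    ... | inj₂ i | inj₂ j = (C ∔ D) , d∔' C D i j dC dD , u∔' (s , uC , uD) , ∔-cong p q
    ... | _ | inj₁ j with refl ← z-only D j = C , dC , uC , th-trans (∔-cong p q) (∔-z s (uz uD) C)
    ... | inj₁ i | inj₂ _ with refl ← z-only C i =
      D , dD , uD , th-trans (∔-cong p q) (th-trans (∔-comm s z D) (∔-z s (uz uC) D))

    -- The right factor is expanded once the left one is neither a sum nor a unit; `mul` first
    -- reduces the left factor to that case.
    mulʳ : ∀ {A B} → T (S c∙) → T (not (isSum A ∨ isE A ∨ isZ A)) → View B → Distributed A → Distributed B →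
           Uses S A → Uses S B → Normal (A ∙ B)
    mulʳ s o (v-sum v w) dA dB uA uB = let (s' , uC , uD) = u∔ uB ; (dC , dD) = d∔ dB in
      step (distr s s' _ _ _) (sum s' (mulʳ s o v dA dC uA uC) (mulʳ s o w dA dD uA uD))
    mulʳ {A} s o v-e dA dB uA uB = A , dA , uA , ∙-e s (ue uB) A
    mulʳ {A} s o v-z dA dB uA uB = z , dz , uB , ∙-z s (uz uB) A
    mulʳ {A} {B} s o (v-other o') dA dB uA uB = (A ∙ B) , d∙' A B o o' dA dB , u∙' (s , uA , uB) , th-refl

    mul : ∀ {A B} → T (S c∙) → View A → View B → Distributed A → Distributed B → Uses S A → Uses S B → Normal (A ∙ B)
    mul {B = B} s (v-sum v w) x dA dB uA uB = let (s' , uC , uD) = u∔ uA ; (dC , dD) = d∔ dA in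
      step (th-trans (∙-comm s _ B) (th-trans (distr s s' _ _ _) (∔-cong (∙-comm s B _) (∙-comm s B _))))
        (sum s' (mul s v x dC dB uC uB) (mul s w x dD dB uD uB))
    mul {B = B} s v-e x dA dB uA uB = B , dB , uB , th-trans (∙-comm s e B) (∙-e s (ue uA) B)
    mul {B = B} s v-z x dA dB uA uB = z , dz , uA , th-trans (∙-comm s z B) (∙-z s (uz uA) B)
    mul s (v-other o) x dA dB uA uB = mulʳ s o x dA dB uA uB

  bool₄ : ∀ a b c d e g → T (not (a ∨ c ∨ e)) → T (not (b ∨ d ∨ g)) → T (not (a ∨ b ∨ c ∨ d ∨ e ∨ g))
  bool₄ false false false false false false _ _ = tt

  bool₂ : ∀ a b → T (not a) → T (not b) → T (not (a ∨ b))
  bool₂ false false _ _ = tt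

  is⊤-only : ∀ A → T (is⊤ A) → A ≡ ⊤ₘ
  is⊤-only ⊤ₘ _ = refl

  is𝟎-only : ∀ A → T (is𝟎 A) → A ≡ 𝟎
  is𝟎-only 𝟎 _ = refl

  module ⅋& = Expand _⅋_ _&_ ⊥ₘ ⊤ₘ c⅋ c& c⊥ c⊤ isWith is⊥ is⊤ is⊤-only (λ u → u) (λ u → u) (λ u → u) (λ u → u) (λ u → u)
    proj₂ (λ A B p q d e → bool₂ (is⊤ A) (is⊤ B) p q , d , e)
    (λ A B p q d e → bool₄ (isWith A) (isWith B) (is⊥ A) (is⊥ B) (is⊤ A) (is⊤ B) p q , d , e) tt
    th-& (λ s → ax-⅋-comm (s ∷ [])) (λ s → ax-&-comm (s ∷ [])) (λ s t → ax-⅋&-distr (s ∷ t ∷ []))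
    (λ s t → ax-⅋-unit (s ∷ t ∷ [])) (λ s t → ax-⅋-⊤ (s ∷ t ∷ [])) (λ s t → ax-&-unit (s ∷ t ∷ []))

  module ⊗⊕ = Expand _⊗_ _⊕_ 𝟏 𝟎 c⊗ c⊕ c𝟏 c𝟎 isPlus is𝟏 is𝟎 is𝟎-only (λ u → u) (λ u → u) (λ u → u) (λ u → u) (λ u → u)
    proj₂ (λ A B p q d e → bool₂ (is𝟎 A) (is𝟎 B) p q , d , e)
    (λ A B p q d e → bool₄ (isPlus A) (isPlus B) (is𝟏 A) (is𝟏 B) (is𝟎 A) (is𝟎 B) p q , d , e) tt
    th-⊕ (λ s → ax-⊗-comm (s ∷ [])) (λ s → ax-⊕-comm (s ∷ [])) (λ s t → ax-⊗⊕-distr (s ∷ t ∷ []))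
    (λ s t → ax-⊗-unit (s ∷ t ∷ [])) (λ s t → ax-⊗-𝟎 (s ∷ t ∷ [])) (λ s t → ax-⊕-unit (s ∷ t ∷ []))

  view⅋ : ∀ A → ⅋&.View A
  view⅋ (A & B) = ⅋&.v-sum (view⅋ A) (view⅋ B)
  view⅋ ⊥ₘ = ⅋&.v-e
  view⅋ ⊤ₘ = ⅋&.v-z
  view⅋ (var x) = ⅋&.v-other tt
  view⅋ (nvar x) = ⅋&.v-other tt
  view⅋ (A ⊗ B) = ⅋&.v-other tt
  view⅋ (A ⅋ B) = ⅋&.v-other tt
  view⅋ (A ⊕ B) = ⅋&.v-other tt
  view⅋ 𝟏 = ⅋&.v-other tt
  view⅋ 𝟎 = ⅋&.v-other tt

  view⊗ : ∀ A → ⊗⊕.View A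
  view⊗ (A ⊕ B) = ⊗⊕.v-sum (view⊗ A) (view⊗ B)
  view⊗ 𝟏 = ⊗⊕.v-e
  view⊗ 𝟎 = ⊗⊕.v-z
  view⊗ (var x) = ⊗⊕.v-other tt
  view⊗ (nvar x) = ⊗⊕.v-other tt
  view⊗ (A ⊗ B) = ⊗⊕.v-other tt
  view⊗ (A ⅋ B) = ⊗⊕.v-other tt
  view⊗ (A & B) = ⊗⊕.v-other tt
  view⊗ ⊥ₘ = ⊗⊕.v-other tt
  view⊗ ⊤ₘ = ⊗⊕.v-other tt

  -- Each rewriting step applies an equation whose connectives all occur in the redex at hand. They
  -- therefore belong to `S`, and the equation to the fragment.
  normalise : ∀ A → Uses S A → Normal A
  normalise (var x) u = var x , tt , tt , th-refl
  normalise (nvar x) u = nvar x , tt , tt , th-refl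
  normalise (A ⊗ B) (s , u , v) with normalise A u | normalise B v
  ... | C , dC , uC , p | D , dD , uD , q = step (th-⊗ p q) (⊗⊕.mul s (view⊗ C) (view⊗ D) dC dD uC uD)
  normalise (A ⅋ B) (s , u , v) with normalise A u | normalise B v
  ... | C , dC , uC , p | D , dD , uD , q = step (th-⅋ p q) (⅋&.mul s (view⅋ C) (view⅋ D) dC dD uC uD)
  normalise (A & B) (s , u , v) = ⅋&.sum s (normalise A u) (normalise B v)
  normalise (A ⊕ B) (s , u , v) = ⊗⊕.sum s (normalise A u) (normalise B v)
  normalise 𝟏 u = 𝟏 , tt , u , th-refl
  normalise ⊥ₘ u = ⊥ₘ , tt , u , th-refl
  normalise ⊤ₘ u = ⊤ₘ , tt , u , th-refl
  normalise 𝟎 u = 𝟎 , tt , u , th-refl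

  -- An AC equation has the same connective on both sides, so being in the fragment is preserved
  -- along a derivation; `th-sym` makes both directions necessary.
  AC⇒E : ∀ {A B} → A =AC B → (Uses S A → Uses S B) × (Uses S B → Uses S A) × (Uses S A → A =E[ S ] B)
  AC⇒E th-refl = (λ u → u) , (λ u → u) , λ _ → th-refl
  AC⇒E (th-sym p) = let (f , g , h) = AC⇒E p in g , f , λ u → th-sym (h (g u))
  AC⇒E (th-trans p q) = let (f , g , h) = AC⇒E p ; (f' , g' , h') = AC⇒E q in
    (λ u → f' (f u)) , (λ u → g (g' u)) , λ u → th-trans (h u) (h' (f u))
  AC⇒E (th-⊗ p q) = let (f , g , h) = AC⇒E p ; (f' , g' , h') = AC⇒E q in
    (λ (s , u , v) → s , f u , f' v) , (λ (s , u , v) → s , g u , g' v) , λ (s , u , v) → th-⊗ (h u) (h' v)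
  AC⇒E (th-⅋ p q) = let (f , g , h) = AC⇒E p ; (f' , g' , h') = AC⇒E q in
    (λ (s , u , v) → s , f u , f' v) , (λ (s , u , v) → s , g u , g' v) , λ (s , u , v) → th-⅋ (h u) (h' v)
  AC⇒E (th-& p q) = let (f , g , h) = AC⇒E p ; (f' , g' , h') = AC⇒E q in
    (λ (s , u , v) → s , f u , f' v) , (λ (s , u , v) → s , g u , g' v) , λ (s , u , v) → th-& (h u) (h' v)
  AC⇒E (th-⊕ p q) = let (f , g , h) = AC⇒E p ; (f' , g' , h') = AC⇒E q in
    (λ (s , u , v) → s , f u , f' v) , (λ (s , u , v) → s , g u , g' v) , λ (s , u , v) → th-⊕ (h u) (h' v)
  AC⇒E (ax-⊗-assoc _ A B C) = (λ (s , u , _ , v , w) → s , (s , u , v) , w) , (λ (s , (_ , u , v) , w) → s , u , s , v , w) , λ (s , _) → ax-⊗-assoc (s ∷ []) A B C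
  AC⇒E (ax-⊗-comm _ A B) = (λ (s , u , v) → s , v , u) , (λ (s , u , v) → s , v , u) , λ (s , _) → ax-⊗-comm (s ∷ []) A B
  AC⇒E (ax-⅋-assoc _ A B C) = (λ (s , u , _ , v , w) → s , (s , u , v) , w) , (λ (s , (_ , u , v) , w) → s , u , s , v , w) , λ (s , _) → ax-⅋-assoc (s ∷ []) A B C
  AC⇒E (ax-⅋-comm _ A B) = (λ (s , u , v) → s , v , u) , (λ (s , u , v) → s , v , u) , λ (s , _) → ax-⅋-comm (s ∷ []) A B
  AC⇒E (ax-⊕-assoc _ A B C) = (λ (s , u , _ , v , w) → s , (s , u , v) , w) , (λ (s , (_ , u , v) , w) → s , u , s , v , w) , λ (s , _) → ax-⊕-assoc (s ∷ []) A B C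
  AC⇒E (ax-⊕-comm _ A B) = (λ (s , u , v) → s , v , u) , (λ (s , u , v) → s , v , u) , λ (s , _) → ax-⊕-comm (s ∷ []) A B
  AC⇒E (ax-&-assoc _ A B C) = (λ (s , u , _ , v , w) → s , (s , u , v) , w) , (λ (s , (_ , u , v) , w) → s , u , s , v , w) , λ (s , _) → ax-&-assoc (s ∷ []) A B C
  AC⇒E (ax-&-comm _ A B) = (λ (s , u , v) → s , v , u) , (λ (s , u , v) → s , v , u) , λ (s , _) → ax-&-comm (s ∷ []) A B

-- From `≅` to the three statements

≅⇒Iso : ∀ {A B} → A ≅ B → Iso ⌜ A ⌝ ⌜ B ⌝
≅⇒Iso {A} {B} (π , π' , p , p') = record
  { to = mor π ; from = mor π'
  ; section = half π π' p ; retraction = half π' π p' }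
  where
  open Forget Fm ⌜_⌝
  mor : ∀ {A B} → ⊢ (A ⁻ ∷ B ∷ []) → Mor ⌜ A ⌝ ⌜ B ⌝
  mor {A} {B} π = subst (λ a → ⊩ a ∷ ⌜ B ⌝ ∷ []) (⌜⁻⌝ A) (forget (Soundness.tr π))
  ap-mor : ∀ {A B} (π : ⊢ (A ⁻ ∷ B ∷ [])) {x̄ y} → E (dual ⌜ A ⌝) x̄ x̄ → E ⌜ B ⌝ y y →
           ap {⌜ A ⌝} {⌜ B ⌝} (mor {A} {B} π) x̄ y ~ Soundness.sem π (cast (sym (⌜⁻⌝ A)) x̄ , (y , tt))
  ap-mor {A} {B} π {x̄} {y} p q = ~trans (≡⇒~ (lem (⌜⁻⌝ A) (forget (Soundness.tr π)) x̄))
    (forget-~ (Soundness.tr π) (cast-E (sym (⌜⁻⌝ A)) p , (q , tt)))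
    where
    lem : ∀ {a a'} (e : a ≡ a') (q : ⊩ a ∷ ⌜ B ⌝ ∷ []) x̄ →
          ⟦ subst (λ a → ⊩ a ∷ ⌜ B ⌝ ∷ []) e q ⟧ (x̄ , (y , tt)) ≡ ⟦ q ⟧ (cast (sym e) x̄ , (y , tt))
    lem refl q x̄ = refl
  half : ∀ {A B} (π : ⊢ (A ⁻ ∷ B ∷ [])) (π' : ⊢ (B ⁻ ∷ A ∷ [])) → cut (ex (swap2 (A ⁻) B) π) π' ≈ ax A →
         Section {⌜ A ⌝} {⌜ B ⌝} (mor {A} {B} π) (mor {B} {A} π')
  half {A} {B} π π' p x̄ x gx̄ gx = ~trans
    (br-pt ⌜ B ⌝ (↭-reflexive (trans (sym (gr-cast (sym (⌜⁻⌝ A)) x̄)) (sym (++-identityʳ _)))) (↭-reflexive (sym (++-identityʳ _)))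
      (λ y ey → ap-mor {A} {B} π eᵈ ey) (λ q → fE (Soundness.sem-Fn π) (cast-E (sym (⌜⁻⌝ A)) eᵈ , (q , tt)))
      (λ ȳ eȳ → ap-mor {B} {A} π' eȳ eˣ) (λ q → fE (Soundness.sem-Fn π') (cast-E (sym (⌜⁻⌝ B)) q , (eˣ , tt)))) (~trans
    (Soundness.sound p {cast (sym (⌜⁻⌝ A)) x̄ , (x , tt)} (Good-cast (sym (⌜⁻⌝ A)) {x̄} gx̄ , (gx , tt)))
    (≡⇒~ (cong (pair ⌜ A ⌝ x) (cast-trans (sym (⌜⁻⌝ A)) (⌜⁻⌝ A) refl x̄))))
    where
    eᵈ = Good-E (dual ⌜ A ⌝) gx̄
    eˣ = Good-E ⌜ A ⌝ gx

distributed-AC : ∀ A B → Distributed A → Distributed B → Iso ⌜ A ⌝ ⌜ B ⌝ → A =AC B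
distributed-AC A B d e I = Iso-AC A B refl refl (Distributed⇒DA A d) (Distributed⇒DA B e) I

-- The isomorphism is transported to the distributed forms by `Th-Iso`, where it gives an AC
-- derivation; that derivation stays within the fragment since the distributed forms do.
fragment : ∀ (S : Sub) A B → Uses S A → Uses S B → A ≅ B → A =E[ S ] B
fragment S A B u v p = let (A' , dA , uA , q) = normalise A u ; (B' , dB , uB , r) = normalise B v in
  th-trans q (th-trans (proj₂ (proj₂ (AC⇒E (distributed-AC A' B' dA dB
    (Iso-trans (Iso-sym (Th-Iso q)) (Iso-trans (≅⇒Iso p) (Th-Iso r)))))) uA) (th-sym r))
  where open Normalise S

everything : ∀ A → Uses (λ _ → true) A
everything (var x) = tt
everything (nvar x) = tt
everything (A ⊗ B) = tt , everything A , everything B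
everything (A ⅋ B) = tt , everything A , everything B
everything (A & B) = tt , everything A , everything B
everything (A ⊕ B) = tt , everything A , everything B
everything 𝟏 = tt
everything ⊥ₘ = tt
everything ⊤ₘ = tt
everything 𝟎 = tt

weaken : ∀ {P Q A B} → (∀ a → P a → Q a) → Th P A B → Th Q A B
weaken h th-refl = th-refl
weaken h (th-sym p) = th-sym (weaken h p)
weaken h (th-trans p q) = th-trans (weaken h p) (weaken h q)
weaken h (th-⊗ p q) = th-⊗ (weaken h p) (weaken h q)
weaken h (th-⅋ p q) = th-⅋ (weaken h p) (weaken h q)
weaken h (th-& p q) = th-& (weaken h p) (weaken h q)
weaken h (th-⊕ p q) = th-⊕ (weaken h p) (weaken h q)
weaken h (ax-⊗-assoc x A B C) = ax-⊗-assoc (h _ x) A B C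
weaken h (ax-⊗-comm x A B) = ax-⊗-comm (h _ x) A B
weaken h (ax-⅋-assoc x A B C) = ax-⅋-assoc (h _ x) A B C
weaken h (ax-⅋-comm x A B) = ax-⅋-comm (h _ x) A B
weaken h (ax-⊕-assoc x A B C) = ax-⊕-assoc (h _ x) A B C
weaken h (ax-⊕-comm x A B) = ax-⊕-comm (h _ x) A B
weaken h (ax-&-assoc x A B C) = ax-&-assoc (h _ x) A B C
weaken h (ax-&-comm x A B) = ax-&-comm (h _ x) A B
weaken h (ax-⊗⊕-distr x A B C) = ax-⊗⊕-distr (h _ x) A B C
weaken h (ax-⅋&-distr x A B C) = ax-⅋&-distr (h _ x) A B C
weaken h (ax-⊗-unit x A) = ax-⊗-unit (h _ x) A
weaken h (ax-⅋-unit x A) = ax-⅋-unit (h _ x) A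
weaken h (ax-⊕-unit x A) = ax-⊕-unit (h _ x) A
weaken h (ax-&-unit x A) = ax-&-unit (h _ x) A
weaken h (ax-⊗-𝟎 x A) = ax-⊗-𝟎 (h _ x) A
weaken h (ax-⅋-⊤ x A) = ax-⅋-⊤ (h _ x) A

theorem8p36 :
    (∀ (A B : Fm) → Distributed A → Distributed B → A ≅ B → A =AC B)
    × (∀ (A B : Fm) → A ≅ B → A =E B)
    × (∀ (S : Sub) (A B : Fm) → Uses S A → Uses S B → A ≅ B → A =E[ S ] B)
theorem8p36 = (λ A B d e p → distributed-AC A B d e (≅⇒Iso p)) ,
  (λ A B p → weaken (λ _ _ → tt) (fragment (λ _ → true) A B (everything A) (everything B) p)) , fragment
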